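{- There is an absolute constant $K>0$ such that the following holds. Let $n\ge 1$, $\epsilon\ge 0$, and let $f\colon S_n\to\{0,1\}$ satisfy $\mathbb{E}[(f-\ell)^2]\le\epsilon$ for some linear function $\ell\colon S_n\to\mathbb{R}$, and $\mathbb{E}[f]\le 1/2$. Then there is a set $\mathcal{C}\subseteq[n]^2$ of cosets with $|\mathcal{C}|\le Kn$ and with at most $K\epsilon n^2$ unordered pairs of non-disjoint cosets in $\mathcal{C}$, such that $g=\max_{(i,j)\in\mathcal{C}}x_{i,j}$ (with $g=0$ if $\mathcal{C}=\emptyset$) satisfies $\Pr[f\neq g]\le K\epsilon$. Conversely, for every $A>0$ there is $B>0$ such that for all $n\ge1$, $\epsilon\ge0$, and every $\mathcal{C}\subseteq[n]^2$ with $|\mathcal{C}|\le An$ and at most $A\epsilon n^2$ unordered pairs of non-disjoint cosets, the function $g=\max_{(i,j)\in\mathcal{C}}x_{i,j}$ satisfies $\mathbb{E}[(g-\ell)^2]\le B\epsilon$ for some linear function $\ell\colon S_n\to\mathbb{R}$.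
   Context: $S_n$ is the symmetric group on $[n]=\{1,\dots,n\}$; expectations and probabilities are over a uniformly random $\pi\in S_n$. For $i,j\in[n]$, $x_{i,j}(\pi)=1$ if $\pi(i)=j$ and $0$ otherwise. A function $S_n\to\mathbb{R}$ is linear if it can be written as $\sum_{i,j}c_{i,j}x_{i,j}$ with real $c_{i,j}$. The coset $(i,j)$ is the set of permutations with $\pi(i)=j$. Two distinct cosets $(i,j),(k,\ell)$ are disjoint (as sets of permutations) iff $i=k$ or $j=\ell$; they are non-disjoint iff $i\neq k$ and $j\neq \ell$.
   Formalization: The quantities ε and A, and the coefficients of the linear function ℓ assumed to approximate f, are taken to be rational instead of real; the constants K, B and the linear function ℓ obtained are rational as well. -}

module Defs where

open import Data.Nat as ℕ using (ℕ; zero; suc)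
open import Data.Nat.Base using (_!)
open import Data.Nat.Properties using (_!≢0)
open import Data.Fin using (Fin; zero; suc; _≟_; _<?_)
import Data.Fin
open import Data.Fin.Properties using (all?)
open import Data.Vec using (Vec; []; _∷_; lookup)
open import Data.List using (List; []; _∷_; map; concatMap; filter; foldr)
import Data.Bool
open import Data.Bool using (Bool; true; false; if_then_else_; _∧_; _∨_)
open import Data.Integer using (+_)
open import Data.Rational using (ℚ; 0ℚ; 1ℚ; _+_; _*_; _-_; _/_)
open import Relation.Binary.PropositionalEquality using (_≡_)
open import Relation.Nullary using (¬_; does)
open import Relation.Nullary.Decidable using (_→-dec_)

-- The symmetric group S_n.
-- A permutation π of [n] = Fin n is represented by its table
-- (π(0), …, π(n-1)) : Vec (Fin n) n, with π(i) = lookup π i.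
-- S_n is the list of all such tables that are injective.

allVecs : (n m : ℕ) → List (Vec (Fin n) m)
allVecs n zero    = [] ∷ []
allVecs n (suc m) = concatMap (λ v → map (_∷ v) (allFin n)) (allVecs n m)
  where
  allFin : (k : ℕ) → List (Fin k)
  allFin zero    = []
  allFin (suc k) = zero ∷ map suc (allFin k)

IsPerm : {n : ℕ} → Vec (Fin n) n → Set
IsPerm {n} π = ∀ (i j : Fin n) → lookup π i ≡ lookup π j → i ≡ j

isPerm? : {n : ℕ} → (π : Vec (Fin n) n) → Relation.Nullary.Dec (IsPerm π)
isPerm? π = all? (λ i → all? (λ j → (lookup π i ≟ lookup π j) →-dec (i ≟ j)))

-- functions S_n → A are functions on tables; only their values on
-- genuine permutations are ever used.
Perm : ℕ → Set
Perm n = Vec (Fin n) n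

Sn : (n : ℕ) → List (Perm n)
Sn n = filter isPerm? (allVecs n n)

sumList : List ℚ → ℚ
sumList = foldr _+_ 0ℚ

ΣFin : (n : ℕ) → (Fin n → ℚ) → ℚ
ΣFin zero    a = 0ℚ
ΣFin (suc n) a = a zero + ΣFin n (λ i → a (suc i))

countFin : (n : ℕ) → (Fin n → Bool) → ℕ
countFin zero    p = 0
countFin (suc n) p = (if p zero then 1 else 0) ℕ.+ countFin n (λ i → p (suc i))

fromℕ : ℕ → ℚ
fromℕ k = (+ k) / 1

b2q : Bool → ℚ
b2q true  = 1ℚ
b2q false = 0ℚ

𝔼 : (n : ℕ) → (Perm n → ℚ) → ℚ
𝔼 n h = sumList (map h (Sn n)) * ((+ 1) / (n !))
  where instance _ = n !≢0

Pr : (n : ℕ) → (Perm n → Bool) → ℚ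
Pr n P = 𝔼 n (λ π → b2q (P π))

x : {n : ℕ} → Fin n → Fin n → Perm n → ℚ
x i j π = if does (lookup π i ≟ j) then 1ℚ else 0ℚ

linear : (n : ℕ) → (Fin n → Fin n → ℚ) → Perm n → ℚ
linear n c π = ΣFin n (λ i → ΣFin n (λ j → c i j * x i j π))

sqDist : (n : ℕ) → (Perm n → ℚ) → (Perm n → ℚ) → ℚ
sqDist n h ℓ = 𝔼 n (λ π → (h π - ℓ π) * (h π - ℓ π))

CosetSet : ℕ → Set
CosetSet n = Fin n → Fin n → Bool

ΣℕFin : (n : ℕ) → (Fin n → ℕ) → ℕ
ΣℕFin zero    a = 0
ΣℕFin (suc n) a = a zero ℕ.+ ΣℕFin n (λ i → a (suc i))

size : {n : ℕ} → CosetSet n → ℕ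
size {n} C = ΣℕFin n (λ i → countFin n (λ j → C i j))

-- number of unordered pairs {(i,j),(k,l)} of distinct non-disjoint cosets
-- in C, i.e. i ≠ k and j ≠ l; each unordered pair is counted once by
-- orienting it so that i < k.
nonDisjointPairs : {n : ℕ} → CosetSet n → ℕ
nonDisjointPairs {n} C =
  ΣℕFin n (λ i → ΣℕFin n (λ j → ΣℕFin n (λ k → countFin n (λ l →
    C i j ∧ C k l ∧ does (i Data.Fin.<? k) ∧ Data.Bool.not (does (j ≟ l))))))

orFin : (n : ℕ) → (Fin n → Bool) → Bool
orFin zero    p = false
orFin (suc n) p = p zero ∨ orFin n (λ i → p (suc i))

maxCosets : {n : ℕ} → CosetSet n → Perm n → Bool
maxCosets {n} C π = orFin n (λ i → orFin n (λ j → C i j ∧ does (lookup π i ≟ j)))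

-- Let p + lin ĉ be the orthogonal projection of f onto the linear functions, where p = E f and ĉ has vanishing row and
-- column sums, so that its error is at most ε.  Relabel the positions and values at random, pair the positions as (0,1),
-- (2,3), …, and swap the values inside some of the pairs.  This embeds a cube on which p + lin ĉ is affine, its coefficients
-- being 2×2 minors of ĉ.  The Friedgut–Kalai–Naor argument on the cube (fourth moments, and comparison with a dictator)
-- then bounds the mean squared distance of these minors from {-1, 0, 1} by O(ε/n).
--
-- If every row and column of ĉ has small energy, a minor is close to its corner entry on average; with C = {ĉ ≥ 3/4} the
-- minors of ĉ - 1_C are small, so f is close to a constant plus the sum S of the cosets in C, and therefore to their union.
-- If some row r is heavy, the minors avoiding r are so small that f is close to a function of π(r), hence to a union of
-- cosets (r, j); a heavy column is the same statement for π⁻¹.  This settles large n.  For bounded n all quantities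
-- have bounded denominators, so a small ε forces f to be exactly linear.  Then, at a zero of f, the transpositions that
-- change f form a star, which makes f depend on a single π(r) or π⁻¹(s).
--
-- Conversely, (g - S)² ≤ S(S - 1), whose expectation counts the non-disjoint pairs of cosets in C.
module Submission where

open import Data.Bool as Bool using (Bool; true; false; if_then_else_; not; _xor_; _∧_; _∨_)
open import Data.Empty using (⊥; ⊥-elim)
open import Data.Fin as Fin using (Fin; zero; suc)
open import Data.Fin.Permutation.Components using (transpose; transpose-inverse)
import Data.Fin.Properties as Fin
open import Data.Integer as ℤ using (ℤ; +_)
import Data.Integer.Properties as ℤ
open import Data.List as List using (List; []; _∷_; map; concatMap; filter; _++_)
open import Data.List.Relation.Unary.All as All using (All)
import Data.Nat
open import Data.Nat as ℕ using (ℕ; zero; suc)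
open import Data.Nat.Base using (_!; ⌊_/2⌋)
import Data.Nat.Properties as ℕ
open import Data.Product using (_×_; _,_; proj₁; proj₂; ∃-syntax; Σ-syntax)
open import Data.Rational hiding (_≤ᵇ_)
open import Data.Rational.Properties hiding (_≟_)
open import Data.Rational.Properties using () renaming (_≟_ to _≟ℚ_)
import Data.Rational.Unnormalised as ℚᵘ
import Data.Rational.Unnormalised.Properties as ℚᵘ
open import Data.Sum using (_⊎_; inj₁; inj₂)
open import Data.Vec as Vec using (Vec; lookup; tabulate)
open import Data.Vec.Properties using (lookup∘tabulate; tabulate∘lookup; tabulate-cong)
import Data.Vec.Properties as Vec
open import Defs
open import Function using (_∘_; id; case_of_)
open import Relation.Binary.Definitions using (tri<; tri≈; tri>)
open import Relation.Binary.PropositionalEquality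
open import Relation.Nullary
open import Relation.Nullary.Decidable using (True; toWitness; toWitnessFalse; dec-true; dec-false; _×-dec_; decidable-stable)
open import Data.Rational.Solver using (module +-*-Solver)
open +-*-Solver using (solve; con; _:+_; _:*_; _:-_; :-_; _:=_)

-- Summed over all n⁴ minors this gives O(n³ε), just the order that an O(ε) variance tolerates; a
-- cube with a single minor would lose a factor n. The obstacle is that minors are blind to
-- functions of the row or of the column alone, so an entry of `ĉ` can be read off only if the other
-- three corners of a typical minor through it are small. A heavy row or column breaks this. There
-- another feature of the cube helps: one large coefficient forces all the other coefficients of the
-- same frame to be small. The target is always closeness in L² to `hits C`, the number of cosets of
-- `C` containing π, instead of closeness to the union: the pair count and the distance to the union
-- both follow, by inequalities between a bit and a natural number. The value of `θ` comes from the
-- light case, and 1179648 = 96/θ is the size from which the heavy case absorbs its degenerate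
-- terms.

-- Rational inequalities by nonnegativity certificates

≤-by : ∀ {p q s} → 0ℚ ≤ s → q ≡ p + s → p ≤ q
≤-by {p} {q} {s} h refl = subst (_≤ p + s) (+-identityʳ p) (+-monoʳ-≤ p h)

infixl 6 _⊕_
infixl 7 _⊗_

-- Polynomial inequalities are certified in one style throughout: `≤-by` takes the slack, displayed
-- as a sum of products of quantities known to be nonnegative (`gap`, `sq≥0`, `lit`), and the ring
-- solver checks the identity. The numerical coefficients in such a term are the multipliers with
-- which the hypotheses are combined.
_⊕_ : ∀ {p q} → 0ℚ ≤ p → 0ℚ ≤ q → 0ℚ ≤ p + q
_⊕_ {p} {q} h k = subst (_≤ p + q) (+-identityˡ 0ℚ) (+-mono-≤ h k)

_⊗_ : ∀ {p q} → 0ℚ ≤ p → 0ℚ ≤ q → 0ℚ ≤ p * q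
_⊗_ {p} {q} h k = subst (_≤ p * q) (*-zeroʳ p) (*-monoˡ-≤-nonNeg p {{nonNegative h}} k)

gap : ∀ {p q} → p ≤ q → 0ℚ ≤ q - p
gap {p} {q} h = subst (_≤ q - p) (+-inverseʳ p) (+-monoˡ-≤ (- p) h)

lit : ∀ q {h : True (0ℚ ≤? q)} → 0ℚ ≤ q
lit q {h} = toWitness h

≥0-by : ∀ {p s} → 0ℚ ≤ s → p ≡ s → 0ℚ ≤ p
≥0-by h refl = h

sq≥0 : ∀ p → 0ℚ ≤ p * p
sq≥0 p with ≤-total 0ℚ p
... | inj₁ h = h ⊗ h
... | inj₂ h = ≥0-by (gap h ⊗ gap h) (solve 1 (λ p → p :* p := (con 0ℚ :- p) :* (con 0ℚ :- p)) refl p)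

fromℤ : ℤ → ℚ
fromℤ z = z / 1

private
  toℚᵘ-fromℤ : ∀ z → toℚᵘ (fromℤ z) ℚᵘ.≃ ℚᵘ.mkℚᵘ z 0
  toℚᵘ-fromℤ z = toℚᵘ-fromℚᵘ (ℚᵘ.mkℚᵘ z 0)

fromℤ-+ : ∀ a b → fromℤ (a ℤ.+ b) ≡ fromℤ a + fromℤ b
fromℤ-+ a b = toℚᵘ-injective (ℚᵘ.≃-trans (toℚᵘ-fromℤ (a ℤ.+ b)) (ℚᵘ.≃-trans
  (ℚᵘ.*≡* (cong (ℤ._* + 1) (cong₂ ℤ._+_ (sym (ℤ.*-identityʳ a)) (sym (ℤ.*-identityʳ b)))))
  (ℚᵘ.≃-sym (ℚᵘ.≃-trans (toℚᵘ-homo-+ (fromℤ a) (fromℤ b)) (ℚᵘ.+-cong (toℚᵘ-fromℤ a) (toℚᵘ-fromℤ b))))))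

fromℤ-* : ∀ a b → fromℤ (a ℤ.* b) ≡ fromℤ a * fromℤ b
fromℤ-* a b = toℚᵘ-injective (ℚᵘ.≃-trans (toℚᵘ-fromℤ (a ℤ.* b))
  (ℚᵘ.≃-sym (ℚᵘ.≃-trans (toℚᵘ-homo-* (fromℤ a) (fromℤ b)) (ℚᵘ.*-cong (toℚᵘ-fromℤ a) (toℚᵘ-fromℤ b)))))

fromℕ-+ : ∀ a b → fromℕ (a ℕ.+ b) ≡ fromℕ a + fromℕ b
fromℕ-+ a b = fromℤ-+ (+ a) (+ b)

fromℕ-* : ∀ a b → fromℕ (a ℕ.* b) ≡ fromℕ a * fromℕ b
fromℕ-* a b = trans (cong fromℤ (ℤ.pos-* a b)) (fromℤ-* (+ a) (+ b))

fromℕ-suc : ∀ a → fromℕ (suc a) ≡ 1ℚ + fromℕ a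
fromℕ-suc = fromℕ-+ 1

fromℕ≥0 : ∀ a → 0ℚ ≤ fromℕ a
fromℕ≥0 zero    = ≤-refl
fromℕ≥0 (suc a) = ≥0-by (lit 1ℚ ⊕ fromℕ≥0 a) (fromℕ-suc a)

fromℕ-mono : ∀ {a b} → a ℕ.≤ b → fromℕ a ≤ fromℕ b
fromℕ-mono {a} {b} h = ≤-by (fromℕ≥0 (b ℕ.∸ a)) (trans (cong fromℕ (sym (ℕ.m+[n∸m]≡n h))) (fromℕ-+ a (b ℕ.∸ a)))

1≤fromℕ-suc : ∀ a → 1ℚ ≤ fromℕ (suc a)
1≤fromℕ-suc a = fromℕ-mono {1} {suc a} (ℕ.s≤s ℕ.z≤n)

recip : ℕ → ℚ
recip k = + 1 / suc k

fromℕ*recip : ∀ k → fromℕ (suc k) * recip k ≡ 1ℚ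
fromℕ*recip k = toℚᵘ-injective (ℚᵘ.≃-trans (toℚᵘ-homo-* (fromℕ (suc k)) (recip k)) (ℚᵘ.≃-trans
  (ℚᵘ.*-cong (toℚᵘ-fromℤ (+ suc k)) (toℚᵘ-fromℚᵘ (ℚᵘ.mkℚᵘ (+ 1) k)))
  (ℚᵘ.*≡* (trans (ℤ.*-identityʳ _) (trans (ℤ.*-comm (+ suc k) (+ 1))
      (sym (cong (+ 1 ℤ.*_) (cong (λ t → + suc t) (ℕ.+-identityʳ k)))))))))

recip≥0 : ∀ k → 0ℚ ≤ recip k
recip≥0 k = nonNegative⁻¹ _ {{normalize-nonNeg 1 (suc k)}}

*-cancelˡ-≤ : ∀ {p q r} → 1ℚ ≤ r → r * p ≤ r * q → p ≤ q
*-cancelˡ-≤ {p} {q} {r} h = *-cancelˡ-≤-pos r {{positive (<-≤-trans (toWitness {a? = 0ℚ <? 1ℚ} _) h)}}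

*-cancelˡ-≤′ : ∀ {p q r} → 0ℚ < r → r * p ≤ r * q → p ≤ q
*-cancelˡ-≤′ {p} {q} {r} h = *-cancelˡ-≤-pos r {{positive h}}

*-mono-≥0 : ∀ {p q r s} → 0ℚ ≤ p → 0ℚ ≤ r → p ≤ q → r ≤ s → p * r ≤ q * s
*-mono-≥0 {p} {q} {r} {s} hp hr h k = ≤-by (gap h ⊗ hr ⊕ (≤-trans hp h) ⊗ gap k)
    (solve 4 (λ p q r s → q :* s := p :* r :+ ((q :- p) :* r :+ q :* (s :- r))) refl p q r s)

*-monoˡ : ∀ {p q} r → 0ℚ ≤ r → p ≤ q → r * p ≤ r * q
*-monoˡ r h = *-monoˡ-≤-nonNeg r {{nonNegative h}}

-- Finite sums

∑ : ∀ {n} → (Fin n → ℚ) → ℚ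
∑ {n} = ΣFin n

∑-cong : ∀ {n} {F G : Fin n → ℚ} → (∀ i → F i ≡ G i) → ∑ F ≡ ∑ G
∑-cong {zero}  h = refl
∑-cong {suc n} h = cong₂ _+_ (h zero) (∑-cong (h ∘ suc))

∑-+ : ∀ {n} (F G : Fin n → ℚ) → ∑ (λ i → F i + G i) ≡ ∑ F + ∑ G
∑-+ {zero}  F G = refl
∑-+ {suc n} F G rewrite ∑-+ (F ∘ suc) (G ∘ suc) = shuffle (F zero) (G zero) (∑ (F ∘ suc)) (∑ (G ∘ suc))
  where
  shuffle = solve 4 (λ a b c d → a :+ b :+ (c :+ d) := a :+ c :+ (b :+ d)) refl

∑-*ˡ : ∀ {n} k (F : Fin n → ℚ) → ∑ (λ i → k * F i) ≡ k * ∑ F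
∑-*ˡ {zero}  k F = sym (*-zeroʳ k)
∑-*ˡ {suc n} k F rewrite ∑-*ˡ k (F ∘ suc) = sym (*-distribˡ-+ k (F zero) (∑ (F ∘ suc)))

∑-*ʳ : ∀ {n} k (F : Fin n → ℚ) → ∑ (λ i → F i * k) ≡ ∑ F * k
∑-*ʳ k F = trans (∑-cong (λ i → *-comm (F i) k)) (trans (∑-*ˡ k F) (*-comm k (∑ F)))

∑-neg : ∀ {n} (F : Fin n → ℚ) → ∑ (λ i → - F i) ≡ - ∑ F
∑-neg {zero}  F = refl
∑-neg {suc n} F rewrite ∑-neg (F ∘ suc) = sym (neg-distrib-+ (F zero) (∑ (F ∘ suc)))

∑-minus : ∀ {n} (F G : Fin n → ℚ) → ∑ (λ i → F i - G i) ≡ ∑ F - ∑ G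
∑-minus F G = trans (∑-+ F (λ i → - G i)) (cong (λ t → ∑ F + t) (∑-neg G))

∑-zero : ∀ n → ∑ {n} (λ _ → 0ℚ) ≡ 0ℚ
∑-zero zero    = refl
∑-zero (suc n) = trans (+-identityˡ _) (∑-zero n)

∑-const : ∀ n c → ∑ {n} (λ _ → c) ≡ fromℕ n * c
∑-const zero    c = sym (*-zeroˡ c)
∑-const (suc n) c = trans (cong (λ t → c + t) (∑-const n c)) (trans (lemma c (fromℕ n)) (cong (_* c) (sym (fromℕ-suc n))))
  where
  lemma = solve 2 (λ c m → c :+ m :* c := (con 1ℚ :+ m) :* c) refl

∑-swap : ∀ {m n} (F : Fin m → Fin n → ℚ) → ∑ (λ i → ∑ (λ j → F i j)) ≡ ∑ (λ j → ∑ (λ i → F i j))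
∑-swap {zero}  {n} F = sym (∑-zero n)
∑-swap {suc m} {n} F = trans (cong (λ t → ∑ (F zero) + t) (∑-swap (F ∘ suc))) (sym (∑-+ (F zero) _))

∑-mono : ∀ {n} {F G : Fin n → ℚ} → (∀ i → F i ≤ G i) → ∑ F ≤ ∑ G
∑-mono {zero}  h = ≤-refl
∑-mono {suc n} h = +-mono-≤ (h zero) (∑-mono (h ∘ suc))

∑≥0 : ∀ {n} {F : Fin n → ℚ} → (∀ i → 0ℚ ≤ F i) → 0ℚ ≤ ∑ F
∑≥0 {n} {F} h = subst (_≤ ∑ F) (∑-zero n) (∑-mono h)

term≤∑ : ∀ {n} {F : Fin n → ℚ} → (∀ i → 0ℚ ≤ F i) → ∀ a → F a ≤ ∑ F
term≤∑ {suc n} {F} h zero    = ≤-by (∑≥0 (h ∘ suc)) refl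
term≤∑ {suc n} {F} h (suc a) = ≤-trans (term≤∑ (h ∘ suc) a) (≤-by (h zero) (+-comm (F zero) _))

b2q≥0 : ∀ b → 0ℚ ≤ b2q b
b2q≥0 true  = lit 1ℚ
b2q≥0 false = ≤-refl

b2q≤1 : ∀ b → b2q b ≤ 1ℚ
b2q≤1 true  = ≤-refl
b2q≤1 false = lit 1ℚ

b2q-idem : ∀ b → b2q b * b2q b ≡ b2q b
b2q-idem true  = refl
b2q-idem false = refl

b2q-∧ : ∀ a b → b2q (a ∧ b) ≡ b2q a * b2q b
b2q-∧ true  b = sym (*-identityˡ (b2q b))
b2q-∧ false b = sym (*-zeroˡ (b2q b))

b2q-not : ∀ b → b2q (not b) ≡ 1ℚ - b2q b
b2q-not true  = refl
b2q-not false = refl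

δ : ∀ {n} → Fin n → Fin n → ℚ
δ i j = b2q (does (i Fin.≟ j))

δ-refl : ∀ {n} (i : Fin n) → δ i i ≡ 1ℚ
δ-refl i with i Fin.≟ i
... | yes _ = refl
... | no ¬p = ⊥-elim (¬p refl)

δ-≢ : ∀ {n} {i j : Fin n} → i ≢ j → δ i j ≡ 0ℚ
δ-≢ {i = i} {j} h with i Fin.≟ j
... | yes p = ⊥-elim (h p)
... | no _  = refl

δ-sym : ∀ {n} (i j : Fin n) → δ i j ≡ δ j i
δ-sym i j with i Fin.≟ j
... | yes refl = sym (δ-refl i)
... | no h = sym (δ-≢ (h ∘ sym))

∑-δ : ∀ {n} a (F : Fin n → ℚ) → ∑ (λ i → δ i a * F i) ≡ F a
∑-δ {suc n} zero F = trans (cong₂ _+_ (*-identityˡ (F zero)) (trans (∑-cong (λ i → *-zeroˡ (F (suc i)))) (∑-zero n)))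
    (+-identityʳ _)
∑-δ {suc n} (suc a) F = trans (cong₂ _+_ (*-zeroˡ (F zero)) (∑-δ a (F ∘ suc))) (+-identityˡ _)

sumOf : ∀ {a} {A : Set a} → List A → (A → ℚ) → ℚ
sumOf xs F = sumList (map F xs)

sumOf-cong : ∀ {a} {A : Set a} (xs : List A) {F G : A → ℚ} → (∀ v → F v ≡ G v) → sumOf xs F ≡ sumOf xs G
sumOf-cong []       h = refl
sumOf-cong (v ∷ xs) h = cong₂ _+_ (h v) (sumOf-cong xs h)

sumOf-mono : ∀ {a} {A : Set a} (xs : List A) {F G : A → ℚ} → (∀ v → F v ≤ G v) → sumOf xs F ≤ sumOf xs G
sumOf-mono []       h = ≤-refl
sumOf-mono (v ∷ xs) h = +-mono-≤ (h v) (sumOf-mono xs h)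

sumOf-+ : ∀ {a} {A : Set a} (xs : List A) (F G : A → ℚ) → sumOf xs (λ v → F v + G v) ≡ sumOf xs F + sumOf xs G
sumOf-+ []       F G = refl
sumOf-+ (v ∷ xs) F G rewrite sumOf-+ xs F G = shuffle (F v) (G v) (sumOf xs F) (sumOf xs G)
  where
  shuffle = solve 4 (λ a b c d → a :+ b :+ (c :+ d) := a :+ c :+ (b :+ d)) refl

sumOf-*ˡ : ∀ {a} {A : Set a} (xs : List A) k (F : A → ℚ) → sumOf xs (λ v → k * F v) ≡ k * sumOf xs F
sumOf-*ˡ []       k F = sym (*-zeroʳ k)
sumOf-*ˡ (v ∷ xs) k F rewrite sumOf-*ˡ xs k F = sym (*-distribˡ-+ k (F v) (sumOf xs F))

sumOf-zero : ∀ {a} {A : Set a} (xs : List A) → sumOf xs (λ _ → 0ℚ) ≡ 0ℚ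
sumOf-zero []       = refl
sumOf-zero (v ∷ xs) = trans (+-identityˡ _) (sumOf-zero xs)

sumOf-swap : ∀ {a b} {A : Set a} {B : Set b} (xs : List A) (ys : List B) (F : A → B → ℚ) →
  sumOf xs (λ v → sumOf ys (F v)) ≡ sumOf ys (λ u → sumOf xs (λ v → F v u))
sumOf-swap []       ys F = sym (sumOf-zero ys)
sumOf-swap (v ∷ xs) ys F = trans (cong (λ t → sumOf ys (F v) + t) (sumOf-swap xs ys F)) (sym (sumOf-+ ys (F v) _))

sumOf-∑ : ∀ {a} {A : Set a} (xs : List A) {n} (F : A → Fin n → ℚ) →
  sumOf xs (λ v → ∑ (F v)) ≡ ∑ (λ i → sumOf xs (λ v → F v i))
sumOf-∑ []       {n} F = sym (∑-zero n)
sumOf-∑ (v ∷ xs) F = trans (cong (λ t → ∑ (F v) + t) (sumOf-∑ xs F)) (sym (∑-+ (F v) _))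

sumOf-++ : ∀ {a} {A : Set a} (xs ys : List A) (F : A → ℚ) → sumOf (xs ++ ys) F ≡ sumOf xs F + sumOf ys F
sumOf-++ []       ys F = sym (+-identityˡ _)
sumOf-++ (v ∷ xs) ys F = trans (cong (λ t → F v + t) (sumOf-++ xs ys F)) (sym (+-assoc (F v) _ _))

sumOf-concatMap : ∀ {a b} {A : Set a} {B : Set b} (g : A → List B) (xs : List A) (F : B → ℚ) →
  sumOf (concatMap g xs) F ≡ sumOf xs (λ v → sumOf (g v) F)
sumOf-concatMap g []       F = refl
sumOf-concatMap g (v ∷ xs) F =
  trans (sumOf-++ (g v) (concatMap g xs) F) (cong (λ t → sumOf (g v) F + t) (sumOf-concatMap g xs F))

sumOf-map : ∀ {a b} {A : Set a} {B : Set b} (g : A → B) (xs : List A) (F : B → ℚ) →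
  sumOf (map g xs) F ≡ sumOf xs (F ∘ g)
sumOf-map g []       F = refl
sumOf-map g (v ∷ xs) F = cong (λ t → F (g v) + t) (sumOf-map g xs F)

sumOf-filter : ∀ {a p} {A : Set a} {P : A → Set p} (P? : ∀ v → Dec (P v)) (xs : List A) (F : A → ℚ) →
  sumOf (filter P? xs) F ≡ sumOf xs (λ v → b2q (does (P? v)) * F v)
sumOf-filter P? []       F = refl
sumOf-filter P? (v ∷ xs) F with does (P? v)
... | true  = cong₂ _+_ (sym (*-identityˡ (F v))) (sumOf-filter P? xs F)
... | false = trans (sumOf-filter P? xs F) (sym (trans (cong (_+ _) (*-zeroˡ (F v))) (+-identityˡ _)))

-- Defs.allVecs enumerates Fin n with a function local to its definition, which is only reachable through allVecs n 1.
private
  allFin : ∀ k → List (Fin k)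
  allFin zero    = []
  allFin (suc k) = zero ∷ map suc (allFin k)

  unwrap : ∀ {k} {L M : List (Fin k)} → map Vec.head (map (Vec._∷ Vec.[]) L ++ []) ≡ M → L ≡ M
  unwrap {L = L} e = trans (sym (heads L)) e
    where
    heads : ∀ L → map Vec.head (map (Vec._∷ Vec.[]) L ++ []) ≡ L
    heads []      = refl
    heads (a ∷ L) = cong (a ∷_) (heads L)

  allVecs-1 : ∀ n → map Vec.head (allVecs n 1) ≡ allFin n
  allVecs-1 zero    = refl
  allVecs-1 (suc k) = cong (zero ∷_) (trans (heads _) (cong (map suc) (unwrap (allVecs-1 k))))
    where
    heads : ∀ L → map Vec.head (map (Vec._∷ Vec.[]) L ++ []) ≡ L
    heads []      = refl
    heads (a ∷ L) = cong (a ∷_) (heads L)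

  allVecs-suc : ∀ n m → allVecs n (suc m) ≡ concatMap (λ v → map (Vec._∷ v) (allFin n)) (allVecs n m)
  allVecs-suc n m = cong (λ t → concatMap (λ v → map (Vec._∷ v) t) (allVecs n m)) (unwrap (allVecs-1 n))

  sumOf-allFin : ∀ n (F : Fin n → ℚ) → sumOf (allFin n) F ≡ ∑ F
  sumOf-allFin zero    F = refl
  sumOf-allFin (suc n) F = cong (λ t → F zero + t) (trans (sumOf-map suc (allFin n) F) (sumOf-allFin n (F ∘ suc)))

sumOf-allVecs-suc : ∀ n m (F : Vec (Fin n) (suc m) → ℚ) →
  sumOf (allVecs n (suc m)) F ≡ sumOf (allVecs n m) (λ v → ∑ (λ a → F (a Vec.∷ v)))
sumOf-allVecs-suc n m F = trans (cong (λ t → sumOf t F) (allVecs-suc n m))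
  (trans (sumOf-concatMap _ (allVecs n m) F)
  (sumOf-cong (allVecs n m) (λ v → trans (sumOf-map (Vec._∷ v) (allFin n) F) (sumOf-allFin n _))))

-- Kronecker delta of tables. As a product over the coordinates it can be summed out one coordinate
-- at a time.
δᵛ : ∀ {n m} → Vec (Fin n) m → Vec (Fin n) m → ℚ
δᵛ Vec.[]      Vec.[]      = 1ℚ
δᵛ (a Vec.∷ v) (b Vec.∷ u) = δ a b * δᵛ v u

δᵛ-refl : ∀ {n m} (v : Vec (Fin n) m) → δᵛ v v ≡ 1ℚ
δᵛ-refl Vec.[]      = refl
δᵛ-refl (a Vec.∷ v) = trans (cong₂ _*_ (δ-refl a) (δᵛ-refl v)) refl

δᵛ-≢ : ∀ {n m} (v u : Vec (Fin n) m) → v ≢ u → δᵛ v u ≡ 0ℚ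
δᵛ-≢ Vec.[]      Vec.[]      h = ⊥-elim (h refl)
δᵛ-≢ (a Vec.∷ v) (b Vec.∷ u) h with a Fin.≟ b
... | no _     = *-zeroˡ (δᵛ v u)
... | yes refl = trans (*-identityˡ _) (δᵛ-≢ v u (h ∘ cong (a Vec.∷_)))

-- In effect: `allVecs` lists every table exactly once.
sumOf-δᵛ : ∀ n m (u : Vec (Fin n) m) (F : Vec (Fin n) m → ℚ) → sumOf (allVecs n m) (λ v → δᵛ v u * F v) ≡ F u
sumOf-δᵛ n zero    Vec.[]      F = trans (+-identityʳ _) (*-identityˡ (F Vec.[]))
sumOf-δᵛ n (suc m) (b Vec.∷ u) F = trans (sumOf-allVecs-suc n m _)
  (trans (sumOf-cong (allVecs n m) (λ v → trans (∑-cong (λ a → shuffle (δ a b) (δᵛ v u) (F (a Vec.∷ v))))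
     (trans (∑-*ˡ (δᵛ v u) (λ a → δ a b * F (a Vec.∷ v))) (cong (λ t → δᵛ v u * t) (∑-δ b (λ a → F (a Vec.∷ v)))))))
  (sumOf-δᵛ n m u (λ v → F (b Vec.∷ v))))
  where
  shuffle = solve 3 (λ a b c → a :* b :* c := b :* (a :* c)) refl

-- Counting permutations

IsInj : ∀ {n m} → Vec (Fin n) m → Set
IsInj v = ∀ i j → lookup v i ≡ lookup v j → i ≡ j

private
  count : ∀ {n m} → Fin n → Vec (Fin n) m → ℚ
  count a Vec.[]      = 0ℚ
  count a (b Vec.∷ v) = δ a b + count a v

  -- The indicator of injectivity in product form. A factor can be negative, when `a` occurs twice
  -- in `v`, but then `v` is not injective and the remaining product is already zero.
  injW : ∀ {n m} → Vec (Fin n) m → ℚ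
  injW Vec.[]      = 1ℚ
  injW (a Vec.∷ v) = (1ℚ - count a v) * injW v

  inj-tail : ∀ {n m} {a : Fin n} {v : Vec (Fin n) m} → IsInj (a Vec.∷ v) → IsInj v
  inj-tail h i j e = Fin.suc-injective (h (suc i) (suc j) e)

  count-∉ : ∀ {n m} (a : Fin n) (v : Vec (Fin n) m) → (∀ i → lookup v i ≢ a) → count a v ≡ 0ℚ
  count-∉ a Vec.[]      h = refl
  count-∉ a (b Vec.∷ v) h = trans (cong₂ _+_ (δ-≢ (h zero ∘ sym)) (count-∉ a v (h ∘ suc))) refl

  count-∈ : ∀ {n m} (a : Fin n) (v : Vec (Fin n) m) → IsInj v → ∀ i → lookup v i ≡ a → count a v ≡ 1ℚ
  count-∈ a (.a Vec.∷ v) h zero refl =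
    trans (cong₂ _+_ (δ-refl a) (count-∉ a v (λ i e → case h (suc i) zero e of λ ()))) refl
  count-∈ a (b Vec.∷ v) h (suc i) e =
    trans (cong₂ _+_ (δ-≢ (λ a≡b → case h zero (suc i) (trans (sym a≡b) (sym e)) of λ ())) (count-∈ a v (inj-tail h) i e)) refl

  injW-spec : ∀ {n m} (v : Vec (Fin n) m) → (IsInj v × injW v ≡ 1ℚ) ⊎ (¬ IsInj v × injW v ≡ 0ℚ)
  injW-spec Vec.[]      = inj₁ ((λ ()) , refl)
  injW-spec (a Vec.∷ v) with injW-spec v
  ... | inj₂ (¬h , e) = inj₂ (¬h ∘ inj-tail , trans (cong (λ t → (1ℚ - count a v) * t) e) (*-zeroʳ (1ℚ - count a v)))
  ... | inj₁ (h , e) with Fin.any? (λ i → lookup v i Fin.≟ a)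
  ...   | yes (i , p) = inj₂ ((λ k → case k (suc i) zero p of λ ()) ,
            trans (cong (λ t → (1ℚ - t) * injW v) (count-∈ a v h i p)) (*-zeroˡ (injW v)))
  ...   | no ¬p = inj₁ (inj , trans (cong₂ (λ s t → (1ℚ - s) * t) (count-∉ a v (λ i p → ¬p (i , p))) e) refl)
    where
    inj : IsInj (a Vec.∷ v)
    inj zero    zero    _ = refl
    inj zero    (suc j) p = ⊥-elim (¬p (j , sym p))
    inj (suc i) zero    p = ⊥-elim (¬p (i , p))
    inj (suc i) (suc j) p = cong suc (h i j p)

  ∑-count : ∀ {n m} (v : Vec (Fin n) m) → ∑ (λ a → count a v) ≡ fromℕ m
  ∑-count {n} Vec.[]  = ∑-zero n
  ∑-count {n} {suc m} (b Vec.∷ v) = trans (∑-+ (λ a → δ a b) (λ a → count a v)) (trans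
    (cong₂ _+_ (trans (∑-cong (λ a → sym (*-identityʳ (δ a b)))) (∑-δ b (λ _ → 1ℚ))) (∑-count v)) (sym (fromℕ-suc m)))

  -- The falling factorial: there are (k+m)!/k! injective words of length m over k+m letters,
  -- counted by prepending letters one at a time.
  ∑-injW : ∀ k m → sumOf (allVecs (k ℕ.+ m) m) injW * fromℕ (k !) ≡ fromℕ ((k ℕ.+ m) !)
  ∑-injW k m = go (k ℕ.+ m) k m refl
    where
    shuffle = solve 3 (λ n m w → n :* con 1ℚ :* w :+ (:- (m :* w)) := (n :- m) :* w) refl
    -- Because the occurrences always add up to m, this holds for every `v`, injective or not, and
    -- the induction requires no case distinction.
    extend : ∀ n m (v : Vec (Fin n) m) → ∑ (λ a → (1ℚ - count a v) * injW v) ≡ (fromℕ n - fromℕ m) * injW v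
    extend n m v = trans (∑-*ʳ (injW v) (λ a → 1ℚ - count a v))
      (cong (_* injW v) (trans (∑-minus (λ _ → 1ℚ) (λ a → count a v))
        (cong₂ _-_ (trans (∑-const n 1ℚ) (*-identityʳ (fromℕ n))) (∑-count v))))
    cancel = solve 4 (λ k m s w → (con 1ℚ :+ k :+ m :- m) :* s :* w := s :* ((con 1ℚ :+ k) :* w)) refl
    go : ∀ n k m → n ≡ k ℕ.+ m → sumOf (allVecs n m) injW * fromℕ (k !) ≡ fromℕ (n !)
    go n k zero e = trans (cong (_* fromℕ (k !)) (+-identityʳ 1ℚ))
      (trans (*-identityˡ (fromℕ (k !))) (cong (λ t → fromℕ (t !)) (trans (sym (ℕ.+-identityʳ k)) (sym e))))
    go n k (suc m) e = trans (cong (_* fromℕ (k !)) (trans (sumOf-allVecs-suc n m injW)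
        (trans (sumOf-cong (allVecs n m) (extend n m)) (sumOf-*ˡ (allVecs n m) (fromℕ n - fromℕ m) injW))))
      (trans (cong (λ t → (t - fromℕ m) * sumOf (allVecs n m) injW * fromℕ (k !))
                (trans (cong fromℕ (trans e (ℕ.+-suc k m))) (trans (fromℕ-+ (suc k) m) (cong (_+ fromℕ m) (fromℕ-suc k)))))
      (trans (cancel (fromℕ k) (fromℕ m) (sumOf (allVecs n m) injW) (fromℕ (k !)))
      (trans (cong (λ t → sumOf (allVecs n m) injW * t)
          (trans (cong (_* fromℕ (k !)) (sym (fromℕ-suc k))) (sym (fromℕ-* (suc k) (k !)))))
        (go n (suc k) m (trans e (ℕ.+-suc k m))))))

abstract
  indicator : ∀ {n} → Perm n → ℚ
  indicator π = b2q (does (isPerm? π))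

  indicator-yes : ∀ {n} {π : Perm n} → IsPerm π → indicator π ≡ 1ℚ
  indicator-yes {π = π} h = cong b2q (dec-true (isPerm? π) h)

  indicator-no : ∀ {n} {π : Perm n} → ¬ IsPerm π → indicator π ≡ 0ℚ
  indicator-no {π = π} h = cong b2q (dec-false (isPerm? π) h)

  sumOf-Sn : ∀ n F → sumOf (Sn n) F ≡ sumOf (allVecs n n) (λ π → indicator π * F π)
  sumOf-Sn n F = sumOf-filter isPerm? (allVecs n n) F

indicator-spec : ∀ {n} (π : Perm n) → (IsPerm π × indicator π ≡ 1ℚ) ⊎ (¬ IsPerm π × indicator π ≡ 0ℚ)
indicator-spec π with isPerm? π
... | yes p = inj₁ (p , indicator-yes p)
... | no ¬p = inj₂ (¬p , indicator-no ¬p)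

weight : ℕ → ℚ
weight n = (+ 1) / (n !) where instance _ = n ℕ.!≢0

weight-spec : ∀ n → fromℕ (n !) * weight n ≡ 1ℚ
weight-spec n with n ! | n ℕ.!≢0
... | suc k | _ = fromℕ*recip k

weight≥0 : ∀ n → 0ℚ ≤ weight n
weight≥0 n = nonNegative⁻¹ (weight n) {{normalize-nonNeg 1 (n !) {{n ℕ.!≢0}}}}

𝔼-cong : ∀ n {F G : Perm n → ℚ} → (∀ π → IsPerm π → F π ≡ G π) → 𝔼 n F ≡ 𝔼 n G
𝔼-cong n {F} {G} h = cong (_* weight n) (trans (sumOf-Sn n F) (trans (sumOf-cong (allVecs n n) pointwise) (sym (sumOf-Sn n G))))
  where
  pointwise : ∀ π → indicator π * F π ≡ indicator π * G π
  pointwise π with indicator π | indicator-spec π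
  ... | _ | inj₁ (p , refl) = cong (1ℚ *_) (h π p)
  ... | _ | inj₂ (_ , refl) = trans (*-zeroˡ (F π)) (sym (*-zeroˡ (G π)))

𝔼-mono : ∀ n {F G : Perm n → ℚ} → (∀ π → IsPerm π → F π ≤ G π) → 𝔼 n F ≤ 𝔼 n G
𝔼-mono n {F} {G} h = *-monoʳ-≤-nonNeg (weight n) {{nonNegative (weight≥0 n)}}
  (subst₂ _≤_ (sym (sumOf-Sn n F)) (sym (sumOf-Sn n G)) (sumOf-mono (allVecs n n) pointwise))
  where
  pointwise : ∀ π → indicator π * F π ≤ indicator π * G π
  pointwise π with indicator π | indicator-spec π
  ... | _ | inj₁ (p , refl) = *-monoˡ {F π} {G π} 1ℚ (lit 1ℚ) (h π p)
  ... | _ | inj₂ (_ , refl) = ≤-reflexive (trans (*-zeroˡ (F π)) (sym (*-zeroˡ (G π))))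

𝔼-+ : ∀ n (F G : Perm n → ℚ) → 𝔼 n (λ π → F π + G π) ≡ 𝔼 n F + 𝔼 n G
𝔼-+ n F G = trans (cong (_* weight n) (sumOf-+ (Sn n) F G)) (*-distribʳ-+ (weight n) (sumOf (Sn n) F) (sumOf (Sn n) G))

𝔼-*ˡ : ∀ n k (F : Perm n → ℚ) → 𝔼 n (λ π → k * F π) ≡ k * 𝔼 n F
𝔼-*ˡ n k F = trans (cong (_* weight n) (sumOf-*ˡ (Sn n) k F)) (*-assoc k (sumOf (Sn n) F) (weight n))

𝔼-*ʳ : ∀ n k (F : Perm n → ℚ) → 𝔼 n (λ π → F π * k) ≡ 𝔼 n F * k
𝔼-*ʳ n k F = trans (𝔼-cong n (λ π _ → *-comm (F π) k)) (trans (𝔼-*ˡ n k F) (*-comm k (𝔼 n F)))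

𝔼-neg : ∀ n (F : Perm n → ℚ) → 𝔼 n (λ π → - F π) ≡ - 𝔼 n F
𝔼-neg n F = trans (𝔼-cong n (λ π _ → neg-1 (F π))) (trans (𝔼-*ˡ n (- 1ℚ) F) (sym (neg-1 (𝔼 n F))))
  where
  neg-1 = solve 1 (λ a → (:- a) := (:- (con 1ℚ)) :* a) refl

𝔼-minus : ∀ n (F G : Perm n → ℚ) → 𝔼 n (λ π → F π - G π) ≡ 𝔼 n F - 𝔼 n G
𝔼-minus n F G = trans (𝔼-+ n F (λ π → - G π)) (cong (λ t → 𝔼 n F + t) (𝔼-neg n G))

𝔼-∑ : ∀ n {m} (F : Fin m → Perm n → ℚ) → 𝔼 n (λ π → ∑ (λ i → F i π)) ≡ ∑ (λ i → 𝔼 n (F i))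
𝔼-∑ n F = trans (cong (_* weight n) (sumOf-∑ (Sn n) (λ π i → F i π))) (sym (∑-*ʳ (weight n) (λ i → sumOf (Sn n) (F i))))

-- This is where |S_n| = n! enters: `indicator` agrees with `injW`, and `∑-injW` is applied with k =
-- 0.
𝔼-const : ∀ n c → 𝔼 n (λ _ → c) ≡ c
𝔼-const n c = trans (𝔼-cong n (λ _ _ → sym (*-identityʳ c))) (trans (𝔼-*ˡ n c (λ _ → 1ℚ))
    (trans (cong (c *_) 𝔼-one) (*-identityʳ c)))
  where
  injW-indicator : ∀ (v : Perm n) → indicator v * 1ℚ ≡ injW v
  injW-indicator v with injW-spec v
  ... | inj₁ (h , e) = trans (cong (_* 1ℚ) (indicator-yes h)) (sym e)
  ... | inj₂ (h , e) = trans (cong (_* 1ℚ) (indicator-no h)) (sym e)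
  𝔼-one : 𝔼 n (λ _ → 1ℚ) ≡ 1ℚ
  𝔼-one = trans (cong (_* weight n) (trans (sumOf-Sn n (λ _ → 1ℚ)) (trans (sumOf-cong (allVecs n n) injW-indicator)
    (trans (sym (*-identityʳ (sumOf (allVecs n n) injW))) (∑-injW 0 n))))) (weight-spec n)

𝔼≥0 : ∀ n {F : Perm n → ℚ} → (∀ π → IsPerm π → 0ℚ ≤ F π) → 0ℚ ≤ 𝔼 n F
𝔼≥0 n {F} h = subst (_≤ 𝔼 n F) (𝔼-const n 0ℚ) (𝔼-mono n h)

-- Turns a bound on a mean into a pointwise bound, at the price of a factor n!. For bounded n that
-- price is a constant.
term≤n!𝔼 : ∀ n {F : Perm n → ℚ} → (∀ π → IsPerm π → 0ℚ ≤ F π) → ∀ π → IsPerm π → F π ≤ fromℕ (n !) * 𝔼 n F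
term≤n!𝔼 n {F} h π p = subst₂ _≤_ (trans (sumOf-δᵛ n n π _) (trans (cong (_* F π) (indicator-yes p)) (*-identityˡ (F π))))
  (trans (sym (sumOf-Sn n F)) (trans (sym (*-identityʳ S)) (trans (cong (S *_) (sym (weight-spec n)))
      (shuffle S (fromℕ (n !)) (weight n)))))
  (sumOf-mono (allVecs n n) pointwise)
  where
  S = sumOf (Sn n) F
  shuffle = solve 3 (λ s a b → s :* (a :* b) := a :* (s :* b)) refl
  weighted≥0 : ∀ ρ → 0ℚ ≤ indicator ρ * F ρ
  weighted≥0 ρ with indicator ρ | indicator-spec ρ
  ... | _ | inj₁ (q , refl) = lit 1ℚ ⊗ h ρ q
  ... | _ | inj₂ (_ , refl) = ≤-reflexive (sym (*-zeroˡ (F ρ)))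
  pointwise : ∀ ρ → δᵛ ρ π * (indicator ρ * F ρ) ≤ indicator ρ * F ρ
  pointwise ρ with Vec.≡-dec Fin._≟_ ρ π
  ... | yes refl = ≤-reflexive (trans (cong (_* (indicator ρ * F ρ)) (δᵛ-refl ρ)) (*-identityˡ (indicator ρ * F ρ)))
  ... | no ≢ = ≤-trans (≤-reflexive (trans (cong (_* (indicator ρ * F ρ)) (δᵛ-≢ ρ π ≢)) (*-zeroˡ (indicator ρ * F ρ))))
      (weighted≥0 ρ)

-- Both sides become double sums over pairs of tables (π, ρ) weighted by a delta; on permutations
-- the conditions ρ = φ π and π = ψ ρ are equivalent, so exchanging the order of summation changes
-- variables.
𝔼-reindex : ∀ n (φ ψ : Perm n → Perm n) →
  (∀ π → IsPerm π → IsPerm (φ π)) → (∀ π → IsPerm π → IsPerm (ψ π)) →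
  (∀ π → IsPerm π → ψ (φ π) ≡ π) → (∀ π → IsPerm π → φ (ψ π) ≡ π) →
  ∀ (F : Perm n → ℚ) → 𝔼 n (F ∘ φ) ≡ 𝔼 n F
𝔼-reindex n φ ψ φ-perm ψ-perm ψφ φψ F = cong (_* weight n) (begin
  sumOf (Sn n) (F ∘ φ)
    ≡⟨ sumOf-Sn n (F ∘ φ) ⟩
  sumOf xs (λ π → indicator π * F (φ π))
    ≡⟨ sumOf-cong xs (λ π → sym (sumOf-δᵛ n n (φ π) (λ ρ → indicator π * F ρ))) ⟩
  sumOf xs (λ π → sumOf xs (λ ρ → δᵛ ρ (φ π) * (indicator π * F ρ)))
    ≡⟨ sumOf-swap xs xs (λ π ρ → δᵛ ρ (φ π) * (indicator π * F ρ)) ⟩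
  sumOf xs (λ ρ → sumOf xs (λ π → δᵛ ρ (φ π) * (indicator π * F ρ)))
    ≡⟨ sumOf-cong xs (λ ρ → sumOf-cong xs (λ π → exchange ρ π)) ⟩
  sumOf xs (λ ρ → sumOf xs (λ π → δᵛ π (ψ ρ) * (indicator ρ * F ρ)))
    ≡⟨ sumOf-cong xs (λ ρ → sumOf-δᵛ n n (ψ ρ) (λ _ → indicator ρ * F ρ)) ⟩
  sumOf xs (λ ρ → indicator ρ * F ρ)
    ≡⟨ sym (sumOf-Sn n F) ⟩
  sumOf (Sn n) F ∎)
  where
  open ≡-Reasoning
  xs = allVecs n n
  vanish : ∀ d e {i} a → i ≡ 0ℚ → d * (i * a) ≡ e * (0ℚ * a)
  vanish d e a refl = lemma d e a
    where
    lemma = solve 3 (λ d e a → d :* (con 0ℚ :* a) := e :* (con 0ℚ :* a)) refl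
  vanish′ : ∀ {d} a → d ≡ 0ℚ → d * a ≡ 0ℚ
  vanish′ a refl = *-zeroˡ a
  exchange : ∀ ρ π → δᵛ ρ (φ π) * (indicator π * F ρ) ≡ δᵛ π (ψ ρ) * (indicator ρ * F ρ)
  exchange ρ π with indicator π | indicator-spec π | indicator ρ | indicator-spec ρ
  ... | _ | inj₂ (¬p , refl) | _ | inj₂ (¬q , refl) = vanish (δᵛ ρ (φ π)) (δᵛ π (ψ ρ)) (F ρ) refl
  ... | _ | inj₁ (p , refl) | _ | inj₂ (¬q , refl) = trans (vanish′ (1ℚ * F ρ)
      (δᵛ-≢ ρ (φ π) (λ e → ¬q (subst IsPerm (sym e) (φ-perm π p)))))
                          (sym (trans (cong (δᵛ π (ψ ρ) *_) (*-zeroˡ (F ρ))) (*-zeroʳ (δᵛ π (ψ ρ)))))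
  ... | _ | inj₂ (¬p , refl) | _ | inj₁ (q , refl) = trans (trans (cong (δᵛ ρ (φ π) *_) (*-zeroˡ (F ρ))) (*-zeroʳ (δᵛ ρ (φ π))))
                          (sym (vanish′ (1ℚ * F ρ) (δᵛ-≢ π (ψ ρ) (λ e → ¬p (subst IsPerm (sym e) (ψ-perm ρ q))))))
  ... | _ | inj₁ (p , refl) | _ | inj₁ (q , refl) with Vec.≡-dec Fin._≟_ ρ (φ π) | Vec.≡-dec Fin._≟_ π (ψ ρ)
  ...   | yes e | yes e′ = cong (_* (1ℚ * F ρ)) (trans (cong (λ t → δᵛ t (φ π)) e)
      (trans (δᵛ-refl (φ π)) (sym (trans (cong (λ t → δᵛ t (ψ ρ)) e′) (δᵛ-refl (ψ ρ))))))
  ...   | no ≢  | no ≢′  = cong (_* (1ℚ * F ρ)) (trans (δᵛ-≢ ρ (φ π) ≢) (sym (δᵛ-≢ π (ψ ρ) ≢′)))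
  ...   | yes e | no ≢   = ⊥-elim (≢ (trans (sym (ψφ π p)) (cong ψ (sym e))))
  ...   | no ≢  | yes e  = ⊥-elim (≢ (trans (sym (φψ ρ q)) (cong φ (sym e))))

-- Composition and inversion of permutations

lookup-injective : ∀ {a} {A : Set a} {n} {v u : Vec A n} → (∀ i → lookup v i ≡ lookup u i) → v ≡ u
lookup-injective {v = v} {u} h = trans (sym (tabulate∘lookup v)) (trans (tabulate-cong h) (tabulate∘lookup u))

rearrange : ∀ {n} → (Fin n → Fin n) → (Fin n → Fin n) → Perm n → Perm n
rearrange α β π = tabulate (λ i → α (lookup π (β i)))

lookup-rearrange : ∀ {n} (α β : Fin n → Fin n) π i → lookup (rearrange α β π) i ≡ α (lookup π (β i))
lookup-rearrange α β π i = lookup∘tabulate _ i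

record Inverse {n} (α α⁻ : Fin n → Fin n) : Set where
  constructor inverse
  field
    left  : ∀ i → α⁻ (α i) ≡ i
    right : ∀ i → α (α⁻ i) ≡ i

id-inverse : ∀ {n} → Inverse {n} id id
id-inverse = inverse (λ _ → refl) (λ _ → refl)

flip-inverse : ∀ {n} {α α⁻ : Fin n → Fin n} → Inverse α α⁻ → Inverse α⁻ α
flip-inverse (inverse l r) = inverse r l

module _ {n} {α α⁻ β β⁻ : Fin n → Fin n} (A : Inverse α α⁻) (B : Inverse β β⁻) where
  private
    module A = Inverse A
    module B = Inverse B

  rearrange-perm : ∀ π → IsPerm π → IsPerm (rearrange α β π)
  rearrange-perm π h i j e = trans (sym (B.left i)) (trans (cong β⁻ (h (β i) (β j) (trans (sym (A.left _))
    (trans (cong α⁻ (trans (sym (lookup-rearrange α β π i)) (trans e (lookup-rearrange α β π j)))) (A.left _))))) (B.left j))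

  rearrange-inverse : ∀ π → rearrange α⁻ β⁻ (rearrange α β π) ≡ π
  rearrange-inverse π = lookup-injective λ i → trans (lookup-rearrange α⁻ β⁻ (rearrange α β π) i)
    (trans (cong α⁻ (lookup-rearrange α β π (β⁻ i))) (trans (A.left _) (cong (lookup π) (B.right i))))

𝔼-rearrange : ∀ {n} {α α⁻ β β⁻ : Fin n → Fin n} → Inverse α α⁻ → Inverse β β⁻ → ∀ F → 𝔼 n (F ∘ rearrange α β) ≡ 𝔼 n F
𝔼-rearrange {n} {α} {α⁻} {β} {β⁻} A B = 𝔼-reindex n (rearrange α β) (rearrange α⁻ β⁻) (rearrange-perm A B)
  (rearrange-perm (flip-inverse A) (flip-inverse B)) (λ π _ → rearrange-inverse A B π)
  (λ π _ → rearrange-inverse (flip-inverse A) (flip-inverse B) π)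

-- Pigeonhole: if `j` were missed, punching it out of the range would inject n+1 positions into n
-- values.
perm-surjective : ∀ {n} (π : Perm n) → IsPerm π → ∀ j → ∃[ i ] lookup π i ≡ j
perm-surjective {suc n} π h j with Fin.any? (λ i → lookup π i Fin.≟ j)
... | yes p = p
... | no ¬p = ⊥-elim (ℕ.1+n≰n (Fin.injective⇒≤ {f = λ i → Fin.punchOut (avoid i)} λ e → h _ _
    (Fin.punchOut-injective (avoid _) (avoid _) e)))
  where
  avoid : ∀ i → j ≢ lookup π i
  avoid i e = ¬p (i , sym e)

index : ∀ {n} → Perm n → Fin n → Fin n
index π j with Fin.any? (λ i → lookup π i Fin.≟ j)
... | yes (i , _) = i
... | no _        = j

lookup-index : ∀ {n} (π : Perm n) → IsPerm π → ∀ j → lookup π (index π j) ≡ j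
lookup-index π h j with Fin.any? (λ i → lookup π i Fin.≟ j)
... | yes (_ , e) = e
... | no ¬p       = ⊥-elim (¬p (perm-surjective π h j))

index-lookup : ∀ {n} (π : Perm n) → IsPerm π → ∀ i → index π (lookup π i) ≡ i
index-lookup π h i = h _ _ (lookup-index π h (lookup π i))

perm-inverse : ∀ {n} (π : Perm n) → IsPerm π → Inverse (lookup π) (index π)
perm-inverse π h = inverse (index-lookup π h) (lookup-index π h)

inv : ∀ {n} → Perm n → Perm n
inv π = tabulate (index π)

lookup-inv : ∀ {n} (π : Perm n) j → lookup (inv π) j ≡ index π j
lookup-inv π j = lookup∘tabulate (index π) j

inv-perm : ∀ {n} (π : Perm n) → IsPerm π → IsPerm (inv π)
inv-perm π h i j e = trans (sym (lookup-index π h i)) (trans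
  (cong (lookup π) (trans (sym (lookup-inv π i)) (trans e (lookup-inv π j)))) (lookup-index π h j))

inv-inv : ∀ {n} (π : Perm n) → IsPerm π → inv (inv π) ≡ π
inv-inv π h = lookup-injective λ i → trans (lookup-inv (inv π) i) (inv-perm π h _ _
  (trans (lookup-index (inv π) (inv-perm π h) i) (sym (trans (lookup-inv π (lookup π i)) (index-lookup π h i)))))

𝔼-inv : ∀ n F → 𝔼 n (F ∘ inv) ≡ 𝔼 n F
𝔼-inv n = 𝔼-reindex n inv inv inv-perm inv-perm inv-inv inv-inv

-- Coset indicators and probabilities of intersections of cosets

X : ∀ {n} → Fin n → Fin n → Perm n → ℚ
X i j π = δ (lookup π i) j

x≡X : ∀ {n} (i j : Fin n) π → x i j π ≡ X i j π
x≡X i j π with lookup π i Fin.≟ j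
... | yes _ = refl
... | no _  = refl

X≥0 : ∀ {n} (i j : Fin n) π → 0ℚ ≤ X i j π
X≥0 i j π = b2q≥0 (does (lookup π i Fin.≟ j))

∑-δʳ : ∀ {n} a (F : Fin n → ℚ) → ∑ (λ i → δ a i * F i) ≡ F a
∑-δʳ a F = trans (∑-cong (λ i → cong (_* F i) (δ-sym a i))) (∑-δ a F)

∑-δ-one : ∀ {n} (a : Fin n) → ∑ (λ i → δ a i) ≡ 1ℚ
∑-δ-one a = trans (∑-cong (λ i → sym (*-identityʳ (δ a i)))) (∑-δʳ a (λ _ → 1ℚ))

row-sum : ∀ {n} (i : Fin n) π → ∑ (λ j → X i j π) ≡ 1ℚ
row-sum i π = ∑-δ-one (lookup π i)

X-index : ∀ {n} (π : Perm n) → IsPerm π → ∀ i j → X i j π ≡ δ (index π j) i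
X-index π h i j with lookup π i Fin.≟ j
... | yes refl = sym (trans (cong (λ t → δ t i) (index-lookup π h i)) (δ-refl i))
... | no ≢     = sym (δ-≢ (λ e → ≢ (trans (cong (lookup π) (sym e)) (lookup-index π h j))))

col-sum : ∀ {n} (j : Fin n) π → IsPerm π → ∑ (λ i → X i j π) ≡ 1ℚ
col-sum j π h = trans (∑-cong (λ i → X-index π h i j)) (∑-δ-one (index π j))

∑-perm : ∀ {n} (π : Perm n) → IsPerm π → ∀ F → ∑ (λ i → F (lookup π i)) ≡ ∑ F
∑-perm π h F = begin
  ∑ (λ i → F (lookup π i))               ≡⟨ ∑-cong (λ i → sym (∑-δʳ (lookup π i) F)) ⟩
  ∑ (λ i → ∑ (λ j → X i j π * F j))      ≡⟨ ∑-swap (λ i j → X i j π * F j) ⟩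
  ∑ (λ j → ∑ (λ i → X i j π * F j))      ≡⟨ ∑-cong (λ j → trans (∑-*ʳ (F j) (λ i → X i j π))
      (trans (cong (_* F j) (col-sum j π h)) (*-identityˡ (F j)))) ⟩
  ∑ F                                    ∎
  where open ≡-Reasoning

linear-eval : ∀ {n} (c : Fin n → Fin n → ℚ) π → linear n c π ≡ ∑ (λ i → c i (lookup π i))
linear-eval c π = ∑-cong λ i → trans (∑-cong λ j → trans (cong (c i j *_) (x≡X i j π)) (*-comm (c i j) (X i j π)))
    (∑-δʳ (lookup π i) (c i))

X-same-row : ∀ {n} (i : Fin n) {j l} π → j ≢ l → X i j π * X i l π ≡ 0ℚ
X-same-row i {j} {l} π h with lookup π i Fin.≟ j
... | no _     = *-zeroˡ (X i l π)
... | yes refl = trans (*-identityˡ (X i l π)) (δ-≢ h)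

X-same-col : ∀ {n} {i k : Fin n} j π → IsPerm π → i ≢ k → X i j π * X k j π ≡ 0ℚ
X-same-col {i = i} {k} j π p h with lookup π i Fin.≟ j
... | no _     = *-zeroˡ (X k j π)
... | yes refl = trans (*-identityˡ (X k j π)) (δ-≢ (λ e → h (p _ _ (sym e))))

X-idem : ∀ {n} (i j : Fin n) π → X i j π * X i j π ≡ X i j π
X-idem i j π = b2q-idem (does (lookup π i Fin.≟ j))

transpose-left : ∀ {n} (i j : Fin n) → transpose i j i ≡ j
transpose-left i j rewrite dec-true (i Fin.≟ i) refl = refl

transpose-other : ∀ {n} {i j k : Fin n} → k ≢ i → k ≢ j → transpose i j k ≡ k
transpose-other {i = i} {j} {k} h h′ rewrite dec-false (k Fin.≟ i) h | dec-false (k Fin.≟ j) h′ = refl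

transpose-inverse′ : ∀ {n} (i j : Fin n) → Inverse (transpose i j) (transpose j i)
transpose-inverse′ i j = inverse (λ k → transpose-inverse j i) (λ k → transpose-inverse i j)

δ-cong-inj : ∀ {n} {α α⁻ : Fin n → Fin n} → Inverse α α⁻ → ∀ a b → δ (α a) (α b) ≡ δ a b
δ-cong-inj {α = α} {α⁻} A a b with a Fin.≟ b
... | yes refl = δ-refl (α a)
... | no ≢     = δ-≢ (λ e → ≢ (trans (sym (Inverse.left A a)) (trans (cong α⁻ e) (Inverse.left A b))))

Xs : ∀ {n} → List (Fin n × Fin n) → Perm n → ℚ
Xs []            π = 1ℚ
Xs ((i , j) ∷ L) π = X i j π * Xs L π

Xs≥0 : ∀ {n} (L : List (Fin n × Fin n)) π → 0ℚ ≤ Xs L π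
Xs≥0 []            π = lit 1ℚ
Xs≥0 ((i , j) ∷ L) π = X≥0 i j π ⊗ Xs≥0 L π

infixr 5 _and_
-- Pairwise non-disjoint cosets, that is, a partial permutation; `Xs` is then the indicator that π
-- extends it.
data Free {n} : List (Fin n × Fin n) → Set where
  empty : Free []
  _and_ : ∀ {i j L} → All (λ e → i ≢ proj₁ e × j ≢ proj₂ e) L → Free L → Free ((i , j) ∷ L)

private
  swap-Xs : ∀ {n} (j l : Fin n) (L : List (Fin n × Fin n)) → All (λ e → j ≢ proj₂ e) L → All (λ e → l ≢ proj₂ e) L →
    ∀ π → Xs L (rearrange (transpose j l) id π) ≡ Xs L π
  swap-Xs j l []            All.[]      All.[]      π = refl
  swap-Xs j l ((i , k) ∷ L) (h All.∷ H) (g All.∷ G) π = cong₂ _*_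
      (trans (cong₂ δ (lookup-rearrange (transpose j l) id π i) (sym (transpose-other (h ∘ sym) (g ∘ sym))))
    (δ-cong-inj (transpose-inverse′ j l) (lookup π i) k)) (swap-Xs j l L H G π)

  swap-X : ∀ {n} (i j l : Fin n) π → X i l (rearrange (transpose j l) id π) ≡ X i j π
  swap-X i j l π = trans (cong₂ δ (lookup-rearrange (transpose j l) id π i) (sym (transpose-left j l)))
      (δ-cong-inj (transpose-inverse′ j l) (lookup π i) j)

-- Exchanging the values j and l after applying π preserves the uniform measure and leaves the other
-- constraints alone, as neither value occurs in `L`.
𝔼-Xs-value : ∀ {n} (i j l : Fin n) (L : List (Fin n × Fin n)) → All (λ e → j ≢ proj₂ e) L → All (λ e → l ≢ proj₂ e) L →
  𝔼 n (Xs ((i , j) ∷ L)) ≡ 𝔼 n (Xs ((i , l) ∷ L))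
𝔼-Xs-value {n} i j l L H G = trans (𝔼-cong n (λ π _ → sym (cong₂ _*_ (swap-X i j l π) (swap-Xs j l L H G π))))
  (𝔼-rearrange (transpose-inverse′ j l) id-inverse (Xs ((i , l) ∷ L)))

Xs-sum : ∀ {n} (i : Fin n) (L : List (Fin n × Fin n)) → ∑ (λ l → 𝔼 n (Xs ((i , l) ∷ L))) ≡ 𝔼 n (Xs L)
Xs-sum {n} i L = trans (sym (𝔼-∑ n (λ l → Xs ((i , l) ∷ L)))) (𝔼-cong n (λ π _ →
  trans (∑-*ʳ (Xs L π) (λ l → X i l π)) (trans (cong (_* Xs L π) (row-sum i π)) (*-identityˡ (Xs L π)))))

Xs-clash : ∀ {n} (i l : Fin n) (L : List (Fin n × Fin n)) → All (λ e → i ≢ proj₁ e) L → ¬ All (λ e → l ≢ proj₂ e) L →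
  ∀ π → IsPerm π → Xs ((i , l) ∷ L) π ≡ 0ℚ
Xs-clash i l []            All.[]      h π p = ⊥-elim (h All.[])
Xs-clash i l ((k , m) ∷ L) (g All.∷ G) h π p with l Fin.≟ m
... | yes refl = trans (sym (*-assoc (X i l π) (X k l π) (Xs L π)))
    (trans (cong (_* Xs L π) (X-same-col l π p g)) (*-zeroˡ (Xs L π)))
... | no ≢     = trans (shuffle (X i l π) (X k m π) (Xs L π))
    (trans (cong (X k m π *_) (Xs-clash i l L G (λ H → h (≢ All.∷ H)) π p)) (*-zeroʳ (X k m π)))
  where
  shuffle = solve 3 (λ a b c → a :* (b :* c) := b :* (a :* c)) refl

private
  fresh? : ∀ {n} (l : Fin n) (L : List (Fin n × Fin n)) → Dec (All (λ e → l ≢ proj₂ e) L)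
  fresh? l = All.all? (λ e → ¬? (l Fin.≟ proj₂ e))

-- Position i takes some value l. By symmetry all values outside `L` are equally likely, and the
-- values occurring in `L` contribute zero. Replacing those zeros by the common value costs only a
-- constant factor and avoids falling factorials.
𝔼-Xs-step : ∀ {n} (i j : Fin n) (L : List (Fin n × Fin n)) → All (λ e → i ≢ proj₁ e × j ≢ proj₂ e) L →
  𝔼 n (Xs L) ≤ fromℕ n * 𝔼 n (Xs ((i , j) ∷ L))
𝔼-Xs-step {n} i j L H = subst₂ _≤_ (Xs-sum i L) (∑-const n (𝔼 n (Xs ((i , j) ∷ L)))) (∑-mono bound)
  where
  bound : ∀ l → 𝔼 n (Xs ((i , l) ∷ L)) ≤ 𝔼 n (Xs ((i , j) ∷ L))
  bound l with fresh? l L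
  ... | yes G = ≤-reflexive (𝔼-Xs-value i l j L G (All.map proj₂ H))
  ... | no ¬G = ≤-trans (≤-reflexive (trans (𝔼-cong n (Xs-clash i l L (All.map proj₁ H) ¬G)) (𝔼-const n 0ℚ)))
      (𝔼≥0 n (λ π _ → Xs≥0 ((i , j) ∷ L) π))

_^ℚ_ : ℚ → ℕ → ℚ
p ^ℚ zero  = 1ℚ
p ^ℚ suc k = p * (p ^ℚ k)

1≤n^k𝔼Xs : ∀ {n} (L : List (Fin n × Fin n)) → Free L → 1ℚ ≤ (fromℕ n ^ℚ List.length L) * 𝔼 n (Xs L)
1≤n^k𝔼Xs {n} []            empty   = ≤-reflexive (sym (trans (*-identityˡ (𝔼 n (λ _ → 1ℚ))) (𝔼-const n 1ℚ)))
1≤n^k𝔼Xs {n} ((i , j) ∷ L) (H and F) = ≤-trans (1≤n^k𝔼Xs L F) (≤-trans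
  (*-monoˡ (fromℕ n ^ℚ List.length L) (pow≥0 (List.length L)) (𝔼-Xs-step i j L H))
  (≤-reflexive (shuffle (fromℕ n ^ℚ List.length L) (fromℕ n) (𝔼 n (Xs ((i , j) ∷ L))))))
  where
  pow≥0 : ∀ k → 0ℚ ≤ fromℕ n ^ℚ k
  pow≥0 zero    = lit 1ℚ
  pow≥0 (suc k) = fromℕ≥0 n ⊗ pow≥0 k
  shuffle = solve 3 (λ a b c → a :* (b :* c) := b :* a :* c) refl

𝔼-X : ∀ {n} (i j : Fin n) → fromℕ n * 𝔼 n (X i j) ≡ 1ℚ
𝔼-X {n} i j = begin
  fromℕ n * 𝔼 n (X i j)                       ≡⟨ sym (∑-const n (𝔼 n (X i j))) ⟩
  ∑ {n} (λ _ → 𝔼 n (X i j))                   ≡⟨ ∑-cong (λ l → trans (single j) (trans (𝔼-Xs-value i j l [] All.[] All.[]) refl))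
      ⟩
  ∑ (λ l → 𝔼 n (Xs ((i , l) ∷ [])))           ≡⟨ Xs-sum i [] ⟩
  𝔼 n (λ _ → 1ℚ)                              ≡⟨ 𝔼-const n 1ℚ ⟩
  1ℚ                                          ∎
  where
  open ≡-Reasoning
  single : ∀ l → 𝔼 n (X i l) ≡ 𝔼 n (Xs ((i , l) ∷ []))
  single l = 𝔼-cong n (λ π _ → sym (*-identityʳ (X i l π)))

-- Here the exact value matters, since second moments are computed from it: of the n values for
-- position i, exactly one clashes with the coset (k, l).
𝔼-XX : ∀ {n} {i k j l : Fin n} → i ≢ k → j ≢ l → fromℕ n * (fromℕ n - 1ℚ) * 𝔼 n (λ π → X i j π * X k l π) ≡ 1ℚ
𝔼-XX {n} {i} {k} {j} {l} i≢k j≢l = begin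
  fromℕ n * (fromℕ n - 1ℚ) * e                            ≡⟨ *-assoc (fromℕ n) (fromℕ n - 1ℚ) e ⟩
  fromℕ n * ((fromℕ n - 1ℚ) * e)                          ≡⟨ cong (fromℕ n *_) (trans (sym tally) (Xs-sum i ((k , l) ∷ []))) ⟩
  fromℕ n * 𝔼 n (Xs ((k , l) ∷ []))                       ≡⟨ cong (fromℕ n *_) (𝔼-cong n (λ π _ → *-identityʳ (X k l π))) ⟩
  fromℕ n * 𝔼 n (X k l)                                   ≡⟨ 𝔼-X k l ⟩
  1ℚ                                                      ∎
  where
  open ≡-Reasoning
  e = 𝔼 n (λ π → X i j π * X k l π)
  e≡ : e ≡ 𝔼 n (Xs ((i , j) ∷ (k , l) ∷ []))
  e≡ = 𝔼-cong n (λ π _ → cong (X i j π *_) (sym (*-identityʳ (X k l π))))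
  term : ∀ m → 𝔼 n (Xs ((i , m) ∷ (k , l) ∷ [])) ≡ (1ℚ - δ m l) * e
  term m with m Fin.≟ l
  ... | yes refl = trans (trans (𝔼-cong n (Xs-clash i m ((k , m) ∷ []) (i≢k All.∷ All.[]) (λ { (h All.∷ All.[]) → h refl })))
      (𝔼-const n 0ℚ)) (sym (*-zeroˡ e))
  ... | no ≢     = trans (𝔼-Xs-value i m j ((k , l) ∷ []) (≢ All.∷ All.[]) (j≢l All.∷ All.[]))
      (trans (sym e≡) (sym (*-identityˡ e)))
  tally : ∑ (λ m → 𝔼 n (Xs ((i , m) ∷ (k , l) ∷ []))) ≡ (fromℕ n - 1ℚ) * e
  tally = trans (∑-cong term) (trans (∑-*ʳ e (λ m → 1ℚ - δ m l)) (cong (_* e) (trans (∑-minus (λ _ → 1ℚ) (λ m → δ m l))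
    (cong₂ _-_ (trans (∑-const n 1ℚ) (*-identityʳ (fromℕ n))) (trans (∑-cong (λ m → δ-sym m l)) (∑-δ-one l))))))

-- Matrices and their 2×2 minors

∑∑ : ∀ {m n} → (Fin m → Fin n → ℚ) → ℚ
∑∑ F = ∑ (λ i → ∑ (F i))

∑∑-cong : ∀ {m n} {F G : Fin m → Fin n → ℚ} → (∀ i j → F i j ≡ G i j) → ∑∑ F ≡ ∑∑ G
∑∑-cong h = ∑-cong (λ i → ∑-cong (h i))

∑∑-mono : ∀ {m n} {F G : Fin m → Fin n → ℚ} → (∀ i j → F i j ≤ G i j) → ∑∑ F ≤ ∑∑ G
∑∑-mono h = ∑-mono (λ i → ∑-mono (h i))

∑∑≥0 : ∀ {m n} {F : Fin m → Fin n → ℚ} → (∀ i j → 0ℚ ≤ F i j) → 0ℚ ≤ ∑∑ F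
∑∑≥0 h = ∑≥0 (λ i → ∑≥0 (h i))

∑∑-+ : ∀ {m n} (F G : Fin m → Fin n → ℚ) → ∑∑ (λ i j → F i j + G i j) ≡ ∑∑ F + ∑∑ G
∑∑-+ F G = trans (∑-cong (λ i → ∑-+ (F i) (G i))) (∑-+ (λ i → ∑ (F i)) (λ i → ∑ (G i)))

∑∑-minus : ∀ {m n} (F G : Fin m → Fin n → ℚ) → ∑∑ (λ i j → F i j - G i j) ≡ ∑∑ F - ∑∑ G
∑∑-minus F G = trans (∑-cong (λ i → ∑-minus (F i) (G i))) (∑-minus (λ i → ∑ (F i)) (λ i → ∑ (G i)))

∑∑-*ˡ : ∀ {m n} k (F : Fin m → Fin n → ℚ) → ∑∑ (λ i j → k * F i j) ≡ k * ∑∑ F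
∑∑-*ˡ k F = trans (∑-cong (λ i → ∑-*ˡ k (F i))) (∑-*ˡ k (λ i → ∑ (F i)))

∑∑-const : ∀ m n c → ∑∑ {m} {n} (λ _ _ → c) ≡ fromℕ m * (fromℕ n * c)
∑∑-const m n c = trans (∑-cong {m} (λ _ → ∑-const n c)) (∑-const m (fromℕ n * c))

Matrix : ℕ → Set
Matrix n = Fin n → Fin n → ℚ

row col : ∀ {n} → Matrix n → Fin n → ℚ
row a i = ∑ (a i)
col a j = ∑ (λ i → a i j)

total energy : ∀ {n} → Matrix n → ℚ
total  a = ∑∑ a
energy a = ∑∑ (λ i j → a i j * a i j)

lin : ∀ {n} → Matrix n → Perm n → ℚ
lin a π = ∑ (λ i → a i (lookup π i))

lin-X : ∀ {n} (a : Matrix n) π → lin a π ≡ ∑∑ (λ k l → a k l * X k l π)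
lin-X a π = ∑-cong λ k → sym (trans (∑-cong (λ l → *-comm (a k l) (X k l π))) (∑-δʳ (lookup π k) (a k)))

-- The additive 2×2 minor on rows i, k and columns j, l. It is the amount by which `lin a` changes
-- when the values of two positions are exchanged, and it does not see functions of the row alone or
-- of the column alone.
Δ : ∀ {n} → Matrix n → Fin n → Fin n → Fin n → Fin n → ℚ
Δ a i k j l = a i j - a k j - a i l + a k l

minors : ∀ {n} → Matrix n → ℚ
minors a = ∑∑ (λ i k → ∑∑ (λ j l → Δ a i k j l * Δ a i k j l))

∑∑-sqdiff : ∀ {n} (A : Fin n → ℚ) →
  ∑∑ (λ j l → (A j - A l) * (A j - A l)) ≡ fromℕ 2 * (fromℕ n * ∑ (λ j → A j * A j) - ∑ A * ∑ A)
∑∑-sqdiff {n} A = begin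
  ∑∑ (λ j l → (A j - A l) * (A j - A l))
    ≡⟨ ∑-cong inner ⟩
  ∑ (λ j → fromℕ n * (A j * A j) + S₂ - fromℕ 2 * S * A j)
    ≡⟨ trans (∑-minus (λ j → fromℕ n * (A j * A j) + S₂) (λ j → fromℕ 2 * S * A j))
       (cong₂ _-_ (trans (∑-+ (λ j → fromℕ n * (A j * A j)) (λ _ → S₂))
           (cong₂ _+_ (∑-*ˡ (fromℕ n) (λ j → A j * A j)) (∑-const n S₂))) (∑-*ˡ (fromℕ 2 * S) A)) ⟩
  fromℕ n * S₂ + fromℕ n * S₂ - fromℕ 2 * S * S
    ≡⟨ tidy (fromℕ n) S S₂ ⟩
  fromℕ 2 * (fromℕ n * S₂ - S * S) ∎
  where
  open ≡-Reasoning
  S = ∑ A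
  S₂ = ∑ (λ j → A j * A j)
  tidy = solve 3 (λ n s t → n :* t :+ n :* t :- con (fromℕ 2) :* s :* s := con (fromℕ 2) :* (n :* t :- s :* s)) refl
  expand = solve 2 (λ a b → (a :- b) :* (a :- b) := a :* a :+ b :* b :- con (fromℕ 2) :* a :* b) refl
  comm = solve 2 (λ a b → con (fromℕ 2) :* a :* b := con (fromℕ 2) :* b :* a) refl
  inner : ∀ j → ∑ (λ l → (A j - A l) * (A j - A l)) ≡ fromℕ n * (A j * A j) + S₂ - fromℕ 2 * S * A j
  inner j = trans (∑-cong (λ l → expand (A j) (A l))) (trans (∑-minus (λ l → A j * A j + A l * A l) (λ l → fromℕ 2 * A j * A l))
    (cong₂ _-_ (trans (∑-+ (λ _ → A j * A j) (λ l → A l * A l)) (cong (_+ S₂) (∑-const n (A j * A j))))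
      (trans (∑-*ˡ (fromℕ 2 * A j) A) (comm (A j) S))))

rowMinors : ∀ {n} → Matrix n → Fin n → Fin n → ℚ
rowMinors a i k = ∑∑ (λ j l → Δ a i k j l * Δ a i k j l)

rowMinors-eval : ∀ {n} (a : Matrix n) i k → rowMinors a i k ≡
  fromℕ 2 * (fromℕ n * ∑ (λ j → (a i j - a k j) * (a i j - a k j)) - (row a i - row a k) * (row a i - row a k))
rowMinors-eval {n} a i k = trans (∑∑-cong (λ j l → cong₂ _*_ (regroup (a i j) (a k j) (a i l) (a k l))
    (regroup (a i j) (a k j) (a i l) (a k l))))
  (trans (∑∑-sqdiff (λ j → a i j - a k j)) (cong (λ t → fromℕ 2 *
      (fromℕ n * ∑ (λ j → (a i j - a k j) * (a i j - a k j)) - t * t)) (∑-minus (a i) (a k))))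
  where
  regroup = solve 4 (λ a b c d → a :- b :- c :+ d := a :- b :- (c :- d)) refl

-- `∑∑-sqdiff` twice: over the columns for a fixed pair of rows, then over the rows.
minors-eval : ∀ {n} (a : Matrix n) → minors a ≡ fromℕ 4 *
  (fromℕ n * fromℕ n * energy a - fromℕ n * ∑ (λ i → row a i * row a i) - fromℕ n * ∑ (λ j → col a j * col a j) + total a * total
      a)
minors-eval {n} a = begin
  minors a
    ≡⟨ ∑∑-cong (rowMinors-eval a) ⟩
  ∑∑ (λ i k → fromℕ 2 * (fromℕ n * D i k - (row a i - row a k) * (row a i - row a k)))
    ≡⟨ trans (∑∑-*ˡ (fromℕ 2) (λ i k → fromℕ n * D i k - (row a i - row a k) * (row a i - row a k)))
        (cong (fromℕ 2 *_) (trans (∑∑-minus (λ i k → fromℕ n * D i k) (λ i k → (row a i - row a k) * (row a i - row a k)))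
        (cong₂ _-_ (trans (∑∑-*ˡ (fromℕ n) D) (cong (fromℕ n *_) ∑∑-D)) (∑∑-sqdiff (row a))))) ⟩
  fromℕ 2 * (fromℕ n * (fromℕ 2 * (fromℕ n * energy a - Q)) - fromℕ 2 * (fromℕ n * P - total a * total a))
    ≡⟨ tidy (fromℕ n) (energy a) P Q (total a) ⟩
  fromℕ 4 * (fromℕ n * fromℕ n * energy a - fromℕ n * P - fromℕ n * Q + total a * total a) ∎
  where
  open ≡-Reasoning
  P = ∑ (λ i → row a i * row a i)
  Q = ∑ (λ j → col a j * col a j)
  D : Fin n → Fin n → ℚ
  D i k = ∑ (λ j → (a i j - a k j) * (a i j - a k j))
  tidy = solve 5 (λ n e p q t → con (fromℕ 2) :* (n :* (con (fromℕ 2) :* (n :* e :- q)) :- con (fromℕ 2) :* (n :* p :- t :* t))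
      := con (fromℕ 4) :* (n :* n :* e :- n :* p :- n :* q :+ t :* t)) refl
  ∑∑-D : ∑∑ D ≡ fromℕ 2 * (fromℕ n * energy a - Q)
  ∑∑-D = begin
    ∑∑ D                                                               ≡⟨ ∑-cong
        (λ i → ∑-swap (λ k j → (a i j - a k j) * (a i j - a k j))) ⟩
    ∑∑ (λ i j → ∑ (λ k → (a i j - a k j) * (a i j - a k j)))           ≡⟨ ∑-swap
        (λ i j → ∑ (λ k → (a i j - a k j) * (a i j - a k j))) ⟩
    ∑ (λ j → ∑∑ (λ i k → (a i j - a k j) * (a i j - a k j)))           ≡⟨ ∑-cong (λ j → ∑∑-sqdiff (λ i → a i j)) ⟩
    ∑ (λ j → fromℕ 2 * (fromℕ n * ∑ (λ i → a i j * a i j) - col a j * col a j))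
      ≡⟨ trans (∑-*ˡ (fromℕ 2) (λ j → fromℕ n * ∑ (λ i → a i j * a i j) - col a j * col a j))
          (cong (fromℕ 2 *_) (trans (∑-minus (λ j → fromℕ n * ∑ (λ i → a i j * a i j)) (λ j → col a j * col a j))
         (cong (_- Q) (trans (∑-*ˡ (fromℕ n) (λ j → ∑ (λ i → a i j * a i j)))
             (cong (fromℕ n *_) (∑-swap (λ j i → a i j * a i j))))))) ⟩
    fromℕ 2 * (fromℕ n * energy a - Q) ∎

-- Second moments of linear functions

-- The four cases (equal cosets, same row, same column, non-disjoint) in one polynomial in deltas,
-- with denominators cleared, so that bilinear sums over matrix entries can be evaluated
-- mechanically.
N*[N-1]*𝔼XX : ∀ {n} (i j k l : Fin n) →
  fromℕ n * (fromℕ n - 1ℚ) * 𝔼 n (λ π → X i j π * X k l π) ≡ fromℕ n * (δ k i * δ l j) + (1ℚ - δ k i - δ l j)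
N*[N-1]*𝔼XX {n} i j k l = by (k Fin.≟ i) (l Fin.≟ j)
  where
  N = fromℕ n
  E = 𝔼 n (λ π → X i j π * X k l π)
  Goal : Bool → Bool → Set
  Goal b c = N * (N - 1ℚ) * E ≡ N * (b2q b * b2q c) + (1ℚ - b2q b - b2q c)
  vanish : ∀ a → E ≡ 0ℚ → N * (N - 1ℚ) * E ≡ a * 0ℚ
  vanish a e = trans (cong (N * (N - 1ℚ) *_) e) (trans (*-zeroʳ (N * (N - 1ℚ))) (sym (*-zeroʳ a)))
  by : (d : Dec (k ≡ i)) (e : Dec (l ≡ j)) → Goal (does d) (does e)
  by (yes refl) (yes refl) = trans (cong (N * (N - 1ℚ) *_) (𝔼-cong n (λ π _ → X-idem i j π)))
    (trans (shuffle N (𝔼 n (X i j))) (trans (cong (_* (N - 1ℚ)) (𝔼-X i j)) (tidy N)))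
    where
    shuffle = solve 2 (λ n e → n :* (n :- con 1ℚ) :* e := n :* e :* (n :- con 1ℚ)) refl
    tidy = solve 1 (λ n → con 1ℚ :* (n :- con 1ℚ) := n :* (con 1ℚ :* con 1ℚ) :+ (con 1ℚ :- con 1ℚ :- con 1ℚ)) refl
  by (yes refl) (no ≢) = trans (vanish N (trans (𝔼-cong n (λ π _ → X-same-row i π (≢ ∘ sym))) (𝔼-const n 0ℚ))) (tidy N)
    where
    tidy = solve 1 (λ n → n :* con 0ℚ := n :* (con 1ℚ :* con 0ℚ) :+ (con 1ℚ :- con 1ℚ :- con 0ℚ)) refl
  by (no ≢) (yes refl) = trans (vanish N (trans (𝔼-cong n (λ π p → X-same-col j π p (≢ ∘ sym))) (𝔼-const n 0ℚ))) (tidy N)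
    where
    tidy = solve 1 (λ n → n :* con 0ℚ := n :* (con 0ℚ :* con 1ℚ) :+ (con 1ℚ :- con 0ℚ :- con 1ℚ)) refl
  by (no ≢) (no ≢′) = trans (𝔼-XX (≢ ∘ sym) (≢′ ∘ sym)) (tidy N)
    where
    tidy = solve 1 (λ n → con 1ℚ := n :* (con 0ℚ :* con 0ℚ) :+ (con 1ℚ :- con 0ℚ :- con 0ℚ)) refl

𝔼-lin*F : ∀ {n} (a : Matrix n) (F : Perm n → ℚ) → 𝔼 n (λ π → F π * lin a π) ≡ ∑∑ (λ k l → a k l * 𝔼 n (λ π → F π * X k l π))
𝔼-lin*F {n} a F = begin
  𝔼 n (λ π → F π * lin a π)
    ≡⟨ 𝔼-cong n (λ π _ → trans (cong (F π *_) (lin-X a π)) (trans (sym (∑∑-*ˡ (F π) (λ k l → a k l * X k l π)))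
        (∑∑-cong (λ k l → shuffle (F π) (a k l) (X k l π))))) ⟩
  𝔼 n (λ π → ∑∑ (λ k l → a k l * (F π * X k l π)))
    ≡⟨ trans (𝔼-∑ n (λ k π → ∑ (λ l → a k l * (F π * X k l π)))) (∑-cong
        (λ k → trans (𝔼-∑ n (λ l π → a k l * (F π * X k l π))) (∑-cong (λ l → 𝔼-*ˡ n (a k l) (λ π → F π * X k l π))))) ⟩
  ∑∑ (λ k l → a k l * 𝔼 n (λ π → F π * X k l π)) ∎
  where
  open ≡-Reasoning
  shuffle = solve 3 (λ f a x → f :* (a :* x) := a :* (f :* x)) refl

𝔼-X*lin : ∀ {n} (a : Matrix n) i j → fromℕ n * (fromℕ n - 1ℚ) * 𝔼 n (λ π → X i j π * lin a π) ≡
  fromℕ n * a i j + (total a - row a i - col a j)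
𝔼-X*lin {n} a i j = begin
  c * 𝔼 n (λ π → X i j π * lin a π)
    ≡⟨ cong (c *_) (𝔼-lin*F a (X i j)) ⟩
  c * ∑∑ (λ k l → a k l * 𝔼 n (λ π → X i j π * X k l π))
    ≡⟨ trans (sym (∑∑-*ˡ c (λ k l → a k l * 𝔼 n (λ π → X i j π * X k l π))))
        (∑∑-cong (λ k l → trans (shuffle c (a k l) (𝔼 n (λ π → X i j π * X k l π)))
        (trans (cong (a k l *_) (N*[N-1]*𝔼XX i j k l)) (expand (fromℕ n) (a k l) (δ k i) (δ l j))))) ⟩
  ∑∑ (λ k l → fromℕ n * (δ k i * (δ l j * a k l)) + (a k l - δ k i * a k l - δ l j * a k l))
    ≡⟨ trans (∑∑-+ (λ k l → fromℕ n * (δ k i * (δ l j * a k l))) (λ k l → a k l - δ k i * a k l - δ l j * a k l))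
        (cong₂ _+_ (trans (∑∑-*ˡ (fromℕ n) (λ k l → δ k i * (δ l j * a k l))) (cong (fromℕ n *_) s₁))
        (trans (∑∑-minus (λ k l → a k l - δ k i * a k l) (λ k l → δ l j * a k l))
            (cong₂ _-_ (trans (∑∑-minus a (λ k l → δ k i * a k l)) (cong (λ t → total a - t) s₂)) (∑-cong (λ k → ∑-δ j (a k))))))
            ⟩
  fromℕ n * a i j + (total a - row a i - col a j) ∎
  where
  open ≡-Reasoning
  c = fromℕ n * (fromℕ n - 1ℚ)
  shuffle = solve 3 (λ c a e → c :* (a :* e) := a :* (c :* e)) refl
  expand = solve 4 (λ n a d e → a :* (n :* (d :* e) :+ (con 1ℚ :- d :- e)) := n :* (d :* (e :* a)) :+ (a :- d :* a :- e :* a))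
      refl
  s₁ : ∑∑ (λ k l → δ k i * (δ l j * a k l)) ≡ a i j
  s₁ = trans (∑-cong (λ k → trans (∑-*ˡ (δ k i) (λ l → δ l j * a k l)) (cong (δ k i *_) (∑-δ j (a k))))) (∑-δ i (λ k → a k j))
  s₂ : ∑∑ (λ k l → δ k i * a k l) ≡ row a i
  s₂ = trans (∑-cong (λ k → ∑-*ˡ (δ k i) (a k))) (∑-δ i (row a))

𝔼-lin : ∀ {n} (a : Matrix n) → fromℕ n * 𝔼 n (lin a) ≡ total a
𝔼-lin {n} a = trans (cong (fromℕ n *_) (trans (𝔼-cong n (λ π _ → sym (*-identityˡ (lin a π)))) (𝔼-lin*F a (λ _ → 1ℚ))))
  (trans (sym (∑∑-*ˡ (fromℕ n) (λ k l → a k l * 𝔼 n (λ π → 1ℚ * X k l π))))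
      (∑∑-cong (λ k l → trans (shuffle (fromℕ n) (a k l) (𝔼 n (λ π → 1ℚ * X k l π)))
    (trans (cong (a k l *_) (trans (cong (fromℕ n *_) (𝔼-cong n (λ π _ → *-identityˡ (X k l π)))) (𝔼-X k l)))
        (*-identityʳ (a k l))))))
  where
  shuffle = solve 3 (λ c a e → c :* (a :* e) := a :* (c :* e)) refl

𝔼-lin² : ∀ {n} (a : Matrix n) → fromℕ n * (fromℕ n - 1ℚ) * 𝔼 n (λ π → lin a π * lin a π) ≡
  fromℕ n * energy a + (total a * total a - ∑ (λ i → row a i * row a i) - ∑ (λ j → col a j * col a j))
𝔼-lin² {n} a = begin
  c * 𝔼 n (λ π → lin a π * lin a π)
    ≡⟨ cong (c *_) (𝔼-lin*F a (lin a)) ⟩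
  c * ∑∑ (λ k l → a k l * 𝔼 n (λ π → lin a π * X k l π))
    ≡⟨ trans (sym (∑∑-*ˡ c (λ k l → a k l * 𝔼 n (λ π → lin a π * X k l π))))
        (∑∑-cong (λ k l → trans (shuffle c (a k l) (𝔼 n (λ π → lin a π * X k l π)))
        (trans (cong (a k l *_) (trans (cong (c *_) (𝔼-cong n (λ π _ → *-comm (lin a π) (X k l π)))) (𝔼-X*lin a k l)))
        (expand (fromℕ n) (a k l) (total a) (row a k) (col a l))))) ⟩
  ∑∑ (λ k l → fromℕ n * (a k l * a k l) + (total a * a k l - row a k * a k l - col a l * a k l))
    ≡⟨ trans (∑∑-+ (λ k l → fromℕ n * (a k l * a k l)) (λ k l → total a * a k l - row a k * a k l - col a l * a k l))
        (cong₂ _+_ (∑∑-*ˡ (fromℕ n) (λ k l → a k l * a k l)) (trans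
        (∑∑-minus (λ k l → total a * a k l - row a k * a k l) (λ k l → col a l * a k l))
        (cong₂ _-_ (trans (∑∑-minus (λ k l → total a * a k l) (λ k l → row a k * a k l))
        (cong₂ _-_ (∑∑-*ˡ (total a) a) (∑-cong (λ k → ∑-*ˡ (row a k) (a k)))))
        (trans (∑-swap (λ k l → col a l * a k l)) (∑-cong (λ l → ∑-*ˡ (col a l) (λ k → a k l))))))) ⟩
  fromℕ n * energy a + (total a * total a - ∑ (λ i → row a i * row a i) - ∑ (λ j → col a j * col a j)) ∎
  where
  open ≡-Reasoning
  c = fromℕ n * (fromℕ n - 1ℚ)
  shuffle = solve 3 (λ c a e → c :* (a :* e) := a :* (c :* e)) refl
  expand = solve 5 (λ n a t r c → a :* (n :* a :+ (t :- r :- c)) := n :* (a :* a) :+ (t :* a :- r :* a :- c :* a)) refl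

𝔼-square : ∀ n (F : Perm n → ℚ) k → 𝔼 n (λ π → (F π - k) * (F π - k)) ≡ 𝔼 n (λ π → F π * F π) - fromℕ 2 * k * 𝔼 n F + k * k
𝔼-square n F k = trans (𝔼-cong n (λ π _ → expand (F π) k)) (trans (𝔼-+ n (λ π → F π * F π - fromℕ 2 * k * F π) (λ _ → k * k))
    (cong₂ _+_
  (trans (𝔼-minus n (λ π → F π * F π) (λ π → fromℕ 2 * k * F π))
      (cong (λ t → 𝔼 n (λ π → F π * F π) - t) (𝔼-*ˡ n (fromℕ 2 * k) F))) (𝔼-const n (k * k))))
  where
  expand = solve 2 (λ a b → (a :- b) :* (a :- b) := a :* a :- con (fromℕ 2) :* b :* a :+ b :* b) refl

-- The bridge between minors and functions: to show that `lin a` is close to a constant it suffices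
-- to bound the sum of its squared minors. Both the light and the heavy case end with it.
variance-minors : ∀ {n} (a : Matrix n) → let μ = 𝔼 n (lin a) in
  fromℕ 4 * (fromℕ n * fromℕ n) * (fromℕ n - 1ℚ) * 𝔼 n (λ π → (lin a π - μ) * (lin a π - μ)) ≡ minors a
variance-minors {n} a = begin
  fromℕ 4 * (N * N) * (N - 1ℚ) * 𝔼 n (λ π → (lin a π - μ) * (lin a π - μ))
    ≡⟨ cong (fromℕ 4 * (N * N) * (N - 1ℚ) *_) (𝔼-square n (lin a) μ) ⟩
  fromℕ 4 * (N * N) * (N - 1ℚ) * (E₂ - fromℕ 2 * μ * μ + μ * μ)
    ≡⟨ regroup N E₂ μ ⟩
  fromℕ 4 * (N * (N * (N - 1ℚ) * E₂) - (N - 1ℚ) * ((N * μ) * (N * μ)))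
    ≡⟨ cong₂ (λ s t → fromℕ 4 * (N * s - (N - 1ℚ) * (t * t))) (𝔼-lin² a) (𝔼-lin a) ⟩
  fromℕ 4 * (N * (N * energy a + (total a * total a - P - Q)) - (N - 1ℚ) * (total a * total a))
    ≡⟨ tidy N (energy a) (total a) P Q ⟩
  fromℕ 4 * (N * N * energy a - N * P - N * Q + total a * total a)
    ≡⟨ sym (minors-eval a) ⟩
  minors a ∎
  where
  open ≡-Reasoning
  N = fromℕ n
  μ = 𝔼 n (lin a)
  E₂ = 𝔼 n (λ π → lin a π * lin a π)
  P = ∑ (λ i → row a i * row a i)
  Q = ∑ (λ j → col a j * col a j)
  regroup = solve 3 (λ N e m → con (fromℕ 4) :* (N :* N) :* (N :- con 1ℚ) :* (e :- con (fromℕ 2) :* m :* m :+ m :* m) := con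
      (fromℕ 4) :* (N :* (N :* (N :- con 1ℚ) :* e) :- (N :- con 1ℚ) :* (N :* m :* (N :* m)))) refl
  tidy = solve 5 (λ N e t p q → con (fromℕ 4) :* (N :* (N :* e :+ (t :* t :- p :- q)) :- (N :- con 1ℚ) :* (t :* t)) := con
      (fromℕ 4) :* (N :* N :* e :- N :* p :- N :* q :+ t :* t)) refl

*-cancel : ∀ {p q r} → 1ℚ ≤ r → r * p ≡ r * q → p ≡ q
*-cancel h e = ≤-antisym (*-cancelˡ-≤ h (≤-reflexive e)) (*-cancelˡ-≤ h (≤-reflexive (sym e)))

N-1≡ : ∀ m → fromℕ (suc m) - 1ℚ ≡ fromℕ m
N-1≡ m = trans (cong (_- 1ℚ) (fromℕ-suc m)) (lemma (fromℕ m))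
  where
  lemma = solve 1 (λ a → con 1ℚ :+ a :- con 1ℚ := a) refl

1≤N-1 : ∀ m → 1ℚ ≤ fromℕ (suc (suc m)) - 1ℚ
1≤N-1 m = subst (1ℚ ≤_) (sym (N-1≡ (suc m))) (1≤fromℕ-suc m)

-- Orthogonal projection onto the linear functions

module Projection (n : ℕ) (I : ℚ) (NI : fromℕ n * I ≡ 1ℚ) (I≥0 : 0ℚ ≤ I) (1≤N-1 : 1ℚ ≤ fromℕ n - 1ℚ) (f : Perm n → Bool) where

  N p : ℚ
  N = fromℕ n

  F : Perm n → ℚ
  F π = b2q (f π)

  p = 𝔼 n F

  q : Fin n → Fin n → ℚ
  q i j = 𝔼 n (λ π → F π * X i j π)

  -- Forced by the normal equations: for a matrix with vanishing row and column sums,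
  -- (n-1)𝔼[x_ij · lin] is the entry at (i, j), while orthogonality of the residual to x_ij asks
  -- this expectation to be q_ij - p/n.
  ĉ : Matrix n
  ĉ i j = (N - 1ℚ) * (q i j - p * I)

  residual : Perm n → ℚ
  residual π = F π - p - lin ĉ π

  N-1≥0 : 0ℚ ≤ N - 1ℚ
  N-1≥0 = ≤-trans (lit 1ℚ) 1≤N-1

  1≤N : 1ℚ ≤ N
  1≤N = ≤-by N-1≥0 (lemma N)
    where
    lemma = solve 1 (λ a → a := con 1ℚ :+ (a :- con 1ℚ)) refl

  𝔼X : ∀ i j → 𝔼 n (X i j) ≡ I
  𝔼X i j = *-cancel 1≤N (trans (𝔼-X i j) (sym NI))

  F≥0 : ∀ π → 0ℚ ≤ F π
  F≥0 π = b2q≥0 (f π)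

  p≥0 : 0ℚ ≤ p
  p≥0 = 𝔼≥0 n (λ π _ → F≥0 π)

  private
    centred : ∀ (G : Fin n → ℚ) → ∑ G ≡ p → ∑ (λ j → (N - 1ℚ) * (G j - p * I)) ≡ 0ℚ
    centred G h = trans (∑-*ˡ (N - 1ℚ) (λ j → G j - p * I)) (trans (cong ((N - 1ℚ) *_)
      (trans (∑-minus G (λ _ → p * I)) (trans (cong₂ _-_ h (trans (∑-const n (p * I)) (trans (shuffle N p I) (cong (p *_) NI))))
          (zero-diff p)))) (*-zeroʳ (N - 1ℚ)))
      where
      shuffle = solve 3 (λ n p i → n :* (p :* i) := p :* (n :* i)) refl
      zero-diff = solve 1 (λ p → p :- p :* con 1ℚ := con 0ℚ) refl

    sum-out : ∀ (G : Fin n → Perm n → ℚ) → (∀ π → IsPerm π → ∑ (λ j → G j π) ≡ 1ℚ) → ∀ H → ∑ (λ j → 𝔼 n (λ π → H π * G j π)) ≡ 𝔼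
        n H
    sum-out G h H = trans (sym (𝔼-∑ n (λ j π → H π * G j π))) (𝔼-cong n (λ π e →
      trans (∑-*ˡ (H π) (λ j → G j π)) (trans (cong (H π *_) (h π e)) (*-identityʳ (H π)))))

  ĉ-row : ∀ i → row ĉ i ≡ 0ℚ
  ĉ-row i = centred (q i) (sum-out (X i) (λ π _ → row-sum i π) F)

  ĉ-col : ∀ j → col ĉ j ≡ 0ℚ
  ĉ-col j = centred (λ i → q i j) (sum-out (λ i → X i j) (λ π h → col-sum j π h) F)

  ĉ-total : total ĉ ≡ 0ℚ
  ĉ-total = trans (∑-cong ĉ-row) (∑-zero n)

  [N-1]𝔼X*lin : ∀ i j → (N - 1ℚ) * 𝔼 n (λ π → X i j π * lin ĉ π) ≡ ĉ i j
  [N-1]𝔼X*lin i j = *-cancel 1≤N (trans (sym (*-assoc N (N - 1ℚ) (𝔼 n (λ π → X i j π * lin ĉ π)))) (trans (𝔼-X*lin ĉ i j)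
    (trans (cong₂ (λ s t → N * ĉ i j + (total ĉ - s - t)) (ĉ-row i) (ĉ-col j))
        (trans (cong (λ t → N * ĉ i j + (t - 0ℚ - 0ℚ)) ĉ-total) (tidy (N * ĉ i j))))))
    where
    tidy = solve 1 (λ a → a :+ (con 0ℚ :- con 0ℚ :- con 0ℚ) := a) refl

  residual⊥X : ∀ i j → 𝔼 n (λ π → residual π * X i j π) ≡ 0ℚ
  residual⊥X i j = begin
    𝔼 n (λ π → residual π * X i j π)
      ≡⟨ 𝔼-cong n (λ π _ → expand (F π) p (lin ĉ π) (X i j π)) ⟩
    𝔼 n (λ π → F π * X i j π - p * X i j π - X i j π * lin ĉ π)
      ≡⟨ trans (𝔼-minus n (λ π → F π * X i j π - p * X i j π) (λ π → X i j π * lin ĉ π))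
          (cong (_- e) (trans (𝔼-minus n (λ π → F π * X i j π) (λ π → p * X i j π))
           (cong (λ t → q i j - t) (trans (𝔼-*ˡ n p (X i j)) (cong (p *_) (𝔼X i j)))))) ⟩
    q i j - p * I - e
      ≡⟨ cong (λ t → q i j - p * I - t) (*-cancel 1≤N-1 ([N-1]𝔼X*lin i j)) ⟩
    q i j - p * I - (q i j - p * I)
      ≡⟨ +-inverseʳ (q i j - p * I) ⟩
    0ℚ ∎
    where
    open ≡-Reasoning
    e = 𝔼 n (λ π → X i j π * lin ĉ π)
    expand = solve 4 (λ f p l x → (f :- p :- l) :* x := f :* x :- p :* x :- x :* l) refl

  residual⊥lin : ∀ a → 𝔼 n (λ π → residual π * lin a π) ≡ 0ℚ
  residual⊥lin a = trans (𝔼-lin*F a residual) (trans (∑∑-cong (λ k l → trans (cong (a k l *_) (residual⊥X k l))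
      (*-zeroʳ (a k l))))
    (trans (∑-cong {n} (λ _ → ∑-zero n)) (∑-zero n)))

  𝔼-residual : 𝔼 n residual ≡ 0ℚ
  𝔼-residual = trans (𝔼-minus n (λ π → F π - p) (lin ĉ)) (trans
      (cong₂ _-_ (trans (𝔼-minus n F (λ _ → p)) (trans (cong (λ t → p - t) (𝔼-const n p)) (+-inverseʳ p)))
    (*-cancel 1≤N (trans (𝔼-lin ĉ) (trans ĉ-total (sym (*-zeroʳ N)))))) refl)

  residual² : ℚ
  residual² = 𝔼 n (λ π → residual π * residual π)

  -- The difference f - `linear n c` is the residual plus p + lin ĉ - lin c, and the residual is
  -- orthogonal to constants and to linear functions.
  residual-minimal : ∀ c → residual² ≤ sqDist n F (linear n c)
  residual-minimal c = ≤-by (𝔼≥0 n {λ π → s π * s π} (λ π _ → sq≥0 (s π))) (begin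
    sqDist n F (linear n c)
      ≡⟨ 𝔼-cong n (λ π _ → trans (cong (λ t → (F π - t) * (F π - t)) (linear-eval c π)) (expand (F π) p (lin ĉ π) (lin c π))) ⟩
    𝔼 n (λ π → residual π * residual π + fromℕ 2 * (p * residual π + residual π * lin ĉ π - residual π * lin c π) + s π * s π)
      ≡⟨ trans (𝔼-+ n (λ π → residual π * residual π + fromℕ 2 * cross π) (λ π → s π * s π)) (cong (_+ 𝔼 n (λ π → s π * s π))
         (trans (𝔼-+ n (λ π → residual π * residual π) (λ π → fromℕ 2 * cross π))
             (cong (λ t → residual² + t) (trans (𝔼-*ˡ n (fromℕ 2) cross) (cong (fromℕ 2 *_) 𝔼-cross))))) ⟩
    residual² + 0ℚ + 𝔼 n (λ π → s π * s π)
      ≡⟨ cong (_+ 𝔼 n (λ π → s π * s π)) (+-identityʳ residual²) ⟩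
    residual² + 𝔼 n (λ π → s π * s π) ∎)
    where
    open ≡-Reasoning
    s cross : Perm n → ℚ
    s π = p + lin ĉ π - lin c π
    cross π = p * residual π + residual π * lin ĉ π - residual π * lin c π
    expand = solve 4 (λ f p l c → (f :- c) :* (f :- c) := (f :- p :- l) :* (f :- p :- l) :+ con (fromℕ 2) :*
        (p :* (f :- p :- l) :+ (f :- p :- l) :* l :- (f :- p :- l) :* c) :+ (p :+ l :- c) :* (p :+ l :- c)) refl
    𝔼-cross : 𝔼 n cross ≡ 0ℚ
    𝔼-cross = trans (𝔼-minus n (λ π → p * residual π + residual π * lin ĉ π) (λ π → residual π * lin c π))
        (cong₂ _-_ (trans (𝔼-+ n (λ π → p * residual π) (λ π → residual π * lin ĉ π))
      (cong₂ _+_ (trans (𝔼-*ˡ n p residual) (trans (cong (p *_) 𝔼-residual) (*-zeroʳ p))) (residual⊥lin ĉ))) (residual⊥lin c))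

  residual²≥0 : 0ℚ ≤ residual²
  residual²≥0 = 𝔼≥0 n (λ π _ → sq≥0 (residual π))

  energy≡ : energy ĉ ≡ (N - 1ℚ) * 𝔼 n (λ π → lin ĉ π * lin ĉ π)
  energy≡ = sym (begin
    (N - 1ℚ) * 𝔼 n (λ π → lin ĉ π * lin ĉ π)
      ≡⟨ cong ((N - 1ℚ) *_) (𝔼-lin*F ĉ (lin ĉ)) ⟩
    (N - 1ℚ) * ∑∑ (λ k l → ĉ k l * 𝔼 n (λ π → lin ĉ π * X k l π))
      ≡⟨ trans (sym (∑∑-*ˡ (N - 1ℚ) (λ k l → ĉ k l * 𝔼 n (λ π → lin ĉ π * X k l π))))
          (∑∑-cong (λ k l → trans (shuffle (N - 1ℚ) (ĉ k l) (𝔼 n (λ π → lin ĉ π * X k l π)))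
         (cong (ĉ k l *_) (trans (cong ((N - 1ℚ) *_) (𝔼-cong n (λ π _ → *-comm (lin ĉ π) (X k l π)))) ([N-1]𝔼X*lin k l))))) ⟩
    energy ĉ ∎)
    where
    open ≡-Reasoning
    shuffle = solve 3 (λ c a e → c :* (a :* e) := a :* (c :* e)) refl

  pythagoras : residual² + 𝔼 n (λ π → lin ĉ π * lin ĉ π) ≡ p - p * p
  pythagoras = sym (begin
    p - p * p
      ≡⟨ tidy₁ p ⟩
    p - fromℕ 2 * p * p + p * p
      ≡⟨ cong (λ t → t - fromℕ 2 * p * p + p * p) (𝔼-cong n (λ π _ → sym (b2q-idem (f π)))) ⟩
    𝔼 n (λ π → F π * F π) - fromℕ 2 * p * p + p * p
      ≡⟨ sym (𝔼-square n F p) ⟩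
    𝔼 n (λ π → (F π - p) * (F π - p))
      ≡⟨ 𝔼-cong n (λ π _ → expand (F π) p (lin ĉ π)) ⟩
    𝔼 n (λ π → residual π * residual π + fromℕ 2 * (residual π * lin ĉ π) + lin ĉ π * lin ĉ π)
      ≡⟨ trans (𝔼-+ n (λ π → residual π * residual π + fromℕ 2 * (residual π * lin ĉ π)) (λ π → lin ĉ π * lin ĉ π))
          (cong (_+ e) (trans (𝔼-+ n (λ π → residual π * residual π) (λ π → fromℕ 2 * (residual π * lin ĉ π)))
          (cong (λ t → residual² + t) (trans (𝔼-*ˡ n (fromℕ 2) (λ π → residual π * lin ĉ π))
              (cong (fromℕ 2 *_) (residual⊥lin ĉ)))))) ⟩
    residual² + 0ℚ + e
      ≡⟨ cong (_+ e) (+-identityʳ residual²) ⟩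
    residual² + e ∎)
    where
    open ≡-Reasoning
    e = 𝔼 n (λ π → lin ĉ π * lin ĉ π)
    tidy₁ = solve 1 (λ p → p :- p :* p := p :- con (fromℕ 2) :* p :* p :+ p :* p) refl
    expand = solve 3 (λ f p l → (f :- p) :* (f :- p) := (f :- p :- l) :* (f :- p :- l) :+ con (fromℕ 2) :* ((f :- p :- l) :* l)
        :+ l :* l) refl

  -- The energy is n-1 times the squared norm of lin ĉ, which is at most the variance p(1-p) ≤ 1/4
  -- of f.
  4energy≤N-1 : fromℕ 4 * energy ĉ ≤ N - 1ℚ
  4energy≤N-1 = subst (_≤ N - 1ℚ) (sym (cong (fromℕ 4 *_) energy≡))
      (bound (N - 1ℚ) p (𝔼 n (λ π → lin ĉ π * lin ĉ π)) residual² N-1≥0 residual²≥0 pythagoras)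
    where
    bound : ∀ k p e r → 0ℚ ≤ k → 0ℚ ≤ r → r + e ≡ p - p * p → fromℕ 4 * (k * e) ≤ k
    bound k p e r hk hr h = ≤-by (hk ⊗ (sq≥0 (1ℚ - fromℕ 2 * p) ⊕ lit (fromℕ 4) ⊗ hr))
      (trans (expand k p) (trans (cong (λ t → k * ((1ℚ - fromℕ 2 * p) * (1ℚ - fromℕ 2 * p)) + fromℕ 4 * (k * t)) (sym h))
          (tidy k p e r)))
      where
      expand = solve 2 (λ k p → k := k :* ((con 1ℚ :- con (fromℕ 2) :* p) :* (con 1ℚ :- con (fromℕ 2) :* p)) :+ con (fromℕ 4) :*
          (k :* (p :- p :* p))) refl
      tidy = solve 4 (λ k p e r → k :* ((con 1ℚ :- con (fromℕ 2) :* p) :* (con 1ℚ :- con (fromℕ 2) :* p)) :+ con (fromℕ 4) :*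
          (k :* (r :+ e)) := con (fromℕ 4) :* (k :* e) :+ k :* ((con 1ℚ :- con (fromℕ 2) :* p) :* (con 1ℚ :- con (fromℕ 2) :* p)
          :+ con (fromℕ 4) :* r)) refl

  ĉ≤1 : ∀ i j → ĉ i j ≤ 1ℚ
  ĉ≤1 i j = bound N I p (q i j) N-1≥0 I≥0 p≥0 NI
    (subst (q i j ≤_) (𝔼X i j) (𝔼-mono n {λ π → F π * X i j π} {X i j}
        (λ π _ → ≤-by (gap (b2q≤1 (f π)) ⊗ X≥0 i j π) (tidy (F π) (X i j π)))))
    where
    tidy = solve 2 (λ f x → x := f :* x :+ (con 1ℚ :- f) :* x) refl
    bound : ∀ N I p q → 0ℚ ≤ N - 1ℚ → 0ℚ ≤ I → 0ℚ ≤ p → N * I ≡ 1ℚ → q ≤ I → (N - 1ℚ) * (q - p * I) ≤ 1ℚ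
    bound N I p q h hI hp e hq = ≤-trans raw (≤-reflexive e)
      where
      raw : (N - 1ℚ) * (q - p * I) ≤ N * I
      raw = ≤-by (h ⊗ gap hq ⊕ h ⊗ (hp ⊗ hI) ⊕ hI) (solve 4 (λ N I p q → N :* I := (N :- con 1ℚ) :* (q :- p :* I) :+
          ((N :- con 1ℚ) :* (I :- q) :+ (N :- con 1ℚ) :* (p :* I) :+ I)) refl N I p q)

  -- Together with p ≤ 1/2 this keeps the entries of ĉ away from -1, so that among -1, 0, 1 only 0
  -- and 1 can be close to them.
  -p≤ĉ : ∀ i j → - p ≤ ĉ i j
  -p≤ĉ i j = bound N I p (q i j) N-1≥0 I≥0 p≥0 NI (𝔼≥0 n {λ π → F π * X i j π} (λ π _ → F≥0 π ⊗ X≥0 i j π))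
    where
    bound : ∀ N I p q → 0ℚ ≤ N - 1ℚ → 0ℚ ≤ I → 0ℚ ≤ p → N * I ≡ 1ℚ → 0ℚ ≤ q → - p ≤ (N - 1ℚ) * (q - p * I)
    bound N I p q h hI hp e hq = ≤-trans (≤-reflexive (trans (cong -_ (sym (*-identityʳ p))) (cong (λ t → - (p * t)) (sym e))))
        raw
      where
      raw : - (p * (N * I)) ≤ (N - 1ℚ) * (q - p * I)
      raw = ≤-by (h ⊗ hq ⊕ hp ⊗ hI) (solve 4 (λ N I p q → (N :- con 1ℚ) :* (q :- p :* I) := (:- (p :* (N :* I))) :+
          ((N :- con 1ℚ) :* q :+ p :* I)) refl N I p q)

-- The cube

Cube : ℕ → Set
Cube = Vec Bool

avg : ∀ m → (Cube m → ℚ) → ℚ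
avg zero    F = F Vec.[]
avg (suc m) F = ½ * (avg m (λ y → F (false Vec.∷ y)) + avg m (λ y → F (true Vec.∷ y)))

avg-cong : ∀ m {F G : Cube m → ℚ} → (∀ y → F y ≡ G y) → avg m F ≡ avg m G
avg-cong zero    h = h Vec.[]
avg-cong (suc m) h = cong₂ (λ s t → ½ * (s + t)) (avg-cong m (λ y → h (false Vec.∷ y))) (avg-cong m (λ y → h (true Vec.∷ y)))

avg-mono : ∀ m {F G : Cube m → ℚ} → (∀ y → F y ≤ G y) → avg m F ≤ avg m G
avg-mono zero    h = h Vec.[]
avg-mono (suc m) {F} {G} h = *-monoˡ {avg m (λ y → F (false Vec.∷ y)) + avg m (λ y → F (true Vec.∷ y))} ½ (lit ½)
  (+-mono-≤ (avg-mono m (λ y → h (false Vec.∷ y))) (avg-mono m (λ y → h (true Vec.∷ y))))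

avg-+ : ∀ m (F G : Cube m → ℚ) → avg m (λ y → F y + G y) ≡ avg m F + avg m G
avg-+ zero    F G = refl
avg-+ (suc m) F G = trans (cong₂ (λ s t → ½ * (s + t)) (avg-+ m (λ y → F (false Vec.∷ y)) (λ y → G (false Vec.∷ y)))
    (avg-+ m (λ y → F (true Vec.∷ y)) (λ y → G (true Vec.∷ y))))
  (shuffle (avg m (λ y → F (false Vec.∷ y))) (avg m (λ y → G (false Vec.∷ y))) (avg m (λ y → F (true Vec.∷ y)))
      (avg m (λ y → G (true Vec.∷ y))))
  where
  shuffle = solve 4 (λ a b c d → con ½ :* (a :+ b :+ (c :+ d)) := con ½ :* (a :+ c) :+ con ½ :* (b :+ d)) refl

avg-*ˡ : ∀ m k (F : Cube m → ℚ) → avg m (λ y → k * F y) ≡ k * avg m F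
avg-*ˡ zero    k F = refl
avg-*ˡ (suc m) k F = trans (cong₂ (λ s t → ½ * (s + t)) (avg-*ˡ m k (λ y → F (false Vec.∷ y)))
    (avg-*ˡ m k (λ y → F (true Vec.∷ y))))
  (shuffle k (avg m (λ y → F (false Vec.∷ y))) (avg m (λ y → F (true Vec.∷ y))))
  where
  shuffle = solve 3 (λ k a b → con ½ :* (k :* a :+ k :* b) := k :* (con ½ :* (a :+ b))) refl

avg-const : ∀ m c → avg m (λ _ → c) ≡ c
avg-const zero    c = refl
avg-const (suc m) c = trans (cong (λ t → ½ * (t + t)) (avg-const m c)) (halves c)
  where
  halves = solve 1 (λ c → con ½ :* (c :+ c) := c) refl

avg≥0 : ∀ m {F : Cube m → ℚ} → (∀ y → 0ℚ ≤ F y) → 0ℚ ≤ avg m F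
avg≥0 m {F} h = subst (_≤ avg m F) (avg-const m 0ℚ) (avg-mono m h)

χ : Bool → ℚ
χ false = 1ℚ
χ true  = - 1ℚ

χ-not : ∀ b → χ (not b) ≡ - χ b
χ-not false = refl
χ-not true  = refl

sumᵥ : ∀ {m} → (ℚ → ℚ) → Vec ℚ m → ℚ
sumᵥ g Vec.[]       = 0ℚ
sumᵥ g (d Vec.∷ ds) = g d + sumᵥ g ds

sumᵥ-mono : ∀ {m} {g h : ℚ → ℚ} → (∀ d → g d ≤ h d) → (ds : Vec ℚ m) → sumᵥ g ds ≤ sumᵥ h ds
sumᵥ-mono H Vec.[]       = ≤-refl
sumᵥ-mono H (d Vec.∷ ds) = +-mono-≤ (H d) (sumᵥ-mono H ds)

sumSq : ∀ {m} → Vec ℚ m → ℚ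
sumSq = sumᵥ (λ d → d * d)

sumSq≥0 : ∀ {m} (ds : Vec ℚ m) → 0ℚ ≤ sumSq ds
sumSq≥0 Vec.[]       = ≤-refl
sumSq≥0 (d Vec.∷ ds) = sq≥0 d ⊕ sumSq≥0 ds

Z : ∀ {m} → Vec ℚ m → Cube m → ℚ
Z Vec.[]       Vec.[]      = 0ℚ
Z (d Vec.∷ ds) (b Vec.∷ y) = χ b * d + Z ds y

-- The offset b is arbitrary so that the induction can absorb the head coordinate into it; likewise
-- for the fourth moment.
avg-[b+Z]² : ∀ {m} (ds : Vec ℚ m) b → avg m (λ y → (b + Z ds y) * (b + Z ds y)) ≡ b * b + sumSq ds
avg-[b+Z]² Vec.[] b = base b
  where
  base = solve 1 (λ b → (b :+ con 0ℚ) :* (b :+ con 0ℚ) := b :* b :+ con 0ℚ) refl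
avg-[b+Z]² {suc m} (d Vec.∷ ds) b = trans (cong₂ (λ s t → ½ * (s + t)) (half false) (half true)) (tidy b d (sumSq ds))
  where
  assoc = solve 3 (λ b c z → (b :+ (c :+ z)) :* (b :+ (c :+ z)) := (b :+ c :+ z) :* (b :+ c :+ z)) refl
  half : ∀ s → avg m (λ y → (b + (χ s * d + Z ds y)) * (b + (χ s * d + Z ds y))) ≡ (b + χ s * d) * (b + χ s * d) + sumSq ds
  half s = trans (avg-cong m (λ y → assoc b (χ s * d) (Z ds y))) (avg-[b+Z]² ds (b + χ s * d))
  tidy = solve 3 (λ b d s → con ½ :* ((b :+ con 1ℚ :* d) :* (b :+ con 1ℚ :* d) :+ s :+
      ((b :+ (:- (con 1ℚ)) :* d) :* (b :+ (:- (con 1ℚ)) :* d) :+ s)) := b :* b :+ (d :* d :+ s)) refl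

_⁴ : ℚ → ℚ
a ⁴ = a * a * (a * a)

-- The Gaussian fourth moment as an upper bound; each coordinate of size d leaves a slack of 2d⁴.
avg-[b+Z]⁴ : ∀ {m} (ds : Vec ℚ m) b →
  avg m (λ y → (b + Z ds y) ⁴) ≤ b ⁴ + fromℕ 6 * (b * b) * sumSq ds + fromℕ 3 * (sumSq ds * sumSq ds)
avg-[b+Z]⁴ Vec.[] b = ≤-reflexive (base b)
  where
  base = solve 1 (λ b → (b :+ con 0ℚ) :* (b :+ con 0ℚ) :* ((b :+ con 0ℚ) :* (b :+ con 0ℚ)) := b :* b :* (b :* b) :+ con (fromℕ 6)
      :* (b :* b) :* con 0ℚ :+ con (fromℕ 3) :* (con 0ℚ :* con 0ℚ)) refl
avg-[b+Z]⁴ {suc m} (d Vec.∷ ds) b = ≤-trans (*-monoˡ ½ (lit ½) (+-mono-≤ (half false) (half true))) (tidy b d (sumSq ds))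
  where
  assoc = solve 3 (λ b c z → (b :+ (c :+ z)) :* (b :+ (c :+ z)) :* ((b :+ (c :+ z)) :* (b :+ (c :+ z))) := (b :+ c :+ z) :*
      (b :+ c :+ z) :* ((b :+ c :+ z) :* (b :+ c :+ z))) refl
  bound : ℚ → ℚ → ℚ
  bound b s = b ⁴ + fromℕ 6 * (b * b) * s + fromℕ 3 * (s * s)
  half : ∀ s → avg m (λ y → (b + (χ s * d + Z ds y)) ⁴) ≤ bound (b + χ s * d) (sumSq ds)
  half s = ≤-trans (≤-reflexive (avg-cong m (λ y → assoc b (χ s * d) (Z ds y)))) (avg-[b+Z]⁴ ds (b + χ s * d))
  expand = solve 3 (λ b d s → b :* b :* (b :* b) :+ con (fromℕ 6) :* (b :* b) :* (d :* d :+ s) :+ con (fromℕ 3) :*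
      ((d :* d :+ s) :* (d :* d :+ s)) := con ½ :* ((b :+ con 1ℚ :* d) :* (b :+ con 1ℚ :* d) :*
      ((b :+ con 1ℚ :* d) :* (b :+ con 1ℚ :* d)) :+ con (fromℕ 6) :* ((b :+ con 1ℚ :* d) :* (b :+ con 1ℚ :* d)) :* s :+ con
      (fromℕ 3) :* (s :* s) :+ ((b :+ (:- (con 1ℚ)) :* d) :* (b :+ (:- (con 1ℚ)) :* d) :*
      ((b :+ (:- (con 1ℚ)) :* d) :* (b :+ (:- (con 1ℚ)) :* d)) :+ con (fromℕ 6) :*
      ((b :+ (:- (con 1ℚ)) :* d) :* (b :+ (:- (con 1ℚ)) :* d)) :* s :+ con (fromℕ 3) :* (s :* s))) :+ con (fromℕ 2) :*
      (d :* d :* (d :* d))) refl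
  tidy : ∀ b d s → ½ * (bound (b + 1ℚ * d) s + bound (b + (- 1ℚ) * d) s) ≤ bound b (d * d + s)
  tidy b d s = ≤-by (lit (fromℕ 2) ⊗ sq≥0 (d * d)) (expand b d s)

flip : ∀ {m} → Cube m → Cube m → Cube m
flip Vec.[]      Vec.[]      = Vec.[]
flip (s Vec.∷ M) (b Vec.∷ y) = (s xor b) Vec.∷ flip M y

restrict : ∀ {m} → Cube m → Vec ℚ m → Vec ℚ m
restrict Vec.[]      Vec.[]       = Vec.[]
restrict (s Vec.∷ M) (d Vec.∷ ds) = (b2q s * d) Vec.∷ restrict M ds

avg-flip : ∀ {m} (M : Cube m) (F : Cube m → ℚ) → avg m (λ y → F (flip M y)) ≡ avg m F
avg-flip Vec.[]          F = refl
avg-flip (false Vec.∷ M) F = cong₂ (λ s t → ½ * (s + t)) (avg-flip M (λ y → F (false Vec.∷ y)))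
    (avg-flip M (λ y → F (true Vec.∷ y)))
avg-flip {suc m} (true Vec.∷ M)  F = trans (cong₂ (λ s t → ½ * (s + t)) (avg-flip M (λ y → F (true Vec.∷ y)))
    (avg-flip M (λ y → F (false Vec.∷ y))))
  (cong (½ *_) (+-comm (avg m (λ y → F (true Vec.∷ y))) (avg m (λ y → F (false Vec.∷ y)))))

-- Flipping the coordinates in `M` cancels everything outside `M` and doubles what is inside. This
-- isolates any chosen group of coefficients.
Z-flip : ∀ {m} (M : Cube m) (ds : Vec ℚ m) y → ½ * Z ds y - ½ * Z ds (flip M y) ≡ Z (restrict M ds) y
Z-flip Vec.[] Vec.[] Vec.[] = refl
Z-flip (s Vec.∷ M) (d Vec.∷ ds) (b Vec.∷ y) = trans (regroup (χ b) (χ (s xor b)) d (Z ds y) (Z ds (flip M y)))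
    (cong₂ _+_ (head s b) (Z-flip M ds y))
  where
  regroup = solve 5 (λ c c′ d z z′ → con ½ :* (c :* d :+ z) :- con ½ :* (c′ :* d :+ z′) := con ½ :* (c :- c′) :* d :+
      (con ½ :* z :- con ½ :* z′)) refl
  same = solve 2 (λ c d → con ½ :* (c :- c) :* d := c :* (con 0ℚ :* d)) refl
  opposite = solve 2 (λ c d → con ½ :* (c :- (:- c)) :* d := c :* (con 1ℚ :* d)) refl
  head : ∀ s b → ½ * (χ b - χ (s xor b)) * d ≡ χ b * (b2q s * d)
  head false b = same (χ b) d
  head true  b = trans (cong (λ t → ½ * (χ b - t) * d) (χ-not b)) (opposite (χ b) d)

-- The Friedgut-Kalai-Naor argument

dist² : ℚ → ℚ
dist² d = (d * d) ⊓ (((d - 1ℚ) * (d - 1ℚ)) ⊓ ((d + 1ℚ) * (d + 1ℚ)))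

dist²≤sq : ∀ d → dist² d ≤ d * d
dist²≤sq d = p⊓q≤p (d * d) (((d - 1ℚ) * (d - 1ℚ)) ⊓ ((d + 1ℚ) * (d + 1ℚ)))

dist²≤χ : ∀ s d → dist² d ≤ (d - χ s) * (d - χ s)
dist²≤χ false d = ≤-trans (p⊓q≤q (d * d) (((d - 1ℚ) * (d - 1ℚ)) ⊓ ((d + 1ℚ) * (d + 1ℚ))))
    (p⊓q≤p ((d - 1ℚ) * (d - 1ℚ)) ((d + 1ℚ) * (d + 1ℚ)))
dist²≤χ true  d = ≤-trans (p⊓q≤q (d * d) (((d - 1ℚ) * (d - 1ℚ)) ⊓ ((d + 1ℚ) * (d + 1ℚ))))
    (p⊓q≤q ((d - 1ℚ) * (d - 1ℚ)) ((d + 1ℚ) * (d + 1ℚ)))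

dist²-glb : ∀ d {k} → k ≤ d * d → k ≤ (d - 1ℚ) * (d - 1ℚ) → k ≤ (d + 1ℚ) * (d + 1ℚ) → k ≤ dist² d
dist²-glb d h₀ h₁ h₂ = ⊓-glb h₀ (⊓-glb h₁ h₂)

dist²≥0 : ∀ d → 0ℚ ≤ dist² d
dist²≥0 d = dist²-glb d (sq≥0 d) (sq≥0 (d - 1ℚ)) (sq≥0 (d + 1ℚ))

module FKN {m : ℕ} (f : Cube m → Bool) (b : ℚ) (ds : Vec ℚ m) where

  ℓ r : Cube m → ℚ
  ℓ y = b + ½ * Z ds y
  r y = b2q (f y) - ℓ y

  err : ℚ
  err = avg m (λ y → r y * r y)

  err≥0 : 0ℚ ≤ err
  err≥0 = avg≥0 m (λ y → sq≥0 (r y))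

  avg-[r-r′]² : ∀ M → avg m (λ y → (r y - r (flip M y)) * (r y - r (flip M y))) ≤ fromℕ 4 * err
  avg-[r-r′]² M = ≤-trans (avg-mono m (λ y → pointwise (r y) (r (flip M y)))) (≤-reflexive (trans
    (trans (avg-*ˡ m (fromℕ 2) (λ y → r y * r y + r (flip M y) * r (flip M y)))
      (cong (fromℕ 2 *_) (trans (avg-+ m (λ y → r y * r y) (λ y → r (flip M y) * r (flip M y)))
          (cong (λ t → err + t) (avg-flip M (λ y → r y * r y))))))
    (double err)))
    where
    pointwise : ∀ a c → (a - c) * (a - c) ≤ fromℕ 2 * (a * a + c * c)
    pointwise a c = ≤-by (sq≥0 (a + c)) (solve 2 (λ a c → con (fromℕ 2) :* (a :* a :+ c :* c) := (a :- c) :* (a :- c) :+ (a :+ c)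
        :* (a :+ c)) refl a c)
    double = solve 1 (λ e → con (fromℕ 2) :* (e :+ e) := con (fromℕ 4) :* e) refl

  r-r′ : ∀ M y → r y - r (flip M y) ≡ b2q (f y) - b2q (f (flip M y)) - Z (restrict M ds) y
  r-r′ M y = trans (regroup (b2q (f y)) (b2q (f (flip M y))) b (½ * Z ds y) (½ * Z ds (flip M y)))
      (cong (λ t → b2q (f y) - b2q (f (flip M y)) - t) (Z-flip M ds y))
    where
    regroup = solve 5 (λ f f′ b z z′ → f :- (b :+ z) :- (f′ :- (b :+ z′)) := f :- f′ :- (z :- z′)) refl

  -- A difference of two values of f is -1, 0 or 1, and every such g satisfies (g - z)² ≥ z² - 4z⁴.
  -- Averaging with z the restricted form, of second moment V and fourth moment at most 3V², gives V
  -- - 12V² on the left. So V cannot lie strictly between O(err) and 1/24.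
  masked : ∀ M → sumSq (restrict M ds) - fromℕ 12 * (sumSq (restrict M ds) * sumSq (restrict M ds)) ≤ fromℕ 4 * err
  masked M = ≤-trans (lower (sumSq e) (avg m (λ y → (0ℚ + Z e y) * (0ℚ + Z e y))) (avg m (λ y → (0ℚ + Z e y) ⁴))
      (avg-[b+Z]² e 0ℚ) (avg-[b+Z]⁴ e 0ℚ))
    (≤-trans (≤-reflexive (sym (trans (avg-+ m (λ y → (0ℚ + Z e y) * (0ℚ + Z e y)) (λ y → (- fromℕ 4) * (0ℚ + Z e y) ⁴))
        (cong (λ t → avg m (λ y → (0ℚ + Z e y) * (0ℚ + Z e y)) + t) (avg-*ˡ m (- fromℕ 4) (λ y → (0ℚ + Z e y) ⁴))))))
    (≤-trans (avg-mono m (λ y → ≤-trans (pointwise (f y) (f (flip M y)) (Z e y))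
        (≤-reflexive (cong (λ t → t * t) (sym (r-r′ M y)))))) (avg-[r-r′]² M)))
    where
    e = restrict M ds
    lower : ∀ V s t → s ≡ 0ℚ * 0ℚ + V → t ≤ 0ℚ ⁴ + fromℕ 6 * (0ℚ * 0ℚ) * V + fromℕ 3 * (V * V) → V - fromℕ 12 * (V * V) ≤ s +
        (- fromℕ 4) * t
    lower V s t refl h = ≤-by (lit (fromℕ 4) ⊗ gap h) (expand V t)
      where
      expand = solve 2 (λ V t → con 0ℚ :* con 0ℚ :+ V :+ (:- (con (fromℕ 4))) :* t := V :- con (fromℕ 12) :* (V :* V) :+ con
          (fromℕ 4) :* (con 0ℚ :* con 0ℚ :* (con 0ℚ :* con 0ℚ) :+ con (fromℕ 6) :* (con 0ℚ :* con 0ℚ) :* V :+ con (fromℕ 3) :*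
          (V :* V) :- t)) refl
    -- The difference of the two sides is 4z⁴ - 2z + 1 = (2z² - ½)² + 2(z - ½)² + ¼.
    quartic : ∀ z → (0ℚ + z) * (0ℚ + z) + (- fromℕ 4) * ((0ℚ + z) * (0ℚ + z) * ((0ℚ + z) * (0ℚ + z))) ≤ (1ℚ - z) * (1ℚ - z)
    quartic z = ≤-by (sq≥0 (fromℕ 2 * (z * z) - ½) ⊕ lit (fromℕ 2) ⊗ sq≥0 (z - ½) ⊕ lit (+ 1 / 4))
        (solve 1 (λ z → (con 1ℚ :- z) :* (con 1ℚ :- z) := (con 0ℚ :+ z) :* (con 0ℚ :+ z) :+ (:- (con (fromℕ 4))) :*
        ((con 0ℚ :+ z) :* (con 0ℚ :+ z) :* ((con 0ℚ :+ z) :* (con 0ℚ :+ z))) :+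
        ((con (fromℕ 2) :* (z :* z) :- con ½) :* (con (fromℕ 2) :* (z :* z) :- con ½) :+ con (fromℕ 2) :*
        ((z :- con ½) :* (z :- con ½)) :+ con (+ 1 / 4))) refl z)
    quartic₀ : ∀ z → (0ℚ + z) * (0ℚ + z) + (- fromℕ 4) * ((0ℚ + z) * (0ℚ + z) * ((0ℚ + z) * (0ℚ + z))) ≤ (0ℚ - z) * (0ℚ - z)
    quartic₀ z = ≤-by (lit (fromℕ 4) ⊗ sq≥0 (z * z)) (solve 1 (λ z → (con 0ℚ :- z) :* (con 0ℚ :- z) := (con 0ℚ :+ z) :*
        (con 0ℚ :+ z) :+ (:- (con (fromℕ 4))) :* ((con 0ℚ :+ z) :* (con 0ℚ :+ z) :* ((con 0ℚ :+ z) :* (con 0ℚ :+ z))) :+ con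
        (fromℕ 4) :* (z :* z :* (z :* z))) refl z)
    negate = solve 1 (λ z → (con 0ℚ :+ (:- z)) :* (con 0ℚ :+ (:- z)) :+ (:- (con (fromℕ 4))) :*
        ((con 0ℚ :+ (:- z)) :* (con 0ℚ :+ (:- z)) :* ((con 0ℚ :+ (:- z)) :* (con 0ℚ :+ (:- z)))) := (con 0ℚ :+ z) :*
        (con 0ℚ :+ z) :+ (:- (con (fromℕ 4))) :* ((con 0ℚ :+ z) :* (con 0ℚ :+ z) :* ((con 0ℚ :+ z) :* (con 0ℚ :+ z)))) refl
    negate′ = solve 1 (λ z → (con 1ℚ :- (:- z)) :* (con 1ℚ :- (:- z)) := (con 0ℚ :- con 1ℚ :- z) :* (con 0ℚ :- con 1ℚ :- z)) refl
    pointwise : ∀ g g′ z → (0ℚ + z) * (0ℚ + z) + (- fromℕ 4) * (0ℚ + z) ⁴ ≤ (b2q g - b2q g′ - z) * (b2q g - b2q g′ - z)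
    pointwise true  true  z = quartic₀ z
    pointwise false false z = quartic₀ z
    pointwise true  false z = quartic z
    pointwise false true  z = ≤-trans (≤-reflexive (sym (negate z))) (≤-trans (quartic (- z)) (≤-reflexive (negate′ z)))

  -- The a priori bound: 2ℓ - 1 differs from the sign 2f - 1 by 2r, so its mean square is at most 2
  -- + 8 err, and it exceeds `sumSq ds` by a square.
  sumSq≤ : sumSq ds ≤ fromℕ 2 + fromℕ 8 * err
  sumSq≤ = bound (sumSq ds) err (avg m (λ y → (fromℕ 2 * b - 1ℚ + Z ds y) * (fromℕ 2 * b - 1ℚ + Z ds y))) (fromℕ 2 * b - 1ℚ)
      (avg-[b+Z]² ds (fromℕ 2 * b - 1ℚ))
    (≤-trans (avg-mono m (λ y → pointwise (f y) b (Z ds y))) (≤-reflexive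
        (trans (avg-+ m (λ y → fromℕ 8 * (r y * r y)) (λ _ → fromℕ 2))
        (cong₂ _+_ (avg-*ˡ m (fromℕ 8) (λ y → r y * r y)) (avg-const m (fromℕ 2))))))
    where
    pointwise : ∀ g b z → (fromℕ 2 * b - 1ℚ + z) * (fromℕ 2 * b - 1ℚ + z) ≤ fromℕ 8 *
        ((b2q g - (b + ½ * z)) * (b2q g - (b + ½ * z))) + fromℕ 2
    pointwise true  b z = ≤-by (sq≥0 (fromℕ 2 * b + z - fromℕ 3))
        (solve 2 (λ b z → con (fromℕ 8) :* ((con 1ℚ :- (b :+ con ½ :* z)) :* (con 1ℚ :- (b :+ con ½ :* z))) :+ con (fromℕ 2) :=
        (con (fromℕ 2) :* b :- con 1ℚ :+ z) :* (con (fromℕ 2) :* b :- con 1ℚ :+ z) :+ (con (fromℕ 2) :* b :+ z :- con (fromℕ 3))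
        :* (con (fromℕ 2) :* b :+ z :- con (fromℕ 3))) refl b z)
    pointwise false b z = ≤-by (sq≥0 (fromℕ 2 * b + z + 1ℚ)) (solve 2
        (λ b z → con (fromℕ 8) :* ((con 0ℚ :- (b :+ con ½ :* z)) :* (con 0ℚ :- (b :+ con ½ :* z))) :+ con (fromℕ 2) :=
        (con (fromℕ 2) :* b :- con 1ℚ :+ z) :* (con (fromℕ 2) :* b :- con 1ℚ :+ z) :+ (con (fromℕ 2) :* b :+ z :+ con 1ℚ) :*
        (con (fromℕ 2) :* b :+ z :+ con 1ℚ)) refl b z)
    bound : ∀ s e a k → a ≡ k * k + s → a ≤ fromℕ 8 * e + fromℕ 2 → s ≤ fromℕ 2 + fromℕ 8 * e
    bound s e a k refl h = ≤-by (gap h ⊕ sq≥0 k) (solve 3 (λ s e k → con (fromℕ 2) :+ con (fromℕ 8) :* e := s :+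
        (con (fromℕ 8) :* e :+ con (fromℕ 2) :- (k :* k :+ s) :+ k :* k)) refl s e k)

unit : ∀ {m} → Fin m → Cube m
unit {suc m} zero    = true Vec.∷ Vec.replicate m false
unit {suc m} (suc t) = false Vec.∷ unit t

private
  Z-restrict-false : ∀ {m} (ds : Vec ℚ m) y → Z (restrict (Vec.replicate m false) ds) y ≡ 0ℚ
  Z-restrict-false Vec.[]       Vec.[]      = refl
  Z-restrict-false (d Vec.∷ ds) (c Vec.∷ y) = trans (cong (λ t → χ c * (0ℚ * d) + t) (Z-restrict-false ds y)) (vanish (χ c) d)
    where
    vanish = solve 2 (λ c d → c :* (con 0ℚ :* d) :+ con 0ℚ := con 0ℚ) refl

Z-restrict-unit : ∀ {m} (ds : Vec ℚ m) t y → Z (restrict (unit t) ds) y ≡ χ (lookup y t) * lookup ds t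
Z-restrict-unit (d Vec.∷ ds) zero    (c Vec.∷ y) = trans (cong (λ t → χ c * (1ℚ * d) + t) (Z-restrict-false ds y)) (tidy (χ c) d)
  where
  tidy = solve 2 (λ c d → c :* (con 1ℚ :* d) :+ con 0ℚ := c :* d) refl
Z-restrict-unit (d Vec.∷ ds) (suc t) (c Vec.∷ y) = trans (cong (λ s → χ c * (0ℚ * d) + s) (Z-restrict-unit ds t y))
    (tidy (χ c) d (χ (lookup y t) * lookup ds t))
  where
  tidy = solve 3 (λ c d e → c :* (con 0ℚ :* d) :+ e := e) refl

shift : ∀ {m} → Fin m → ℚ → Vec ℚ m → Vec ℚ m
shift zero    k (d Vec.∷ ds) = (d - k) Vec.∷ ds
shift (suc t) k (d Vec.∷ ds) = d Vec.∷ shift t k ds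

Z-shift : ∀ {m} (ds : Vec ℚ m) t k y → Z (shift t k ds) y ≡ Z ds y - χ (lookup y t) * k
Z-shift (d Vec.∷ ds) zero    k (c Vec.∷ y) = tidy (χ c) d k (Z ds y)
  where
  tidy = solve 4 (λ c d k z → c :* (d :- k) :+ z := c :* d :+ z :- c :* k) refl
Z-shift (d Vec.∷ ds) (suc t) k (c Vec.∷ y) = trans (cong (λ s → χ c * d + s) (Z-shift ds t k y))
    (sym (+-assoc (χ c * d) (Z ds y) (- (χ (lookup y t) * k))))

sumSq-shift : ∀ {m} (ds : Vec ℚ m) t k → sumSq (shift t k ds) ≡ sumSq ds - lookup ds t * lookup ds t + (lookup ds t - k) *
    (lookup ds t - k)
sumSq-shift (d Vec.∷ ds) zero    k = tidy d k (sumSq ds)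
  where
  tidy = solve 3 (λ d k s → (d :- k) :* (d :- k) :+ s := d :* d :+ s :- d :* d :+ (d :- k) :* (d :- k)) refl
sumSq-shift (d Vec.∷ ds) (suc t) k = trans (cong (λ s → d * d + s) (sumSq-shift ds t k)) (tidy d (sumSq ds) (lookup ds t) k)
  where
  tidy = solve 4 (λ d s e k → d :* d :+ (s :- e :* e :+ (e :- k) :* (e :- k)) := d :* d :+ s :- e :* e :+ (e :- k) :* (e :- k))
      refl

dist²-shift : ∀ {m} (ds : Vec ℚ m) t s → sumᵥ dist² ds ≤ sumSq (shift t (χ s) ds)
dist²-shift (d Vec.∷ ds) zero    s = +-mono-≤ (dist²≤χ s d) (sumᵥ-mono dist²≤sq ds)
dist²-shift (d Vec.∷ ds) (suc t) s = +-mono-≤ (dist²≤sq d) (dist²-shift ds t s)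

signOf : ∀ d → ∃[ s ] 0ℚ ≤ χ s * d
signOf d with ≤-total 0ℚ d
... | inj₁ h = false , ≥0-by h (*-identityˡ d)
... | inj₂ h = true , ≥0-by (gap h) (solve 1 (λ d → (:- (con 1ℚ)) :* d := con 0ℚ :- d) refl d)

χ-xor : ∀ s c → χ (s xor c) ≡ χ s * χ c
χ-xor false c = sym (*-identityˡ (χ c))
χ-xor true  c = trans (χ-not c) (negated (χ c))
  where
  negated = solve 1 (λ c → (:- c) := (:- (con 1ℚ)) :* c) refl

χ² : ∀ s → χ s * χ s ≡ 1ℚ
χ² false = refl
χ² true  = refl

module _ {m : ℕ} (f : Cube m → Bool) (b : ℚ) (ds : Vec ℚ m) where
  open FKN f b ds

  -- If |d_t| is bounded below then f agrees with the dictator ½ (1 + sgn(d_t) χ(y_t)) wherever r is small at y and at its t-neighbour.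
  dictator : ∀ t s → 0ℚ ≤ χ s * lookup ds t →
    lookup ds t * lookup ds t * sumSq (shift t (χ s) ds) ≤ (fromℕ 32 + fromℕ 8 * (lookup ds t * lookup ds t)) * err
  dictator t s hs = conclude (d * d) (sumSq ds′) (avg m (λ y → (k + Z ds′ y) * (k + Z ds′ y))) err (avg m (λ y → Δr y * Δr y)) k
      (sq≥0 d) (avg-[b+Z]² ds′ k)
    (subst₂ _≤_ (avg-*ˡ m (d * d) (λ y → (k + Z ds′ y) * (k + Z ds′ y)))
      (trans (avg-+ m (λ y → fromℕ 8 * (Δr y * Δr y)) (λ y → fromℕ 8 * (d * d) * (r y * r y)))
          (cong₂ _+_ (avg-*ˡ m (fromℕ 8) (λ y → Δr y * Δr y)) (avg-*ˡ m (fromℕ 8 * (d * d)) (λ y → r y * r y))))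
      (avg-mono m pointwise))
    (avg-[r-r′]² (unit t))
    where
    d = lookup ds t
    ds′ = shift t (χ s) ds
    k = fromℕ 2 * b - 1ℚ
    Δr : Cube m → ℚ
    Δr y = r y - r (flip (unit t) y)
    conclude : ∀ D S A e R k → 0ℚ ≤ D → A ≡ k * k + S → D * A ≤ fromℕ 8 * R + fromℕ 8 * D * e → R ≤ fromℕ 4 * e → D * S ≤
        (fromℕ 32 + fromℕ 8 * D) * e
    conclude D S A e R k hD refl h h′ = ≤-by (gap h ⊕ lit (fromℕ 8) ⊗ gap h′ ⊕ hD ⊗ sq≥0 k)
        (solve 5 (λ D S e R k → (con (fromℕ 32) :+ con (fromℕ 8) :* D) :* e := D :* S :+
        (con (fromℕ 8) :* R :+ con (fromℕ 8) :* D :* e :- D :* (k :* k :+ S) :+ con (fromℕ 8) :* (con (fromℕ 4) :* e :- R) :+ D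
        :* (k :* k))) refl D S e R k)
    -- If g is not the bit predicted by the sign σ, then g - g′ is zero or of the sign opposite to
    -- `χ σ`, hence at distance at least a from `χ σ * a`. In that case the left factor is 4a².
    agree : ∀ g g′ σ a → 0ℚ ≤ a → (fromℕ 2 * b2q g - 1ℚ - χ σ) * (fromℕ 2 * b2q g - 1ℚ - χ σ) * (a * a) ≤ fromℕ 4 *
        ((b2q g - b2q g′ - χ σ * a) * (b2q g - b2q g′ - χ σ * a))
    agree true  g′    false a h = ≤-by (lit (fromℕ 4) ⊗ sq≥0 (1ℚ - b2q g′ - 1ℚ * a))
        (lemma a (fromℕ 4 * ((1ℚ - b2q g′ - 1ℚ * a) * (1ℚ - b2q g′ - 1ℚ * a))))
      where
      lemma = solve 2 (λ a z → z := (con (fromℕ 2) :* con 1ℚ :- con 1ℚ :- con 1ℚ) :*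
          (con (fromℕ 2) :* con 1ℚ :- con 1ℚ :- con 1ℚ) :* (a :* a) :+ z) refl
    agree false true  false a h = ≤-by (lit (fromℕ 8) ⊗ h ⊕ lit (fromℕ 4))
        (solve 1 (λ a → con (fromℕ 4) :* ((con 0ℚ :- con 1ℚ :- con 1ℚ :* a) :* (con 0ℚ :- con 1ℚ :- con 1ℚ :* a)) :=
        (con (fromℕ 2) :* con 0ℚ :- con 1ℚ :- con 1ℚ) :* (con (fromℕ 2) :* con 0ℚ :- con 1ℚ :- con 1ℚ) :* (a :* a) :+
        (con (fromℕ 8) :* a :+ con (fromℕ 4))) refl a)
    agree false false false a h = ≤-reflexive (solve 1 (λ a → (con (fromℕ 2) :* con 0ℚ :- con 1ℚ :- con 1ℚ) :*
        (con (fromℕ 2) :* con 0ℚ :- con 1ℚ :- con 1ℚ) :* (a :* a) := con (fromℕ 4) :*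
        ((con 0ℚ :- con 0ℚ :- con 1ℚ :* a) :* (con 0ℚ :- con 0ℚ :- con 1ℚ :* a))) refl a)
    agree false g′    true  a h = ≤-by (lit (fromℕ 4) ⊗ sq≥0 (0ℚ - b2q g′ - (- 1ℚ) * a))
        (lemma a (fromℕ 4 * ((0ℚ - b2q g′ - (- 1ℚ) * a) * (0ℚ - b2q g′ - (- 1ℚ) * a))))
      where
      lemma = solve 2 (λ a z → z := (con (fromℕ 2) :* con 0ℚ :- con 1ℚ :- (:- (con 1ℚ))) :*
          (con (fromℕ 2) :* con 0ℚ :- con 1ℚ :- (:- (con 1ℚ))) :* (a :* a) :+ z) refl
    agree true  true  true  a h = ≤-reflexive (solve 1 (λ a → (con (fromℕ 2) :* con 1ℚ :- con 1ℚ :- (:- (con 1ℚ))) :*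
        (con (fromℕ 2) :* con 1ℚ :- con 1ℚ :- (:- (con 1ℚ))) :* (a :* a) := con (fromℕ 4) :*
        ((con 1ℚ :- con 1ℚ :- (:- (con 1ℚ)) :* a) :* (con 1ℚ :- con 1ℚ :- (:- (con 1ℚ)) :* a))) refl a)
    agree true  false true  a h = ≤-by (lit (fromℕ 8) ⊗ h ⊕ lit (fromℕ 4))
        (solve 1 (λ a → con (fromℕ 4) :* ((con 1ℚ :- con 0ℚ :- (:- (con 1ℚ)) :* a) :* (con 1ℚ :- con 0ℚ :- (:- (con 1ℚ)) :* a))
        := (con (fromℕ 2) :* con 1ℚ :- con 1ℚ :- (:- (con 1ℚ))) :* (con (fromℕ 2) :* con 1ℚ :- con 1ℚ :- (:- (con 1ℚ))) :*
        (a :* a) :+ (con (fromℕ 8) :* a :+ con (fromℕ 4))) refl a)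
    combine : ∀ g D w R ρ → D * ((g - w) * (g - w)) ≤ fromℕ 4 * R → 0ℚ ≤ D → ∀ u → g - u ≡ fromℕ 2 * ρ → D * ((u - w) * (u - w))
        ≤ fromℕ 8 * R + fromℕ 8 * D * (ρ * ρ)
    combine g D w R ρ h hD u e = ≤-trans (≤-by (lit (fromℕ 2) ⊗ gap h ⊕ hD ⊗ sq≥0 (fromℕ 2 * g - u - w)) (expand g D w u R))
      (≤-reflexive (trans (cong (λ t → fromℕ 8 * R + fromℕ 2 * D * (t * t)) e) (tidy D R ρ)))
      where
      expand = solve 5 (λ g D w u R → con (fromℕ 8) :* R :+ con (fromℕ 2) :* D :* ((g :- u) :* (g :- u)) := D :*
          ((u :- w) :* (u :- w)) :+ (con (fromℕ 2) :* (con (fromℕ 4) :* R :- D :* ((g :- w) :* (g :- w))) :+ D :*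
          ((con (fromℕ 2) :* g :- u :- w) :* (con (fromℕ 2) :* g :- u :- w)))) refl
      tidy = solve 3 (λ D R ρ → con (fromℕ 8) :* R :+ con (fromℕ 2) :* D :* (con (fromℕ 2) :* ρ :* (con (fromℕ 2) :* ρ)) := con
          (fromℕ 8) :* R :+ con (fromℕ 8) :* D :* (ρ :* ρ)) refl
    pointwise : ∀ y → d * d * ((k + Z ds′ y) * (k + Z ds′ y)) ≤ fromℕ 8 * (Δr y * Δr y) + fromℕ 8 * (d * d) * (r y * r y)
    pointwise y = subst (λ t → d * d * (t * t) ≤ fromℕ 8 * (Δr y * Δr y) + fromℕ 8 * (d * d) * (r y * r y)) (sym rewriteℓ)
      (combine (fromℕ 2 * b2q (f y) - 1ℚ) (d * d) (χ (s xor c)) (Δr y * Δr y) (r y) near (sq≥0 d) (fromℕ 2 * ℓ y - 1ℚ)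
          (twice (b2q (f y)) (ℓ y)))
      where
      c = lookup y t
      twice = solve 2 (λ f l → con (fromℕ 2) :* f :- con 1ℚ :- (con (fromℕ 2) :* l :- con 1ℚ) := con (fromℕ 2) :* (f :- l)) refl
      rewriteℓ : k + Z ds′ y ≡ fromℕ 2 * ℓ y - 1ℚ - χ (s xor c)
      rewriteℓ = trans (cong (λ t → k + t) (Z-shift ds t (χ s) y)) (trans (tidy b (Z ds y) (χ c) (χ s))
          (cong (λ u → fromℕ 2 * ℓ y - 1ℚ - u) (sym (χ-xor s c))))
        where
        tidy = solve 4 (λ b z c s → con (fromℕ 2) :* b :- con 1ℚ :+ (z :- c :* s) := con (fromℕ 2) :* (b :+ con ½ :* z) :- con 1ℚ
            :- s :* c) refl
      signed : χ (s xor c) * (χ s * d) ≡ χ c * d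
      signed = trans (cong (_* (χ s * d)) (χ-xor s c)) (trans (regroup (χ s) (χ c) d)
          (trans (cong (_* (χ c * d)) (χ² s)) (*-identityˡ (χ c * d))))
        where
        regroup = solve 3 (λ s c d → s :* c :* (s :* d) := s :* s :* (c :* d)) refl
      square : χ s * d * (χ s * d) ≡ d * d
      square = trans (regroup (χ s) d) (trans (cong (_* (d * d)) (χ² s)) (*-identityˡ (d * d)))
        where
        regroup = solve 2 (λ s d → s :* d :* (s :* d) := s :* s :* (d :* d)) refl
      Δr≡ : Δr y ≡ b2q (f y) - b2q (f (flip (unit t) y)) - χ (s xor c) * (χ s * d)
      Δr≡ = trans (r-r′ (unit t) y) (cong (λ u → b2q (f y) - b2q (f (flip (unit t) y)) - u)
          (trans (Z-restrict-unit ds t y) (sym signed)))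
      near : d * d * ((fromℕ 2 * b2q (f y) - 1ℚ - χ (s xor c)) * (fromℕ 2 * b2q (f y) - 1ℚ - χ (s xor c))) ≤ fromℕ 4 *
          (Δr y * Δr y)
      near = subst₂ _≤_ (trans (*-comm (w * w) (χ s * d * (χ s * d))) (cong (_* (w * w)) square))
          (cong (λ u → fromℕ 4 * (u * u)) (sym Δr≡))
        (agree (f y) (f (flip (unit t) y)) (s xor c) (χ s * d) hs)
        where
        w = fromℕ 2 * b2q (f y) - 1ℚ - χ (s xor c)

  -- The same estimate without the chosen coordinate: a large coefficient suppresses all the others.
  -- The heavy case rests on this form.
  dictator-rest : ∀ t → lookup ds t * lookup ds t * (sumSq ds - lookup ds t * lookup ds t) ≤
      (fromℕ 32 + fromℕ 8 * (lookup ds t * lookup ds t)) * err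
  dictator-rest t with signOf (lookup ds t)
  ... | s , hs = ≤-trans (*-monoˡ {sumSq ds - d * d} {sumSq (shift t (χ s) ds)} (d * d) (sq≥0 d)
      (≤-by (sq≥0 (d - χ s)) (sumSq-shift ds t (χ s)))) (dictator t s hs)
    where
    d = lookup ds t

private
  -- Greedy choice: discard leading coordinates as long as the rest still reaches k; when the tail
  -- falls to at most k, keep the head, itself at most k, and the whole tail.
  mask : ∀ {m} (ds : Vec ℚ m) k → (∀ t → lookup ds t * lookup ds t ≤ k) → k ≤ sumSq ds →
    0ℚ ≤ k → ∃[ M ] (k ≤ sumSq (restrict M ds) × sumSq (restrict M ds) ≤ k + k)
  mask Vec.[] k small big hk = Vec.[] , big , hk ⊕ hk
  mask {suc m} (d Vec.∷ ds) k small big hk with ≤-total k (sumSq ds)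
  ... | inj₁ h with mask ds k (small ∘ suc) h hk
  ...   | M , lo , hi = false Vec.∷ M , subst (k ≤_) (drop d (sumSq (restrict M ds))) lo , subst (_≤ k + k)
      (drop d (sumSq (restrict M ds))) hi
    where
    drop = solve 2 (λ d s → s := con 0ℚ :* d :* (con 0ℚ :* d) :+ s) refl
  mask {suc m} (d Vec.∷ ds) k small big hk | inj₂ h = Vec.replicate (suc m) true , subst (k ≤_) (full (d Vec.∷ ds)) big , subst
      (_≤ k + k) (full (d Vec.∷ ds)) (+-mono-≤ (small zero) h)
    where
    full : ∀ {m} (ds : Vec ℚ m) → sumSq ds ≡ sumSq (restrict (Vec.replicate m true) ds)
    full Vec.[]       = refl
    full (d Vec.∷ ds) = cong₂ _+_ (cong (λ t → t * t) (sym (*-identityˡ d))) (full ds)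

private
  unmask : ∀ {m} (ds : Vec ℚ m) → sumSq ds ≡ sumSq (restrict (Vec.replicate m true) ds)
  unmask Vec.[]       = refl
  unmask (d Vec.∷ ds) = cong₂ _+_ (cong (λ t → t * t) (sym (*-identityˡ d))) (unmask ds)

module _ {m : ℕ} (f : Cube m → Bool) (b : ℚ) (ds : Vec ℚ m) where
  open FKN f b ds

  -- 2056 = 64·32 + 8: the dictator estimate divided by a squared coefficient of at least 1/64.
  fkn-large : ∀ t → (+ 1 / 64) ≤ lookup ds t * lookup ds t → sumᵥ dist² ds ≤ fromℕ 2056 * err
  fkn-large t h = ≤-trans (dist²-shift ds t (proj₁ s)) (cancel (lookup ds t * lookup ds t) (sumSq (shift t (χ (proj₁ s)) ds)) err
      h err≥0 (dictator f b ds t (proj₁ s) (proj₂ s)))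
    where
    s = signOf (lookup ds t)
    expand = solve 3 (λ D S e → D :* (con (fromℕ 2056) :* e) := D :* S :+
        ((con (fromℕ 32) :+ con (fromℕ 8) :* D) :* e :- D :* S :+ con (fromℕ 2048) :* (D :- con (+ 1 / 64)) :* e)) refl
    cancel : ∀ D S e → (+ 1 / 64) ≤ D → 0ℚ ≤ e → D * S ≤ (fromℕ 32 + fromℕ 8 * D) * e → S ≤ fromℕ 2056 * e
    cancel D S e hD he h = *-cancelˡ-≤′ {S} {fromℕ 2056 * e} {D} (<-≤-trans (toWitness {a? = 0ℚ <? (+ 1 / 64)} _) hD)
      (≤-by (gap h ⊕ lit (fromℕ 2048) ⊗ gap hD ⊗ he) (expand D S e))

  private
    halve : ∀ V e → 0ℚ ≤ V → V ≤ (+ 1 / 24) → V - fromℕ 12 * (V * V) ≤ fromℕ 4 * e → V ≤ fromℕ 8 * e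
    halve V e hV h h′ = ≤-by (lit (fromℕ 2) ⊗ gap h′ ⊕ lit (fromℕ 24) ⊗ hV ⊗ gap h) (expand V e)
      where
      expand = solve 2 (λ V e → con (fromℕ 8) :* e := V :+ (con (fromℕ 2) :*
          (con (fromℕ 4) :* e :- (V :- con (fromℕ 12) :* (V :* V))) :+ con (fromℕ 24) :* V :* (con (+ 1 / 24) :- V))) refl
    enlarge₁ : ∀ e → 0ℚ ≤ e → fromℕ 8 * e ≤ fromℕ 2056 * e
    enlarge₁ e he = ≤-by (lit (fromℕ 2048) ⊗ he) (expand e)
      where
      expand = solve 1 (λ e → con (fromℕ 2056) :* e := con (fromℕ 8) :* e :+ con (fromℕ 2048) :* e) refl
    enlarge₂ : ∀ e → 0ℚ ≤ e → (+ 1 / 48) ≤ fromℕ 8 * e → fromℕ 2 + fromℕ 8 * e ≤ fromℕ 2056 * e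
    enlarge₂ e he h = ≤-by (lit (fromℕ 96) ⊗ gap h ⊕ lit (fromℕ 1280) ⊗ he) (expand e)
      where
      expand = solve 1 (λ e → con (fromℕ 2056) :* e := con (fromℕ 2) :+ con (fromℕ 8) :* e :+
          (con (fromℕ 96) :* (con (fromℕ 8) :* e :- con (+ 1 / 48)) :+ con (fromℕ 1280) :* e)) refl

    masked-small : ∀ M → sumSq (restrict M ds) ≤ (+ 1 / 24) → sumSq (restrict M ds) ≤ fromℕ 8 * err
    masked-small M h = halve (sumSq (restrict M ds)) err (sumSq≥0 (restrict M ds)) h (masked M)

  -- Without a large coefficient, a total above 1/48 would contain a group of coordinates with V
  -- between 1/48 and 1/24. By `masked` such a group has V ≤ 8 err, so err is bounded below and the
  -- a priori bound `sumSq≤` is already O(err). A total of at most 1/48 is handled by `masked`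
  -- directly.
  fkn-small : (∀ t → lookup ds t * lookup ds t ≤ (+ 1 / 48)) → sumSq ds ≤ fromℕ 2056 * err
  fkn-small small = by (≤-total (sumSq ds) (+ 1 / 48))
    where
    by : (sumSq ds ≤ (+ 1 / 48)) ⊎ ((+ 1 / 48) ≤ sumSq ds) → sumSq ds ≤ fromℕ 2056 * err
    by (inj₁ h) = ≤-trans (≤-reflexive (unmask ds)) (≤-trans (masked-small (Vec.replicate m true)
        (≤-trans (≤-reflexive (sym (unmask ds))) (≤-trans h (toWitness {a? = (+ 1 / 48) ≤? (+ 1 / 24)} _)))) (enlarge₁ err err≥0))
    by (inj₂ h) = conclude (mask ds (+ 1 / 48) small h (lit (+ 1 / 48)))
      where
      conclude : ∃[ M ] ((+ 1 / 48) ≤ sumSq (restrict M ds) × sumSq (restrict M ds) ≤ (+ 1 / 48) + (+ 1 / 48)) → sumSq ds ≤ fromℕ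
          2056 * err
      conclude (M , lo , hi) = ≤-trans sumSq≤ (enlarge₂ err err≥0 (≤-trans lo (masked-small M hi)))

  fkn : sumᵥ dist² ds ≤ fromℕ 2056 * err
  fkn = by (Fin.any? (λ t → (+ 1 / 64) ≤? lookup ds t * lookup ds t))
    where
    by : Dec (∃[ t ] (+ 1 / 64) ≤ lookup ds t * lookup ds t) → sumᵥ dist² ds ≤ fromℕ 2056 * err
    by (yes (t , h)) = fkn-large t h
    by (no none)     = ≤-trans (sumᵥ-mono dist²≤sq ds) (fkn-small small)
      where
      small : ∀ t → lookup ds t * lookup ds t ≤ (+ 1 / 48)
      small t with ≤-total (+ 1 / 64) (lookup ds t * lookup ds t)
      ... | inj₁ h = ⊥-elim (none (t , h))
      ... | inj₂ h = ≤-trans h (toWitness {a? = (+ 1 / 64) ≤? (+ 1 / 48)} _)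

-- Sums over distinct indices as expectations over a random permutation

ν : ∀ {n} → Fin n → Fin n → ℚ
ν i j = 1ℚ - δ i j

ν-refl : ∀ {n} (i : Fin n) → ν i i ≡ 0ℚ
ν-refl i = cong (λ t → 1ℚ - t) (δ-refl i)

ν-≢ : ∀ {n} {i j : Fin n} → i ≢ j → ν i j ≡ 1ℚ
ν-≢ h = cong (λ t → 1ℚ - t) (δ-≢ h)

ν-absorb : ∀ {n} (i j : Fin n) {a : ℚ} → (i ≡ j → a ≡ 0ℚ) → ν i j * a ≡ a
ν-absorb i j {a} h = by (i Fin.≟ j)
  where
  by : (d : Dec (i ≡ j)) → (1ℚ - b2q (does d)) * a ≡ a
  by (yes e) = trans (*-zeroˡ a) (sym (h e))
  by (no _)  = *-identityˡ a

δ≥0 : ∀ {n} (i j : Fin n) → 0ℚ ≤ δ i j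
δ≥0 i j = b2q≥0 (does (i Fin.≟ j))

ν≥0 : ∀ {n} (i j : Fin n) → 0ℚ ≤ ν i j
ν≥0 i j = gap (b2q≤1 (does (i Fin.≟ j)))

ν₄ : ∀ {n} → Fin n → Fin n → Fin n → Fin n → ℚ
ν₄ i j k l = ν i j * ν i k * ν i l * (ν j k * ν j l * ν k l)

ν₄≥0 : ∀ {n} (i j k l : Fin n) → 0ℚ ≤ ν₄ i j k l
ν₄≥0 i j k l = ν≥0 i j ⊗ ν≥0 i k ⊗ ν≥0 i l ⊗ (ν≥0 j k ⊗ ν≥0 j l ⊗ ν≥0 k l)

pick : ∀ {n} (a : Fin n) (σ : Perm n) (G : Fin n → ℚ) → ∑ (λ i → X a i σ * G i) ≡ G (lookup σ a)
pick a σ G = ∑-δʳ (lookup σ a) G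

∑₄ : ∀ {n} → (Fin n → Fin n → Fin n → Fin n → ℚ) → ℚ
∑₄ H = ∑∑ (λ i j → ∑∑ (λ k l → H i j k l))

∑₄-mono : ∀ {n} {G H : Fin n → Fin n → Fin n → Fin n → ℚ} → (∀ i j k l → G i j k l ≤ H i j k l) → ∑₄ G ≤ ∑₄ H
∑₄-mono h = ∑∑-mono (λ i j → ∑∑-mono (h i j))

∑₄-cong : ∀ {n} {G H : Fin n → Fin n → Fin n → Fin n → ℚ} → (∀ i j k l → G i j k l ≡ H i j k l) → ∑₄ G ≡ ∑₄ H
∑₄-cong h = ∑∑-cong (λ i j → ∑∑-cong (h i j))

∑₄-*ˡ : ∀ {n} c (H : Fin n → Fin n → Fin n → Fin n → ℚ) → ∑₄ (λ i j k l → c * H i j k l) ≡ c * ∑₄ H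
∑₄-*ˡ c H = trans (∑∑-cong (λ i j → ∑∑-*ˡ c (H i j))) (∑∑-*ˡ c (λ i j → ∑∑ (H i j)))

𝔼-∑∑ : ∀ n {m k} (F : Fin m → Fin k → Perm n → ℚ) → 𝔼 n (λ π → ∑∑ (λ i j → F i j π)) ≡ ∑∑ (λ i j → 𝔼 n (F i j))
𝔼-∑∑ n F = trans (𝔼-∑ n (λ i π → ∑ (λ j → F i j π))) (∑-cong (λ i → 𝔼-∑ n (F i)))

private
  ν≤𝔼XX : ∀ {n} {a b : Fin n} → a ≢ b → ∀ i j → ν i j ≤ fromℕ n * (fromℕ n * 1ℚ) * 𝔼 n (Xs ((a , i) ∷ (b , j) ∷ []))
  ν≤𝔼XX {n} {a} {b} h i j with i Fin.≟ j
  ... | yes _ = fromℕ≥0 n ⊗ (fromℕ≥0 n ⊗ lit 1ℚ) ⊗ 𝔼≥0 n {Xs ((a , i) ∷ (b , j) ∷ [])} (λ π _ → Xs≥0 ((a , i) ∷ (b , j) ∷ []) π)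
  ... | no ≢  = 1≤n^k𝔼Xs ((a , i) ∷ (b , j) ∷ []) (((h , ≢) All.∷ All.[]) and (All.[] and empty))

  ν₄-zero : ∀ a b c d e f → (a ≡ 0ℚ) ⊎ (b ≡ 0ℚ) ⊎ (c ≡ 0ℚ) ⊎ (d ≡ 0ℚ) ⊎ (e ≡ 0ℚ) ⊎ (f ≡ 0ℚ) → a * b * c * (d * e * f) ≡ 0ℚ
  ν₄-zero a b c d e f (inj₁ refl) = solve 5 (λ b c d e f → con 0ℚ :* b :* c :* (d :* e :* f) := con 0ℚ) refl b c d e f
  ν₄-zero a b c d e f (inj₂ (inj₁ refl)) = solve 5 (λ a c d e f → a :* con 0ℚ :* c :* (d :* e :* f) := con 0ℚ) refl a c d e f
  ν₄-zero a b c d e f (inj₂ (inj₂ (inj₁ refl))) = solve 5 (λ a b d e f → a :* b :* con 0ℚ :* (d :* e :* f) := con 0ℚ) refl a b d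
      e f
  ν₄-zero a b c d e f (inj₂ (inj₂ (inj₂ (inj₁ refl)))) = solve 5 (λ a b c e f → a :* b :* c :* (con 0ℚ :* e :* f) := con 0ℚ) refl
      a b c e f
  ν₄-zero a b c d e f (inj₂ (inj₂ (inj₂ (inj₂ (inj₁ refl))))) = solve 5
      (λ a b c d f → a :* b :* c :* (d :* con 0ℚ :* f) := con 0ℚ) refl a b c d f
  ν₄-zero a b c d e f (inj₂ (inj₂ (inj₂ (inj₂ (inj₂ refl))))) = solve 5
      (λ a b c d e → a :* b :* c :* (d :* e :* con 0ℚ) := con 0ℚ) refl a b c d e

  ν-zero? : ∀ {n} (i j : Fin n) → ν i j ≡ 0ℚ ⊎ (i ≢ j × ν i j ≡ 1ℚ)
  ν-zero? i j with i Fin.≟ j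
  ... | yes _ = inj₁ refl
  ... | no ≢  = inj₂ (≢ , refl)

entries : ∀ {n} → (a b c d i j k l : Fin n) → List (Fin n × Fin n)
entries a b c d i j k l = (a , i) ∷ (b , j) ∷ (c , k) ∷ (d , l) ∷ []

Distinct : ∀ {n} → (a b c d : Fin n) → Set
Distinct a b c d = (a ≢ b × a ≢ c × a ≢ d) × (b ≢ c × b ≢ d) × c ≢ d

private
  ν₄≤𝔼X : ∀ {n} {a b c d : Fin n} → Distinct a b c d → ∀ i j k l →
    ν₄ i j k l ≤ (fromℕ n ^ℚ 4) * 𝔼 n (Xs (entries a b c d i j k l))
  ν₄≤𝔼X {n} {a} {b} {c} {d} ((ab , ac , ad) , (bc , bd) , cd) i j k l = by (ν-zero? i j) (ν-zero? i k) (ν-zero? i l)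
      (ν-zero? j k) (ν-zero? j l) (ν-zero? k l)
    where
    E = (fromℕ n ^ℚ 4) * 𝔼 n (Xs (entries a b c d i j k l))
    Z? : Fin n → Fin n → Set
    Z? i j = ν i j ≡ 0ℚ ⊎ (i ≢ j × ν i j ≡ 1ℚ)
    vanish : (ν i j ≡ 0ℚ) ⊎ (ν i k ≡ 0ℚ) ⊎ (ν i l ≡ 0ℚ) ⊎ (ν j k ≡ 0ℚ) ⊎ (ν j l ≡ 0ℚ) ⊎ (ν k l ≡ 0ℚ) → ν₄ i j k l ≤ E
    vanish h = ≤-trans (≤-reflexive (ν₄-zero (ν i j) (ν i k) (ν i l) (ν j k) (ν j l) (ν k l) h))
      (fromℕ≥0 n ⊗ (fromℕ≥0 n ⊗ (fromℕ≥0 n ⊗ (fromℕ≥0 n ⊗ lit 1ℚ))) ⊗ 𝔼≥0 n {Xs (entries a b c d i j k l)}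
          (λ π _ → Xs≥0 (entries a b c d i j k l) π))
    by : Z? i j → Z? i k → Z? i l → Z? j k → Z? j l → Z? k l → ν₄ i j k l ≤ E
    by (inj₁ h) _ _ _ _ _ = vanish (inj₁ h)
    by _ (inj₁ h) _ _ _ _ = vanish (inj₂ (inj₁ h))
    by _ _ (inj₁ h) _ _ _ = vanish (inj₂ (inj₂ (inj₁ h)))
    by _ _ _ (inj₁ h) _ _ = vanish (inj₂ (inj₂ (inj₂ (inj₁ h))))
    by _ _ _ _ (inj₁ h) _ = vanish (inj₂ (inj₂ (inj₂ (inj₂ (inj₁ h)))))
    by _ _ _ _ _ (inj₁ h) = vanish (inj₂ (inj₂ (inj₂ (inj₂ (inj₂ h)))))
    by (inj₂ (ij , e₁)) (inj₂ (ik , e₂)) (inj₂ (il , e₃)) (inj₂ (jk , e₄)) (inj₂ (jl , e₅)) (inj₂ (kl , e₆)) =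
      ≤-trans (≤-reflexive (cong₂ _*_ (cong₂ _*_ (cong₂ _*_ e₁ e₂) e₃) (cong₂ _*_ (cong₂ _*_ e₄ e₅) e₆)))
        (1≤n^k𝔼Xs (entries a b c d i j k l) (((ab , ij) All.∷ (ac , ik) All.∷ (ad , il) All.∷ All.[]) and
            (((bc , jk) All.∷ (bd , jl) All.∷ All.[]) and (((cd , kl) All.∷ All.[]) and (All.[] and empty)))))

-- A random permutation sends (a, b) to each pair of distinct values with probability at least 1/n².
-- `𝔼-quad` is the analogue for four positions.
𝔼-pair : ∀ {n} {a b : Fin n} → a ≢ b → (H : Fin n → Fin n → ℚ) → (∀ i j → 0ℚ ≤ H i j) →
  ∑∑ (λ i j → ν i j * H i j) ≤ fromℕ n * fromℕ n * 𝔼 n (λ σ → H (lookup σ a) (lookup σ b))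
𝔼-pair {n} {a} {b} a≢b H H≥0 = ≤-trans
  (∑∑-mono (λ i j → ≤-trans (≤-reflexive (*-comm (ν i j) (H i j)))
      (≤-trans (*-monoˡ {ν i j} {N * (N * 1ℚ) * 𝔼 n (Xs ((a , i) ∷ (b , j) ∷ []))} (H i j) (H≥0 i j) (ν≤𝔼XX a≢b i j))
    (≤-reflexive (shuffle (H i j) N (𝔼 n (Xs ((a , i) ∷ (b , j) ∷ []))))))))
  (≤-reflexive (trans (∑∑-*ˡ (N * N) (λ i j → 𝔼 n (Xs ((a , i) ∷ (b , j) ∷ [])) * H i j)) (cong (N * N *_)
    (trans (∑∑-cong (λ i j → sym (𝔼-*ʳ n (H i j) (Xs ((a , i) ∷ (b , j) ∷ [])))))
        (trans (sym (𝔼-∑∑ n (λ i j π → Xs ((a , i) ∷ (b , j) ∷ []) π * H i j))) (𝔼-cong n (λ σ _ → eval σ)))))))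
  where
  N = fromℕ n
  shuffle = solve 3 (λ h n e → h :* (n :* (n :* con 1ℚ) :* e) := n :* n :* (e :* h)) refl
  assoc = solve 3 (λ x y h → x :* (y :* con 1ℚ) :* h := x :* (y :* h)) refl
  eval : ∀ σ → ∑∑ (λ i j → Xs ((a , i) ∷ (b , j) ∷ []) σ * H i j) ≡ H (lookup σ a) (lookup σ b)
  eval σ = trans (∑-cong (λ i → trans (∑-cong (λ j → assoc (X a i σ) (X b j σ) (H i j)))
      (trans (∑-*ˡ (X a i σ) (λ j → X b j σ * H i j)) (cong (X a i σ *_) (pick b σ (H i))))))
    (pick a σ (λ i → H i (lookup σ b)))

𝔼-quad : ∀ {n} {a b c d : Fin n} → Distinct a b c d → (H : Fin n → Fin n → Fin n → Fin n → ℚ) → (∀ i j k l → 0ℚ ≤ H i j k l) →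
  ∑₄ (λ i j k l → ν₄ i j k l * H i j k l) ≤ (fromℕ n ^ℚ 4) * 𝔼 n (λ σ → H (lookup σ a) (lookup σ b) (lookup σ c) (lookup σ d))
𝔼-quad {n} {a} {b} {c} {d} distinct H H≥0 = ≤-trans
  (∑₄-mono (λ i j k l → ≤-trans (≤-reflexive (*-comm (ν₄ i j k l) (H i j k l)))
      (≤-trans (*-monoˡ {ν₄ i j k l} {N⁴ * E i j k l} (H i j k l) (H≥0 i j k l) (ν₄≤𝔼X distinct i j k l))
    (≤-reflexive (shuffle (H i j k l) N⁴ (E i j k l))))))
  (≤-reflexive (trans (∑₄-*ˡ N⁴ (λ i j k l → E i j k l * H i j k l)) (cong (N⁴ *_)
    (trans (∑₄-cong (λ i j k l → sym (𝔼-*ʳ n (H i j k l) (Xs (entries a b c d i j k l)))))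
        (trans (sym (trans (𝔼-∑∑ n (λ i j π → ∑∑ (λ k l → term i j k l π))) (∑∑-cong (λ i j → 𝔼-∑∑ n (term i j)))))
      (𝔼-cong n (λ σ _ → eval σ)))))))
  where
  N⁴ = fromℕ n ^ℚ 4
  E : Fin n → Fin n → Fin n → Fin n → ℚ
  E i j k l = 𝔼 n (Xs (entries a b c d i j k l))
  term : Fin n → Fin n → Fin n → Fin n → Perm n → ℚ
  term i j k l π = Xs (entries a b c d i j k l) π * H i j k l
  shuffle = solve 3 (λ h n e → h :* (n :* e) := n :* (e :* h)) refl
  assoc = solve 5 (λ x y z w h → x :* (y :* (z :* (w :* con 1ℚ))) :* h := x :* (y :* (z :* (w :* h)))) refl
  eval : ∀ σ → ∑₄ (λ i j k l → term i j k l σ) ≡ H (lookup σ a) (lookup σ b) (lookup σ c) (lookup σ d)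
  eval σ = trans (∑₄-cong (λ i j k l → assoc (X a i σ) (X b j σ) (X c k σ) (X d l σ) (H i j k l)))
    (trans (∑-cong (λ i → trans (∑-cong (λ j →
      trans (∑-cong (λ k → trans (∑-*ˡ (X a i σ) (λ l → X b j σ * (X c k σ * (X d l σ * H i j k l))))
          (cong (X a i σ *_) (trans (∑-*ˡ (X b j σ) (λ l → X c k σ * (X d l σ * H i j k l)))
          (cong (X b j σ *_) (trans (∑-*ˡ (X c k σ) (λ l → X d l σ * H i j k l)) (cong (X c k σ *_) (pick d σ (H i j k)))))))))
      (trans (∑-*ˡ (X a i σ) (λ k → X b j σ * (X c k σ * H i j k (lookup σ d))))
          (cong (X a i σ *_) (trans (∑-*ˡ (X b j σ) (λ k → X c k σ * H i j k (lookup σ d)))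
          (cong (X b j σ *_) (pick c σ (λ k → H i j k (lookup σ d)))))))))
      (trans (∑-*ˡ (X a i σ) (λ j → X b j σ * H i j (lookup σ c) (lookup σ d)))
          (cong (X a i σ *_) (pick b σ (λ j → H i j (lookup σ c) (lookup σ d)))))))
    (pick a σ (λ i → H i (lookup σ b) (lookup σ c) (lookup σ d))))

-- Frames: the positions are paired as (0,1), (2,3), …, and a point of the cube says which pairs to swap.

swapPairs : ∀ n → Cube ⌊ n /2⌋ → Fin n → Fin n
swapPairs (suc zero)    y           i             = i
swapPairs (suc (suc n)) (s Vec.∷ y) zero          = if s then suc zero else zero
swapPairs (suc (suc n)) (s Vec.∷ y) (suc zero)    = if s then zero else suc zero
swapPairs (suc (suc n)) (s Vec.∷ y) (suc (suc i)) = suc (suc (swapPairs n y i))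

swapPairs-involutive : ∀ n y i → swapPairs n y (swapPairs n y i) ≡ i
swapPairs-involutive (suc zero)    y               i             = refl
swapPairs-involutive (suc (suc n)) (false Vec.∷ y) zero          = refl
swapPairs-involutive (suc (suc n)) (true  Vec.∷ y) zero          = refl
swapPairs-involutive (suc (suc n)) (false Vec.∷ y) (suc zero)    = refl
swapPairs-involutive (suc (suc n)) (true  Vec.∷ y) (suc zero)    = refl
swapPairs-involutive (suc (suc n)) (s Vec.∷ y)     (suc (suc i)) = cong (λ t → suc (suc t)) (swapPairs-involutive n y i)

fstOf sndOf : ∀ n → Fin ⌊ n /2⌋ → Fin n
fstOf (suc (suc n)) zero    = zero
fstOf (suc (suc n)) (suc t) = suc (suc (fstOf n t))
sndOf (suc (suc n)) zero    = suc zero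
sndOf (suc (suc n)) (suc t) = suc (suc (sndOf n t))

fst≢snd : ∀ n t → fstOf n t ≢ sndOf n t
fst≢snd (suc (suc n)) zero    ()
fst≢snd (suc (suc n)) (suc t) e = fst≢snd n t (Fin.suc-injective (Fin.suc-injective e))

frameMinors : ∀ n → Matrix n → Vec ℚ ⌊ n /2⌋
frameMinors n G = tabulate (λ t → Δ G (fstOf n t) (sndOf n t) (fstOf n t) (sndOf n t))

frameMean : ∀ n → Matrix n → ℚ
frameMean zero          G = 0ℚ
frameMean (suc zero)    G = G zero zero
frameMean (suc (suc n)) G = ½ * (G zero zero + G (suc zero) (suc zero) + G zero (suc zero) + G (suc zero) zero) + frameMean n
    (λ i j → G (suc (suc i)) (suc (suc j)))

-- Each 2×2 diagonal block contributes its diagonal or its antidiagonal sum, that is, half the sum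
-- of its entries plus or minus half its minor. For odd n the last position is never moved and
-- enters only the mean.
frame-affine : ∀ n (G : Matrix n) y → ∑ (λ i → G i (swapPairs n y i)) ≡ frameMean n G + ½ * Z (frameMinors n G) y
frame-affine zero          G Vec.[] = refl
frame-affine (suc zero)    G Vec.[] = refl
frame-affine (suc (suc n)) G (s Vec.∷ y) = begin
  G zero (swapPairs _ (s Vec.∷ y) zero) + (G (suc zero) (swapPairs _ (s Vec.∷ y) (suc zero)) + rest)
    ≡⟨ cong (λ t → G zero (swapPairs _ (s Vec.∷ y) zero) + (G (suc zero) (swapPairs _ (s Vec.∷ y) (suc zero)) + t))
        (frame-affine n (λ i j → G (suc (suc i)) (suc (suc j))) y) ⟩
  G zero (swapPairs _ (s Vec.∷ y) zero) + (G (suc zero) (swapPairs _ (s Vec.∷ y) (suc zero)) + (M + ½ * z))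
    ≡⟨ head s ⟩
  ½ * (a + d + b + c) + M + ½ * (χ s * (a - c - b + d) + z) ∎
  where
  open ≡-Reasoning
  a = G zero zero
  b = G zero (suc zero)
  c = G (suc zero) zero
  d = G (suc zero) (suc zero)
  rest = ∑ (λ i → G (suc (suc i)) (suc (suc (swapPairs n y i))))
  M = frameMean n (λ i j → G (suc (suc i)) (suc (suc j)))
  z = Z (frameMinors n (λ i j → G (suc (suc i)) (suc (suc j)))) y
  unswapped = solve 6 (λ a b c d m z → a :+ (d :+ (m :+ con ½ :* z)) := con ½ :* (a :+ d :+ b :+ c) :+ m :+ con ½ :*
      (con 1ℚ :* (a :- c :- b :+ d) :+ z)) refl
  swapped = solve 6 (λ a b c d m z → b :+ (c :+ (m :+ con ½ :* z)) := con ½ :* (a :+ d :+ b :+ c) :+ m :+ con ½ :*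
      ((:- (con 1ℚ)) :* (a :- c :- b :+ d) :+ z)) refl
  head : ∀ s → G zero (swapPairs _ (s Vec.∷ y) zero) + (G (suc zero) (swapPairs _ (s Vec.∷ y) (suc zero)) + (M + ½ * z)) ≡ ½ *
      (a + d + b + c) + M + ½ * (χ s * (a - c - b + d) + z)
  head false = unswapped a b c d M z
  head true  = swapped a b c d M z

sumᵥ-tabulate : ∀ {m} g (G : Fin m → ℚ) → sumᵥ g (tabulate G) ≡ ∑ (λ t → g (G t))
sumᵥ-tabulate {zero}  g G = refl
sumᵥ-tabulate {suc m} g G = cong (λ t → g (G zero) + t) (sumᵥ-tabulate g (G ∘ suc))

𝔼-avg : ∀ n m (F : Cube m → Perm n → ℚ) → 𝔼 n (λ π → avg m (λ y → F y π)) ≡ avg m (λ y → 𝔼 n (F y))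
𝔼-avg n zero    F = refl
𝔼-avg n (suc m) F = trans (𝔼-*ˡ n ½ (λ π → avg m (λ y → F (false Vec.∷ y) π) + avg m (λ y → F (true Vec.∷ y) π))) (cong (½ *_)
  (trans (𝔼-+ n (λ π → avg m (λ y → F (false Vec.∷ y) π)) (λ π → avg m (λ y → F (true Vec.∷ y) π)))
      (cong₂ _+_ (𝔼-avg n m (λ y → F (false Vec.∷ y))) (𝔼-avg n m (λ y → F (true Vec.∷ y))))))

module Frames (n : ℕ) (f : Perm n → Bool) (a : Matrix n) (p : ℚ) where

  err² : ℚ
  err² = 𝔼 n (λ π → (b2q (f π) - p - lin a π) * (b2q (f π) - p - lin a π))

  M : ℕ
  M = ⌊ n /2⌋

  grid : Perm n → Perm n → Matrix n
  grid σ π t u = a (lookup σ t) (lookup π u)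

  -- The embedded cube is y ↦ π ∘ (swaps given by y) ∘ σ⁻¹, so block t of the grid sits in the rows
  -- σ(2t), σ(2t+1) and the columns π(2t), π(2t+1).
  point : Perm n → Perm n → Cube M → Perm n
  point σ π y = rearrange id (λ i → swapPairs n y (index σ i)) π

  ds : Perm n → Perm n → Vec ℚ M
  ds σ π = frameMinors n (grid σ π)

  frameErr : Perm n → Perm n → ℚ
  frameErr σ π = FKN.err (λ y → f (point σ π y)) (p + frameMean n (grid σ π)) (ds σ π)

  private
    lin-point : ∀ σ π y → IsPerm σ → lin a (point σ π y) ≡ frameMean n (grid σ π) + ½ * Z (ds σ π) y
    lin-point σ π y h = begin
      ∑ (λ i → a i (lookup (point σ π y) i))
        ≡⟨ ∑-cong (λ i → cong (a i) (lookup-rearrange id (λ i → swapPairs n y (index σ i)) π i)) ⟩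
      ∑ (λ i → a i (lookup π (swapPairs n y (index σ i))))
        ≡⟨ sym (∑-perm σ h (λ i → a i (lookup π (swapPairs n y (index σ i))))) ⟩
      ∑ (λ t → a (lookup σ t) (lookup π (swapPairs n y (index σ (lookup σ t)))))
        ≡⟨ ∑-cong (λ t → cong (λ u → a (lookup σ t) (lookup π (swapPairs n y u))) (index-lookup σ h t)) ⟩
      ∑ (λ t → grid σ π t (swapPairs n y t))
        ≡⟨ frame-affine n (grid σ π) y ⟩
      frameMean n (grid σ π) + ½ * Z (ds σ π) y ∎
      where open ≡-Reasoning

    position : ∀ σ → IsPerm σ → ∀ y → Inverse (λ i → swapPairs n y (index σ i)) (λ t → lookup σ (swapPairs n y t))
    position σ h y = inverse (λ i → trans (cong (lookup σ) (swapPairs-involutive n y (index σ i))) (lookup-index σ h i))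
      (λ t → trans (cong (swapPairs n y) (index-lookup σ h (swapPairs n y t))) (swapPairs-involutive n y t))

  -- For fixed σ and y the map π ↦ `point σ π y` is a bijection of S_n, so every vertex of the
  -- random cube is a uniformly random permutation.
  𝔼-frameErr : ∀ σ → IsPerm σ → 𝔼 n (frameErr σ) ≡ err²
  𝔼-frameErr σ h = begin
    𝔼 n (λ π → avg M (λ y → FKN.r (λ y → f (point σ π y)) (p + frameMean n (grid σ π)) (ds σ π) y * FKN.r (λ y → f (point σ π y))
        (p + frameMean n (grid σ π)) (ds σ π) y))
      ≡⟨ 𝔼-cong n (λ π _ → avg-cong M (λ y → cong (λ t → t * t) (trans
          (regroup (b2q (f (point σ π y))) p (frameMean n (grid σ π)) (½ * Z (ds σ π) y))
          (cong (λ t → b2q (f (point σ π y)) - p - t) (sym (lin-point σ π y h)))))) ⟩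
    𝔼 n (λ π → avg M (λ y → R (point σ π y)))
      ≡⟨ 𝔼-avg n M (λ y π → R (point σ π y)) ⟩
    avg M (λ y → 𝔼 n (λ π → R (point σ π y)))
      ≡⟨ avg-cong M (λ y → 𝔼-rearrange id-inverse (position σ h y) R) ⟩
    avg M (λ y → err²)
      ≡⟨ avg-const M err² ⟩
    err² ∎
    where
    open ≡-Reasoning
    R : Perm n → ℚ
    R π = (b2q (f π) - p - lin a π) * (b2q (f π) - p - lin a π)
    regroup = solve 4 (λ f p b z → f :- (p :+ b :+ z) := f :- p :- (b :+ z)) refl

  minor : Perm n → Perm n → Fin M → ℚ
  minor σ π t = Δ a (lookup σ (fstOf n t)) (lookup σ (sndOf n t)) (lookup π (fstOf n t)) (lookup π (sndOf n t))

  Δ-degenerate-row : ∀ i j l → Δ a i i j l ≡ 0ℚ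
  Δ-degenerate-row i j l = lemma (a i j) (a i l)
    where
    lemma = solve 2 (λ x y → x :- x :- y :+ y := con 0ℚ) refl

  Δ-degenerate-col : ∀ i k j → Δ a i k j j ≡ 0ℚ
  Δ-degenerate-col i k j = lemma (a i j) (a k j)
    where
    lemma = solve 2 (λ x y → x :- y :- x :+ y := con 0ℚ) refl

  -- Every pair t of a random frame yields a random minor, while the cube bounds the sum over all M
  -- pairs at once. The factor `fromℕ M` on the left is this gain.
  dist²-minors : fromℕ M * ∑₄ (λ i k j l → dist² (Δ a i k j l)) ≤ fromℕ n * fromℕ n * (fromℕ n * fromℕ n) * (fromℕ 2056 * err²)
  dist²-minors = begin
    fromℕ M * S
      ≡⟨ sym (∑-const M S) ⟩
    ∑ {M} (λ _ → S)
      ≤⟨ ∑-mono per-pair ⟩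
    ∑ (λ t → N⁴ * 𝔼 n (λ σ → 𝔼 n (λ π → dist² (minor σ π t))))
      ≡⟨ ∑-*ˡ N⁴ (λ t → 𝔼 n (λ σ → 𝔼 n (λ π → dist² (minor σ π t)))) ⟩
    N⁴ * ∑ (λ t → 𝔼 n (λ σ → 𝔼 n (λ π → dist² (minor σ π t))))
      ≡⟨ cong (N⁴ *_) (sym (trans (𝔼-cong n (λ σ _ → 𝔼-∑ n (λ t π → dist² (minor σ π t))))
          (𝔼-∑ n (λ t σ → 𝔼 n (λ π → dist² (minor σ π t)))))) ⟩
    N⁴ * 𝔼 n (λ σ → 𝔼 n (λ π → ∑ (λ t → dist² (minor σ π t))))
      ≤⟨ *-monoˡ {𝔼 n (λ σ → 𝔼 n (λ π → ∑ (λ t → dist² (minor σ π t))))} {fromℕ 2056 * err²} N⁴ N⁴≥0 frames ⟩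
    N⁴ * (fromℕ 2056 * err²) ∎
    where
    open ≤-Reasoning
    N = fromℕ n
    N⁴ = N * N * (N * N)
    N⁴≥0 : 0ℚ ≤ N⁴
    N⁴≥0 = fromℕ≥0 n ⊗ fromℕ≥0 n ⊗ (fromℕ≥0 n ⊗ fromℕ≥0 n)
    S = ∑₄ (λ i k j l → dist² (Δ a i k j l))
    frames : 𝔼 n (λ σ → 𝔼 n (λ π → ∑ (λ t → dist² (minor σ π t)))) ≤ fromℕ 2056 * err²
    frames = ≤-trans (𝔼-mono n {λ σ → 𝔼 n (λ π → ∑ (λ t → dist² (minor σ π t)))} {λ _ → fromℕ 2056 * err²} (λ σ h →
      ≤-trans (𝔼-mono n {λ π → ∑ (λ t → dist² (minor σ π t))} {λ π → fromℕ 2056 * frameErr σ π} (λ π _ →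
        ≤-trans (≤-reflexive (sym (sumᵥ-tabulate dist² (minor σ π))))
            (fkn (λ y → f (point σ π y)) (p + frameMean n (grid σ π)) (ds σ π))))
      (≤-reflexive (trans (𝔼-*ˡ n (fromℕ 2056) (frameErr σ)) (cong (fromℕ 2056 *_) (𝔼-frameErr σ h))))))
      (≤-reflexive (𝔼-const n (fromℕ 2056 * err²)))
    per-pair : ∀ t → S ≤ N⁴ * 𝔼 n (λ σ → 𝔼 n (λ π → dist² (minor σ π t)))
    per-pair t = begin
      S
        -- Minors with a repeated row or column vanish and 0 has distance 0, so the sum over all
        -- quadruples is already a sum over distinct rows and distinct columns.
        ≡⟨ ∑∑-cong (λ i k → trans (∑∑-cong (λ j l → sym (ν-absorb i k λ { refl → cong dist² (Δ-degenerate-row i j l) })))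
            (∑∑-*ˡ (ν i k) (λ j l → dist² (Δ a i k j l)))) ⟩
      ∑∑ (λ i k → ν i k * D i k)
        ≤⟨ 𝔼-pair (fst≢snd n t) D (λ i k → ∑∑≥0 (λ j l → dist²≥0 (Δ a i k j l))) ⟩
      N * N * 𝔼 n (λ σ → D (lookup σ (fstOf n t)) (lookup σ (sndOf n t)))
        ≤⟨ *-monoˡ {𝔼 n (λ σ → D (lookup σ (fstOf n t)) (lookup σ (sndOf n t)))}
            {𝔼 n (λ σ → N * N * 𝔼 n (λ π → dist² (minor σ π t)))} (N * N) (fromℕ≥0 n ⊗ fromℕ≥0 n)
             (𝔼-mono n {λ σ → D (lookup σ (fstOf n t)) (lookup σ (sndOf n t))} {λ σ → N * N * 𝔼 n (λ π → dist² (minor σ π t))}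
                 (λ σ _ → inner (lookup σ (fstOf n t)) (lookup σ (sndOf n t)))) ⟩
      N * N * 𝔼 n (λ σ → N * N * 𝔼 n (λ π → dist² (minor σ π t)))
        ≡⟨ trans (cong (N * N *_) (𝔼-*ˡ n (N * N) (λ σ → 𝔼 n (λ π → dist² (minor σ π t)))))
            (sym (*-assoc (N * N) (N * N) (𝔼 n (λ σ → 𝔼 n (λ π → dist² (minor σ π t)))))) ⟩
      N⁴ * 𝔼 n (λ σ → 𝔼 n (λ π → dist² (minor σ π t))) ∎
      where
      D : Fin n → Fin n → ℚ
      D i k = ∑∑ (λ j l → dist² (Δ a i k j l))
      inner : ∀ i k → D i k ≤ N * N * 𝔼 n (λ π → dist² (Δ a i k (lookup π (fstOf n t)) (lookup π (sndOf n t))))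
      inner i k = ≤-trans (≤-reflexive (∑∑-cong (λ j l → sym (ν-absorb j l λ { refl → cong dist² (Δ-degenerate-col i k j) }))))
          (𝔼-pair (fst≢snd n t) (λ j l → dist² (Δ a i k j l)) (λ j l → dist²≥0 (Δ a i k j l)))

-- Unions of cosets

𝟙 : ∀ {n} → CosetSet n → Matrix n
𝟙 C i j = b2q (C i j)

hits : ∀ {n} → CosetSet n → Perm n → ℚ
hits C = lin (𝟙 C)

private
  isPositive : ℕ → Bool
  isPositive zero    = false
  isPositive (suc _) = true

  fromℕ-if : ∀ b k → fromℕ ((if b then 1 else 0) ℕ.+ k) ≡ b2q b + fromℕ k
  fromℕ-if true  k = fromℕ-suc k
  fromℕ-if false k = sym (+-identityˡ (fromℕ k))

  fromℕ-countFin : ∀ n p → fromℕ (countFin n p) ≡ ∑ (λ i → b2q (p i))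
  fromℕ-countFin zero    p = refl
  fromℕ-countFin (suc n) p = trans (fromℕ-if (p zero) (countFin n (λ i → p (suc i))))
      (cong (λ t → b2q (p zero) + t) (fromℕ-countFin n (λ i → p (suc i))))

  fromℕ-ΣℕFin : ∀ n a → fromℕ (ΣℕFin n a) ≡ ∑ (λ i → fromℕ (a i))
  fromℕ-ΣℕFin zero    a = refl
  fromℕ-ΣℕFin (suc n) a = trans (fromℕ-+ (a zero) (ΣℕFin n (λ i → a (suc i))))
      (cong (λ t → fromℕ (a zero) + t) (fromℕ-ΣℕFin n (λ i → a (suc i))))

  orFin-count : ∀ n p → orFin n p ≡ isPositive (countFin n p)
  orFin-count zero    p = refl
  orFin-count (suc n) p with p zero
  ... | true  = refl
  ... | false = orFin-count n (λ i → p (suc i))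

  orFin-≟ : ∀ n (p : Fin n → Bool) a → orFin n (λ j → p j ∧ does (a Fin.≟ j)) ≡ p a
  orFin-≟ (suc n) p zero = trans (cong₂ _∨_ (∧-true (p zero)) (all-false n (λ j → p (suc j)))) (∨-false (p zero))
    where
    ∧-true : ∀ b → b ∧ true ≡ b
    ∧-true true  = refl
    ∧-true false = refl
    ∨-false : ∀ b → b ∨ false ≡ b
    ∨-false true  = refl
    ∨-false false = refl
    all-false : ∀ n (p : Fin n → Bool) → orFin n (λ j → p j ∧ false) ≡ false
    all-false zero    p = refl
    all-false (suc n) p with p zero
    ... | true  = all-false n (λ j → p (suc j))
    ... | false = all-false n (λ j → p (suc j))
  orFin-≟ (suc n) p (suc a) with p zero
  ... | true  = orFin-≟ n (λ j → p (suc j)) a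
  ... | false = orFin-≟ n (λ j → p (suc j)) a

  orFin-cong : ∀ n {p q : Fin n → Bool} → (∀ i → p i ≡ q i) → orFin n p ≡ orFin n q
  orFin-cong zero    h = refl
  orFin-cong (suc n) h = cong₂ _∨_ (h zero) (orFin-cong n (λ i → h (suc i)))

maxCosets-eval : ∀ {n} (C : CosetSet n) π → maxCosets C π ≡ orFin n (λ i → C i (lookup π i))
maxCosets-eval {n} C π = orFin-cong n (λ i → orFin-≟ n (C i) (lookup π i))

hits-count : ∀ {n} (C : CosetSet n) π → ∃[ k ] (hits C π ≡ fromℕ k × maxCosets C π ≡ isPositive k)
hits-count {n} C π = countFin n (λ i → C i (lookup π i)) , sym (fromℕ-countFin n (λ i → C i (lookup π i))) ,
  trans (maxCosets-eval C π) (orFin-count n (λ i → C i (lookup π i)))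

size-total : ∀ {n} (C : CosetSet n) → fromℕ (size C) ≡ total (𝟙 C)
size-total {n} C = trans (fromℕ-ΣℕFin n (λ i → countFin n (λ j → C i j))) (∑-cong (λ i → fromℕ-countFin n (λ j → C i j)))

private
  lt : ∀ {n} → Fin n → Fin n → ℚ
  lt i k = b2q (does (i Fin.<? k))

  ν-lt : ∀ {n} (i k : Fin n) → ν i k ≡ lt i k + lt k i
  ν-lt i k with Fin.<-cmp i k
  ... | tri< i<k i≢k k≮i = trans (ν-≢ i≢k) (sym (cong₂ (λ s t → b2q s + b2q t) (dec-true (i Fin.<? k) i<k)
      (dec-false (k Fin.<? i) k≮i)))
  ... | tri≈ i≮k refl k≮i = trans (ν-refl i) (sym (cong₂ (λ s t → b2q s + b2q t) (dec-false (i Fin.<? k) i≮k)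
      (dec-false (k Fin.<? i) k≮i)))
  ... | tri> i≮k i≢k k<i = trans (ν-≢ i≢k) (sym (cong₂ (λ s t → b2q s + b2q t) (dec-false (i Fin.<? k) i≮k)
      (dec-true (k Fin.<? i) k<i)))

  pairs-∑ : ∀ {n} (C : CosetSet n) → fromℕ (nonDisjointPairs C) ≡ ∑₄ (λ i j k l → lt i k * (𝟙 C i j * 𝟙 C k l * ν j l))
  pairs-∑ {n} C = trans (fromℕ-ΣℕFin n _) (∑-cong λ i → trans (fromℕ-ΣℕFin n _)
      (∑-cong λ j → trans (fromℕ-ΣℕFin n _) (∑-cong λ k → trans (fromℕ-countFin n _) (∑-cong λ l →
    trans (b2q-∧ (C i j) _) (trans (cong (𝟙 C i j *_) (trans (b2q-∧ (C k l) _)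
        (cong (𝟙 C k l *_) (trans (b2q-∧ (does (i Fin.<? k)) _) (cong (lt i k *_) (b2q-not (does (j Fin.≟ l))))))))
      (shuffle (𝟙 C i j) (𝟙 C k l) (lt i k) (ν j l)))))))
    where
    shuffle = solve 4 (λ a b c d → a :* (b :* (c :* d)) := c :* (a :* b :* d)) refl

∑₄-flip : ∀ {n} (H : Fin n → Fin n → Fin n → Fin n → ℚ) → ∑₄ H ≡ ∑₄ (λ i j k l → H k l i j)
∑₄-flip H = begin
  ∑ (λ i → ∑ (λ j → ∑ (λ k → ∑ (λ l → H i j k l))))   ≡⟨ ∑-cong (λ i → ∑-swap (λ j k → ∑ (λ l → H i j k l))) ⟩
  ∑ (λ i → ∑ (λ k → ∑ (λ j → ∑ (λ l → H i j k l))))   ≡⟨ ∑-swap (λ i k → ∑ (λ j → ∑ (λ l → H i j k l))) ⟩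
  ∑ (λ k → ∑ (λ i → ∑ (λ j → ∑ (λ l → H i j k l))))   ≡⟨ ∑-cong (λ k → ∑-cong (λ i → ∑-swap (λ j l → H i j k l))) ⟩
  ∑ (λ k → ∑ (λ i → ∑ (λ l → ∑ (λ j → H i j k l))))   ≡⟨ ∑-cong (λ k → ∑-swap (λ i l → ∑ (λ j → H i j k l))) ⟩
  ∑ (λ k → ∑ (λ l → ∑ (λ i → ∑ (λ j → H i j k l))))   ∎
  where open ≡-Reasoning

∑₄-+ : ∀ {n} (G H : Fin n → Fin n → Fin n → Fin n → ℚ) → ∑₄ (λ i j k l → G i j k l + H i j k l) ≡ ∑₄ G + ∑₄ H
∑₄-+ G H = trans (∑∑-cong (λ i j → ∑∑-+ (G i j) (H i j))) (∑∑-+ (λ i j → ∑∑ (G i j)) (λ i j → ∑∑ (H i j)))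

-- Adding the pair count to its mirror image replaces the orientation i < k by i ≠ k, a condition
-- that is polynomial in deltas.
ordered-pairs : ∀ {n} (C : CosetSet n) → fromℕ 2 * fromℕ (nonDisjointPairs C) ≡ ∑₄
    (λ i j k l → 𝟙 C i j * 𝟙 C k l * (ν i k * ν j l))
ordered-pairs {n} C = begin
  fromℕ 2 * fromℕ (nonDisjointPairs C)
    ≡⟨ cong (fromℕ 2 *_) (pairs-∑ C) ⟩
  fromℕ 2 * ∑₄ P
    ≡⟨ double (∑₄ P) ⟩
  ∑₄ P + ∑₄ P
    ≡⟨ cong (λ t → ∑₄ P + t) (trans (∑₄-flip P) (∑₄-cong (λ i j k l → cong (lt k i *_)
        (cong₂ _*_ (*-comm (𝟙 C k l) (𝟙 C i j)) (cong (λ t → 1ℚ - t) (δ-sym l j)))))) ⟩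
  ∑₄ P + ∑₄ (λ i j k l → lt k i * (𝟙 C i j * 𝟙 C k l * ν j l))
    ≡⟨ trans (sym (∑₄-+ P (λ i j k l → lt k i * (𝟙 C i j * 𝟙 C k l * ν j l))))
        (∑₄-cong (λ i j k l → trans (gather (lt i k) (lt k i) (𝟙 C i j * 𝟙 C k l) (ν j l))
        (cong (λ t → 𝟙 C i j * 𝟙 C k l * (t * ν j l)) (sym (ν-lt i k))))) ⟩
  ∑₄ (λ i j k l → 𝟙 C i j * 𝟙 C k l * (ν i k * ν j l)) ∎
  where
  open ≡-Reasoning
  P : Fin n → Fin n → Fin n → Fin n → ℚ
  P i j k l = lt i k * (𝟙 C i j * 𝟙 C k l * ν j l)
  double = solve 1 (λ a → con (fromℕ 2) :* a := a :+ a) refl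
  gather = solve 4 (λ s t c v → s :* (c :* v) :+ t :* (c :* v) := c :* ((s :+ t) :* v)) refl

ordered-sum : ∀ {n} (a : Matrix n) → ∑₄ (λ i j k l → a i j * a k l * (ν i k * ν j l)) ≡
  total a * total a - ∑ (λ i → row a i * row a i) - ∑ (λ j → col a j * col a j) + energy a
ordered-sum {n} a = begin
  ∑₄ (λ i j k l → a i j * a k l * (ν i k * ν j l))
    ≡⟨ ∑∑-cong (λ i j → trans (∑∑-cong (λ k l → expand (a i j) (a k l) (δ i k) (δ j l)))
        (trans (∑∑-*ˡ (a i j) (λ k l → a k l - δ i k * a k l - δ j l * a k l + δ i k * (δ j l * a k l)))
        (cong (a i j *_) (inner i j)))) ⟩
  ∑∑ (λ i j → a i j * (total a - row a i - col a j + a i j))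
    ≡⟨ ∑∑-cong (λ i j → expand′ (a i j) (total a) (row a i) (col a j)) ⟩
  ∑∑ (λ i j → total a * a i j - row a i * a i j - col a j * a i j + a i j * a i j)
    ≡⟨ trans (∑∑-+ (λ i j → total a * a i j - row a i * a i j - col a j * a i j) (λ i j → a i j * a i j)) (cong (_+ energy a)
       (trans (∑∑-minus (λ i j → total a * a i j - row a i * a i j) (λ i j → col a j * a i j)) (cong₂ _-_
         (trans (∑∑-minus (λ i j → total a * a i j) (λ i j → row a i * a i j))
             (cong₂ _-_ (∑∑-*ˡ (total a) a) (∑-cong (λ i → ∑-*ˡ (row a i) (a i)))))
         (trans (∑-swap (λ i j → col a j * a i j)) (∑-cong (λ j → ∑-*ˡ (col a j) (λ i → a i j))))))) ⟩
  total a * total a - ∑ (λ i → row a i * row a i) - ∑ (λ j → col a j * col a j) + energy a ∎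
  where
  open ≡-Reasoning
  expand = solve 4 (λ a b d e → a :* b :* ((con 1ℚ :- d) :* (con 1ℚ :- e)) := a :* (b :- d :* b :- e :* b :+ d :* (e :* b))) refl
  expand′ = solve 4 (λ a t r c → a :* (t :- r :- c :+ a) := t :* a :- r :* a :- c :* a :+ a :* a) refl
  inner : ∀ i j → ∑∑ (λ k l → a k l - δ i k * a k l - δ j l * a k l + δ i k * (δ j l * a k l)) ≡ total a - row a i - col a j + a
      i j
  inner i j = trans (∑∑-+ (λ k l → a k l - δ i k * a k l - δ j l * a k l) (λ k l → δ i k * (δ j l * a k l))) (cong₂ _+_
    (trans (∑∑-minus (λ k l → a k l - δ i k * a k l) (λ k l → δ j l * a k l)) (cong₂ _-_
      (trans (∑∑-minus a (λ k l → δ i k * a k l)) (cong (λ t → total a - t)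
          (trans (∑-cong (λ k → ∑-*ˡ (δ i k) (a k))) (∑-δʳ i (row a)))))
      (∑-cong (λ k → ∑-δʳ j (a k)))))
    (trans (∑-cong (λ k → trans (∑-*ˡ (δ i k) (λ l → δ j l * a k l)) (cong (δ i k *_) (∑-δʳ j (a k))))) (∑-δʳ i (λ k → a k j))))

-- S² - S counts ordered pairs of distinct cosets of C containing π. Disjoint pairs never occur, and
-- a non-disjoint pair has probability 1/(n(n-1)).
𝔼-pairs : ∀ {n} (C : CosetSet n) →
  fromℕ n * (fromℕ n - 1ℚ) * 𝔼 n (λ π → hits C π * hits C π - hits C π) ≡ fromℕ 2 * fromℕ (nonDisjointPairs C)
𝔼-pairs {n} C = begin
  N * (N - 1ℚ) * 𝔼 n (λ π → hits C π * hits C π - hits C π)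
    ≡⟨ cong (N * (N - 1ℚ) *_) (𝔼-minus n (λ π → hits C π * hits C π) (hits C)) ⟩
  N * (N - 1ℚ) * (𝔼 n (λ π → hits C π * hits C π) - 𝔼 n (hits C))
    ≡⟨ regroup N (𝔼 n (λ π → hits C π * hits C π)) (𝔼 n (hits C)) ⟩
  N * (N - 1ℚ) * 𝔼 n (λ π → hits C π * hits C π) - (N - 1ℚ) * (N * 𝔼 n (hits C))
    ≡⟨ cong₂ (λ s t → s - (N - 1ℚ) * t) (𝔼-lin² (𝟙 C)) (trans (𝔼-lin (𝟙 C)) (∑∑-cong (λ i j → sym (b2q-idem (C i j))))) ⟩
  N * e + (t * t - P - Q) - (N - 1ℚ) * e
    ≡⟨ tidy N e t P Q ⟩
  t * t - P - Q + e
    ≡⟨ sym (ordered-sum (𝟙 C)) ⟩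
  ∑₄ (λ i j k l → 𝟙 C i j * 𝟙 C k l * (ν i k * ν j l))
    ≡⟨ sym (ordered-pairs C) ⟩
  fromℕ 2 * fromℕ (nonDisjointPairs C) ∎
  where
  open ≡-Reasoning
  N = fromℕ n
  e = energy (𝟙 C)
  t = total (𝟙 C)
  P = ∑ (λ i → row (𝟙 C) i * row (𝟙 C) i)
  Q = ∑ (λ j → col (𝟙 C) j * col (𝟙 C) j)
  regroup = solve 3 (λ N a b → N :* (N :- con 1ℚ) :* (a :- b) := N :* (N :- con 1ℚ) :* a :- (N :- con 1ℚ) :* (N :* b)) refl
  tidy = solve 5 (λ N e t p q → N :* e :+ (t :* t :- p :- q) :- (N :- con 1ℚ) :* e := t :* t :- p :- q :+ e) refl

private
  xor-bound : ∀ g k → b2q (g xor isPositive k) ≤ (b2q g - fromℕ k) * (b2q g - fromℕ k)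
  xor-bound true  zero    = ≤-refl {1ℚ}
  xor-bound false zero    = lit 0ℚ
  xor-bound true  (suc k) = sq≥0 (1ℚ - fromℕ (suc k))
  xor-bound false (suc k) = subst (λ t → 1ℚ ≤ (0ℚ - t) * (0ℚ - t)) (sym (fromℕ-suc k)) (bound (fromℕ k) (fromℕ≥0 k))
    where
    bound : ∀ t → 0ℚ ≤ t → 1ℚ ≤ (0ℚ - (1ℚ + t)) * (0ℚ - (1ℚ + t))
    bound t h = ≤-by (lit (fromℕ 2) ⊗ h ⊕ h ⊗ h) (solve 1 (λ t → (con 0ℚ :- (con 1ℚ :+ t)) :* (con 0ℚ :- (con 1ℚ :+ t)) := con 1ℚ
        :+ (con (fromℕ 2) :* t :+ t :* t)) refl t)

  fromℕ-2+ : ∀ k → fromℕ (suc (suc k)) ≡ fromℕ 2 + fromℕ k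
  fromℕ-2+ = fromℕ-+ 2

  -- The left side vanishes for k ≤ 1, and for k ≥ 2 a bit is at distance at least k - 1 from k.
  -- Hence closeness of some Boolean function to `hits C` already limits the number of non-disjoint
  -- pairs.
  pair-bound : ∀ g k → fromℕ k * fromℕ k - fromℕ k ≤ fromℕ 2 * ((b2q g - fromℕ k) * (b2q g - fromℕ k))
  pair-bound g zero          = lit (fromℕ 2) ⊗ sq≥0 (b2q g - 0ℚ)
  pair-bound g (suc zero)    = lit (fromℕ 2) ⊗ sq≥0 (b2q g - 1ℚ)
  pair-bound g (suc (suc k)) = subst (λ t → t * t - t ≤ fromℕ 2 * ((b2q g - t) * (b2q g - t))) (sym (fromℕ-2+ k))
      (bound g (fromℕ k) (fromℕ≥0 k))
    where
    bound : ∀ g t → 0ℚ ≤ t → (fromℕ 2 + t) * (fromℕ 2 + t) - (fromℕ 2 + t) ≤ fromℕ 2 *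
        ((b2q g - (fromℕ 2 + t)) * (b2q g - (fromℕ 2 + t)))
    bound true  t h = ≤-by (h ⊕ h ⊗ h) (solve 1 (λ t → con (fromℕ 2) :*
        ((con 1ℚ :- (con (fromℕ 2) :+ t)) :* (con 1ℚ :- (con (fromℕ 2) :+ t))) := (con (fromℕ 2) :+ t) :* (con (fromℕ 2) :+ t) :-
        (con (fromℕ 2) :+ t) :+ (t :+ t :* t)) refl t)
    bound false t h = ≤-by (lit (fromℕ 6) ⊕ lit (fromℕ 5) ⊗ h ⊕ h ⊗ h)
        (solve 1 (λ t → con (fromℕ 2) :* ((con 0ℚ :- (con (fromℕ 2) :+ t)) :* (con 0ℚ :- (con (fromℕ 2) :+ t))) :=
        (con (fromℕ 2) :+ t) :* (con (fromℕ 2) :+ t) :- (con (fromℕ 2) :+ t) :+ (con (fromℕ 6) :+ con (fromℕ 5) :* t :+ t :* t))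
        refl t)

  max-bound : ∀ k → (b2q (isPositive k) - fromℕ k) * (b2q (isPositive k) - fromℕ k) ≤ fromℕ k * fromℕ k - fromℕ k
  max-bound zero    = lit 0ℚ
  max-bound (suc k) = subst (λ t → (1ℚ - t) * (1ℚ - t) ≤ t * t - t) (sym (fromℕ-suc k)) (bound (fromℕ k) (fromℕ≥0 k))
    where
    bound : ∀ t → 0ℚ ≤ t → (1ℚ - (1ℚ + t)) * (1ℚ - (1ℚ + t)) ≤ (1ℚ + t) * (1ℚ + t) - (1ℚ + t)
    bound t h = ≤-by h (solve 1 (λ t → (con 1ℚ :+ t) :* (con 1ℚ :+ t) :- (con 1ℚ :+ t) := (con 1ℚ :- (con 1ℚ :+ t)) :*
        (con 1ℚ :- (con 1ℚ :+ t)) :+ t) refl t)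

Pr-hits : ∀ n (f : Perm n → Bool) (C : CosetSet n) → Pr n (λ π → f π xor maxCosets C π) ≤ sqDist n (λ π → b2q (f π)) (hits C)
Pr-hits n f C = 𝔼-mono n {λ π → b2q (f π xor maxCosets C π)} {λ π → (b2q (f π) - hits C π) * (b2q (f π) - hits C π)}
    (λ π _ → pointwise π (hits-count C π))
  where
  pointwise : ∀ π → ∃[ k ] (hits C π ≡ fromℕ k × maxCosets C π ≡ isPositive k) → b2q (f π xor maxCosets C π) ≤
      (b2q (f π) - hits C π) * (b2q (f π) - hits C π)
  pointwise π (k , e , e′) = subst₂ _≤_ (cong (λ t → b2q (f π xor t)) (sym e′))
      (cong (λ t → (b2q (f π) - t) * (b2q (f π) - t)) (sym e)) (xor-bound (f π) k)

𝔼-pairs≤ : ∀ n (f : Perm n → Bool) (C : CosetSet n) → 𝔼 n (λ π → hits C π * hits C π - hits C π) ≤ fromℕ 2 * sqDist n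
    (λ π → b2q (f π)) (hits C)
𝔼-pairs≤ n f C = ≤-trans (𝔼-mono n {λ π → hits C π * hits C π - hits C π}
    {λ π → fromℕ 2 * ((b2q (f π) - hits C π) * (b2q (f π) - hits C π))}
    (λ π _ → pointwise π (hits-count C π)))
  (≤-reflexive (𝔼-*ˡ n (fromℕ 2) (λ π → (b2q (f π) - hits C π) * (b2q (f π) - hits C π))))
  where
  pointwise : ∀ π → ∃[ k ] (hits C π ≡ fromℕ k × maxCosets C π ≡ isPositive k) → hits C π * hits C π - hits C π ≤ fromℕ 2 *
      ((b2q (f π) - hits C π) * (b2q (f π) - hits C π))
  pointwise π (k , e , _) = subst (λ t → t * t - t ≤ fromℕ 2 * ((b2q (f π) - t) * (b2q (f π) - t))) (sym e) (pair-bound (f π) k)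

maxCosets-hits : ∀ n (C : CosetSet n) → sqDist n (λ π → b2q (maxCosets C π)) (hits C) ≤ 𝔼 n (λ π → hits C π * hits C π - hits C π)
maxCosets-hits n C = 𝔼-mono n {λ π → (b2q (maxCosets C π) - hits C π) * (b2q (maxCosets C π) - hits C π)}
    {λ π → hits C π * hits C π - hits C π} (λ π _ → pointwise π (hits-count C π))
  where
  pointwise : ∀ π → ∃[ k ] (hits C π ≡ fromℕ k × maxCosets C π ≡ isPositive k) → (b2q (maxCosets C π) - hits C π) *
      (b2q (maxCosets C π) - hits C π) ≤ hits C π * hits C π - hits C π
  pointwise π (k , e , e′) = subst₂ _≤_ (cong₂ (λ s t → (b2q s - t) * (b2q s - t)) (sym e′) (sym e))
      (cong (λ t → t * t - t) (sym e)) (max-bound k)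

pairs≤ : ∀ n (f : Perm n → Bool) (C : CosetSet n) → 1ℚ ≤ fromℕ n →
  fromℕ (nonDisjointPairs C) ≤ sqDist n (λ π → b2q (f π)) (hits C) * (fromℕ n * fromℕ n)
pairs≤ n f C h = conclude (fromℕ n) (fromℕ (nonDisjointPairs C)) (𝔼 n (λ π → hits C π * hits C π - hits C π))
    (sqDist n (λ π → b2q (f π)) (hits C))
  h (𝔼-pairs C) (𝔼-pairs≤ n f C) (𝔼≥0 n {λ π → (b2q (f π) - hits C π) * (b2q (f π) - hits C π)}
      (λ π _ → sq≥0 (b2q (f π) - hits C π)))
  where
  conclude : ∀ N P e d → 1ℚ ≤ N → N * (N - 1ℚ) * e ≡ fromℕ 2 * P → e ≤ fromℕ 2 * d → 0ℚ ≤ d → P ≤ d * (N * N)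
  conclude N P e d hN hP he hd = *-cancelˡ-≤ {P} {d * (N * N)} {fromℕ 2} (toWitness {a? = 1ℚ ≤? fromℕ 2} _)
      (≤-trans (≤-reflexive (sym hP)) raw)
    where
    raw : N * (N - 1ℚ) * e ≤ fromℕ 2 * (d * (N * N))
    raw = ≤-by (≤-trans (lit 1ℚ) hN ⊗ gap hN ⊗ gap he ⊕ lit (fromℕ 2) ⊗ (≤-trans (lit 1ℚ) hN) ⊗ hd)
        (solve 3 (λ N e d → con (fromℕ 2) :* (d :* (N :* N)) := N :* (N :- con 1ℚ) :* e :+
        (N :* (N :- con 1ℚ) :* (con (fromℕ 2) :* d :- e) :+ con (fromℕ 2) :* N :* d)) refl N e d)

-- Integrality and rounding

Integral : ℚ → Set
Integral q = ∃[ k ] q ≡ fromℤ k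

int-+ : ∀ {p q} → Integral p → Integral q → Integral (p + q)
int-+ (a , refl) (b , refl) = a ℤ.+ b , sym (fromℤ-+ a b)

int-* : ∀ {p q} → Integral p → Integral q → Integral (p * q)
int-* (a , refl) (b , refl) = a ℤ.* b , sym (fromℤ-* a b)

int-1 : Integral 1ℚ
int-1 = + 1 , refl

int-neg : ∀ {p} → Integral p → Integral (- p)
int-neg {p} h = subst Integral (lemma p) (int-* (ℤ.-[1+ 0 ] , refl) h)
  where
  lemma = solve 1 (λ p → (:- (con 1ℚ)) :* p := (:- p)) refl

int-- : ∀ {p q} → Integral p → Integral q → Integral (p - q)
int-- h k = int-+ h (int-neg k)

int-b2q : ∀ b → Integral (b2q b)
int-b2q true  = + 1 , refl
int-b2q false = + 0 , refl

int-∑ : ∀ {n} {F : Fin n → ℚ} → (∀ i → Integral (F i)) → Integral (∑ F)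
int-∑ {zero}  h = + 0 , refl
int-∑ {suc n} h = int-+ (h zero) (int-∑ (h ∘ suc))

int-fromℕ : ∀ k → Integral (fromℕ k)
int-fromℕ k = + k , refl

int-gap : ∀ {w} → Integral w → w ≡ 0ℚ ⊎ 1ℚ ≤ w * w
int-gap (+ zero , e)        = inj₁ e
int-gap (+ suc m , refl)    = inj₂ (*-mono-≥0 {1ℚ} {fromℕ (suc m)} {1ℚ} {fromℕ (suc m)} (lit 1ℚ) (lit 1ℚ) (1≤fromℕ-suc m)
    (1≤fromℕ-suc m))
int-gap (ℤ.-[1+ m ] , refl) = inj₂ (subst (1ℚ ≤_) (fromℤ-* ℤ.-[1+ m ] ℤ.-[1+ m ])
    (fromℕ-mono {1} {suc (m ℕ.+ m ℕ.* suc m)} (ℕ.s≤s ℕ.z≤n)))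

n≤3⌊n/2⌋ : ∀ n → 2 ℕ.≤ n → n ℕ.≤ 3 ℕ.* ⌊ n /2⌋
n≤3⌊n/2⌋ (suc zero) (ℕ.s≤s ())
n≤3⌊n/2⌋ (suc (suc zero)) _ = ℕ.s≤s (ℕ.s≤s ℕ.z≤n)
n≤3⌊n/2⌋ (suc (suc (suc zero))) _ = ℕ.s≤s (ℕ.s≤s (ℕ.s≤s ℕ.z≤n))
n≤3⌊n/2⌋ (suc (suc (suc (suc n)))) _ = subst (4 ℕ.+ n ℕ.≤_) (sym (ℕ.*-suc 3 ⌊ 2 ℕ.+ n /2⌋))
  (ℕ.≤-trans (ℕ.n≤1+n (4 ℕ.+ n)) (ℕ.+-monoʳ-≤ 3 (n≤3⌊n/2⌋ (suc (suc n)) (ℕ.s≤s (ℕ.s≤s ℕ.z≤n)))))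

dist²-gap : ∀ A w → A * A ≤ (+ 1 / 16) → Integral w → A * A ≤ (A + w) * (A + w)
dist²-gap A w hA hw with int-gap hw
... | inj₁ refl = ≤-reflexive (cong (λ t → t * t) (sym (+-identityʳ A)))
... | inj₂ h    = ≤-by (sq≥0 (½ * w + fromℕ 2 * A) ⊕ lit (+ 3 / 4) ⊗ gap h ⊕ lit (fromℕ 4) ⊗ gap hA ⊕ lit ½)
    (solve 2 (λ A w → (A :+ w) :* (A :+ w) := A :* A :+ ((con ½ :* w :+ con (fromℕ 2) :* A) :* (con ½ :* w :+ con (fromℕ 2) :* A)
    :+ con (+ 3 / 4) :* (w :* w :- con 1ℚ) :+ con (fromℕ 4) :* (con (+ 1 / 16) :- A :* A) :+ con ½)) refl A w)

-- For |A| ≤ 1/4 the integer nearest to A + z is z, so no integer, in particular none of -1, 0, 1,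
-- is closer to A + z than |A|.
dist²≥ : ∀ A z → A * A ≤ (+ 1 / 16) → Integral z → A * A ≤ dist² (A + z)
dist²≥ A z hA hz = dist²-glb (A + z) (dist²-gap A z hA hz)
  (≤-trans (dist²-gap A (z - 1ℚ) hA (int-- hz int-1)) (≤-reflexive (cong (λ t → t * t) (sym (+-assoc A z (- 1ℚ))))))
  (≤-trans (dist²-gap A (z + 1ℚ) hA (int-+ hz int-1)) (≤-reflexive (cong (λ t → t * t) (sym (+-assoc A z 1ℚ)))))

-- Perturbation by η: for each of the three targets, a² ≤ 2b² + 2(a - b)².
dist²-shift-≥ : ∀ c η → ½ * dist² c - η * η ≤ dist² (c - η)
dist²-shift-≥ c η = dist²-glb (c - η) (bound (dist² c) c η 0ℚ (≤-trans (dist²≤sq c) (≤-reflexive (zero-shift c)))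
    (zero-shift′ c η))
  (bound (dist² c) c η 1ℚ (dist²≤χ false c) refl) (bound (dist² c) c η (- 1ℚ) (dist²≤χ true c) refl)
  where
  zero-shift = solve 1 (λ c → c :* c := (c :- con 0ℚ) :* (c :- con 0ℚ)) refl
  zero-shift′ = solve 2 (λ c η → (c :- η) :* (c :- η) := (c :- η :- con 0ℚ) :* (c :- η :- con 0ℚ)) refl
  bound : ∀ d c η g {s} → d ≤ (c - g) * (c - g) → s ≡ (c - η - g) * (c - η - g) → ½ * d - η * η ≤ s
  bound d c η g h refl = ≤-by (lit ½ ⊗ gap h ⊕ lit ½ ⊗ sq≥0 (c - g - fromℕ 2 * η))
      (solve 4 (λ d c η g → (c :- η :- g) :* (c :- η :- g) := con ½ :* d :- η :* η :+
      (con ½ :* ((c :- g) :* (c :- g) :- d) :+ con ½ :* ((c :- g :- con (fromℕ 2) :* η) :* (c :- g :- con (fromℕ 2) :* η)))) refl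
      d c η g)

-- 12288 = 4·3072. In `count-bad` the energies of the row and the column through an entry carry the
-- weight 3072 N, so each of them takes at most N²/4 from a budget of 2N².
θ : ℚ
θ = + 1 / 12288

-- All rows and columns light

module Light (n : ℕ) (I : ℚ) (NI : fromℕ n * I ≡ 1ℚ) (I≥0 : 0ℚ ≤ I) (1≤N-1 : 1ℚ ≤ fromℕ n - 1ℚ) (f : Perm n → Bool) where
  open Projection n I NI I≥0 1≤N-1 f
  open Frames n f ĉ p using (dist²-minors)

  module _ (2≤n : 2 ℕ.≤ n) where

    -- 6168 = 3·2056, as n ≤ 3⌊n/2⌋ for n ≥ 2.
    dist²-total : ∑₄ (λ i k j l → dist² (Δ ĉ i k j l)) ≤ fromℕ 6168 * (N * N * N) * residual²
    dist²-total = conclude N (fromℕ ⌊ n /2⌋) (∑₄ (λ i k j l → dist² (Δ ĉ i k j l))) residual² 1≤N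
      (subst (N ≤_) (fromℕ-* 3 ⌊ n /2⌋) (fromℕ-mono {n} {3 ℕ.* ⌊ n /2⌋} (n≤3⌊n/2⌋ n 2≤n)))
      (∑∑≥0 (λ i k → ∑∑≥0 (λ j l → dist²≥0 (Δ ĉ i k j l)))) dist²-minors
      where
      conclude : ∀ N M S r → 1ℚ ≤ N → N ≤ fromℕ 3 * M → 0ℚ ≤ S → M * S ≤ N * N * (N * N) * (fromℕ 2056 * r) → S ≤ fromℕ 6168 *
          (N * N * N) * r
      conclude N M S r h hM hS H = *-cancelˡ-≤ {S} {fromℕ 6168 * (N * N * N) * r} {N} h raw
        where
        raw : N * S ≤ N * (fromℕ 6168 * (N * N * N) * r)
        raw = ≤-by (gap hM ⊗ hS ⊕ lit (fromℕ 3) ⊗ gap H) (solve 4 (λ N M S r → N :* (con (fromℕ 6168) :* (N :* N :* N) :* r) := N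
            :* S :+ ((con (fromℕ 3) :* M :- N) :* S :+ con (fromℕ 3) :*
            (N :* N :* (N :* N) :* (con (fromℕ 2056) :* r) :- M :* S))) refl N M S r)

  C : CosetSet n
  C i j = does ((+ 3 / 4) ≤? ĉ i j)

  a : Matrix n
  a i j = ĉ i j - 𝟙 C i j

  bad : Matrix n
  bad i j = b2q (does ((+ 1 / 256) ≤? dist² (ĉ i j)))

  module _ (p≤½ : p ≤ ½) where

    private
      -½≤ĉ : ∀ i j → - ½ ≤ ĉ i j
      -½≤ĉ i j = ≤-trans (neg-antimono-≤ p≤½) (-p≤ĉ i j)

    a²≤1 : ∀ i j → a i j * a i j ≤ 1ℚ
    a²≤1 i j = by (ĉ i j) (-½≤ĉ i j) (ĉ≤1 i j) ((+ 3 / 4) ≤? ĉ i j)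
      where
      by : ∀ c → - ½ ≤ c → c ≤ 1ℚ → (d : Dec ((+ 3 / 4) ≤ c)) → (c - b2q (does d)) * (c - b2q (does d)) ≤ 1ℚ
      by c lo hi (yes h) = ≤-by (gap h ⊗ gap hi ⊕ lit (+ 1 / 4) ⊗ gap h ⊕ lit (+ 15 / 16))
          (solve 1 (λ c → con 1ℚ := (c :- con 1ℚ) :* (c :- con 1ℚ) :+
          ((c :- con (+ 3 / 4)) :* (con 1ℚ :- c) :+ con (+ 1 / 4) :* (c :- con (+ 3 / 4)) :+ con (+ 15 / 16))) refl c)
      by c lo hi (no _) = ≤-by (gap hi ⊗ gap lo ⊕ lit ½ ⊗ gap hi) (solve 1
          (λ c → con 1ℚ := (c :- con 0ℚ) :* (c :- con 0ℚ) :+ ((con 1ℚ :- c) :* (c :- (:- (con ½))) :+ con ½ :* (con 1ℚ :- c)))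
          refl c)

    -- A good entry is within 1/16 of -1, 0 or 1. The bound ĉ ≥ -1/2 excludes -1, and the cut-off
    -- 3/4 in `C` sends the entry to the right one of 0 and 1.
    a²-good : ∀ i j → bad i j ≡ 0ℚ → a i j * a i j ≤ (+ 1 / 256)
    a²-good i j = by (ĉ i j) (-½≤ĉ i j) (ĉ≤1 i j) ((+ 3 / 4) ≤? ĉ i j) ((+ 1 / 256) ≤? dist² (ĉ i j))
      where
      low : ∀ c → c * c ≤ (+ 1 / 256) → (+ 3 / 4) ≤ c → ⊥
      low c h h′ = toWitnessFalse {a? = (+ 9 / 16) ≤? (+ 1 / 256)} _ (≤-trans raw h)
        where
        raw : (+ 9 / 16) ≤ c * c
        raw = ≤-by (gap h′ ⊗ gap h′ ⊕ lit (+ 3 / 2) ⊗ gap h′) (solve 1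
            (λ c → c :* c := con (+ 9 / 16) :+ ((c :- con (+ 3 / 4)) :* (c :- con (+ 3 / 4)) :+ con (+ 3 / 2) :*
            (c :- con (+ 3 / 4)))) refl c)
      high : ∀ c → (c - 1ℚ) * (c - 1ℚ) ≤ (+ 1 / 256) → c ≤ (+ 3 / 4) → ⊥
      high c h h′ = toWitnessFalse {a? = (+ 1 / 16) ≤? (+ 1 / 256)} _ (≤-trans raw h)
        where
        raw : (+ 1 / 16) ≤ (c - 1ℚ) * (c - 1ℚ)
        raw = ≤-by (gap h′ ⊗ gap h′ ⊕ lit ½ ⊗ gap h′) (solve 1 (λ c → (c :- con 1ℚ) :* (c :- con 1ℚ) := con (+ 1 / 16) :+
            ((con (+ 3 / 4) :- c) :* (con (+ 3 / 4) :- c) :+ con ½ :* (con (+ 3 / 4) :- c))) refl c)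
      belowZero : ∀ c → (c + 1ℚ) * (c + 1ℚ) ≤ (+ 1 / 256) → - ½ ≤ c → ⊥
      belowZero c h h′ = toWitnessFalse {a? = (+ 1 / 4) ≤? (+ 1 / 256)} _ (≤-trans raw h)
        where
        raw : (+ 1 / 4) ≤ (c + 1ℚ) * (c + 1ℚ)
        raw = ≤-by (gap h′ ⊗ gap h′ ⊕ gap h′) (solve 1 (λ c → (c :+ con 1ℚ) :* (c :+ con 1ℚ) := con (+ 1 / 4) :+
            ((c :- (:- (con ½))) :* (c :- (:- (con ½))) :+ (c :- (:- (con ½))))) refl c)
      minus-zero = solve 1 (λ c → c :* c := (c :- con 0ℚ) :* (c :- con 0ℚ)) refl
      split : ∀ c {k} → dist² c ≤ k → (c * c ≤ k) ⊎ ((c - 1ℚ) * (c - 1ℚ) ≤ k) ⊎ ((c + 1ℚ) * (c + 1ℚ) ≤ k)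
      split c {k} h = select (⊓-sel (c * c) (((c - 1ℚ) * (c - 1ℚ)) ⊓ ((c + 1ℚ) * (c + 1ℚ))))
          (⊓-sel ((c - 1ℚ) * (c - 1ℚ)) ((c + 1ℚ) * (c + 1ℚ))) h
        where
        select : ∀ {x y z w d : ℚ} → d ≡ x ⊎ d ≡ w → w ≡ y ⊎ w ≡ z → d ≤ k → (x ≤ k) ⊎ (y ≤ k) ⊎ (z ≤ k)
        select (inj₁ refl) _           h = inj₁ h
        select (inj₂ refl) (inj₁ refl) h = inj₂ (inj₁ h)
        select (inj₂ refl) (inj₂ refl) h = inj₂ (inj₂ h)
      by : ∀ c → - ½ ≤ c → c ≤ 1ℚ → (d : Dec ((+ 3 / 4) ≤ c)) → (b : Dec ((+ 1 / 256) ≤ dist² c)) → b2q (does b) ≡ 0ℚ →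
          (c - b2q (does d)) * (c - b2q (does d)) ≤ (+ 1 / 256)
      by c lo hi d (yes _) ()
      by c lo hi d (no ¬b) _ = go d (split c (<⇒≤ (≰⇒> ¬b)))
        where
        go : (d : Dec ((+ 3 / 4) ≤ c)) → (c * c ≤ (+ 1 / 256)) ⊎ ((c - 1ℚ) * (c - 1ℚ) ≤ (+ 1 / 256)) ⊎
            ((c + 1ℚ) * (c + 1ℚ) ≤ (+ 1 / 256)) →
          (c - b2q (does d)) * (c - b2q (does d)) ≤ (+ 1 / 256)
        go (yes h) (inj₁ h₀)        = ⊥-elim (low c h₀ h)
        go (no _)  (inj₁ h₀)        = ≤-trans (≤-reflexive (sym (minus-zero c))) h₀
        go (yes _) (inj₂ (inj₁ h₁)) = h₁
        go (no ¬h) (inj₂ (inj₁ h₁)) = ⊥-elim (high c h₁ (<⇒≤ (≰⇒> ¬h)))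
        go d       (inj₂ (inj₂ h₂)) = ⊥-elim (belowZero c h₂ lo)

    badAt : Fin n → Fin n → Fin n → Fin n → ℚ
    badAt i k j l = bad i j + bad k j + bad i l + bad k l

    -- With four good corners |Δ a| ≤ 4/16, and Δ ĉ differs from Δ a by the integer Δ of `𝟙 C`, so
    -- `dist²≥` applies. If a corner is bad, the trivial bound 16 on the squared minor is charged to
    -- it.
    minor-bound : ∀ i k j l → Δ a i k j l * Δ a i k j l ≤ dist² (Δ ĉ i k j l) + fromℕ 16 * badAt i k j l
    minor-bound i k j l = by ((+ 1 / 256) ≤? dist² (ĉ i j)) ((+ 1 / 256) ≤? dist² (ĉ k j)) ((+ 1 / 256) ≤? dist² (ĉ i l))
        ((+ 1 / 256) ≤? dist² (ĉ k l)) refl refl refl refl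
      where
      cs : ∀ a b c d → (a - b - c + d) * (a - b - c + d) ≤ fromℕ 4 * (a * a + b * b + c * c + d * d)
      cs a b c d = ≤-by (sq≥0 (a + b) ⊕ sq≥0 (a + c) ⊕ sq≥0 (a - d) ⊕ sq≥0 (b - c) ⊕ sq≥0 (b + d) ⊕ sq≥0 (c + d))
          (solve 4 (λ a b c d → con (fromℕ 4) :* (a :* a :+ b :* b :+ c :* c :+ d :* d) := (a :- b :- c :+ d) :*
          (a :- b :- c :+ d) :+ ((a :+ b) :* (a :+ b) :+ (a :+ c) :* (a :+ c) :+ (a :- d) :* (a :- d) :+ (b :- c) :* (b :- c) :+
          (b :+ d) :* (b :+ d) :+ (c :+ d) :* (c :+ d))) refl a b c d)
      sum4 : ∀ a b c d k → a ≤ k → b ≤ k → c ≤ k → d ≤ k → fromℕ 4 * (a + b + c + d) ≤ fromℕ 16 * k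
      sum4 a b c d k ha hb hc hd = ≤-by (lit (fromℕ 4) ⊗ (gap ha ⊕ gap hb ⊕ gap hc ⊕ gap hd))
          (solve 5 (λ a b c d k → con (fromℕ 16) :* k := con (fromℕ 4) :* (a :+ b :+ c :+ d) :+ con (fromℕ 4) :*
          (k :- a :+ (k :- b) :+ (k :- c) :+ (k :- d))) refl a b c d k)
      Δ²≤ : ∀ k′ → a i j * a i j ≤ k′ → a k j * a k j ≤ k′ → a i l * a i l ≤ k′ → a k l * a k l ≤ k′ → Δ a i k j l * Δ a i k j l
          ≤ fromℕ 16 * k′
      Δ²≤ k′ h₁ h₂ h₃ h₄ = ≤-trans (cs (a i j) (a k j) (a i l) (a k l))
          (sum4 (a i j * a i j) (a k j * a k j) (a i l * a i l) (a k l * a k l) k′ h₁ h₂ h₃ h₄)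
      Δ-split = solve 8 (λ c₁ c₂ c₃ c₄ b₁ b₂ b₃ b₄ → c₁ :- b₁ :- (c₂ :- b₂) :- (c₃ :- b₃) :+ (c₄ :- b₄) :+ (b₁ :- b₂ :- b₃ :+ b₄)
          := c₁ :- c₂ :- c₃ :+ c₄) refl
      pad : ∀ d b → 0ℚ ≤ d → 1ℚ ≤ b → fromℕ 16 * 1ℚ ≤ d + fromℕ 16 * b
      pad d b hd hb = ≤-by (hd ⊕ lit (fromℕ 16) ⊗ gap hb) (solve 2 (λ d b → d :+ con (fromℕ 16) :* b := con (fromℕ 16) :* con 1ℚ
          :+ (d :+ con (fromℕ 16) :* (b :- con 1ℚ))) refl d b)
      pad₀ : ∀ d b → 0ℚ ≤ b → d ≤ d + fromℕ 16 * b
      pad₀ d b hb = ≤-by (lit (fromℕ 16) ⊗ hb) refl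
      bad≥0 : ∀ i j → 0ℚ ≤ bad i j
      bad≥0 i j = b2q≥0 (does ((+ 1 / 256) ≤? dist² (ĉ i j)))
      one : ∀ w x y z → 0ℚ ≤ w → 0ℚ ≤ x → 0ℚ ≤ y → 0ℚ ≤ z → (1ℚ ≤ w) ⊎ (1ℚ ≤ x) ⊎ (1ℚ ≤ y) ⊎ (1ℚ ≤ z) → 1ℚ ≤ w + x + y + z
      one w x y z hw hx hy hz (inj₁ h) = ≤-by (gap h ⊕ hx ⊕ hy ⊕ hz)
          (solve 4 (λ w x y z → w :+ x :+ y :+ z := con 1ℚ :+ (w :- con 1ℚ :+ x :+ y :+ z)) refl w x y z)
      one w x y z hw hx hy hz (inj₂ (inj₁ h)) = ≤-by (hw ⊕ gap h ⊕ hy ⊕ hz)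
          (solve 4 (λ w x y z → w :+ x :+ y :+ z := con 1ℚ :+ (w :+ (x :- con 1ℚ) :+ y :+ z)) refl w x y z)
      one w x y z hw hx hy hz (inj₂ (inj₂ (inj₁ h))) = ≤-by (hw ⊕ hx ⊕ gap h ⊕ hz)
          (solve 4 (λ w x y z → w :+ x :+ y :+ z := con 1ℚ :+ (w :+ x :+ (y :- con 1ℚ) :+ z)) refl w x y z)
      one w x y z hw hx hy hz (inj₂ (inj₂ (inj₂ h))) = ≤-by (hw ⊕ hx ⊕ hy ⊕ gap h)
          (solve 4 (λ w x y z → w :+ x :+ y :+ z := con 1ℚ :+ (w :+ x :+ y :+ (z :- con 1ℚ))) refl w x y z)
      large : (1ℚ ≤ bad i j) ⊎ (1ℚ ≤ bad k j) ⊎ (1ℚ ≤ bad i l) ⊎ (1ℚ ≤ bad k l) → Δ a i k j l * Δ a i k j l ≤ dist² (Δ ĉ i k j l)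
          + fromℕ 16 * badAt i k j l
      large h = ≤-trans (Δ²≤ 1ℚ (a²≤1 i j) (a²≤1 k j) (a²≤1 i l) (a²≤1 k l))
        (pad (dist² (Δ ĉ i k j l)) (badAt i k j l) (dist²≥0 (Δ ĉ i k j l))
            (one (bad i j) (bad k j) (bad i l) (bad k l) (bad≥0 i j) (bad≥0 k j) (bad≥0 i l) (bad≥0 k l) h))
      by : ∀ {P₁ P₂ P₃ P₄ : Set} (d₁ : Dec P₁) (d₂ : Dec P₂) (d₃ : Dec P₃) (d₄ : Dec P₄) →
        bad i j ≡ b2q (does d₁) → bad k j ≡ b2q (does d₂) → bad i l ≡ b2q (does d₃) → bad k l ≡ b2q (does d₄) →
        Δ a i k j l * Δ a i k j l ≤ dist² (Δ ĉ i k j l) + fromℕ 16 * badAt i k j l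
      by (yes _) _ _ _ e _ _ _ = large (inj₁ (≤-reflexive (sym e)))
      by _ (yes _) _ _ _ e _ _ = large (inj₂ (inj₁ (≤-reflexive (sym e))))
      by _ _ (yes _) _ _ _ e _ = large (inj₂ (inj₂ (inj₁ (≤-reflexive (sym e)))))
      by _ _ _ (yes _) _ _ _ e = large (inj₂ (inj₂ (inj₂ (≤-reflexive (sym e)))))
      by (no _) (no _) (no _) (no _) e₁ e₂ e₃ e₄ = ≤-trans (dist²≥ (Δ a i k j l) (Δ (𝟙 C) i k j l)
          (Δ²≤ (+ 1 / 256) (a²-good i j e₁) (a²-good k j e₂) (a²-good i l e₃) (a²-good k l e₄))
          (int-+ (int-- (int-- (int-b2q (C i j)) (int-b2q (C k j))) (int-b2q (C i l))) (int-b2q (C k l))))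
        (≤-trans (≤-reflexive (cong dist² (Δ-split (ĉ i j) (ĉ k j) (ĉ i l) (ĉ k l) (𝟙 C i j) (𝟙 C k j) (𝟙 C i l) (𝟙 C k l))))
          (pad₀ (dist² (Δ ĉ i k j l)) (badAt i k j l) (bad≥0 i j ⊕ bad≥0 k j ⊕ bad≥0 i l ⊕ bad≥0 k l)))

  module _ (light-row : ∀ i → ∑ (λ j → ĉ i j * ĉ i j) ≤ θ * N) (light-col : ∀ j → ∑ (λ i → ĉ i j * ĉ i j) ≤ θ * N) (N-large : fromℕ 1536 ≤ N) where

    private
      Q : Matrix n
      Q i j = ∑∑ (λ k l → dist² (Δ ĉ i k j l))

      η : Fin n → Fin n → Fin n → Fin n → ℚ
      η i j k l = ĉ k j + ĉ i l - ĉ k l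

      -- Averaged over (k, l), the minor Δ ĉ i k j l is ĉ i j up to an error of small second moment.
      ∑η² : ∀ i j → ∑∑ (λ k l → η i j k l * η i j k l) ≤ fromℕ 3 * (N * ∑ (λ k → ĉ k j * ĉ k j) + N * ∑ (λ l → ĉ i l * ĉ i l) +
          energy ĉ)
      ∑η² i j = ≤-trans (∑∑-mono (λ k l → cs (ĉ k j) (ĉ i l) (ĉ k l)))
          (≤-reflexive (trans (∑∑-*ˡ (fromℕ 3) (λ k l → ĉ k j * ĉ k j + ĉ i l * ĉ i l + ĉ k l * ĉ k l)) (cong (fromℕ 3 *_)
        (trans (∑∑-+ (λ k l → ĉ k j * ĉ k j + ĉ i l * ĉ i l) (λ k l → ĉ k l * ĉ k l))
            (cong (_+ energy ĉ) (trans (∑∑-+ (λ k l → ĉ k j * ĉ k j) (λ k l → ĉ i l * ĉ i l))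
          (cong₂ _+_ (trans (∑-cong (λ k → ∑-const n (ĉ k j * ĉ k j))) (∑-*ˡ N (λ k → ĉ k j * ĉ k j)))
              (∑-const n (∑ (λ l → ĉ i l * ĉ i l))))))))))
        where
        cs : ∀ a b c → (a + b - c) * (a + b - c) ≤ fromℕ 3 * (a * a + b * b + c * c)
        cs a b c = ≤-by (sq≥0 (a - b) ⊕ sq≥0 (a + c) ⊕ sq≥0 (b + c)) (solve 3
            (λ a b c → con (fromℕ 3) :* (a :* a :+ b :* b :+ c :* c) := (a :+ b :- c) :* (a :+ b :- c) :+
            ((a :- b) :* (a :- b) :+ (a :+ c) :* (a :+ c) :+ (b :+ c) :* (b :+ c))) refl a b c)

      dist²≤Q : ∀ i j → N * (N * (½ * dist² (ĉ i j))) - ∑∑ (λ k l → η i j k l * η i j k l) ≤ Q i j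
      dist²≤Q i j = ≤-trans (≤-reflexive (sym (trans (∑∑-minus (λ _ _ → ½ * dist² (ĉ i j)) (λ k l → η i j k l * η i j k l))
          (cong (λ t → t - ∑∑ (λ k l → η i j k l * η i j k l)) (∑∑-const n n (½ * dist² (ĉ i j)))))))
        (∑∑-mono (λ k l → ≤-trans (dist²-shift-≥ (ĉ i j) (η i j k l))
            (≤-reflexive (cong dist² (regroup (ĉ i j) (ĉ k j) (ĉ i l) (ĉ k l))))))
        where
        regroup = solve 4 (λ a b c d → a :- (b :+ c :- d) := a :- b :- c :+ d) refl

    -- A bad entry spoils a positive proportion of the minors through it: they equal the entry up to
    -- `η`, whose second moment is small because the row, the column and the whole matrix are light.
    -- So bad entries can be counted by the sum of `dist²` over the minors.
    bad≤Q : ∀ i j → bad i j * (N * N) ≤ fromℕ 1024 * Q i j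
    bad≤Q i j = by ((+ 1 / 256) ≤? dist² (ĉ i j))
      where
      -- After multiplication by 1024 the entry supplies 2N². The error takes at most 3072·2θN² +
      -- 768(N-1) = N²/2 + 768(N-1), which is below N² once N ≥ 1536.
      count-bad : ∀ N d c r e x q → (+ 1 / 256) ≤ d → c ≤ θ * N → r ≤ θ * N → fromℕ 4 * e ≤ N - 1ℚ → fromℕ 1536 ≤ N → x ≤ fromℕ 3
          * (N * c + N * r + e) → N * (N * (½ * d)) - x ≤ q → 1ℚ * (N * N) ≤ fromℕ 1024 * q
      count-bad N d c r e x q hd hc hr he hN hx hq = ≤-by
        (lit (fromℕ 512) ⊗ (sq≥0 N) ⊗ gap hd ⊕ lit (fromℕ 3072) ⊗ N≥0 ⊗ gap hc ⊕ lit (fromℕ 3072) ⊗ N≥0 ⊗ gap hr ⊕ lit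
            (fromℕ 768) ⊗ gap he ⊕ lit (fromℕ 1024) ⊗ gap hx ⊕ lit (fromℕ 1024) ⊗ gap hq ⊕ lit ½ ⊗ N≥0 ⊗ gap hN ⊕ lit (fromℕ 768))
        (expand N d c r e x q)
        where
        N≥0 : 0ℚ ≤ N
        N≥0 = ≤-trans (lit (fromℕ 1536)) hN
        expand = solve 7 (λ N d c r e x q → con (fromℕ 1024) :* q := con 1ℚ :* (N :* N) :+
            (con (fromℕ 512) :* (N :* N) :* (d :- con (+ 1 / 256)) :+ con (fromℕ 3072) :* N :* (con (+ 1 / 12288) :* N :- c) :+
            con (fromℕ 3072) :* N :* (con (+ 1 / 12288) :* N :- r) :+ con (fromℕ 768) :* (N :- con 1ℚ :- con (fromℕ 4) :* e) :+
            con (fromℕ 1024) :* (con (fromℕ 3) :* (N :* c :+ N :* r :+ e) :- x) :+ con (fromℕ 1024) :*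
            (q :- (N :* (N :* (con ½ :* d)) :- x)) :+ con ½ :* N :* (N :- con (fromℕ 1536)) :+ con (fromℕ 768))) refl
      by : (d : Dec ((+ 1 / 256) ≤ dist² (ĉ i j))) → b2q (does d) * (N * N) ≤ fromℕ 1024 * Q i j
      by (yes h) = count-bad N (dist² (ĉ i j)) (∑ (λ k → ĉ k j * ĉ k j)) (∑ (λ l → ĉ i l * ĉ i l)) (energy ĉ)
          (∑∑ (λ k l → η i j k l * η i j k l)) (Q i j)
        h (light-col j) (light-row i) 4energy≤N-1 N-large (∑η² i j) (dist²≤Q i j)
      by (no _)  = ≤-trans (≤-reflexive (*-zeroˡ (N * N))) (lit (fromℕ 1024) ⊗ ∑∑≥0 (λ k l → dist²≥0 (Δ ĉ i k j l)))

    private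
      S : ℚ
      S = ∑₄ (λ i k j l → dist² (Δ ĉ i k j l))

      ∑∑bad≤S : ∑∑ bad * (N * N) ≤ fromℕ 1024 * S
      ∑∑bad≤S = ≤-trans (≤-reflexive (sym (trans (∑-cong (λ i → ∑-*ʳ (N * N) (bad i))) (∑-*ʳ (N * N) (λ i → ∑ (bad i))))))
        (≤-trans (∑∑-mono bad≤Q) (≤-reflexive (trans (∑∑-*ˡ (fromℕ 1024) Q)
            (cong (fromℕ 1024 *_) (∑-cong (λ i → ∑-swap (λ j k → ∑ (λ l → dist² (Δ ĉ i k j l)))))))))

      ∑badAt : ∑₄ (λ i k j l → bad i j + bad k j + bad i l + bad k l) ≡ fromℕ 4 * (N * N * ∑∑ bad)
      ∑badAt = trans (trans (∑₄-+ (λ i k j l → bad i j + bad k j + bad i l) (λ i k j l → bad k l))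
          (cong₂ _+_ (trans (∑₄-+ (λ i k j l → bad i j + bad k j) (λ i k j l → bad i l))
          (cong₂ _+_ (trans (∑₄-+ (λ i k j l → bad i j) (λ i k j l → bad k j)) (cong₂ _+_ s₁ s₂)) s₃)) s₄))
              (collect (N * N * ∑∑ bad))
        where
        B = ∑∑ bad
        collect = solve 1 (λ b → b :+ b :+ b :+ b := con (fromℕ 4) :* b) refl
        inner : ∀ i → ∑∑ {n} {n} (λ j l → bad i j) ≡ N * ∑ (bad i)
        inner i = trans (∑-cong (λ j → ∑-const n (bad i j))) (∑-*ˡ N (bad i))
        inner′ : ∀ i → ∑∑ {n} {n} (λ j l → bad i l) ≡ N * ∑ (bad i)
        inner′ i = ∑-const n (∑ (bad i))
        outer : ∑∑ {n} {n} (λ i k → N * ∑ (bad i)) ≡ N * N * B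
        outer = trans (∑-cong (λ i → ∑-const n (N * ∑ (bad i)))) (trans (∑-*ˡ N (λ i → N * ∑ (bad i)))
            (trans (cong (N *_) (∑-*ˡ N (λ i → ∑ (bad i)))) (sym (*-assoc N N B))))
        outer′ : ∑∑ {n} {n} (λ i k → N * ∑ (bad k)) ≡ N * N * B
        outer′ = trans (∑-swap {n} {n} (λ i k → N * ∑ (bad k))) outer
        s₁ : ∑₄ (λ i k j l → bad i j) ≡ N * N * B
        s₁ = trans (∑∑-cong {n} {n} (λ i k → inner i)) outer
        s₂ : ∑₄ (λ i k j l → bad k j) ≡ N * N * B
        s₂ = trans (∑∑-cong {n} {n} (λ i k → inner k)) outer′
        s₃ : ∑₄ (λ i k j l → bad i l) ≡ N * N * B
        s₃ = trans (∑∑-cong {n} {n} (λ i k → inner′ i)) outer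
        s₄ : ∑₄ (λ i k j l → bad k l) ≡ N * N * B
        s₄ = trans (∑∑-cong {n} {n} (λ i k → inner′ k)) outer′

    module _ (p≤½ : p ≤ ½) (2≤n : 2 ℕ.≤ n) where

      private
        -- 65537 = 1 + 16·4·1024: each entry is a corner of 4N² quadruples, each bad corner is
        -- charged 16, and N² times the number of bad entries is at most 1024 S.
        minors-a : minors a ≤ fromℕ 65537 * S
        minors-a = ≤-trans (∑₄-mono (minor-bound p≤½)) (≤-trans (≤-reflexive
            (trans (∑₄-+ (λ i k j l → dist² (Δ ĉ i k j l)) (λ i k j l → fromℕ 16 * (bad i j + bad k j + bad i l + bad k l)))
            (cong (λ t → S + t) (trans (∑₄-*ˡ (fromℕ 16) (λ i k j l → bad i j + bad k j + bad i l + bad k l))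
                (cong (fromℕ 16 *_) ∑badAt)))))
          (conclude S (∑∑ bad) N ∑∑bad≤S))
          where
          conclude : ∀ S B N → B * (N * N) ≤ fromℕ 1024 * S → S + fromℕ 16 * (fromℕ 4 * (N * N * B)) ≤ fromℕ 65537 * S
          conclude S B N h = ≤-by (lit (fromℕ 64) ⊗ gap h) (solve 3 (λ S B N → con (fromℕ 65537) :* S := S :+ con (fromℕ 16) :*
              (con (fromℕ 4) :* (N :* N :* B)) :+ con (fromℕ 64) :* (con (fromℕ 1024) :* S :- B :* (N :* N))) refl S B N)

        μ V κ : ℚ
        μ = 𝔼 n (lin a)
        V = 𝔼 n (λ π → (lin a π - μ) * (lin a π - μ))
        κ = p + μ

        V≤ : V ≤ fromℕ 65537 * fromℕ 6168 * residual²
        V≤ = conclude N V (minors a) S residual² N-large residual²≥0 (variance-minors a) minors-a (dist²-total 2≤n)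
          where
          conclude : ∀ N V m S r → fromℕ 1536 ≤ N → 0ℚ ≤ r → fromℕ 4 * (N * N) * (N - 1ℚ) * V ≡ m → m ≤ fromℕ 65537 * S → S ≤
              fromℕ 6168 * (N * N * N) * r → V ≤ fromℕ 65537 * fromℕ 6168 * r
          conclude N V m S r hN hr refl h h′ = *-cancelˡ-≤′ {V} {fromℕ 65537 * fromℕ 6168 * r} {fromℕ 4 * (N * N) * (N - 1ℚ)}
              pos-denom raw
            where
            1≤N′ : 1ℚ ≤ N
            1≤N′ = ≤-trans (toWitness {a? = 1ℚ ≤? fromℕ 1536} _) hN
            N≥0 : 0ℚ ≤ N
            N≥0 = ≤-trans (lit 1ℚ) 1≤N′
            pos-denom : 0ℚ < fromℕ 4 * (N * N) * (N - 1ℚ)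
            pos-denom = <-≤-trans (toWitness {a? = 0ℚ <? fromℕ 4} _) (≤-by
                (lit (fromℕ 4) ⊗ (N≥0 ⊗ N≥0) ⊗ (gap hN ⊕ lit (fromℕ 1534)) ⊕ lit (fromℕ 4) ⊗ gap 1≤N′ ⊗
                (gap 1≤N′ ⊕ lit (fromℕ 2))) (expand N))
              where
              expand = solve 1 (λ N → con (fromℕ 4) :* (N :* N) :* (N :- con 1ℚ) := con (fromℕ 4) :+
                  (con (fromℕ 4) :* (N :* N) :* (N :- con (fromℕ 1536) :+ con (fromℕ 1534)) :+ con (fromℕ 4) :* (N :- con 1ℚ) :*
                  (N :- con 1ℚ :+ con (fromℕ 2)))) refl
            raw : fromℕ 4 * (N * N) * (N - 1ℚ) * V ≤ fromℕ 4 * (N * N) * (N - 1ℚ) * (fromℕ 65537 * fromℕ 6168 * r)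
            raw = ≤-by (gap h ⊕ lit (fromℕ 65537) ⊗ gap h′ ⊕ lit (fromℕ 65537 * fromℕ 6168) ⊗ hr ⊗ (N≥0 ⊗ N≥0) ⊗
                (lit (fromℕ 3) ⊗ gap hN ⊕ lit (fromℕ 4604))) (expand N V S r)
              where
              expand = solve 4 (λ N V S r → con (fromℕ 4) :* (N :* N) :* (N :- con 1ℚ) :*
                  (con (fromℕ 65537) :* con (fromℕ 6168) :* r) := con (fromℕ 4) :* (N :* N) :* (N :- con 1ℚ) :* V :+
                  (con (fromℕ 65537) :* S :- con (fromℕ 4) :* (N :* N) :* (N :- con 1ℚ) :* V :+ con (fromℕ 65537) :*
                  (con (fromℕ 6168) :* (N :* N :* N) :* r :- S) :+ con (fromℕ 65537) :* con (fromℕ 6168) :* r :* (N :* N) :*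
                  (con (fromℕ 3) :* (N :- con (fromℕ 1536)) :+ con (fromℕ 4604)))) refl

        N*μ : N * μ ≡ - total (𝟙 C)
        N*μ = trans (𝔼-lin a) (trans (∑∑-minus ĉ (𝟙 C)) (trans (cong (λ t → t - total (𝟙 C)) ĉ-total)
            (+-identityˡ (- total (𝟙 C)))))

      -- An entry in C has square at least 9/16, whereas the energy is at most (N-1)/4. Besides
      -- bounding |C| this controls the constant `κ`.
      2size≤N : fromℕ 2 * total (𝟙 C) ≤ N
      2size≤N = conclude (total (𝟙 C)) (energy ĉ) N (≤-trans (≤-reflexive (sym (∑∑-*ˡ (+ 9 / 16) (𝟙 C))))
          (∑∑-mono (λ i j → cell (ĉ i j) ((+ 3 / 4) ≤? ĉ i j)))) 4energy≤N-1 1≤N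
        where
        cell : ∀ c → (d : Dec ((+ 3 / 4) ≤ c)) → (+ 9 / 16) * b2q (does d) ≤ c * c
        cell c (yes h) = ≤-by (gap h ⊗ gap h ⊕ lit (+ 3 / 2) ⊗ gap h)
            (solve 1 (λ c → c :* c := con (+ 9 / 16) :* con 1ℚ :+ ((c :- con (+ 3 / 4)) :* (c :- con (+ 3 / 4)) :+ con (+ 3 / 2)
            :* (c :- con (+ 3 / 4)))) refl c)
        cell c (no _)  = sq≥0 c
        conclude : ∀ T e N → (+ 9 / 16) * T ≤ e → fromℕ 4 * e ≤ N - 1ℚ → 1ℚ ≤ N → fromℕ 2 * T ≤ N
        conclude T e N h h′ hN = ≤-by (lit (+ 32 / 9) ⊗ gap h ⊕ lit (+ 8 / 9) ⊗ gap h′ ⊕ lit (+ 1 / 9) ⊗ gap hN ⊕ lit 1ℚ)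
            (solve 3 (λ T e N → N := con (fromℕ 2) :* T :+ (con (+ 32 / 9) :* (e :- con (+ 9 / 16) :* T) :+ con (+ 8 / 9) :*
            (N :- con 1ℚ :- con (fromℕ 4) :* e) :+ con (+ 1 / 9) :* (N :- con 1ℚ) :+ con 1ℚ)) refl T e N)

      private
        -- The mean of lin a is -|C|/n, between -½ and 0, and p lies between 0 and ½.
        κ²≤¼ : κ * κ ≤ (+ 1 / 4)
        κ²≤¼ = square κ (*-cancelˡ-≤ {p = - ½} {q = κ} {r = N} 1≤N (lower N p μ (total (𝟙 C)) p≥0 1≤N N*μ 2size≤N))
            (*-cancelˡ-≤ {κ} {½} {N} 1≤N (upper N p μ (total (𝟙 C)) p≤½ 1≤N N*μ (∑∑≥0 (λ i j → b2q≥0 (C i j)))))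
          where
          square : ∀ k → - ½ ≤ k → k ≤ ½ → k * k ≤ (+ 1 / 4)
          square k h h′ = ≤-by (gap h ⊗ gap h′) (solve 1 (λ k → con (+ 1 / 4) := k :* k :+ (k :- (:- (con ½))) :* (con ½ :- k))
              refl k)
          lower : ∀ N p m T → 0ℚ ≤ p → 1ℚ ≤ N → N * m ≡ - T → fromℕ 2 * T ≤ N → N * (- ½) ≤ N * (p + m)
          lower N p m T hp hN e h = ≤-trans raw (≤-reflexive (trans (cong (λ t → N * p + t) (sym e)) (sym (*-distribˡ-+ N p m))))
            where
            raw : N * (- ½) ≤ N * p + (- T)
            raw = ≤-by ((≤-trans (lit 1ℚ) hN) ⊗ hp ⊕ lit ½ ⊗ gap h) (solve 3
                (λ N p T → N :* p :+ (:- T) := N :* (:- (con ½)) :+ (N :* p :+ con ½ :* (N :- con (fromℕ 2) :* T))) refl N p T)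
          upper : ∀ N p m T → p ≤ ½ → 1ℚ ≤ N → N * m ≡ - T → 0ℚ ≤ T → N * (p + m) ≤ N * ½
          upper N p m T hp hN e h = ≤-trans (≤-reflexive (trans (*-distribˡ-+ N p m) (cong (λ t → N * p + t) e))) raw
            where
            raw : N * p + (- T) ≤ N * ½
            raw = ≤-by ((≤-trans (lit 1ℚ) hN) ⊗ gap hp ⊕ h) (solve 3 (λ N p T → N :* con ½ := N :* p :+ (:- T) :+
                (N :* (con ½ :- p) :+ T)) refl N p T)

        int-hits : ∀ π → Integral (F π - hits C π)
        int-hits π = int-- (int-b2q (f π)) (int-∑ (λ i → int-b2q (C i (lookup π i))))

        pointwise : ∀ π → (F π - hits C π) * (F π - hits C π) ≤ fromℕ 8 *
            (residual π * residual π + (lin a π - μ) * (lin a π - μ))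
        pointwise π = ≤-trans (rounded (F π - hits C π) κ κ²≤¼ (int-gap (int-hits π)))
            (≤-trans (≤-reflexive (cong (λ t → fromℕ 4 * (t * t)) split)) (parallelogram (residual π) (lin a π - μ)))
          where
          rounded : ∀ w k → k * k ≤ (+ 1 / 4) → w ≡ 0ℚ ⊎ 1ℚ ≤ w * w → w * w ≤ fromℕ 4 * ((w - k) * (w - k))
          rounded w k hk (inj₁ refl) = lit (fromℕ 4) ⊗ sq≥0 (0ℚ - k)
          rounded w k hk (inj₂ h) = ≤-by (lit (fromℕ 2) ⊗ sq≥0 (w - fromℕ 2 * k) ⊕ gap h ⊕ lit (fromℕ 4) ⊗ gap hk)
              (solve 2 (λ w k → con (fromℕ 4) :* ((w :- k) :* (w :- k)) := w :* w :+
              (con (fromℕ 2) :* ((w :- con (fromℕ 2) :* k) :* (w :- con (fromℕ 2) :* k)) :+ (w :* w :- con 1ℚ) :+ con (fromℕ 4)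
              :* (con (+ 1 / 4) :- k :* k))) refl w k)
          parallelogram : ∀ r s → fromℕ 4 * ((r + s) * (r + s)) ≤ fromℕ 8 * (r * r + s * s)
          parallelogram r s = ≤-by (lit (fromℕ 4) ⊗ sq≥0 (r - s)) (solve 2
              (λ r s → con (fromℕ 8) :* (r :* r :+ s :* s) := con (fromℕ 4) :* ((r :+ s) :* (r :+ s)) :+ con (fromℕ 4) :*
              ((r :- s) :* (r :- s))) refl r s)
          lin-a : lin a π ≡ lin ĉ π - hits C π
          lin-a = ∑-minus (λ i → ĉ i (lookup π i)) (λ i → 𝟙 C i (lookup π i))
          regroup = solve 5 (λ F h p m l → F :- h :- (p :+ m) := F :- p :- l :+ (l :- h :- m)) refl
          split : F π - hits C π - κ ≡ residual π + (lin a π - μ)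
          split = trans (regroup (F π) (hits C π) p μ (lin ĉ π)) (cong (λ t → residual π + (t - μ)) (sym lin-a))

      light-approx : sqDist n F (hits C) ≤ fromℕ 8 * (1ℚ + fromℕ 65537 * fromℕ 6168) * residual²
      light-approx = ≤-trans (𝔼-mono n {λ π → (F π - hits C π) * (F π - hits C π)}
          {λ π → fromℕ 8 * (residual π * residual π + (lin a π - μ) * (lin a π - μ))} (λ π _ → pointwise π))
        (≤-trans (≤-reflexive (trans (𝔼-*ˡ n (fromℕ 8) (λ π → residual π * residual π + (lin a π - μ) * (lin a π - μ)))
            (cong (fromℕ 8 *_) (𝔼-+ n (λ π → residual π * residual π) (λ π → (lin a π - μ) * (lin a π - μ))))))
        (conclude residual² V (fromℕ 65537 * fromℕ 6168) V≤))
        where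
        conclude : ∀ r v c → v ≤ c * r → fromℕ 8 * (r + v) ≤ fromℕ 8 * (1ℚ + c) * r
        conclude r v c h = ≤-by (lit (fromℕ 8) ⊗ gap h) (solve 3 (λ r v c → con (fromℕ 8) :* (con 1ℚ :+ c) :* r := con (fromℕ 8)
            :* (r :+ v) :+ con (fromℕ 8) :* (c :* r :- v)) refl r v c)

-- A heavy row

frame-distinct : ∀ n {s t} → s ≢ t → Distinct (fstOf n s) (sndOf n s) (fstOf n t) (sndOf n t)
frame-distinct n {s} {t} h = (fst≢snd n s , fst≢fst n h , fst≢snd′ n h) , ((λ e → fst≢snd′ n (h ∘ sym) (sym e)) , snd≢snd n h) ,
    fst≢snd n t
  where
  ss : ∀ {n} {i j : Fin n} → Fin.suc (Fin.suc i) ≡ suc (suc j) → i ≡ j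
  ss e = Fin.suc-injective (Fin.suc-injective e)
  fst≢fst : ∀ n {s t} → s ≢ t → fstOf n s ≢ fstOf n t
  fst≢fst (suc (suc n)) {zero}  {zero}  h e = h refl
  fst≢fst (suc (suc n)) {zero}  {suc t} h ()
  fst≢fst (suc (suc n)) {suc s} {zero}  h ()
  fst≢fst (suc (suc n)) {suc s} {suc t} h e = fst≢fst n (h ∘ cong suc) (ss e)
  snd≢snd : ∀ n {s t} → s ≢ t → sndOf n s ≢ sndOf n t
  snd≢snd (suc (suc n)) {zero}  {zero}  h e = h refl
  snd≢snd (suc (suc n)) {zero}  {suc t} h ()
  snd≢snd (suc (suc n)) {suc s} {zero}  h ()
  snd≢snd (suc (suc n)) {suc s} {suc t} h e = snd≢snd n (h ∘ cong suc) (ss e)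
  fst≢snd′ : ∀ n {s t} → s ≢ t → fstOf n s ≢ sndOf n t
  fst≢snd′ (suc (suc n)) {zero}  {zero}  h ()
  fst≢snd′ (suc (suc n)) {zero}  {suc t} h ()
  fst≢snd′ (suc (suc n)) {suc s} {zero}  h ()
  fst≢snd′ (suc (suc n)) {suc s} {suc t} h e = fst≢snd′ n (h ∘ cong suc) (ss e)

sumSq-rest : ∀ {m} (G : Fin m → ℚ) s → sumSq (tabulate G) - lookup (tabulate G) s * lookup (tabulate G) s ≡ ∑
    (λ t → ν t s * (G t * G t))
sumSq-rest G s = sym (trans (∑-cong (λ t → expand (δ t s) (G t * G t)))
    (trans (∑-minus (λ t → G t * G t) (λ t → δ t s * (G t * G t)))
  (cong₂ _-_ (sym (sumᵥ-tabulate (λ d → d * d) G)) (trans (∑-δ s (λ t → G t * G t))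
      (sym (cong (λ t → t * t) (lookup∘tabulate G s)))))))
  where
  expand = solve 2 (λ d g → (con 1ℚ :- d) :* g := g :- d :* g) refl

∑-∑∑-swap : ∀ {k m n} (H : Fin k → Fin m → Fin n → ℚ) → ∑ (λ c → ∑∑ (λ i j → H c i j)) ≡ ∑∑ (λ i j → ∑ (λ c → H c i j))
∑-∑∑-swap H = trans (∑-swap (λ c i → ∑ (H c i))) (∑-cong (λ i → ∑-swap (λ c j → H c i j)))

module HeavyFrames (n : ℕ) (f : Perm n → Bool) (a : Matrix n) (p : ℚ) (a²≤1 : ∀ i j → a i j * a i j ≤ 1ℚ)
  (I : ℚ) (NI : fromℕ n * I ≡ 1ℚ) (1≤N : 1ℚ ≤ fromℕ n) where

  open Frames n f a p

  private
    N : ℚ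
    N = fromℕ n

  D : Fin n → Fin n → Fin n → Fin n → ℚ
  D i k j l = Δ a i k j l * Δ a i k j l

  D≥0 : ∀ i k j l → 0ℚ ≤ D i k j l
  D≥0 i k j l = sq≥0 (Δ a i k j l)

  D≤16 : ∀ i k j l → D i k j l ≤ fromℕ 16
  D≤16 i k j l = bound (a i j) (a k j) (a i l) (a k l) (a²≤1 i j) (a²≤1 k j) (a²≤1 i l) (a²≤1 k l)
    where
    bound : ∀ a b c d → a * a ≤ 1ℚ → b * b ≤ 1ℚ → c * c ≤ 1ℚ → d * d ≤ 1ℚ → (a - b - c + d) * (a - b - c + d) ≤ fromℕ 16
    bound a b c d ha hb hc hd = ≤-by (lit (fromℕ 4) ⊗ (gap ha ⊕ gap hb ⊕ gap hc ⊕ gap hd) ⊕ sq≥0 (a + b) ⊕ sq≥0 (a + c) ⊕ sq≥0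
        (a - d) ⊕ sq≥0 (b - c) ⊕ sq≥0 (b + d) ⊕ sq≥0 (c + d)) (solve 4
        (λ a b c d → con (fromℕ 16) := (a :- b :- c :+ d) :* (a :- b :- c :+ d) :+
        (con (fromℕ 4) :* (con 1ℚ :- a :* a :+ (con 1ℚ :- b :* b) :+ (con 1ℚ :- c :* c) :+ (con 1ℚ :- d :* d)) :+ (a :+ b) :*
        (a :+ b) :+ (a :+ c) :* (a :+ c) :+ (a :- d) :* (a :- d) :+ (b :- c) :* (b :- c) :+ (b :+ d) :* (b :+ d) :+ (c :+ d) :*
        (c :+ d))) refl a b c d)

  module _ (r : Fin n) (s : Fin M) where

    private
      D₂ : Perm n → Perm n → Fin M → ℚ
      D₂ σ π t = minor σ π t * minor σ π t

      -- 160 = 32 + 8·16: `dictator-rest` with a squared minor of at most 16.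
      frame-bound : ∀ σ → IsPerm σ → 𝔼 n (λ π → D₂ σ π s * ∑ (λ t → ν t s * D₂ σ π t)) ≤ fromℕ 160 * err²
      frame-bound σ h = ≤-trans (𝔼-mono n {λ π → D₂ σ π s * ∑ (λ t → ν t s * D₂ σ π t)} {λ π → fromℕ 160 * frameErr σ π}
          (λ π _ → pointwise π))
        (≤-reflexive (trans (𝔼-*ˡ n (fromℕ 160) (frameErr σ)) (cong (fromℕ 160 *_) (𝔼-frameErr σ h))))
        where
        conclude : ∀ d q e → d ≤ fromℕ 16 → 0ℚ ≤ e → d * q ≤ (fromℕ 32 + fromℕ 8 * d) * e → d * q ≤ fromℕ 160 * e
        conclude d q e hd he h = ≤-by (gap h ⊕ lit (fromℕ 8) ⊗ gap hd ⊗ he)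
            (solve 3 (λ d q e → con (fromℕ 160) :* e := d :* q :+ ((con (fromℕ 32) :+ con (fromℕ 8) :* d) :* e :- d :* q :+ con
            (fromℕ 8) :* (con (fromℕ 16) :- d) :* e)) refl d q e)
        pointwise : ∀ π → D₂ σ π s * ∑ (λ t → ν t s * D₂ σ π t) ≤ fromℕ 160 * frameErr σ π
        pointwise π = conclude (D₂ σ π s) (∑ (λ t → ν t s * D₂ σ π t)) (frameErr σ π)
            (D≤16 (lookup σ (fstOf n s)) (lookup σ (sndOf n s)) (lookup π (fstOf n s)) (lookup π (sndOf n s)))
          (FKN.err≥0 (λ y → f (point σ π y)) (p + frameMean n (grid σ π)) (ds σ π))
          (subst₂ (λ u v → u * v ≤ (fromℕ 32 + fromℕ 8 * u) * frameErr σ π) (cong (λ t → t * t) (lookup∘tabulate (minor σ π) s))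
              (sumSq-rest (minor σ π) s)
            (dictator-rest (λ y → f (point σ π y)) (p + frameMean n (grid σ π)) (ds σ π) s))

      N⁴ N⁸ : ℚ
      N⁴ = N ^ℚ 4
      N⁸ = N⁴ * N⁴

      N⁴≥0 : 0ℚ ≤ N⁴
      N⁴≥0 = fromℕ≥0 n ⊗ (fromℕ≥0 n ⊗ (fromℕ≥0 n ⊗ (fromℕ≥0 n ⊗ lit 1ℚ)))

      joint : Fin n → Fin n → Fin n → Fin n → ℚ
      joint i k i′ k′ = ∑₄ (λ j l j′ l′ → ν₄ j l j′ l′ * (D i k j l * D i′ k′ j′ l′))

    -- The products of two squared minors in disjoint rows and disjoint columns, the first of them
    -- through row r. These are the pairs of minors that can occur together in one frame.
    W : ℚ
    W = ∑ (λ k → ∑∑ (λ i′ k′ → ν₄ r k i′ k′ * joint r k i′ k′))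

    private
      selected : Perm n → ℚ
      selected σ = X (fstOf n s) r σ

      W≤ : ∀ {t} → t ≢ s → W ≤ N⁸ * 𝔼 n (λ σ → selected σ * 𝔼 n (λ π → D₂ σ π s * D₂ σ π t))
      W≤ {t} t≢s = begin
        W
          ≡⟨ sym (trans (∑-cong (λ i → trans (∑-cong (λ k → trans (∑∑-cong
              (λ i′ k′ → shuffle (ν₄ i k i′ k′) (δ i r) (joint i k i′ k′)))
              (∑∑-*ˡ (δ i r) (λ i′ k′ → ν₄ i k i′ k′ * joint i k i′ k′))))
               (∑-*ˡ (δ i r) (λ k → ∑∑ (λ i′ k′ → ν₄ i k i′ k′ * joint i k i′ k′)))))
                   (∑-δ r (λ i → ∑ (λ k → ∑∑ (λ i′ k′ → ν₄ i k i′ k′ * joint i k i′ k′))))) ⟩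
        ∑₄ (λ i k i′ k′ → ν₄ i k i′ k′ * (δ i r * joint i k i′ k′))
          ≤⟨ 𝔼-quad (frame-distinct n (t≢s ∘ sym)) (λ i k i′ k′ → δ i r * joint i k i′ k′)
              (λ i k i′ k′ → δ≥0 i r ⊗ ∑∑≥0 (λ j l → ∑∑≥0 (λ j′ l′ → ν₄≥0 j l j′ l′ ⊗ (D≥0 i k j l ⊗ D≥0 i′ k′ j′ l′)))) ⟩
        N⁴ * 𝔼 n (λ σ → selected σ * joint (σ₁ σ) (σ₂ σ) (σ₃ σ) (σ₄ σ))
          ≤⟨ *-monoˡ {𝔼 n (λ σ → selected σ * joint (σ₁ σ) (σ₂ σ) (σ₃ σ) (σ₄ σ))}
              {𝔼 n (λ σ → N⁴ * (selected σ * 𝔼 n (λ π → D₂ σ π s * D₂ σ π t)))} N⁴ N⁴≥0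
               (𝔼-mono n {λ σ → selected σ * joint (σ₁ σ) (σ₂ σ) (σ₃ σ) (σ₄ σ)}
                   {λ σ → N⁴ * (selected σ * 𝔼 n (λ π → D₂ σ π s * D₂ σ π t))} (λ σ _ →
                 ≤-trans (*-monoˡ {joint (σ₁ σ) (σ₂ σ) (σ₃ σ) (σ₄ σ)} {N⁴ * 𝔼 n (λ π → D₂ σ π s * D₂ σ π t)} (selected σ)
                     (X≥0 (fstOf n s) r σ) (inner σ)) (≤-reflexive (shuffle′ (selected σ) N⁴
                     (𝔼 n (λ π → D₂ σ π s * D₂ σ π t)))))) ⟩
        N⁴ * 𝔼 n (λ σ → N⁴ * (selected σ * 𝔼 n (λ π → D₂ σ π s * D₂ σ π t)))
          ≡⟨ trans (cong (N⁴ *_) (𝔼-*ˡ n N⁴ (λ σ → selected σ * 𝔼 n (λ π → D₂ σ π s * D₂ σ π t))))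
              (sym (*-assoc N⁴ N⁴ (𝔼 n (λ σ → selected σ * 𝔼 n (λ π → D₂ σ π s * D₂ σ π t))))) ⟩
        N⁸ * 𝔼 n (λ σ → selected σ * 𝔼 n (λ π → D₂ σ π s * D₂ σ π t)) ∎
        where
        open ≤-Reasoning
        σ₁ σ₂ σ₃ σ₄ : Perm n → Fin n
        σ₁ σ = lookup σ (fstOf n s)
        σ₂ σ = lookup σ (sndOf n s)
        σ₃ σ = lookup σ (fstOf n t)
        σ₄ σ = lookup σ (sndOf n t)
        shuffle = solve 3 (λ v d j → v :* (d :* j) := d :* (v :* j)) refl
        shuffle′ = solve 3 (λ x n e → x :* (n :* e) := n :* (x :* e)) refl
        inner : ∀ σ → joint (σ₁ σ) (σ₂ σ) (σ₃ σ) (σ₄ σ) ≤ N⁴ * 𝔼 n (λ π → D₂ σ π s * D₂ σ π t)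
        inner σ = 𝔼-quad (frame-distinct n (t≢s ∘ sym)) (λ j l j′ l′ → D (σ₁ σ) (σ₂ σ) j l * D (σ₃ σ) (σ₄ σ) j′ l′)
            (λ j l j′ l′ → D≥0 (σ₁ σ) (σ₂ σ) j l ⊗ D≥0 (σ₃ σ) (σ₄ σ) j′ l′)

    -- Only frames in which r is the first row of pair s are counted. They have probability 1/n,
    -- which gives the factor N, and each of the other M - 1 pairs provides the second minor, with
    -- the sum over these pairs bounded by `frame-bound`.
    W-bound : N * ((fromℕ M - 1ℚ) * W) ≤ N ^ℚ 4 * (N ^ℚ 4) * (fromℕ 160 * err²)
    W-bound = begin
      N * ((fromℕ M - 1ℚ) * W)
        ≡⟨ cong (N *_) (sym (trans (∑-*ʳ W (λ t → ν t s)) (cong (_* W)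
            (trans (∑-minus (λ _ → 1ℚ) (λ t → δ t s)) (cong₂ _-_ (trans (∑-const M 1ℚ) (*-identityʳ (fromℕ M)))
            (trans (∑-cong (λ t → δ-sym t s)) (∑-δ-one s))))))) ⟩
      N * ∑ (λ t → ν t s * W)
        ≤⟨ *-monoˡ {∑ (λ t → ν t s * W)} {∑ (λ t → N⁸ * (ν t s * E t))} N (fromℕ≥0 n) (∑-mono (λ t → per-pair t)) ⟩
      N * ∑ (λ t → N⁸ * (ν t s * E t))
        ≡⟨ cong (N *_) (trans (∑-*ˡ N⁸ (λ t → ν t s * E t)) (cong (N⁸ *_) gather)) ⟩
      N * (N⁸ * 𝔼 n (λ σ → selected σ * B σ))
        ≤⟨ *-monoˡ {N⁸ * 𝔼 n (λ σ → selected σ * B σ)} {N⁸ * (I * (fromℕ 160 * err²))} N (fromℕ≥0 n)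
            (*-monoˡ {𝔼 n (λ σ → selected σ * B σ)} {I * (fromℕ 160 * err²)} N⁸ (N⁴≥0 ⊗ N⁴≥0) average) ⟩
      N * (N⁸ * (I * (fromℕ 160 * err²)))
        ≡⟨ trans (regroup N N⁸ I (fromℕ 160 * err²)) (trans (cong (λ t → t * (N⁸ * (fromℕ 160 * err²))) NI)
            (*-identityˡ (N⁸ * (fromℕ 160 * err²)))) ⟩
      N⁸ * (fromℕ 160 * err²) ∎
      where
      open ≤-Reasoning
      E : Fin M → ℚ
      E t = 𝔼 n (λ σ → selected σ * 𝔼 n (λ π → D₂ σ π s * D₂ σ π t))
      B : Perm n → ℚ
      B σ = 𝔼 n (λ π → D₂ σ π s * ∑ (λ t → ν t s * D₂ σ π t))
      regroup = solve 4 (λ n m i e → n :* (m :* (i :* e)) := n :* i :* (m :* e)) refl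
      per-pair : ∀ t → ν t s * W ≤ N⁸ * (ν t s * E t)
      per-pair t = by (t Fin.≟ s)
        where
        vanish = solve 3 (λ w n e → (con 1ℚ :- con 1ℚ) :* w := n :* ((con 1ℚ :- con 1ℚ) :* e)) refl
        one = solve 1 (λ w → (con 1ℚ :- con 0ℚ) :* w := w) refl
        by : (d : Dec (t ≡ s)) → (1ℚ - b2q (does d)) * W ≤ N⁸ * ((1ℚ - b2q (does d)) * E t)
        by (yes refl) = ≤-reflexive (vanish W N⁸ (E t))
        by (no t≢s)   = ≤-trans (≤-reflexive (one W)) (≤-trans (W≤ t≢s) (≤-reflexive (cong (N⁸ *_) (sym (one (E t))))))
      gather : ∑ (λ t → ν t s * E t) ≡ 𝔼 n (λ σ → selected σ * B σ)
      gather = sym (trans (𝔼-cong n (λ σ _ → trans (cong (selected σ *_) (expand-B σ))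
          (trans (sym (∑-*ˡ (selected σ) (λ t → ν t s * 𝔼 n (λ π → D₂ σ π s * D₂ σ π t))))
          (∑-cong (λ t → shuffle (selected σ) (ν t s) (𝔼 n (λ π → D₂ σ π s * D₂ σ π t)))))))
        (trans (𝔼-∑ n (λ t σ → ν t s * (selected σ * 𝔼 n (λ π → D₂ σ π s * D₂ σ π t))))
            (∑-cong (λ t → 𝔼-*ˡ n (ν t s) (λ σ → selected σ * 𝔼 n (λ π → D₂ σ π s * D₂ σ π t))))))
        where
        shuffle = solve 3 (λ x v e → x :* (v :* e) := v :* (x :* e)) refl
        expand-B : ∀ σ → B σ ≡ ∑ (λ t → ν t s * 𝔼 n (λ π → D₂ σ π s * D₂ σ π t))
        expand-B σ = trans (𝔼-cong n (λ π _ → trans (sym (∑-*ˡ (D₂ σ π s) (λ t → ν t s * D₂ σ π t)))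
            (∑-cong (λ t → shuffle (D₂ σ π s) (ν t s) (D₂ σ π t)))))
          (trans (𝔼-∑ n (λ t π → ν t s * (D₂ σ π s * D₂ σ π t))) (∑-cong (λ t → 𝔼-*ˡ n (ν t s) (λ π → D₂ σ π s * D₂ σ π t))))
      average : 𝔼 n (λ σ → selected σ * B σ) ≤ I * (fromℕ 160 * err²)
      average = ≤-trans (𝔼-mono n {λ σ → selected σ * B σ} {λ σ → selected σ * (fromℕ 160 * err²)}
          (λ σ h → *-monoˡ {B σ} {fromℕ 160 * err²} (selected σ) (X≥0 (fstOf n s) r σ) (frame-bound σ h)))
        (≤-reflexive (trans (𝔼-*ʳ n (fromℕ 160 * err²) selected) (cong (_* (fromℕ 160 * err²))
            (*-cancel {𝔼 n selected} {I} 1≤N (trans (𝔼-X (fstOf n s) r) (sym NI))))))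

    avoiding : ℚ
    avoiding = ∑∑ (λ i k → ν r i * ν r k * rowMinors a i k)

    private
      ν-row : ∀ i k j l → ν i k * D i k j l ≡ D i k j l
      ν-row i k j l = ν-absorb i k λ { refl → cong (λ t → t * t) (Δ-degenerate-row i j l) }
      ν-col : ∀ i k j l → ν j l * D i k j l ≡ D i k j l
      ν-col i k j l = ν-absorb j l λ { refl → cong (λ t → t * t) (Δ-degenerate-col i k j) }

      clash : Fin n → Fin n → Fin n → Fin n → Fin n → Fin n → Fin n → ℚ
      clash k i′ k′ j l j′ l′ = δ k i′ + δ k k′ + (δ j j′ + δ j l′ + (δ l j′ + δ l l′))

      six : ∀ d₁ d₂ d₃ d₄ d₅ d₆ → Fin 6 → ℚ
      six d₁ d₂ d₃ d₄ d₅ d₆ zero = d₁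
      six d₁ d₂ d₃ d₄ d₅ d₆ (suc zero) = d₂
      six d₁ d₂ d₃ d₄ d₅ d₆ (suc (suc zero)) = d₃
      six d₁ d₂ d₃ d₄ d₅ d₆ (suc (suc (suc zero))) = d₄
      six d₁ d₂ d₃ d₄ d₅ d₆ (suc (suc (suc (suc zero)))) = d₅
      six d₁ d₂ d₃ d₄ d₅ d₆ (suc (suc (suc (suc (suc zero))))) = d₆

      bernoulli-step : ∀ x s d → x ≤ 1ℚ → 0ℚ ≤ x → 1ℚ - s ≤ x → 0ℚ ≤ d → d ≤ 1ℚ →
        (x * (1ℚ - d) ≤ 1ℚ) × (0ℚ ≤ x * (1ℚ - d)) × (1ℚ - (s + d) ≤ x * (1ℚ - d))
      bernoulli-step x s d hx x≥0 hs d≥0 d≤1 = ≤-by (gap hx ⊕ x≥0 ⊗ d≥0) (e₁ x d) , x≥0 ⊗ gap d≤1 , ≤-by (gap hs ⊕ gap hx ⊗ d≥0)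
          (e₂ x s d)
        where
        e₁ = solve 2 (λ x d → con 1ℚ := x :* (con 1ℚ :- d) :+ (con 1ℚ :- x :+ x :* d)) refl
        e₂ = solve 3 (λ x s d → x :* (con 1ℚ :- d) := con 1ℚ :- (s :+ d) :+ (x :- (con 1ℚ :- s) :+ (con 1ℚ :- x) :* d)) refl

      -- The Bernoulli (union) bound: the probability-like product of the six distinctness
      -- conditions loses at most the sum of the six coincidences.
      bernoulli : ∀ (d : Fin 6 → ℚ) → (∀ i → 0ℚ ≤ d i) → (∀ i → d i ≤ 1ℚ) →
        let d₁ = d zero; d₂ = d (suc zero); d₃ = d (suc (suc zero)); d₄ = d (suc (suc (suc zero))); d₅ = d (suc (suc (suc (suc zero)))); d₆ = d (suc (suc (suc (suc (suc zero))))) in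
        1ℚ - (d₁ + d₂ + d₃ + d₄ + d₅ + d₆) ≤ (1ℚ - d₁) * (1ℚ - d₂) * (1ℚ - d₃) * (1ℚ - d₄) * (1ℚ - d₅) * (1ℚ - d₆)
      bernoulli d lo hi = proj₂ (proj₂ s₆)
        where
        i₁ i₂ i₃ i₄ i₅ i₆ : Fin 6
        i₁ = zero
        i₂ = suc zero
        i₃ = suc (suc zero)
        i₄ = suc (suc (suc zero))
        i₅ = suc (suc (suc (suc zero)))
        i₆ = suc (suc (suc (suc (suc zero))))
        x₁ = 1ℚ - d i₁
        x₂ = x₁ * (1ℚ - d i₂)
        x₃ = x₂ * (1ℚ - d i₃)
        x₄ = x₃ * (1ℚ - d i₄)
        x₅ = x₄ * (1ℚ - d i₅)
        step₁ = solve 1 (λ d → con 1ℚ := con 1ℚ :- d :+ d) refl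
        s₂ = bernoulli-step x₁ (d i₁) (d i₂) (≤-by (lo i₁) (step₁ (d i₁))) (gap (hi i₁)) ≤-refl (lo i₂) (hi i₂)
        s₃ = bernoulli-step x₂ (d i₁ + d i₂) (d i₃) (proj₁ s₂) (proj₁ (proj₂ s₂)) (proj₂ (proj₂ s₂)) (lo i₃) (hi i₃)
        s₄ = bernoulli-step x₃ (d i₁ + d i₂ + d i₃) (d i₄) (proj₁ s₃) (proj₁ (proj₂ s₃)) (proj₂ (proj₂ s₃)) (lo i₄) (hi i₄)
        s₅ = bernoulli-step x₄ (d i₁ + d i₂ + d i₃ + d i₄) (d i₅) (proj₁ s₄) (proj₁ (proj₂ s₄)) (proj₂ (proj₂ s₄)) (lo i₅) (hi i₅)
        s₆ = bernoulli-step x₅ (d i₁ + d i₂ + d i₃ + d i₄ + d i₅) (d i₆) (proj₁ s₅) (proj₁ (proj₂ s₅)) (proj₂ (proj₂ s₅)) (lo i₆)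
            (hi i₆)

      -- Of the twelve distinctness factors in the two `ν₄`, four are absorbed because degenerate
      -- minors vanish and two belong to `avoiding`. The remaining six link the two minors and are
      -- removed by `bernoulli`, with the first squared minor bounded by 16.
      pointwise : ∀ k i′ k′ j l j′ l′ →
        ν r i′ * ν r k′ * D i′ k′ j′ l′ * (D r k j l - fromℕ 16 * clash k i′ k′ j l j′ l′) ≤ ν₄ r k i′ k′ *
            (ν₄ j l j′ l′ * (D r k j l * D i′ k′ j′ l′))
      pointwise k i′ k′ j l j′ l′ = ≤-trans
        (core (ν r i′ * ν r k′ * P) Q (clash k i′ k′ j l j′ l′) (ν k i′ * ν k k′ * ν j j′ * ν j l′ * ν l j′ * ν l l′)
            (ν≥0 r i′ ⊗ ν≥0 r k′ ⊗ D≥0 i′ k′ j′ l′) (D≥0 r k j l) (D≤16 r k j l)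
          (≤-trans (≤-reflexive (cong (λ t → 1ℚ - t) (assoc (δ k i′) (δ k k′) (δ j j′) (δ j l′) (δ l j′) (δ l l′))))
              (bernoulli (six (δ k i′) (δ k k′) (δ j j′) (δ j l′) (δ l j′) (δ l l′)) lo hi))
          (clash≥0))
        (≤-reflexive (trans (reorder₁ (ν r i′) (ν r k′) (ν k i′) (ν k k′) (ν j j′) (ν j l′) (ν l j′) (ν l l′) P Q)
          (trans (cong₂ (λ u v → ν r i′ * ν r k′ * (ν k i′ * ν k k′) * (ν j j′ * ν j l′ * (ν l j′ * ν l l′)) * (u * v))
              (sym (trans (cong (ν i′ k′ *_) (ν-col i′ k′ j′ l′)) (ν-row i′ k′ j′ l′)))
              (sym (trans (cong (ν r k *_) (ν-col r k j l)) (ν-row r k j l))))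
            (reorder₂ (ν r i′) (ν r k′) (ν k i′) (ν k k′) (ν j j′) (ν j l′) (ν l j′) (ν l l′) P Q (ν i′ k′) (ν j′ l′) (ν r k)
                (ν j l)))))
        where
        P = D i′ k′ j′ l′
        Q = D r k j l
        δ≤1 : ∀ (i j : Fin n) → δ i j ≤ 1ℚ
        δ≤1 i j = b2q≤1 (does (i Fin.≟ j))
        lo : ∀ i → 0ℚ ≤ six (δ k i′) (δ k k′) (δ j j′) (δ j l′) (δ l j′) (δ l l′) i
        lo zero = δ≥0 k i′
        lo (suc zero) = δ≥0 k k′
        lo (suc (suc zero)) = δ≥0 j j′
        lo (suc (suc (suc zero))) = δ≥0 j l′
        lo (suc (suc (suc (suc zero)))) = δ≥0 l j′
        lo (suc (suc (suc (suc (suc zero))))) = δ≥0 l l′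
        hi : ∀ i → six (δ k i′) (δ k k′) (δ j j′) (δ j l′) (δ l j′) (δ l l′) i ≤ 1ℚ
        hi zero = δ≤1 k i′
        hi (suc zero) = δ≤1 k k′
        hi (suc (suc zero)) = δ≤1 j j′
        hi (suc (suc (suc zero))) = δ≤1 j l′
        hi (suc (suc (suc (suc zero)))) = δ≤1 l j′
        hi (suc (suc (suc (suc (suc zero))))) = δ≤1 l l′
        clash≥0 : 0ℚ ≤ clash k i′ k′ j l j′ l′
        clash≥0 = δ≥0 k i′ ⊕ δ≥0 k k′ ⊕ (δ≥0 j j′ ⊕ δ≥0 j l′ ⊕ (δ≥0 l j′ ⊕ δ≥0 l l′))
        assoc = solve 6 (λ a b c d e f → a :+ b :+ (c :+ d :+ (e :+ f)) := a :+ b :+ c :+ d :+ e :+ f) refl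
        core : ∀ w q c x → 0ℚ ≤ w → 0ℚ ≤ q → q ≤ fromℕ 16 → 1ℚ - c ≤ x → 0ℚ ≤ c → w * (q - fromℕ 16 * c) ≤ w * (x * q)
        core w q c x hw hq hq′ h hc = ≤-by (hw ⊗ (gap h ⊗ hq ⊕ gap hq′ ⊗ hc))
            (solve 4 (λ w q c x → w :* (x :* q) := w :* (q :- con (fromℕ 16) :* c) :+ w :*
            ((x :- (con 1ℚ :- c)) :* q :+ (con (fromℕ 16) :- q) :* c)) refl w q c x)
        reorder₁ = solve 10 (λ a b c d e f g h P Q → a :* b :* P :* (c :* d :* e :* f :* g :* h :* Q) := a :* b :* (c :* d) :*
            (e :* f :* (g :* h)) :* (P :* Q)) refl
        reorder₂ = solve 14 (λ a b c d e f g h P Q u v w z → a :* b :* (c :* d) :* (e :* f :* (g :* h)) :*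
            (u :* (v :* P) :* (w :* (z :* Q))) := w :* a :* b :* (c :* d :* u) :* (z :* e :* f :* (g :* h :* v) :* (Q :* P))) refl

    T : ℚ
    T = ∑ (λ k → rowMinors a r k)

    private
      clash-sum : ∀ i′ k′ j′ l′ → ∑ (λ k → ∑∑ (λ j l → clash k i′ k′ j l j′ l′)) ≡ fromℕ 6 * (N * N)
      clash-sum i′ k′ j′ l′ = begin
        ∑ (λ k → ∑∑ (λ j l → clash k i′ k′ j l j′ l′))
          ≡⟨ ∑-cong (λ k → trans (∑∑-+ (λ j l → δ k i′ + δ k k′) (λ j l → δ j j′ + δ j l′ + (δ l j′ + δ l l′)))
              (cong₂ _+_ (∑∑-const n n (δ k i′ + δ k k′)) cols)) ⟩
        ∑ (λ k → N * (N * (δ k i′ + δ k k′)) + fromℕ 4 * N)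
          ≡⟨ trans (∑-+ (λ k → N * (N * (δ k i′ + δ k k′))) (λ _ → fromℕ 4 * N))
              (cong₂ _+_ (trans (∑-*ˡ N (λ k → N * (δ k i′ + δ k k′))) (cong (N *_)
              (trans (∑-*ˡ N (λ k → δ k i′ + δ k k′)) (cong (N *_) (trans (∑-+ (λ k → δ k i′) (λ k → δ k k′))
              (cong₂ _+_ (one i′) (one k′))))))) (∑-const n (fromℕ 4 * N))) ⟩
        N * (N * (1ℚ + 1ℚ)) + N * (fromℕ 4 * N)
          ≡⟨ tidy N ⟩
        fromℕ 6 * (N * N) ∎
        where
        open ≡-Reasoning
        tidy = solve 1 (λ N → N :* (N :* (con 1ℚ :+ con 1ℚ)) :+ N :* (con (fromℕ 4) :* N) := con (fromℕ 6) :* (N :* N)) refl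
        one : ∀ i → ∑ (λ k → δ k i) ≡ 1ℚ
        one i = trans (∑-cong (λ k → δ-sym k i)) (∑-δ-one i)
        tidy′ = solve 1 (λ N → N :* con 1ℚ :+ N :* con 1ℚ :+ N :* (con 1ℚ :+ con 1ℚ) := con (fromℕ 4) :* N) refl
        cols : ∑∑ (λ j l → δ j j′ + δ j l′ + (δ l j′ + δ l l′)) ≡ fromℕ 4 * N
        cols = trans (∑∑-+ (λ j l → δ j j′ + δ j l′) (λ j l → δ l j′ + δ l l′)) (trans (cong₂ _+_
          (trans (∑-cong (λ j → ∑-const n (δ j j′ + δ j l′))) (trans (∑-*ˡ N (λ j → δ j j′ + δ j l′))
              (trans (cong (N *_) (trans (∑-+ (λ j → δ j j′) (λ j → δ j l′)) (cong₂ _+_ (one j′) (one l′))))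
              (*-distribˡ-+ N 1ℚ 1ℚ))))
          (trans (∑-cong {n} (λ j → trans (∑-+ (λ l → δ l j′) (λ l → δ l l′)) (cong₂ _+_ (one j′) (one l′))))
              (∑-const n (1ℚ + 1ℚ)))) (tidy′ N))

    -- Without the linking conditions W would factor as T · `avoiding`. For a fixed second minor the
    -- collisions over (k, j, l) number 6N², counted with multiplicity, and each costs at most 16.
    W≥ : (T - fromℕ 96 * (N * N)) * avoiding ≤ W
    W≥ = begin
      A * avoiding
        ≡⟨ sym (∑∑-*ˡ A (λ i k → ν r i * ν r k * rowMinors a i k)) ⟩
      ∑∑ (λ i′ k′ → A * (ν r i′ * ν r k′ * rowMinors a i′ k′))
        ≡⟨ ∑∑-cong (λ i′ k′ → trans (shuffle A (ν r i′ * ν r k′) (rowMinors a i′ k′))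
            (trans (sym (∑∑-*ˡ (ν r i′ * ν r k′ * A) (λ j′ l′ → D i′ k′ j′ l′))) (∑∑-cong (λ j′ l′ → inner i′ k′ j′ l′)))) ⟩
      ∑₄ (λ i′ k′ j′ l′ → ∑ (λ k → ∑∑ (λ j l → G k i′ k′ j l j′ l′)))
        ≡⟨ ∑∑-cong (λ i′ k′ → trans (sym (∑-∑∑-swap (λ k j′ l′ → ∑∑ (λ j l → G k i′ k′ j l j′ l′))))
            (∑-cong (λ k → ∑₄-flip (λ j′ l′ j l → G k i′ k′ j l j′ l′)))) ⟩
      ∑∑ (λ i′ k′ → ∑ (λ k → ∑₄ (λ j l j′ l′ → G k i′ k′ j l j′ l′)))
        ≡⟨ sym (∑-∑∑-swap (λ k i′ k′ → ∑₄ (λ j l j′ l′ → G k i′ k′ j l j′ l′))) ⟩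
      ∑ (λ k → ∑∑ (λ i′ k′ → ∑₄ (λ j l j′ l′ → G k i′ k′ j l j′ l′)))
        ≤⟨ ∑-mono (λ k → ∑∑-mono (λ i′ k′ → ∑₄-mono (λ j l j′ l′ → pointwise k i′ k′ j l j′ l′))) ⟩
      ∑ (λ k → ∑∑ (λ i′ k′ → ∑₄ (λ j l j′ l′ → ν₄ r k i′ k′ * (ν₄ j l j′ l′ * (D r k j l * D i′ k′ j′ l′)))))
        ≡⟨ ∑-cong (λ k → ∑∑-cong (λ i′ k′ → ∑₄-*ˡ (ν₄ r k i′ k′) (λ j l j′ l′ → ν₄ j l j′ l′ * (D r k j l * D i′ k′ j′ l′)))) ⟩
      W ∎
      where
      open ≤-Reasoning
      A = T - fromℕ 96 * (N * N)
      G : Fin n → Fin n → Fin n → Fin n → Fin n → Fin n → Fin n → ℚ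
      G k i′ k′ j l j′ l′ = ν r i′ * ν r k′ * D i′ k′ j′ l′ * (D r k j l - fromℕ 16 * clash k i′ k′ j l j′ l′)
      shuffle = solve 3 (λ a v m → a :* (v :* m) := v :* a :* m) refl
      shuffle′ = solve 3 (λ v a d → v :* a :* d := v :* d :* a) refl
      six-times = solve 1 (λ m → con (fromℕ 16) :* (con (fromℕ 6) :* m) := con (fromℕ 96) :* m) refl
      inner : ∀ i′ k′ j′ l′ → ν r i′ * ν r k′ * A * D i′ k′ j′ l′ ≡ ∑ (λ k → ∑∑ (λ j l → G k i′ k′ j l j′ l′))
      inner i′ k′ j′ l′ = trans (shuffle′ (ν r i′ * ν r k′) A (D i′ k′ j′ l′))
          (sym (trans (∑-cong (λ k → ∑∑-*ˡ w (λ j l → D r k j l - fromℕ 16 * clash k i′ k′ j l j′ l′)))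
        (trans (∑-*ˡ w (λ k → ∑∑ (λ j l → D r k j l - fromℕ 16 * clash k i′ k′ j l j′ l′)))
            (cong (w *_) (trans (∑-cong (λ k → trans (∑∑-minus (D r k) (λ j l → fromℕ 16 * clash k i′ k′ j l j′ l′))
            (cong (λ t → rowMinors a r k - t) (∑∑-*ˡ (fromℕ 16) (λ j l → clash k i′ k′ j l j′ l′)))))
          (trans (∑-minus (λ k → rowMinors a r k) (λ k → fromℕ 16 * ∑∑ (λ j l → clash k i′ k′ j l j′ l′)))
              (cong (λ t → T - t) (trans (∑-*ˡ (fromℕ 16) (λ k → ∑∑ (λ j l → clash k i′ k′ j l j′ l′)))
              (trans (cong (fromℕ 16 *_) (clash-sum i′ k′ j′ l′)) (six-times (N * N)))))))))))
        where
        w = ν r i′ * ν r k′ * D i′ k′ j′ l′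

1≤* : ∀ {p q} → 1ℚ ≤ p → 1ℚ ≤ q → 1ℚ ≤ p * q
1≤* {p} {q} h k = *-mono-≥0 {1ℚ} {p} {1ℚ} {q} (lit 1ℚ) (lit 1ℚ) h k

module Heavy (n : ℕ) (I : ℚ) (NI : fromℕ n * I ≡ 1ℚ) (I≥0 : 0ℚ ≤ I) (1≤N-1 : 1ℚ ≤ fromℕ n - 1ℚ) (f : Perm n → Bool)
  (p≤½ : 𝔼 n (λ π → b2q (f π)) ≤ ½) (r k₀ : Fin n) (r≢k₀ : r ≢ k₀) (s : Fin ⌊ n /2⌋) where
  open Projection n I NI I≥0 1≤N-1 f

  private
    ĉ²≤1 : ∀ i j → ĉ i j * ĉ i j ≤ 1ℚ
    ĉ²≤1 i j = bound (ĉ i j) (≤-trans (≤-trans (toWitness {a? = (- 1ℚ) ≤? (- ½)} _) (neg-antimono-≤ p≤½)) (-p≤ĉ i j)) (ĉ≤1 i j)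
      where
      bound : ∀ c → - 1ℚ ≤ c → c ≤ 1ℚ → c * c ≤ 1ℚ
      bound c h h′ = ≤-by (gap h ⊗ gap h′) (solve 1 (λ c → con 1ℚ := c :* c :+ (c :- (:- (con 1ℚ))) :* (con 1ℚ :- c)) refl c)

  open HeavyFrames n f ĉ p ĉ²≤1 I NI 1≤N

  private
    R : ℚ
    R = ∑ (λ j → ĉ r j * ĉ r j)

    -- As the row and column sums of ĉ vanish, so do the cross terms, and T is exactly 2N(NR +
    -- energy).
    T≥ : fromℕ 2 * (N * (N * R)) ≤ T r s
    T≥ = ≤-trans (≤-by (lit (fromℕ 2) ⊗ (fromℕ≥0 n) ⊗ energy≥0) (expand N R (energy ĉ))) (≤-reflexive (sym T≡))
      where
      energy≥0 : 0ℚ ≤ energy ĉ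
      energy≥0 = ∑∑≥0 (λ i j → sq≥0 (ĉ i j))
      expand = solve 3 (λ N R e → con (fromℕ 2) :* (N :* (N :* R :+ e)) := con (fromℕ 2) :* (N :* (N :* R)) :+ con (fromℕ 2) :* N
          :* e) refl
      square = solve 2 (λ a b → (a :- b) :* (a :- b) := a :* a :+ b :* b :- con (fromℕ 2) :* (a :* b)) refl
      no-rows = solve 2 (λ N q → con (fromℕ 2) :* (N :* q :- (con 0ℚ :- con 0ℚ) :* (con 0ℚ :- con 0ℚ)) := con (fromℕ 2) :*
          (N :* q)) refl
      cross : ∑∑ (λ k j → fromℕ 2 * (ĉ r j * ĉ k j)) ≡ 0ℚ
      cross = trans (∑∑-*ˡ (fromℕ 2) (λ k j → ĉ r j * ĉ k j)) (trans (cong (fromℕ 2 *_) (trans (∑-swap (λ k j → ĉ r j * ĉ k j))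
        (trans (∑-cong (λ j → trans (∑-*ˡ (ĉ r j) (λ k → ĉ k j)) (trans (cong (ĉ r j *_) (ĉ-col j)) (*-zeroʳ (ĉ r j)))))
            (∑-zero n)))) refl)
      drop0 = solve 1 (λ a → a :- con 0ℚ := a) refl
      T≡ : T r s ≡ fromℕ 2 * (N * (N * R + energy ĉ))
      T≡ = begin
        ∑ (λ k → rowMinors ĉ r k)
          ≡⟨ ∑-cong (λ k → trans (rowMinors-eval ĉ r k) (trans (cong₂ (λ u v → fromℕ 2 *
              (N * ∑ (λ j → (ĉ r j - ĉ k j) * (ĉ r j - ĉ k j)) - (u - v) * (u - v))) (ĉ-row r) (ĉ-row k))
              (no-rows N (∑ (λ j → (ĉ r j - ĉ k j) * (ĉ r j - ĉ k j)))))) ⟩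
        ∑ (λ k → fromℕ 2 * (N * ∑ (λ j → (ĉ r j - ĉ k j) * (ĉ r j - ĉ k j))))
          ≡⟨ trans (∑-*ˡ (fromℕ 2) (λ k → N * ∑ (λ j → (ĉ r j - ĉ k j) * (ĉ r j - ĉ k j))))
              (cong (fromℕ 2 *_) (trans (∑-*ˡ N (λ k → ∑ (λ j → (ĉ r j - ĉ k j) * (ĉ r j - ĉ k j))))
              (cong (N *_) (trans (∑∑-cong (λ k j → square (ĉ r j) (ĉ k j)))
             (trans (∑∑-minus (λ k j → ĉ r j * ĉ r j + ĉ k j * ĉ k j) (λ k j → fromℕ 2 * (ĉ r j * ĉ k j)))
                 (trans (cong₂ _-_ (trans (∑∑-+ {n} (λ k j → ĉ r j * ĉ r j) (λ k j → ĉ k j * ĉ k j))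
                 (cong (_+ energy ĉ) (∑-const n R))) cross) (drop0 (N * R + energy ĉ)))))))) ⟩
        fromℕ 2 * (N * (N * R + energy ĉ)) ∎
        where open ≡-Reasoning

    -- Row r is overwritten by another row k₀. This changes lin ĉ only by a function of π(r), and
    -- every minor of the new matrix is a minor of ĉ avoiding r, so `variance-minors` makes what
    -- remains nearly constant.
    ψ : Fin n → Fin n
    ψ i = if does (i Fin.≟ r) then k₀ else i

    a : Matrix n
    a i = ĉ (ψ i)

    U : Fin n → ℚ
    U j = ĉ r j - ĉ k₀ j

    μ V : ℚ
    μ = 𝔼 n (lin a)
    V = 𝔼 n (λ π → (lin a π - μ) * (lin a π - μ))

    lin-split : ∀ π → lin ĉ π ≡ lin a π + U (lookup π r)
    lin-split π = trans (∑-cong pointwise) (trans (∑-+ (λ i → a i (lookup π i)) (λ i → δ i r * U (lookup π r)))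
        (cong (λ t → lin a π + t) (∑-δ r (λ _ → U (lookup π r)))))
      where
      here = solve 2 (λ c k → c := k :+ con 1ℚ :* (c :- k)) refl
      there = solve 2 (λ c u → c := c :+ con 0ℚ :* u) refl
      pointwise : ∀ i → ĉ i (lookup π i) ≡ a i (lookup π i) + δ i r * U (lookup π r)
      pointwise i with i Fin.≟ r
      ... | yes refl = here (ĉ i (lookup π i)) (ĉ k₀ (lookup π i))
      ... | no _     = there (ĉ i (lookup π i)) (U (lookup π r))

    -- Pairs of rows containing r are redirected to pairs containing k₀. The pairs with first row r
    -- and those with second row r each add at most one more copy of `avoiding`.
    minors-a : minors a ≤ fromℕ 3 * avoiding r s
    minors-a = ≤-trans (∑∑-mono pointwise) (≤-trans (≤-reflexive (trans
        (∑∑-+ (λ i k → ν r i * ν r k * m i k + δ i r * (ν r k * m k₀ k)) (λ i k → δ k r * (ν r i * m i k₀)))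
        (cong₂ _+_ (trans (∑∑-+ (λ i k → ν r i * ν r k * m i k) (λ i k → δ i r * (ν r k * m k₀ k)))
            (cong (λ t → avoiding r s + t) (trans (∑-cong (λ i → ∑-*ˡ (δ i r) (λ k → ν r k * m k₀ k)))
            (∑-δ r (λ _ → ∑ (λ k → ν r k * m k₀ k))))))
          (∑-cong (λ i → ∑-δ r (λ _ → ν r i * m i k₀))))))
      (three (avoiding r s) (∑ (λ k → ν r k * m k₀ k)) (∑ (λ i → ν r i * m i k₀)) row≤ col≤))
      where
      m : Fin n → Fin n → ℚ
      m = rowMinors ĉ
      m≥0 : ∀ i k → 0ℚ ≤ m i k
      m≥0 i k = ∑∑≥0 (λ j l → sq≥0 (Δ ĉ i k j l))
      m-same : ∀ i → m i i ≡ 0ℚ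
      m-same i = trans (∑∑-cong (λ j l → zero² (ĉ i j) (ĉ i l))) (trans (∑-cong {n} (λ _ → ∑-zero n)) (∑-zero n))
        where
        zero² = solve 2 (λ x y → (x :- x :- y :+ y) :* (x :- x :- y :+ y) := con 0ℚ) refl
      three : ∀ a b c → b ≤ a → c ≤ a → a + b + c ≤ fromℕ 3 * a
      three a b c h h′ = ≤-by (gap h ⊕ gap h′) (solve 3 (λ a b c → con (fromℕ 3) :* a := a :+ b :+ c :+ (a :- b :+ (a :- c)))
          refl a b c)
      weight≥0′ : ∀ i k → 0ℚ ≤ ν r i * ν r k * m i k
      weight≥0′ i k = ν≥0 r i ⊗ ν≥0 r k ⊗ m≥0 i k
      one = solve 2 (λ v m → con 1ℚ :* v :* m := v :* m) refl
      one′ = solve 2 (λ v m → v :* con 1ℚ :* m := v :* m) refl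
      row≤ : ∑ (λ k → ν r k * m k₀ k) ≤ avoiding r s
      row≤ = ≤-trans (≤-reflexive (∑-cong (λ k → sym (trans (cong (λ t → t * ν r k * m k₀ k) (ν-≢ r≢k₀))
          (one (ν r k) (m k₀ k))))))
        (term≤∑ {F = λ i → ∑ (λ k → ν r i * ν r k * m i k)} (λ i → ∑≥0 (λ k → weight≥0′ i k)) k₀)
      col≤ : ∑ (λ i → ν r i * m i k₀) ≤ avoiding r s
      col≤ = ∑-mono (λ i → ≤-trans (≤-reflexive (sym (trans (cong (λ t → ν r i * t * m i k₀) (ν-≢ r≢k₀))
          (one′ (ν r i) (m i k₀)))))
        (term≤∑ {F = λ k → ν r i * ν r k * m i k} (λ k → weight≥0′ i k) k₀))
      replace : ∀ (m : Fin n → Fin n → ℚ) → m k₀ k₀ ≡ 0ℚ → ∀ i k b c → m (if b then k₀ else i) (if c then k₀ else k) ≡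
        (1ℚ - b2q b) * (1ℚ - b2q c) * m i k + b2q b * ((1ℚ - b2q c) * m k₀ k) + b2q c * ((1ℚ - b2q b) * m i k₀)
      replace m h i k true  true  = trans h (both (m i k) (m k₀ k) (m i k₀))
        where
        both = solve 3 (λ v w x → con 0ℚ := (con 1ℚ :- con 1ℚ) :* (con 1ℚ :- con 1ℚ) :* v :+ con 1ℚ :* ((con 1ℚ :- con 1ℚ) :* w)
            :+ con 1ℚ :* ((con 1ℚ :- con 1ℚ) :* x)) refl
      replace m h i k true  false = first (m k₀ k) (m i k) (m i k₀)
        where
        first = solve 3 (λ w v x → w := (con 1ℚ :- con 1ℚ) :* (con 1ℚ :- con 0ℚ) :* v :+ con 1ℚ :* ((con 1ℚ :- con 0ℚ) :* w) :+
            con 0ℚ :* ((con 1ℚ :- con 1ℚ) :* x)) refl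
      replace m h i k false true  = second (m i k₀) (m i k) (m k₀ k)
        where
        second = solve 3 (λ x v w → x := (con 1ℚ :- con 0ℚ) :* (con 1ℚ :- con 1ℚ) :* v :+ con 0ℚ :* ((con 1ℚ :- con 1ℚ) :* w) :+
            con 1ℚ :* ((con 1ℚ :- con 0ℚ) :* x)) refl
      replace m h i k false false = neither (m i k) (m k₀ k) (m i k₀)
        where
        neither = solve 3 (λ v w x → v := (con 1ℚ :- con 0ℚ) :* (con 1ℚ :- con 0ℚ) :* v :+ con 0ℚ :* ((con 1ℚ :- con 0ℚ) :* w) :+
            con 0ℚ :* ((con 1ℚ :- con 0ℚ) :* x)) refl
      pointwise : ∀ i k → m (ψ i) (ψ k) ≤ ν r i * ν r k * m i k + δ i r * (ν r k * m k₀ k) + δ k r * (ν r i * m i k₀)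
      pointwise i k = subst₂ (λ u v → m (ψ i) (ψ k) ≤ (1ℚ - u) * (1ℚ - v) * m i k + δ i r * ((1ℚ - v) * m k₀ k) + δ k r *
          ((1ℚ - u) * m i k₀)) (δ-sym i r) (δ-sym k r) (≤-reflexive eq)
        where
        eq : m (ψ i) (ψ k) ≡ (1ℚ - δ i r) * (1ℚ - δ k r) * m i k + δ i r * ((1ℚ - δ k r) * m k₀ k) + δ k r *
            ((1ℚ - δ i r) * m i k₀)
        eq = replace m (m-same k₀) i k (does (i Fin.≟ r)) (does (k Fin.≟ r))

  module _ (heavy : θ * N ≤ R) (N-large : fromℕ 1179648 ≤ N) (M-large : N ≤ fromℕ 4 * (fromℕ ⌊ n /2⌋ - 1ℚ)) where

    private
      avoiding≥0 : 0ℚ ≤ avoiding r s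
      avoiding≥0 = ∑∑≥0 (λ i k → ν≥0 r i ⊗ ν≥0 r k ⊗ ∑∑≥0 (λ j l → sq≥0 (Δ ĉ i k j l)))

      avoiding≤ : θ * avoiding r s ≤ fromℕ 640 * (N * N * N) * residual²
      avoiding≤ = conclude N (fromℕ ⌊ n /2⌋) R (T r s) (W r s) (avoiding r s) residual² 1≤N avoiding≥0 heavy N-large M-large T≥
          (W≥ r s) (W-bound r s)
        where
        conclude : ∀ N M R T W v e → 1ℚ ≤ N → 0ℚ ≤ v → θ * N ≤ R → fromℕ 1179648 ≤ N → N ≤ fromℕ 4 * (M - 1ℚ) → fromℕ 2 *
            (N * (N * R)) ≤ T →
          (T - fromℕ 96 * (N * N)) * v ≤ W → N * ((M - 1ℚ) * W) ≤ N ^ℚ 4 * (N ^ℚ 4) * (fromℕ 160 * e) → θ * v ≤ fromℕ 640 *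
              (N * N * N) * e
        conclude N M R T W v e h1 hv hR hN hM hT hW hB = *-cancelˡ-≤ {θ * v} {fromℕ 640 * (N * N * N) * e} {N * N * (N * N * N)}
            (1≤* (1≤* h1 h1) (1≤* (1≤* h1 h1) h1))
          (≤-by (fromN ⊗ gap hM ⊗ W≥0 ⊕ lit (fromℕ 4) ⊗ gap hB ⊕ (fromN ⊗ fromN) ⊗ gap W′) (expand N M W v e))
          where
          fromN : 0ℚ ≤ N
          fromN = ≤-trans (lit 1ℚ) h1
          expandT = solve 5 (λ N R T v W → W := con (+ 1 / 12288) :* (N :* N :* N) :* v :+
              (con (fromℕ 2) :* (N :* N) :* (R :- con (+ 1 / 12288) :* N) :* v :+ (T :- con (fromℕ 2) :* (N :* (N :* R))) :* v :+
              (W :- (T :- con (fromℕ 96) :* (N :* N)) :* v) :+ con (+ 1 / 12288) :* (N :* N) :* (N :- con (fromℕ 1179648)) :* v))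
              refl
          W′ : θ * (N * N * N) * v ≤ W
          -- T is at least 2N²R ≥ 2θN³, and half of this pays for the degenerate term: 96N² ≤ θN³
          -- exactly when N ≥ 96/θ = 1179648.
          W′ = ≤-by ((lit (fromℕ 2) ⊗ (fromN ⊗ fromN)) ⊗ gap hR ⊗ hv ⊕ gap hT ⊗ hv ⊕ gap hW ⊕ lit (+ 1 / 12288) ⊗ (fromN ⊗ fromN)
              ⊗ gap hN ⊗ hv) (expandT N R T v W)
          W≥0 : 0ℚ ≤ W
          W≥0 = ≤-trans (lit θ ⊗ (fromN ⊗ fromN ⊗ fromN) ⊗ hv) W′
          expand = solve 5 (λ N M W v e → N :* N :* (N :* N :* N) :* (con (fromℕ 640) :* (N :* N :* N) :* e) := N :* N :*
              (N :* N :* N) :* (con (+ 1 / 12288) :* v) :+ (N :* (con (fromℕ 4) :* (M :- con 1ℚ) :- N) :* W :+ con (fromℕ 4) :*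
              (N :* (N :* (N :* (N :* con 1ℚ))) :* (N :* (N :* (N :* (N :* con 1ℚ)))) :* (con (fromℕ 160) :* e) :- N :*
              ((M :- con 1ℚ) :* W)) :+ N :* N :* (W :- con (+ 1 / 12288) :* (N :* N :* N) :* v))) refl

      -- 3·640/(4θ) = 5898240, and the remaining factor 2 absorbs N/(N-1).
      V≤ : V ≤ fromℕ 11796480 * residual²
      V≤ = conclude N V (minors a) (avoiding r s) residual² N-large residual²≥0 (variance-minors a) minors-a avoiding≤
        where
        conclude : ∀ N V m v e → fromℕ 1179648 ≤ N → 0ℚ ≤ e → fromℕ 4 * (N * N) * (N - 1ℚ) * V ≡ m → m ≤ fromℕ 3 * v → θ * v ≤
            fromℕ 640 * (N * N * N) * e → V ≤ fromℕ 11796480 * e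
        conclude N V m v e hN he refl h h′ = *-cancelˡ-≤ {V} {fromℕ 11796480 * e} {N * N * (N - 1ℚ)} (1≤* (1≤* 1≤N′ 1≤N′) 1≤N-1′)
          (≤-by (lit (+ 1 / 4) ⊗ gap h ⊕ lit (fromℕ 9216) ⊗ gap h′ ⊕ lit (fromℕ 5898240) ⊗ (N≥0 ⊗ N≥0) ⊗
              (gap hN ⊕ lit (fromℕ 1179646)) ⊗ he) (expand N V v e))
          where
          1≤N′ : 1ℚ ≤ N
          1≤N′ = ≤-trans (toWitness {a? = 1ℚ ≤? fromℕ 1179648} _) hN
          N≥0 : 0ℚ ≤ N
          N≥0 = ≤-trans (lit 1ℚ) 1≤N′
          1≤N-1′ : 1ℚ ≤ N - 1ℚ
          1≤N-1′ = ≤-by (gap hN ⊕ lit (fromℕ 1179646)) (lemma N)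
            where
            lemma = solve 1 (λ N → N :- con 1ℚ := con 1ℚ :+ (N :- con (fromℕ 1179648) :+ con (fromℕ 1179646))) refl
          expand = solve 4 (λ N V v e → N :* N :* (N :- con 1ℚ) :* (con (fromℕ 11796480) :* e) := N :* N :* (N :- con 1ℚ) :* V :+
              (con (+ 1 / 4) :* (con (fromℕ 3) :* v :- con (fromℕ 4) :* (N :* N) :* (N :- con 1ℚ) :* V) :+ con (fromℕ 9216) :*
              (con (fromℕ 640) :* (N :* N :* N) :* e :- con (+ 1 / 12288) :* v) :+ con (fromℕ 5898240) :* (N :* N) :*
              (N :- con (fromℕ 1179648) :+ con (fromℕ 1179646)) :* e)) refl

      g : Fin n → ℚ
      g j = p + μ + U j

    u : Fin n → Bool
    u j = does (½ ≤? g j)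

    heavy-approx : 𝔼 n (λ π → (F π - b2q (u (lookup π r))) * (F π - b2q (u (lookup π r)))) ≤ fromℕ 8 * (1ℚ + fromℕ 11796480) *
        residual²
    heavy-approx = ≤-trans (𝔼-mono n {λ π → (F π - b2q (u (lookup π r))) * (F π - b2q (u (lookup π r)))}
        {λ π → fromℕ 8 * (residual π * residual π + (lin a π - μ) * (lin a π - μ))} (λ π _ → pointwise π))
      (≤-trans (≤-reflexive (trans (𝔼-*ˡ n (fromℕ 8) (λ π → residual π * residual π + (lin a π - μ) * (lin a π - μ)))
          (cong (fromℕ 8 *_) (𝔼-+ n (λ π → residual π * residual π) (λ π → (lin a π - μ) * (lin a π - μ))))))
      (conclude residual² V (fromℕ 11796480) V≤))
      where
      conclude : ∀ r v c → v ≤ c * r → fromℕ 8 * (r + v) ≤ fromℕ 8 * (1ℚ + c) * r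
      conclude r v c h = ≤-by (lit (fromℕ 8) ⊗ gap h) (solve 3 (λ r v c → con (fromℕ 8) :* (con 1ℚ :+ c) :* r := con (fromℕ 8) :*
          (r :+ v) :+ con (fromℕ 8) :* (c :* r :- v)) refl r v c)
      parallelogram : ∀ r s → fromℕ 4 * ((r + s) * (r + s)) ≤ fromℕ 8 * (r * r + s * s)
      parallelogram r s = ≤-by (lit (fromℕ 4) ⊗ sq≥0 (r - s)) (solve 2
          (λ r s → con (fromℕ 8) :* (r :* r :+ s :* s) := con (fromℕ 4) :* ((r :+ s) :* (r :+ s)) :+ con (fromℕ 4) :*
          ((r :- s) :* (r :- s))) refl r s)
      -- Rounding x at ½ gives the wrong bit only if |b - x| ≥ ½, which pays for the error of 1.
      rounded : ∀ b x → (d : Dec (½ ≤ x)) → (b2q b - b2q (does d)) * (b2q b - b2q (does d)) ≤ fromℕ 4 *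
          ((b2q b - x) * (b2q b - x))
      rounded true  x (yes h) = lit (fromℕ 4) ⊗ sq≥0 (1ℚ - x)
      rounded false x (no h)  = lit (fromℕ 4) ⊗ sq≥0 (0ℚ - x)
      rounded false x (yes h) = ≤-by (lit (fromℕ 4) ⊗ (gap h ⊗ gap h ⊕ gap h)) (expand x)
        where
        expand = solve 1 (λ x → con (fromℕ 4) :* ((con 0ℚ :- x) :* (con 0ℚ :- x)) := (con 0ℚ :- con 1ℚ) :* (con 0ℚ :- con 1ℚ) :+
            con (fromℕ 4) :* ((x :- con ½) :* (x :- con ½) :+ (x :- con ½))) refl
      rounded true  x (no ¬h) = ≤-by (lit (fromℕ 4) ⊗ (gap h ⊗ gap h ⊕ gap h)) (expand x)
        where
        h : x ≤ ½
        h = <⇒≤ (≰⇒> ¬h)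
        expand = solve 1 (λ x → con (fromℕ 4) :* ((con 1ℚ :- x) :* (con 1ℚ :- x)) := (con 1ℚ :- con 0ℚ) :* (con 1ℚ :- con 0ℚ) :+
            con (fromℕ 4) :* ((con ½ :- x) :* (con ½ :- x) :+ (con ½ :- x))) refl
      regroup = solve 5 (λ F p m u l → F :- (p :+ m :+ u) := F :- p :- (l :+ u) :+ (l :- m)) refl
      split : ∀ π → F π - g (lookup π r) ≡ residual π + (lin a π - μ)
      split π = trans (regroup (F π) p μ (U (lookup π r)) (lin a π))
          (cong (λ t → F π - p - t + (lin a π - μ)) (sym (lin-split π)))
      pointwise : ∀ π → (F π - b2q (u (lookup π r))) * (F π - b2q (u (lookup π r))) ≤ fromℕ 8 *
          (residual π * residual π + (lin a π - μ) * (lin a π - μ))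
      pointwise π = ≤-trans (rounded (f π) (g (lookup π r)) (½ ≤? g (lookup π r)))
          (≤-trans (≤-reflexive (cong (λ t → fromℕ 4 * (t * t)) (split π))) (parallelogram (residual π) (lin a π - μ)))

-- Boolean functions that are exactly linear

compose-inverse : ∀ {n} {α α⁻ β β⁻ : Fin n → Fin n} → Inverse α α⁻ → Inverse β β⁻ → Inverse (α ∘ β) (β⁻ ∘ α⁻)
compose-inverse {α = α} {α⁻} {β} {β⁻} (inverse l r) (inverse l′ r′) = inverse (λ i → trans (cong β⁻ (l (β i))) (l′ i))
    (λ i → trans (cong α (r′ (α⁻ i))) (r i))

transpose-right : ∀ {n} {i j : Fin n} → i ≢ j → transpose i j j ≡ i
transpose-right {i = i} {j} h rewrite dec-false (j Fin.≟ i) (h ∘ sym) | dec-true (j Fin.≟ j) refl = refl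

∑-reindex : ∀ {n} {α α⁻ : Fin n → Fin n} → Inverse α α⁻ → ∀ F → ∑ (λ i → F (α i)) ≡ ∑ F
∑-reindex {α = α} {α⁻} A F = trans (∑-cong (λ i → cong F (sym (lookup∘tabulate α i)))) (∑-perm (tabulate α) perm F)
  where
  perm : IsPerm (tabulate α)
  perm i j e = trans (sym (Inverse.left A i)) (trans (cong α⁻ (trans (sym (lookup∘tabulate α i))
      (trans e (lookup∘tabulate α j)))) (Inverse.left A j))

b2q-sum≤1 : ∀ a b c → b2q a + b2q b ≡ b2q c → a ≡ true → b ≡ true → ⊥
b2q-sum≤1 true true true  () refl refl
b2q-sum≤1 true true false () refl refl

b2q-injective : ∀ a b → b2q a ≡ b2q b → a ≡ b
b2q-injective true  true  _ = refl
b2q-injective false false _ = refl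

-- The two differences of bits both equal a - a′ ≠ 0, hence ±1, and a difference ±1 determines both
-- bits. So the sums with b and with b′ coincide.
rigid : ∀ a a′ b b′ x y z z′ → a + b ≡ b2q x → a′ + b ≡ b2q y → a + b′ ≡ b2q z → a′ + b′ ≡ b2q z′ → a ≢ a′ → b ≡ b′
rigid a a′ b b′ x y z z′ ex ey ez ez′ ne = table x y z z′ ex ey ez ez′
    (trans (cong₂ _-_ (sym ex) (sym ey)) (trans (difference a a′ b b′) (cong₂ _-_ ez ez′)))
  where
  cancelʳ : ∀ p q r → p + r ≡ q + r → p ≡ q
  cancelʳ p q r e = trans (lemma p r) (trans (cong (_- r) e) (sym (lemma q r)))
    where
    lemma = solve 2 (λ p r → p := p :+ r :- r) refl
  cancelˡ : ∀ p q r → r + p ≡ r + q → p ≡ q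
  cancelˡ p q r e = cancelʳ p q r (trans (+-comm p r) (trans e (+-comm r q)))
  difference = solve 4 (λ a a′ b b′ → a :+ b :- (a′ :+ b) := a :+ b′ :- (a′ :+ b′)) refl
  table : ∀ x y z z′ → a + b ≡ b2q x → a′ + b ≡ b2q y → a + b′ ≡ b2q z → a′ + b′ ≡ b2q z′ → b2q x - b2q y ≡ b2q z - b2q z′ → b ≡
      b′
  table true  true  _     _     ex ey _ _ _ = ⊥-elim (ne (cancelʳ a a′ b (trans ex (sym ey))))
  table false false _     _     ex ey _ _ _ = ⊥-elim (ne (cancelʳ a a′ b (trans ex (sym ey))))
  table true  false true  true  _ _ ez ez′ _ = ⊥-elim (ne (cancelʳ a a′ b′ (trans ez (sym ez′))))
  table false true  true  true  _ _ ez ez′ _ = ⊥-elim (ne (cancelʳ a a′ b′ (trans ez (sym ez′))))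
  table true  false false false _ _ ez ez′ _ = ⊥-elim (ne (cancelʳ a a′ b′ (trans ez (sym ez′))))
  table false true  false false _ _ ez ez′ _ = ⊥-elim (ne (cancelʳ a a′ b′ (trans ez (sym ez′))))
  table true  false true  false ex _ ez _ _ = cancelˡ b b′ a (trans ex (sym ez))
  table false true  false true  ex _ ez _ _ = cancelˡ b b′ a (trans ex (sym ez))
  table true  false false true  _ _ _ _ ()
  table false true  true  false _ _ _ _ ()

module Exact (n : ℕ) (f : Perm n → Bool) (c : Matrix n) (p : ℚ) (exact : ∀ π → IsPerm π → b2q (f π) ≡ p + lin c π)
  (π₀ : Perm n) (π₀-perm : IsPerm π₀) (fπ₀ : f π₀ ≡ false) where

  -- The gain in handing the value held by position k under π₀ over to position i. Summed along σ,
  -- these gains telescope to lin c (π₀ ∘ σ) - lin c π₀.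
  w : Fin n → Fin n → ℚ
  w i k = c i (lookup π₀ k) - c k (lookup π₀ k)

  S : (Fin n → Fin n) → ℚ
  S σ = ∑ (λ i → w i (σ i))

  value : (Fin n → Fin n) → Bool
  value σ = f (rearrange id σ π₀)

  w-refl : ∀ i → w i i ≡ 0ℚ
  w-refl i = +-inverseʳ (c i (lookup π₀ i))

  -- Since f vanishes at π₀, the accumulated gain is itself a value of f. Every S σ is therefore 0
  -- or 1, which is the source of all the contradictions below.
  S-value : ∀ {σ σ⁻} → Inverse σ σ⁻ → S σ ≡ b2q (value σ)
  S-value {σ} A = trans (∑-minus (λ i → c i (lookup π₀ (σ i))) (λ i → c (σ i) (lookup π₀ (σ i)))) (trans
    (cong₂ _-_ (∑-cong (λ i → cong (c i) (sym (lookup-rearrange id σ π₀ i)))) (∑-reindex A (λ i → c i (lookup π₀ i))))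
    (trans (cancel p (lin c (rearrange id σ π₀)) (lin c π₀)) (trans
        (cong₂ _-_ (sym (exact (rearrange id σ π₀) (rearrange-perm id-inverse A π₀ π₀-perm)))
      (trans (sym (exact π₀ π₀-perm)) (cong b2q fπ₀))) (minus-zero (b2q (value σ))))))
    where
    cancel = solve 3 (λ p a b → a :- b := p :+ a :- (p :+ b)) refl
    minus-zero = solve 1 (λ a → a :- con 0ℚ := a) refl

  S-id : S id ≡ 0ℚ
  S-id = trans (∑-cong w-refl) (∑-zero n)

  S-swap : ∀ σ {a b} → a ≢ b → S (σ ∘ transpose a b) ≡ S σ + ((w a (σ b) - w a (σ a)) + (w b (σ a) - w b (σ b)))
  S-swap σ {a} {b} a≢b = trans (∑-cong pointwise) (trans (∑-+ (λ i → w i (σ i))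
      (λ i → δ i a * (w a (σ b) - w a (σ a)) + δ i b * (w b (σ a) - w b (σ b))))
    (cong (λ t → S σ + t) (trans (∑-+ (λ i → δ i a * (w a (σ b) - w a (σ a))) (λ i → δ i b * (w b (σ a) - w b (σ b))))
        (cong₂ _+_ (∑-δ a (λ _ → w a (σ b) - w a (σ a))) (∑-δ b (λ _ → w b (σ a) - w b (σ b)))))))
    where
    at-a = solve 3 (λ x y z → x := y :+ (con 1ℚ :* (x :- y) :+ con 0ℚ :* z)) refl
    at-b = solve 3 (λ x y z → x := y :+ (con 0ℚ :* z :+ con 1ℚ :* (x :- y))) refl
    at-other = solve 3 (λ x y z → x := x :+ (con 0ℚ :* y :+ con 0ℚ :* z)) refl
    pointwise : ∀ i → w i (σ (transpose a b i)) ≡ w i (σ i) + (δ i a * (w a (σ b) - w a (σ a)) + δ i b * (w b (σ a) - w b (σ b)))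
    pointwise i = by (i Fin.≟ a) (i Fin.≟ b)
      where
      Goal : ℚ → ℚ → Fin n → Set
      Goal d e t = w i (σ t) ≡ w i (σ i) + (d * (w a (σ b) - w a (σ a)) + e * (w b (σ a) - w b (σ b)))
      by : Dec (i ≡ a) → Dec (i ≡ b) → Goal (δ i a) (δ i b) (transpose a b i)
      by (yes refl) _ = subst₂ (λ t u → Goal t u (transpose a b a)) (sym (δ-refl a)) (sym (δ-≢ a≢b))
          (subst (Goal 1ℚ 0ℚ) (sym (transpose-left a b)) (at-a (w a (σ b)) (w a (σ a)) (w b (σ a) - w b (σ b))))
      by (no ≢a) (yes refl) = subst₂ (λ t u → Goal t u (transpose a b b)) (sym (δ-≢ ≢a)) (sym (δ-refl b))
          (subst (Goal 0ℚ 1ℚ) (sym (transpose-right a≢b)) (at-b (w b (σ a)) (w b (σ b)) (w a (σ b) - w a (σ a))))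
      by (no ≢a) (no ≢b) = subst₂ (λ t u → Goal t u (transpose a b i)) (sym (δ-≢ ≢a)) (sym (δ-≢ ≢b))
          (subst (Goal 0ℚ 0ℚ) (sym (transpose-other ≢a ≢b)) (at-other (w i (σ i)) (w a (σ b) - w a (σ a))
          (w b (σ a) - w b (σ b))))

  edge : Fin n → Fin n → Bool
  edge a b = value (transpose a b)

  private
    T : ∀ (a b : Fin n) → Inverse (transpose a b) (transpose b a)
    T = transpose-inverse′

  edge-w : ∀ {a b} → a ≢ b → w a b + w b a ≡ b2q (edge a b)
  edge-w {a} {b} h = trans (sym (trans (S-swap id h) (trans (cong₂ (λ s t → s + ((w a b - t) + (w b a - w b b))) S-id (w-refl a))
      (trans (cong (λ t → 0ℚ + ((w a b - 0ℚ) + (w b a - t))) (w-refl b)) (tidy (w a b) (w b a)))))) (S-value (T a b))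
    where
    tidy = solve 2 (λ x y → con 0ℚ :+ (x :- con 0ℚ :+ (y :- con 0ℚ)) := x :+ y) refl

  edge-sym : ∀ {a b} → a ≢ b → edge a b ≡ edge b a
  edge-sym {a} {b} h = b2q-injective (edge a b) (edge b a) (trans (sym (edge-w h))
      (trans (+-comm (w a b) (w b a)) (edge-w (h ∘ sym))))

  triple : Fin n → Fin n → Fin n → Bool
  triple a b d = value (transpose a b ∘ transpose b d)

  triple-w : ∀ {a b d} → a ≢ b → b ≢ d → a ≢ d → w a b + w b d + w d a ≡ b2q (triple a b d)
  triple-w {a} {b} {d} ab bd ad = trans (sym (trans (S-swap (transpose a b) bd)
      (trans (cong₂ _+_ (trans (S-value (T a b)) (sym (edge-w ab)))
      (cong₂ (λ u v → (w b v - w b u) + (w d u - w d v)) (transpose-right ab) (transpose-other (ad ∘ sym) (bd ∘ sym))))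
      (trans (cong (λ t → w a b + w b a + ((w b d - w b a) + (w d a - t))) (w-refl d)) (tidy (w a b) (w b a) (w b d) (w d a))))))
    (S-value (compose-inverse (T a b) (T b d)))
    where
    tidy = solve 4 (λ x y z u → x :+ y :+ (z :- y :+ (u :- con 0ℚ)) := x :+ z :+ u) refl

  -- The gains of disjoint transpositions add, so their product would give f the value 2.
  no-disjoint-edges : ∀ {a b d e} → a ≢ b → d ≢ e → d ≢ a → d ≢ b → e ≢ a → e ≢ b → edge a b ≡ true → edge d e ≡ true → ⊥
  no-disjoint-edges {a} {b} {d} {e} ab de da db ea eb = b2q-sum≤1 (edge a b) (edge d e) (value (transpose a b ∘ transpose d e))
    (trans (sym (trans (S-swap (transpose a b) de) (trans (cong₂ _+_ (S-value (T a b))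
        (cong₂ (λ u v → (w d v - w d u) + (w e u - w e v)) (transpose-other da db) (transpose-other ea eb)))
      (cong (λ t → b2q (edge a b) + t) (trans (cong₂ (λ u v → (w d e - u) + (w e d - v)) (w-refl d) (w-refl e))
          (trans (tidy (w d e) (w e d)) (edge-w de)))))))
    (S-value (compose-inverse (T a b) (T d e))))
    where
    tidy = solve 2 (λ x y → x :- con 0ℚ :+ (y :- con 0ℚ) := x :+ y) refl

  -- The two 3-cycles on {a, b, d} together traverse each of the three edges in both directions.
  two-triples : ∀ {a b d} → a ≢ b → b ≢ d → a ≢ d → b2q (triple a b d) + b2q (triple a d b) ≡ b2q (edge a b) + b2q (edge b d) +
      b2q (edge a d)
  two-triples {a} {b} {d} ab bd ad = trans (cong₂ _+_ (sym (triple-w ab bd ad)) (sym (triple-w ad (bd ∘ sym) ab)))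
    (trans (regroup (w a b) (w b d) (w d a) (w a d) (w d b) (w b a)) (cong₂ _+_ (cong₂ _+_ (edge-w ab) (edge-w bd)) (edge-w ad)))
    where
    regroup = solve 6 (λ x y z x′ y′ z′ → x :+ y :+ z :+ (x′ :+ y′ :+ z′) := x :+ z′ :+ (y :+ y′) :+ (x′ :+ z)) refl

  -- Two bits cannot sum to 3.
  no-triangle : ∀ {a b d} → a ≢ b → b ≢ d → a ≢ d → edge a b ≡ true → edge b d ≡ true → edge a d ≡ true → ⊥
  no-triangle {a} {b} {d} ab bd ad e₁ e₂ e₃ = three (triple a b d) (triple a d b) (edge a b) (edge b d) (edge a d)
      (two-triples ab bd ad) e₁ e₂ e₃
    where
    three : ∀ t u x y z → b2q t + b2q u ≡ b2q x + b2q y + b2q z → x ≡ true → y ≡ true → z ≡ true → ⊥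
    three true  true  true true true () refl refl refl
    three true  false true true true () refl refl refl
    three false true  true true true () refl refl refl
    three false false true true true () refl refl refl

  -- Every edge meets s. A graph without two disjoint edges and without a triangle is a star, so
  -- such an s exists; when there are no edges at all, any vertex serves.
  Centre : Fin n → Set
  Centre s = ∀ a b → a ≢ b → a ≢ s → b ≢ s → edge a b ≡ false

  Avoiding : Fin n → Set
  Avoiding s = ∃[ a ] ∃[ b ] (a ≢ b × a ≢ s × b ≢ s × edge a b ≡ true)

  centre? : ∀ s → Centre s ⊎ Avoiding s
  centre? s with Fin.any? (λ a → Fin.any? (λ b → ¬? (a Fin.≟ b) ×-dec ¬? (a Fin.≟ s) ×-dec ¬? (b Fin.≟ s) ×-dec
      (edge a b Bool.≟ true)))
  ... | yes h = inj₂ h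
  ... | no ¬h = inj₁ λ a b ab as bs → ¬true (edge a b) (λ e → ¬h (a , b , ab , as , bs , e))
    where
    ¬true : ∀ x → ¬ (x ≡ true) → x ≡ false
    ¬true true  h = ⊥-elim (h refl)
    ¬true false h = refl

  centre : Fin n → ∃[ s ] Centre s
  centre z = by₀ (centre? z)
    where
    by₂ : ∀ {a b d} → a ≢ b → b ≢ d → a ≢ d → edge a b ≡ true → edge b d ≡ true → Centre b ⊎ Avoiding b → ∃[ s ] Centre s
    by₂ {a} {b} {d} ab bd ad e₁ e₂ (inj₁ h) = b , h
    by₂ {a} {b} {d} ab bd ad e₁ e₂ (inj₂ (x , y , xy , xb , yb , e)) = ⊥-elim (cases (x Fin.≟ a) (y Fin.≟ a))
      where
      third : ∀ y → y ≢ a → y ≢ b → edge a y ≡ true → ⊥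
      third y ya yb e with y Fin.≟ d
      ... | yes refl = no-triangle ab bd ad e₁ e₂ e
      ... | no yd    = no-disjoint-edges bd (ya ∘ sym) ab ad yb yd e₂ e
      cases : Dec (x ≡ a) → Dec (y ≡ a) → ⊥
      cases (yes refl) _ = third y (xy ∘ sym) yb e
      cases (no xa) (yes refl) = third x xa xb (trans (edge-sym (xa ∘ sym)) e)
      cases (no xa) (no ya) = no-disjoint-edges ab xy xa xb ya yb e₁ e
    by₁ : ∀ {a b} → a ≢ b → edge a b ≡ true → Centre a ⊎ Avoiding a → ∃[ s ] Centre s
    by₁ {a} {b} ab e₁ (inj₁ h) = a , h
    by₁ {a} {b} ab e₁ (inj₂ (x , y , xy , xa , ya , e)) = cases (x Fin.≟ b) (y Fin.≟ b)
      where
      cases : Dec (x ≡ b) → Dec (y ≡ b) → ∃[ s ] Centre s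
      cases (yes refl) _ = by₂ ab xy (ya ∘ sym) e₁ e (centre? b)
      cases (no xb) (yes refl) = by₂ ab (xy ∘ sym) (xa ∘ sym) e₁ (trans (edge-sym (xy ∘ sym)) e) (centre? b)
      cases (no xb) (no yb) = ⊥-elim (no-disjoint-edges ab xy xa xb ya yb e₁ e)
    by₀ : Centre z ⊎ Avoiding z → ∃[ s ] Centre s
    by₀ (inj₁ h) = z , h
    by₀ (inj₂ (a , b , ab , _ , _ , e)) = by₁ ab e (centre? a)

  module Star (s : Fin n) (star : Centre s) (o : Fin n) (o≢s : o ≢ s) where

    anti : ∀ {a b} → a ≢ s → b ≢ s → w a b + w b a ≡ 0ℚ
    anti {a} {b} as bs with a Fin.≟ b
    ... | yes refl = trans (cong₂ _+_ (w-refl a) (w-refl a)) refl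
    ... | no ab    = trans (edge-w ab) (cong b2q (star a b ab as bs))

    private
      solve-zero : ∀ x y → x + y ≡ 0ℚ → x ≡ 0ℚ - y
      solve-zero x y e = trans (lemma x y) (cong (λ t → t - y) e)
        where
        lemma = solve 2 (λ x y → x := x :+ y :- y) refl

    -- Away from s all transpositions have value 0, hence so do both 3-cycles, being two bits with
    -- sum 0. Thus w is antisymmetric and closed there, so it is a gradient, with o as base point.
    potential : ∀ i k → i ≢ s → k ≢ s → w i k ≡ w i o - w k o
    potential i k is ks with i Fin.≟ k | k Fin.≟ o | i Fin.≟ o
    ... | yes refl | _ | _ = trans (w-refl i) (sym (+-inverseʳ (w i o)))
    ... | no _ | yes refl | _ = trans (minus-zero (w i k)) (cong (λ t → w i k - t) (sym (w-refl k)))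
      where
      minus-zero = solve 1 (λ a → a := a :- con 0ℚ) refl
    ... | no _ | no _ | yes refl = trans (solve-zero (w i k) (w k i) (anti is ks)) (cong (λ t → t - w k i) (sym (w-refl i)))
    ... | no ik | no ko | no io = conclude (w i k) (w k o) (w o i) (w i o)
        (trans (triple-w ik ko io) (zero-sum (triple i k o) (triple i o k) (edge i k) (edge k o) (edge i o)
            (two-triples ik ko io) (star i k ik is ks) (star k o ko ks o≢s) (star i o io is o≢s))) (anti is o≢s)
      where
      zero-sum : ∀ t u x y z → b2q t + b2q u ≡ b2q x + b2q y + b2q z → x ≡ false → y ≡ false → z ≡ false → b2q t ≡ 0ℚ
      zero-sum false u _ _ _ _ _ _ _ = refl
      zero-sum true true  false false false () refl refl refl
      zero-sum true false false false false () refl refl refl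
      conclude : ∀ ik ko oi io → ik + ko + oi ≡ 0ℚ → io + oi ≡ 0ℚ → ik ≡ io - ko
      conclude ik ko oi io e e′ = trans (lemma ik ko oi io) (trans (cong₂ (λ s t → s - t + (io - ko)) e e′) (tidy (io - ko)))
        where
        lemma = solve 4 (λ ik ko oi io → ik := ik :+ ko :+ oi :- (io :+ oi) :+ (io :- ko)) refl
        tidy = solve 1 (λ a → con 0ℚ :- con 0ℚ :+ a := a) refl

    u : Fin n → ℚ
    u i = (1ℚ - δ i s) * w i o

    -- A gauge change by the potential, set to zero at s. It leaves S unchanged, because a potential
    -- sums to zero along any permutation, and it kills every arc avoiding s.
    w̃ : Fin n → Fin n → ℚ
    w̃ i k = w i k - u i + u k

    S-w̃ : ∀ {σ σ⁻} → Inverse σ σ⁻ → ∑ (λ i → w̃ i (σ i)) ≡ S σ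
    S-w̃ {σ} A = trans (∑-+ (λ i → w i (σ i) - u i) (λ i → u (σ i)))
        (trans (cong₂ _+_ (∑-minus (λ i → w i (σ i)) u) (∑-reindex A u)) (cancel (S σ) (∑ u)))
      where
      cancel = solve 2 (λ a b → a :- b :+ b := a) refl

    u-off : ∀ {i} → i ≢ s → u i ≡ w i o
    u-off {i} h = trans (cong (λ t → (1ℚ - t) * w i o) (δ-≢ h)) (lemma (w i o))
      where
      lemma = solve 1 (λ a → (con 1ℚ :- con 0ℚ) :* a := a) refl

    w̃-off : ∀ {i k} → i ≢ s → k ≢ s → w̃ i k ≡ 0ℚ
    w̃-off {i} {k} is ks = trans (cong₂ (λ x y → w i k - x + y) (u-off is) (u-off ks))
        (trans (cong (λ t → t - w i o + w k o) (potential i k is ks)) (tidy (w i o) (w k o)))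
      where
      tidy = solve 2 (λ a b → a :- b :- a :+ b := con 0ℚ) refl

    w̃-refl : ∀ i → w̃ i i ≡ 0ℚ
    w̃-refl i = trans (cong (λ t → t - u i + u i) (w-refl i)) (tidy (u i))
      where
      tidy = solve 1 (λ a → con 0ℚ :- a :+ a := con 0ℚ) refl

    -- Only the arc leaving s and the arc entering s survive, so f is a function of σ(s) plus a
    -- function of σ⁻¹(s).
    S-star : ∀ {σ σ⁻} → Inverse σ σ⁻ → S σ ≡ w̃ s (σ s) + w̃ (σ⁻ s) s
    S-star {σ} {σ⁻} A = trans (sym (S-w̃ A)) (trans (∑-cong pointwise)
        (trans (∑-+ (λ i → δ i s * w̃ s (σ s)) (λ i → δ i (σ⁻ s) * w̃ i s))
      (cong₂ _+_ (∑-δ s (λ _ → w̃ s (σ s))) (∑-δ (σ⁻ s) (λ i → w̃ i s)))))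
      where
      at-s = solve 1 (λ x → x := con 1ℚ :* x :+ con 0ℚ :* con 0ℚ) refl
      off = solve 2 (λ x y → con 0ℚ := con 0ℚ :* x :+ con 0ℚ :* y) refl
      at-v = solve 2 (λ x y → y := con 0ℚ :* x :+ con 1ℚ :* y) refl
      pointwise : ∀ i → w̃ i (σ i) ≡ δ i s * w̃ s (σ s) + δ i (σ⁻ s) * w̃ i s
      pointwise i = by (i Fin.≟ s) (i Fin.≟ σ⁻ s)
        where
        by : Dec (i ≡ s) → Dec (i ≡ σ⁻ s) → w̃ i (σ i) ≡ δ i s * w̃ s (σ s) + δ i (σ⁻ s) * w̃ i s
        by (yes refl) _ = trans (trans (lemma (w̃ i (σ i)) (δ i (σ⁻ i)))
            (cong (λ t → 1ℚ * w̃ i (σ i) + δ i (σ⁻ i) * t) (sym (w̃-refl i))))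
            (cong (λ t → t * w̃ i (σ i) + δ i (σ⁻ i) * w̃ i i) (sym (δ-refl i)))
          where
          lemma = solve 2 (λ x d → x := con 1ℚ :* x :+ d :* con 0ℚ) refl
        by (no is) (yes iv) = trans (cong (w̃ i) (trans (cong σ iv) (Inverse.right A s)))
            (trans (at-v (w̃ s (σ s)) (w̃ i s)) (cong₂ (λ x y → x * w̃ s (σ s) + y * w̃ i s) (sym (δ-≢ is))
            (sym (trans (cong (δ i) (sym iv)) (δ-refl i)))))
        by (no is) (no iv) = trans (w̃-off is (λ e → iv (trans (sym (Inverse.left A i)) (cong σ⁻ e))))
            (trans (off (w̃ s (σ s)) (w̃ i s)) (cong₂ (λ x y → x * w̃ s (σ s) + y * w̃ i s) (sym (δ-≢ is)) (sym (δ-≢ iv))))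

    -- Every combination of σ(s) = t and σ⁻¹(s) = v occurs: through a transposition if t = v and a
    -- 3-cycle otherwise. With `rigid`, one of the two summands must be constant.
    AB : ∀ t v → t ≢ s → v ≢ s → ∃[ b ] w̃ s t + w̃ v s ≡ b2q b
    AB t v ts vs with t Fin.≟ v
    ... | yes refl = edge s t , trans (sym (trans (S-star (T s t))
        (cong₂ (λ x y → w̃ s x + w̃ y s) (transpose-left s t) (transpose-right ts)))) (S-value (T s t))
    ... | no tv    = triple s t v , trans (sym (trans (S-star (compose-inverse (T s t) (T t v)))
          (cong₂ (λ x y → w̃ s x + w̃ y s) (trans (cong (transpose s t) (transpose-other (ts ∘ sym) (vs ∘ sym)))
              (transpose-left s t)) (trans (cong (transpose v t) (transpose-right ts)) (transpose-right (tv ∘ sym))))))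
          (S-value (compose-inverse (T s t) (T t v)))

    private
      σOf : Perm n → Fin n → Fin n
      σOf π i = index π₀ (lookup π i)

      σ⁻Of : Perm n → Fin n → Fin n
      σ⁻Of π k = index π (lookup π₀ k)

      σOf-inverse : ∀ π → IsPerm π → Inverse (σOf π) (σ⁻Of π)
      σOf-inverse π h = inverse (λ i → trans (cong (index π) (lookup-index π₀ π₀-perm (lookup π i))) (index-lookup π h i))
        (λ k → trans (cong (index π₀) (lookup-index π h (lookup π₀ k))) (index-lookup π₀ π₀-perm k))

      f-star : ∀ π → IsPerm π → b2q (f π) ≡ w̃ s (σOf π s) + w̃ (σ⁻Of π s) s
      f-star π h = trans (trans (cong (λ t → b2q (f t)) (lookup-injective
          (λ i → trans (sym (lookup-index π₀ π₀-perm (lookup π i))) (sym (lookup-rearrange id (σOf π) π₀ i)))))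
        (sym (S-value (σOf-inverse π h)))) (S-star (σOf-inverse π h))

      isOne : ℚ → Bool
      isOne q = does (q ≟ℚ 1ℚ)

      isOne-b2q : ∀ b → isOne (b2q b) ≡ b
      isOne-b2q true  = refl
      isOne-b2q false = refl

      off-s : Fin n → Bool
      off-s i = not (does (i Fin.≟ s))

      f-zero : ∀ π → IsPerm π → σOf π s ≡ s → f π ≡ false
      f-zero π h e = b2q-injective (f π) false (trans (f-star π h) (trans
          (cong₂ (λ x y → w̃ s x + w̃ y s) e (trans (cong (σ⁻Of π) (sym e)) (Inverse.left (σOf-inverse π h) s)))
          (trans (cong₂ _+_ (w̃-refl s) (w̃-refl s)) refl)))

    RowDictator ColDictator : Set
    RowDictator = Σ[ v ∈ (Fin n → Bool) ] (∀ π → IsPerm π → f π ≡ v (lookup π s))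
    ColDictator = Σ[ v ∈ (Fin n → Bool) ] (∀ π → IsPerm π → f π ≡ v (index π (lookup π₀ s)))

    private
      guarded : ∀ (i : Fin n) x b → (i ≡ s → b ≡ false) → (i ≢ s → x ≡ b2q b) → b ≡ off-s i ∧ isOne x
      guarded i x b h h′ = by (i Fin.≟ s)
        where
        by : (d : Dec (i ≡ s)) → b ≡ not (does d) ∧ isOne x
        by (yes e) = h e
        by (no ≢)  = sym (trans (cong isOne (h′ ≢)) (isOne-b2q b))

      -- The case σ(s) = s is outside the reach of `AB`; there f is 0, which is the purpose of the
      -- guard `off-s`.
      constant-A : (∀ t → t ≢ s → w̃ s t ≡ w̃ s o) → ColDictator
      constant-A h = (λ i → off-s i ∧ isOne (w̃ s o + w̃ i s)) , λ π e → guarded (σ⁻Of π s) (w̃ s o + w̃ (σ⁻Of π s) s) (f π)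
        (λ e′ → f-zero π e (trans (cong (σOf π) (sym e′)) (Inverse.right (σOf-inverse π e) s)))
        (λ ≢ → trans (cong (_+ w̃ (σ⁻Of π s) s) (sym (h (σOf π s) (λ e′ → ≢
            (trans (cong (σ⁻Of π) (sym e′)) (Inverse.left (σOf-inverse π e) s)))))) (sym (f-star π e)))

      constant-B : (∀ v → v ≢ s → w̃ v s ≡ w̃ o s) → RowDictator
      constant-B h = (λ j → off-s (index π₀ j) ∧ isOne (w̃ s (index π₀ j) + w̃ o s)) , λ π e → guarded (σOf π s)
          (w̃ s (σOf π s) + w̃ o s) (f π)
        (λ e′ → f-zero π e e′)
        (λ ≢ → trans (cong (λ t → w̃ s (σOf π s) + t) (sym (h (σ⁻Of π s)
            (λ e′ → ≢ (trans (cong (σOf π) (sym e′)) (Inverse.right (σOf-inverse π e) s)))))) (sym (f-star π e)))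

      varying-A : ∀ t → t ≢ s → w̃ s t ≢ w̃ s o → ∀ v → v ≢ s → w̃ v s ≡ w̃ o s
      varying-A t ts h v vs = rigid (w̃ s t) (w̃ s o) (w̃ v s) (w̃ o s) (proj₁ tv) (proj₁ ov) (proj₁ to) (proj₁ oo) (proj₂ tv)
          (proj₂ ov) (proj₂ to) (proj₂ oo) h
        where
        tv = AB t v ts vs
        ov = AB o v o≢s vs
        to = AB t o ts o≢s
        oo = AB o o o≢s o≢s

    dictator-star : RowDictator ⊎ ColDictator
    dictator-star = by (Fin.any? {P = λ t → t ≢ s × w̃ s t ≢ w̃ s o} (λ t → ¬? (t Fin.≟ s) ×-dec ¬? (w̃ s t ≟ℚ w̃ s o)))
      where
      by : Dec (∃[ t ] (t ≢ s × w̃ s t ≢ w̃ s o)) → RowDictator ⊎ ColDictator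
      by (yes (t , ts , h)) = inj₁ (constant-B (varying-A t ts h))
      by (no ¬h) = inj₂ (constant-A (λ t ts → decidable-stable (w̃ s t ≟ℚ w̃ s o) (λ ≢ → ¬h (t , ts , ≢))))

-- Approximation by sums of coset indicators

-- The common output of all cases. The pair count and the distance to the union are extracted from
-- L² closeness to `hits C` once, in `union`.
Approx : (n : ℕ) → (Perm n → Bool) → ℚ → Set
Approx n f κ = ∃[ C ] (total (𝟙 C) ≤ fromℕ n × sqDist n (λ π → b2q (f π)) (hits {n} C) ≤ κ)

∑-b2q≤ : ∀ n (v : Fin n → Bool) → ∑ (λ i → b2q (v i)) ≤ fromℕ n
∑-b2q≤ n v = ≤-trans (∑-mono (λ i → b2q≤1 (v i))) (≤-reflexive (trans (∑-const n 1ℚ) (*-identityʳ (fromℕ n))))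

approx-row : ∀ {n f κ} s (v : Fin n → Bool) →
  𝔼 n (λ π → (b2q (f π) - b2q (v (lookup π s))) * (b2q (f π) - b2q (v (lookup π s)))) ≤ κ → Approx n f κ
approx-row {n} {f} {κ} s v h = C , ≤-trans (≤-reflexive total-C) (∑-b2q≤ n v) , ≤-trans
    (≤-reflexive (𝔼-cong n (λ π _ → cong (λ t → (b2q (f π) - t) * (b2q (f π) - t)) (hits-C π)))) h
  where
  C : CosetSet n
  C i j = does (i Fin.≟ s) ∧ v j
  hits-C : ∀ π → hits C π ≡ b2q (v (lookup π s))
  hits-C π = trans (∑-cong (λ i → b2q-∧ (does (i Fin.≟ s)) (v (lookup π i)))) (∑-δ s (λ i → b2q (v (lookup π i))))
  total-C : total (𝟙 C) ≡ ∑ (λ j → b2q (v j))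
  total-C = trans (∑-cong (λ i → trans (∑-cong (λ j → b2q-∧ (does (i Fin.≟ s)) (v j))) (∑-*ˡ (δ i s) (λ j → b2q (v j)))))
      (∑-δ s (λ _ → ∑ (λ j → b2q (v j))))

approx-col : ∀ {n f κ} s (v : Fin n → Bool) →
  𝔼 n (λ π → (b2q (f π) - b2q (v (index π s))) * (b2q (f π) - b2q (v (index π s)))) ≤ κ → Approx n f κ
approx-col {n} {f} {κ} s v h = C , ≤-trans (≤-reflexive total-C) (∑-b2q≤ n v) , ≤-trans
    (≤-reflexive (𝔼-cong n (λ π e → cong (λ t → (b2q (f π) - t) * (b2q (f π) - t)) (hits-C π e)))) h
  where
  C : CosetSet n
  C i j = does (j Fin.≟ s) ∧ v i
  hits-C : ∀ π → IsPerm π → hits C π ≡ b2q (v (index π s))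
  hits-C π e = trans (∑-cong (λ i → trans (b2q-∧ (does (lookup π i Fin.≟ s)) (v i)) (cong (_* b2q (v i)) (X-index π e i s))))
      (∑-δʳ (index π s) (λ i → b2q (v i)))
  total-C : total (𝟙 C) ≡ ∑ (λ i → b2q (v i))
  total-C = ∑-cong (λ i → trans (∑-cong (λ j → b2q-∧ (does (j Fin.≟ s)) (v i))) (∑-δ s (λ _ → b2q (v i))))

approx-empty : ∀ {n f κ} → 𝔼 n (λ π → b2q (f π)) ≤ κ → Approx n f κ
approx-empty {n} {f} {κ} h = (λ _ _ → false) , ≤-trans (≤-reflexive (trans (∑-cong {n} (λ _ → ∑-zero n)) (∑-zero n))) (fromℕ≥0 n)
    ,
  ≤-trans (≤-reflexive (𝔼-cong n (λ π _ → trans (cong (λ t → (b2q (f π) - t) * (b2q (f π) - t)) (∑-zero n))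
      (trans (minus-zero (b2q (f π))) (b2q-idem (f π)))))) h
  where
  minus-zero = solve 1 (λ a → (a :- con 0ℚ) :* (a :- con 0ℚ) := a :* a) refl

same⇒0 : ∀ n {f g : Perm n → Bool} → (∀ π → IsPerm π → f π ≡ g π) → 𝔼 n (λ π → (b2q (f π) - b2q (g π)) * (b2q (f π) - b2q (g π)))
    ≡ 0ℚ
same⇒0 n {f} {g} h = trans (𝔼-cong n (λ π e → trans (cong (λ t → (b2q (f π) - b2q t) * (b2q (f π) - b2q t)) (sym (h π e)))
    (vanish (b2q (f π))))) (𝔼-const n 0ℚ)
  where
  vanish = solve 1 (λ a → (a :- a) :* (a :- a) := con 0ℚ) refl

search : ∀ {n} m (P : Vec (Fin n) m → Bool) → (∃[ v ] P v ≡ true) ⊎ (∀ v → P v ≡ false)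
search zero    P with P Vec.[] in eq
... | true  = inj₁ (Vec.[] , eq)
... | false = inj₂ λ { Vec.[] → eq }
search (suc m) P with search m (λ v → does (Fin.any? (λ a → P (a Vec.∷ v) Bool.≟ true)))
... | inj₁ (v , e) with Fin.any? (λ a → P (a Vec.∷ v) Bool.≟ true)
...   | yes (a , e′) = inj₁ (a Vec.∷ v , e′)
...   | no _ with e
...     | ()
search (suc m) P | inj₂ h = inj₂ λ { (a Vec.∷ v) → absent a v (Fin.any? (λ a → P (a Vec.∷ v) Bool.≟ true)) (h v) }
  where
  absent : ∀ a v → (d : Dec (∃[ a ] P (a Vec.∷ v) ≡ true)) → does d ≡ false → P (a Vec.∷ v) ≡ false
  absent a v (no ¬e) _ with P (a Vec.∷ v) in eq
  ... | true  = ⊥-elim (¬e (a , eq))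
  ... | false = refl

-- A function equal to 1 on all of S_n would have mean 1 > ½. The zero found is the base point π₀ of
-- the exact analysis.
find-zero : ∀ n (f : Perm n → Bool) → 𝔼 n (λ π → b2q (f π)) ≤ ½ → ∃[ π ] (IsPerm π × f π ≡ false)
find-zero n f h = by (search n (λ π → does (isPerm? π) ∧ not (f π)))
  where
  extract : ∀ π → (d : Dec (IsPerm π)) → does d ∧ not (f π) ≡ true → IsPerm π × f π ≡ false
  extract π (yes p) e with f π
  ... | false = p , refl
  all-true : ∀ π → (d : Dec (IsPerm π)) → does d ∧ not (f π) ≡ false → IsPerm π → f π ≡ true
  all-true π (no ¬p) e p = ⊥-elim (¬p p)
  all-true π (yes _) e p with f π
  ... | true = refl
  by : (∃[ π ] does (isPerm? π) ∧ not (f π) ≡ true) ⊎ (∀ π → does (isPerm? π) ∧ not (f π) ≡ false) → ∃[ π ]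
      (IsPerm π × f π ≡ false)
  by (inj₁ (π , e)) = π , extract π (isPerm? π) e
  by (inj₂ all)     = ⊥-elim (toWitnessFalse {a? = 1ℚ ≤? ½} _ (subst (_≤ ½)
      (trans (𝔼-cong n (λ π p → cong b2q (all-true π (isPerm? π) (all π) p))) (𝔼-const n 1ℚ)) h))

-- Small n: an error below a threshold depending on n must vanish, since all the quantities involved have bounded denominators.

int-sumOf : ∀ {A : Set} (xs : List A) {F : A → ℚ} → (∀ v → Integral (F v)) → Integral (sumOf xs F)
int-sumOf []       h = + 0 , refl
int-sumOf (v ∷ xs) h = int-+ (h v) (int-sumOf xs h)

int-n!𝔼 : ∀ n {F : Perm n → ℚ} → (∀ π → Integral (F π)) → Integral (fromℕ (n !) * 𝔼 n F)
int-n!𝔼 n {F} h = subst Integral (sym (trans (shuffle (fromℕ (n !)) (sumOf (Sn n) F) (weight n))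
    (trans (cong (sumOf (Sn n) F *_) (weight-spec n)) (*-identityʳ (sumOf (Sn n) F))))) (int-sumOf (Sn n) h)
  where
  shuffle = solve 3 (λ a s b → a :* (s :* b) := s :* (a :* b)) refl

module Small (n : ℕ) (I : ℚ) (NI : fromℕ n * I ≡ 1ℚ) (I≥0 : 0ℚ ≤ I) (1≤N-1 : 1ℚ ≤ fromℕ n - 1ℚ) (f : Perm n → Bool)
  (p≤½ : 𝔼 n (λ π → b2q (f π)) ≤ ½) (i₀ i₁ : Fin n) (i₀≢i₁ : i₀ ≢ i₁) where
  open Projection n I NI I≥0 1≤N-1 f

  -- A common denominator of all values of the residual: n! clears the expectations and n clears
  -- p/n.
  D : ℚ
  D = N * fromℕ (n !)

  private
    int-Dĉ : ∀ i j → Integral (D * ĉ i j)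
    int-Dĉ i j = subst Integral (sym (trans (expand N (fromℕ (n !)) (q i j) p I)
        (cong (λ t → (N - 1ℚ) * (N * (fromℕ (n !) * q i j) - fromℕ (n !) * p * t)) NI)))
      (int-* (int-- (int-fromℕ n) int-1) (int-- (int-* (int-fromℕ n) (int-n!𝔼 n (λ π → int-* (int-b2q (f π)) (int-b2q (does (lookup π i Fin.≟ j)))))) (int-* (int-n!𝔼 n (λ π → int-b2q (f π))) int-1)))
      where
      expand = solve 5 (λ N m q p i → N :* m :* ((N :- con 1ℚ) :* (q :- p :* i)) := (N :- con 1ℚ) :*
          (N :* (m :* q) :- m :* p :* (N :* i))) refl

    int-residual : ∀ π → Integral (D * residual π)
    int-residual π = subst Integral (sym (expand N (fromℕ (n !)) (F π) p (lin ĉ π)))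
      (int-- (int-- (int-* (int-* (int-fromℕ n) (int-fromℕ (n !))) (int-b2q (f π))) (int-* (int-fromℕ n) (int-n!𝔼 n (λ π → int-b2q (f π)))))
        (subst Integral (∑-*ˡ D (λ i → ĉ i (lookup π i))) (int-∑ (λ i → int-Dĉ i (lookup π i)))))
      where
      expand = solve 5 (λ N m f p l → N :* m :* (f :- p :- l) := N :* m :* f :- N :* (m :* p) :- N :* m :* l) refl

  -- A single squared residual is at most n! times the mean. If threshold · residual² < 1, every
  -- integer D · residual π therefore has absolute value below 1 and vanishes.
  threshold : ℚ
  threshold = D * D * fromℕ (n !)

  module _ (tiny : threshold * residual² < 1ℚ) where

    private
      exact : ∀ π → IsPerm π → b2q (f π) ≡ p + lin ĉ π
      exact π h = by (int-gap (int-residual π))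
        where
        from-zero : ∀ F p l r → r ≡ F - p - l → r ≡ 0ℚ → F ≡ p + l
        from-zero F p l r e e′ = trans (lemma F p l) (trans (cong (_+ (p + l)) (trans (sym e) e′)) (+-identityˡ (p + l)))
          where
          lemma = solve 3 (λ F p l → F := F :- p :- l :+ (p :+ l)) refl
        D≥1 : 1ℚ ≤ D
        D≥1 = 1≤* 1≤N (fromℕ-mono {1} {n !} (ℕ.1≤n! n))
        square = solve 2 (λ D r → D :* r :* (D :* r) := D :* D :* (r :* r)) refl
        bound : D * residual π * (D * residual π) ≤ threshold * residual²
        bound = ≤-trans (≤-reflexive (square D (residual π))) (≤-trans
            (*-monoˡ {residual π * residual π} {fromℕ (n !) * residual²} (D * D) (sq≥0 D)
          (term≤n!𝔼 n {λ π → residual π * residual π} (λ π _ → sq≥0 (residual π)) π h))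
              (≤-reflexive (sym (*-assoc (D * D) (fromℕ (n !)) residual²))))
        by : D * residual π ≡ 0ℚ ⊎ 1ℚ ≤ D * residual π * (D * residual π) → b2q (f π) ≡ p + lin ĉ π
        by (inj₁ e) = from-zero (F π) p (lin ĉ π) (residual π) refl (*-cancel {residual π} {0ℚ} {D} D≥1
            (trans e (sym (*-zeroʳ D))))
        by (inj₂ h) = ⊥-elim (<-irrefl refl (<-≤-trans tiny (≤-trans h bound)))

    small-approx : Approx n f 0ℚ
    small-approx = from (find-zero n f p≤½)
      where
      from : ∃[ π ] (IsPerm π × f π ≡ false) → Approx n f 0ℚ
      from (π₀ , π₀-perm , fπ₀) = from-centre (centre i₀)
        where
        open Exact n f ĉ p exact π₀ π₀-perm fπ₀
        from-centre : ∃[ s ] Centre s → Approx n f 0ℚ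
        from-centre (s , star) = by (other (i₀ Fin.≟ s))
          where
          other : Dec (i₀ ≡ s) → ∃[ o ] o ≢ s
          other (yes refl) = i₁ , i₀≢i₁ ∘ sym
          other (no ≢)     = i₀ , ≢
          by : ∃[ o ] o ≢ s → Approx n f 0ℚ
          by (o , o≢s) = conclude (Star.dictator-star s star o o≢s)
            where
            conclude : Star.RowDictator s star o o≢s ⊎ Star.ColDictator s star o o≢s → Approx n f 0ℚ
            conclude (inj₁ (v , h)) = approx-row {n} {f} {0ℚ} s v (≤-reflexive (same⇒0 n {f} {λ π → v (lookup π s)} h))
            conclude (inj₂ (v , h)) = approx-col {n} {f} {0ℚ} (lookup π₀ s) v
                (≤-reflexive (same⇒0 n {f} {λ π → v (index π (lookup π₀ s))} h))

-- Assembling the forward direction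

K-light K-heavy : ℚ
K-light = fromℕ 8 * (1ℚ + fromℕ 65537 * fromℕ 6168)
K-heavy = fromℕ 8 * (1ℚ + fromℕ 11796480)

Approx-mono : ∀ {n f κ κ′} → κ ≤ κ′ → Approx n f κ → Approx n f κ′
Approx-mono h (C , t , d) = C , t , ≤-trans d h

module Large (n : ℕ) (I : ℚ) (NI : fromℕ n * I ≡ 1ℚ) (I≥0 : 0ℚ ≤ I) (1≤N-1 : 1ℚ ≤ fromℕ n - 1ℚ)
  (i₀ i₁ : Fin n) (i₀≢i₁ : i₀ ≢ i₁) (s : Fin ⌊ n /2⌋) (2≤n : 2 ℕ.≤ n) (n-large : 1179648 ℕ.≤ n) where

  private
    N-large : fromℕ 1179648 ≤ fromℕ n
    N-large = fromℕ-mono {1179648} {n} n-large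

    M-large : fromℕ n ≤ fromℕ 4 * (fromℕ ⌊ n /2⌋ - 1ℚ)
    M-large = conclude (fromℕ n) (fromℕ ⌊ n /2⌋) N-large (subst (fromℕ n ≤_) (fromℕ-* 3 ⌊ n /2⌋)
        (fromℕ-mono {n} {3 ℕ.* ⌊ n /2⌋} (n≤3⌊n/2⌋ n 2≤n)))
      where
      conclude : ∀ N M → fromℕ 1179648 ≤ N → N ≤ fromℕ 3 * M → N ≤ fromℕ 4 * (M - 1ℚ)
      conclude N M h h′ = ≤-by (lit (+ 4 / 3) ⊗ gap h′ ⊕ lit (+ 1 / 3) ⊗ gap h ⊕ lit (fromℕ 393212)) (expand N M)
        where
        expand = solve 2 (λ N M → con (fromℕ 4) :* (M :- con 1ℚ) := N :+
            (con (+ 4 / 3) :* (con (fromℕ 3) :* M :- N) :+ con (+ 1 / 3) :* (N :- con (fromℕ 1179648)) :+ con (fromℕ 393212)))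
            refl

    other : ∀ r → ∃[ k ] r ≢ k
    other r with r Fin.≟ i₀
    ... | yes refl = i₁ , i₀≢i₁
    ... | no ≢     = i₀ , ≢

    module Proj (f : Perm n → Bool) = Projection n I NI I≥0 1≤N-1 f

  rowEnergy colEnergy : (Perm n → Bool) → Fin n → ℚ
  rowEnergy f r = ∑ (λ j → Proj.ĉ f r j * Proj.ĉ f r j)
  colEnergy f s = ∑ (λ i → Proj.ĉ f i s * Proj.ĉ f i s)

  heavy-row : ∀ f → 𝔼 n (λ π → b2q (f π)) ≤ ½ → ∀ r → θ * fromℕ n ≤ rowEnergy f r →
    Σ[ u ∈ (Fin n → Bool) ] 𝔼 n (λ π → (b2q (f π) - b2q (u (lookup π r))) * (b2q (f π) - b2q (u (lookup π r)))) ≤ K-heavy *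
        Proj.residual² f
  heavy-row f p≤½ r h = H.u h N-large M-large , H.heavy-approx h N-large M-large
    where
    module H = Heavy n I NI I≥0 1≤N-1 f p≤½ r (proj₁ (other r)) (proj₂ (other r)) s

  module Transposed (f : Perm n → Bool) where

    fᵀ : Perm n → Bool
    fᵀ π = f (inv π)

    𝔼-fᵀ : 𝔼 n (λ π → b2q (fᵀ π)) ≡ 𝔼 n (λ π → b2q (f π))
    𝔼-fᵀ = 𝔼-inv n (λ π → b2q (f π))

    X-inv : ∀ (i j : Fin n) (π : Perm n) → IsPerm π → X i j π ≡ X j i (inv π)
    X-inv i j π h = trans (X-index π h i j) (cong (λ t → δ t i) (sym (lookup-inv π j)))

    ĉᵀ : ∀ i j → Proj.ĉ fᵀ j i ≡ Proj.ĉ f i j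
    ĉᵀ i j = cong₂ (λ a b → (fromℕ n - 1ℚ) * (a - b * I)) (sym q-eq) 𝔼-fᵀ
      where
      q-eq : 𝔼 n (λ π → b2q (f π) * X i j π) ≡ 𝔼 n (λ π → b2q (fᵀ π) * X j i π)
      q-eq = trans (𝔼-cong n (λ π h → cong₂ (λ a b → b2q (f a) * b) (sym (inv-inv π h)) (X-inv i j π h)))
          (𝔼-inv n (λ π → b2q (fᵀ π) * X j i π))

    residualᵀ : ∀ c → Proj.residual² fᵀ ≤ sqDist n (λ π → b2q (f π)) (linear n c)
    residualᵀ c = ≤-trans (Proj.residual-minimal fᵀ (λ j i → c i j))
        (≤-reflexive (trans (𝔼-cong n (λ π h → cong (λ t → (b2q (fᵀ π) - t) * (b2q (fᵀ π) - t)) (linearᵀ π h)))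
      (𝔼-inv n (λ π → (b2q (f π) - linear n c π) * (b2q (f π) - linear n c π)))))
      where
      linearᵀ : ∀ π → IsPerm π → linear n (λ j i → c i j) π ≡ linear n c (inv π)
      linearᵀ π h = trans (linear-eval (λ j i → c i j) π) (trans (sym
          (∑-reindex (flip-inverse (perm-inverse π h)) (λ j → c (lookup π j) j)))
        (trans (∑-cong (λ k → cong₂ c (lookup-index π h k) (sym (lookup-inv π k)))) (sym (linear-eval c (inv π)))))

  approximate : ∀ f → 𝔼 n (λ π → b2q (f π)) ≤ ½ → ∀ c {ε} → 0ℚ ≤ ε → sqDist n (λ π → b2q (f π)) (linear n c) ≤ ε → Approx n f
      ((K-light + K-heavy) * ε)
  approximate f p≤½ c {ε} ε≥0 close = by-row (Fin.any? (λ r → θ * N ≤? rowEnergy f r))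
    where
    N = fromℕ n
    Goal = Approx n f ((K-light + K-heavy) * ε)
    light≤ : ∀ l h e r → 0ℚ ≤ l → 0ℚ ≤ h → 0ℚ ≤ e → r ≤ e → l * r ≤ (l + h) * e
    light≤ l h e r hl hh he hr = ≤-by (hl ⊗ gap hr ⊕ hh ⊗ he) (solve 4
        (λ l h e r → (l :+ h) :* e := l :* r :+ (l :* (e :- r) :+ h :* e)) refl l h e r)
    heavy≤ : ∀ l h e r → 0ℚ ≤ l → 0ℚ ≤ h → 0ℚ ≤ e → r ≤ e → h * r ≤ (l + h) * e
    heavy≤ l h e r hl hh he hr = ≤-by (hh ⊗ gap hr ⊕ hl ⊗ he) (solve 4
        (λ l h e r → (l :+ h) :* e := h :* r :+ (h :* (e :- r) :+ l :* e)) refl l h e r)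
    residual≤ : Proj.residual² f ≤ ε
    residual≤ = ≤-trans (Proj.residual-minimal f c) close
    by-col : (∀ r → ¬ (θ * N ≤ rowEnergy f r)) → Dec (∃[ r ] θ * N ≤ colEnergy f r) → Goal
    by-col light-rows (no none′) = L.C f′ , half (total (𝟙 (L.C f′))) N (fromℕ≥0 n) (L.2size≤N f′ rows cols N-large′ p≤½ 2≤n) ,
      ≤-trans (L.light-approx f′ rows cols N-large′ p≤½ 2≤n) (light≤ K-light K-heavy ε (Proj.residual² f) (lit K-light)
          (lit K-heavy) ε≥0 residual≤)
      where
      f′ = f
      module L (f : Perm n → Bool) = Light n I NI I≥0 1≤N-1 f
      half : ∀ t N → 0ℚ ≤ N → fromℕ 2 * t ≤ N → t ≤ N
      half t N hN h = ≤-by (lit ½ ⊗ gap h ⊕ lit ½ ⊗ hN) (solve 2 (λ t N → N := t :+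
          (con ½ :* (N :- con (fromℕ 2) :* t) :+ con ½ :* N)) refl t N)
      rows : ∀ i → rowEnergy f i ≤ θ * N
      rows i = <⇒≤ (≰⇒> (light-rows i))
      cols : ∀ j → colEnergy f j ≤ θ * N
      cols j = <⇒≤ (≰⇒> (λ h → none′ (j , h)))
      N-large′ : fromℕ 1536 ≤ N
      N-large′ = ≤-trans (toWitness {a? = fromℕ 1536 ≤? fromℕ 1179648} _) N-large
    by-col _ (yes (r , h)) = approx-col {n} {f} r (proj₁ byLine) (≤-trans
        (≤-reflexive (trans (𝔼-cong n (λ π e → cong₂ (λ a b → (b2q (f a) - b2q (proj₁ byLine b)) *
        (b2q (f a) - b2q (proj₁ byLine b))) (sym (inv-inv π e)) (sym (lookup-inv π r))))
          (𝔼-inv n (λ π → (b2q (fᵀ π) - b2q (proj₁ byLine (lookup π r))) * (b2q (fᵀ π) - b2q (proj₁ byLine (lookup π r)))))))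
        (≤-trans (proj₂ byLine) (heavy≤ K-light K-heavy ε (Proj.residual² fᵀ) (lit K-light) (lit K-heavy) ε≥0
            (≤-trans (residualᵀ c) close))))
      where
      open Transposed f
      byLine : Σ[ u ∈ (Fin n → Bool) ] 𝔼 n (λ π → (b2q (fᵀ π) - b2q (u (lookup π r))) * (b2q (fᵀ π) - b2q (u (lookup π r)))) ≤
          K-heavy * Proj.residual² fᵀ
      byLine = heavy-row fᵀ (≤-trans (≤-reflexive 𝔼-fᵀ) p≤½) r (≤-trans h
          (≤-reflexive (∑-cong (λ i → cong (λ t → t * t) (sym (ĉᵀ i r))))))
    by-row : Dec (∃[ r ] θ * N ≤ rowEnergy f r) → Goal
    by-row (yes (r , h)) = approx-row {n} {f} r (proj₁ byLine) (≤-trans (proj₂ byLine)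
        (heavy≤ K-light K-heavy ε (Proj.residual² f) (lit K-light) (lit K-heavy) ε≥0 residual≤))
      where
      byLine : Σ[ u ∈ (Fin n → Bool) ] 𝔼 n (λ π → (b2q (f π) - b2q (u (lookup π r))) * (b2q (f π) - b2q (u (lookup π r)))) ≤
          K-heavy * Proj.residual² f
      byLine = heavy-row f p≤½ r h
    by-row (no light-rows) = by-col (λ r h → light-rows (r , h)) (Fin.any? (λ r → θ * N ≤? colEnergy f r))

threshold-at : ℕ → ℚ
threshold-at n = fromℕ n * fromℕ (n !) * (fromℕ n * fromℕ (n !)) * fromℕ (n !)

-- A sum in place of a maximum: it dominates the threshold of every smaller n.
K-small : ℕ → ℚ
K-small zero    = 0ℚ
K-small (suc n) = K-small n + threshold-at n

threshold≥0 : ∀ n → 0ℚ ≤ threshold-at n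
threshold≥0 n = fromℕ≥0 n ⊗ fromℕ≥0 (n !) ⊗ (fromℕ≥0 n ⊗ fromℕ≥0 (n !)) ⊗ fromℕ≥0 (n !)

K-small≥0 : ∀ n → 0ℚ ≤ K-small n
K-small≥0 zero    = ≤-refl
K-small≥0 (suc n) = K-small≥0 n ⊕ threshold≥0 n

threshold≤K-small : ∀ {m n} → m ℕ.< n → threshold-at m ≤ K-small n
threshold≤K-small {m} {suc n} (ℕ.s≤s h) with ℕ.m≤n⇒m<n∨m≡n h
... | inj₁ m<n  = ≤-trans (threshold≤K-small m<n) (≤-by (threshold≥0 n) refl)
... | inj₂ refl = ≤-by (K-small≥0 n) (+-comm (K-small n) (threshold-at n))

module Forward (n₀ : ℕ) (n₀≡ : n₀ ≡ 1179648) where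

  -- The bound n₀ is known only through an equation, so that `K-small n₀` stays symbolic; with the
  -- literal in place it would be a sum of more than a million terms.
  K : ℚ
  K = 1ℚ + (K-light + K-heavy) + K-small n₀

  private
    Kl : ℚ
    Kl = K-light + K-heavy

    Kl≥0 : 0ℚ ≤ Kl
    Kl≥0 = lit K-light ⊕ lit K-heavy

  1≤K : 1ℚ ≤ K
  1≤K = ≤-by (Kl≥0 ⊕ K-small≥0 n₀) (+-assoc 1ℚ Kl (K-small n₀))

  approximate : ∀ n → 1 ℕ.≤ n → ∀ ε → 0ℚ ≤ ε → ∀ f → (∃[ c ] sqDist n (λ π → b2q (f π)) (linear n c) ≤ ε) → 𝔼 n (λ π → b2q (f π))
      ≤ ½ → Approx n f (K * ε)
  -- On S₁ a function with mean at most ½ is 0, so the empty set of cosets works. The projection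
  -- formulas start at n = 2, where N - 1 ≥ 1.
  approximate (suc zero) _ ε ε≥0 f _ p≤½ = approx-empty {1} {f}
      (≤-trans (≤-reflexive (trans (constant-on-S₁ (λ π → b2q (f π)))
      (cong b2q (zero-value (f π₁) (≤-trans (≤-reflexive (sym (constant-on-S₁ (λ π → b2q (f π))))) p≤½)))))
      (≤-trans (lit 1ℚ) 1≤K ⊗ ε≥0))
    where
    π₁ : Perm 1
    π₁ = zero Vec.∷ Vec.[]
    only : ∀ π → π ≡ π₁
    only (zero Vec.∷ Vec.[]) = refl
    constant-on-S₁ : ∀ G → 𝔼 1 G ≡ G π₁
    constant-on-S₁ G = trans (𝔼-cong 1 (λ π _ → cong G (only π))) (𝔼-const 1 (G π₁))
    zero-value : ∀ b → b2q b ≤ ½ → b ≡ false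
    zero-value true  h = ⊥-elim (toWitnessFalse {a? = 1ℚ ≤? ½} _ h)
    zero-value false h = refl
  approximate (suc (suc m)) 1≤n ε ε≥0 f (c , close) p≤½ = by (n₀ ℕ.≤? n)
    where
    n = suc (suc m)
    2≤n : 2 ℕ.≤ n
    2≤n = ℕ.s≤s (ℕ.s≤s ℕ.z≤n)
    z≢1 : Fin.zero {suc m} ≢ suc zero
    z≢1 ()
    module Pr = Projection n (recip (suc m)) (fromℕ*recip (suc m)) (recip≥0 (suc m)) (1≤N-1 m) f
    module Sm = Small n (recip (suc m)) (fromℕ*recip (suc m)) (recip≥0 (suc m)) (1≤N-1 m) f p≤½ zero (suc zero) z≢1
    module La = Large n (recip (suc m)) (fromℕ*recip (suc m)) (recip≥0 (suc m)) (1≤N-1 m) zero (suc zero) z≢1 zero 2≤n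
    grow₁ : ∀ a b e → 0ℚ ≤ b → 0ℚ ≤ e → a * e ≤ (1ℚ + a + b) * e
    grow₁ a b e hb he = ≤-by (he ⊕ hb ⊗ he) (solve 3 (λ a b e → (con 1ℚ :+ a :+ b) :* e := a :* e :+ (e :+ b :* e)) refl a b e)
    grow₂ : ∀ a b e → 0ℚ ≤ a → 0ℚ ≤ e → b * e ≤ (1ℚ + a + b) * e
    grow₂ a b e ha he = ≤-by (he ⊕ ha ⊗ he) (solve 3 (λ a b e → (con 1ℚ :+ a :+ b) :* e := b :* e :+ (e :+ a :* e)) refl a b e)
    residual≤ : Pr.residual² ≤ ε
    residual≤ = ≤-trans (Pr.residual-minimal c) close
    compare : ∀ x → x < 1ℚ ⊎ 1ℚ ≤ x
    compare x with x <? 1ℚ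
    ... | yes h = inj₁ h
    ... | no h  = inj₂ (≮⇒≥ h)
    small : n ℕ.< n₀ → (Sm.threshold * Pr.residual² < 1ℚ) ⊎ (1ℚ ≤ Sm.threshold * Pr.residual²) → Approx n f (K * ε)
    small h (inj₁ tiny) = Approx-mono {n} {f} {0ℚ} {K * ε} (≤-trans (lit 1ℚ) 1≤K ⊗ ε≥0) (Sm.small-approx tiny)
    -- For bounded n an error that is not tiny makes the claim trivial: 𝔼 f ≤ ½ ≤ threshold ·
    -- residual² ≤ Kε, so the empty set of cosets is close enough.
    small h (inj₂ big)  = approx-empty {n} {f} (≤-trans p≤½ (≤-trans (toWitness {a? = ½ ≤? 1ℚ} _) (≤-trans big (≤-trans
      (*-mono-≥0 {Sm.threshold} {K-small n₀} {Pr.residual²} {ε} (threshold≥0 n) Pr.residual²≥0 (threshold≤K-small h) residual≤)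
          (grow₂ Kl (K-small n₀) ε Kl≥0 ε≥0)))))
    by : Dec (n₀ ℕ.≤ n) → Approx n f (K * ε)
    by (yes h) = Approx-mono {n} {f} {Kl * ε} {K * ε} (grow₁ Kl (K-small n₀) ε (K-small≥0 n₀) ε≥0)
        (La.approximate (subst (ℕ._≤ n) n₀≡ h) f p≤½ c ε≥0 close)
    by (no h)  = small (ℕ.≰⇒> h) (compare (Sm.threshold * Pr.residual²))

  union : ∀ n → 1 ℕ.≤ n → ∀ ε f → Approx n f (K * ε) → ∃[ C ] (fromℕ (size {n} C) ≤ K * fromℕ n
    × fromℕ (nonDisjointPairs {n} C) ≤ K * ε * (fromℕ n * fromℕ n)
    × Pr n (λ π → f π xor maxCosets C π) ≤ K * ε)
  union n 1≤n ε f (C , small , close) = C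
    , ≤-trans (≤-reflexive (size-total C)) (≤-trans small (≤-trans (≤-reflexive (sym (*-identityˡ (fromℕ n))))
        (*-mono-≥0 {1ℚ} {K} {fromℕ n} {fromℕ n} (lit 1ℚ) (fromℕ≥0 n) 1≤K ≤-refl)))
    , ≤-trans (pairs≤ n f C (fromℕ-mono {1} {n} 1≤n)) (*-mono-≥0 {sqDist n (λ π → b2q (f π)) (hits C)} {K * ε}
        {fromℕ n * fromℕ n} {fromℕ n * fromℕ n}
        (𝔼≥0 n {λ π → (b2q (f π) - hits C π) * (b2q (f π) - hits C π)} (λ π _ → sq≥0 (b2q (f π) - hits C π)))
            (fromℕ≥0 n ⊗ fromℕ≥0 n) close ≤-refl)
    , ≤-trans (Pr-hits n f C) close

-- The converse

converse : ∀ (A : ℚ) n → 1 ℕ.≤ n → ∀ ε → 0ℚ ≤ ε → 0ℚ ≤ A → (C : CosetSet n) →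
  fromℕ (nonDisjointPairs {n} C) ≤ A * ε * (fromℕ n * fromℕ n) →
  sqDist n (λ π → b2q (maxCosets C π)) (linear n (𝟙 C)) ≤ (A + A + (A + A)) * ε
converse A n 1≤n ε ε≥0 A≥0 C few = ≤-trans (≤-reflexive (𝔼-cong n
    (λ π _ → cong (λ t → (b2q (maxCosets C π) - t) * (b2q (maxCosets C π) - t)) (linear-eval (𝟙 C) π))))
  (≤-trans (maxCosets-hits n C) (bound n 1≤n C few))
  where
  -- The factor 4: a factor 2 for ordered pairs, and n² ≤ 2n(n-1) for n ≥ 2.
  conclude : ∀ N e P A ε → 1ℚ ≤ N - 1ℚ → N * (N - 1ℚ) * e ≡ fromℕ 2 * P → P ≤ A * ε * (N * N) → 0ℚ ≤ A * ε → e ≤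
      (A + A + (A + A)) * ε
  conclude N e P A ε h eq hP hA = *-cancelˡ-≤ {e} {(A + A + (A + A)) * ε} {N * (N - 1ℚ)} (1≤* 1≤N h)
      (≤-trans (≤-reflexive eq) raw)
    where
    N-1+1 = solve 1 (λ N → N := con 1ℚ :+ (N :- con 1ℚ)) refl
    1≤N : 1ℚ ≤ N
    1≤N = ≤-by (≤-trans (lit 1ℚ) h) (N-1+1 N)
    raw : fromℕ 2 * P ≤ N * (N - 1ℚ) * ((A + A + (A + A)) * ε)
    raw = ≤-by (lit (fromℕ 2) ⊗ gap hP ⊕ lit (fromℕ 2) ⊗ hA ⊗ (≤-trans (lit 1ℚ) 1≤N) ⊗ gap h) (expand N P A ε)
      where
      expand = solve 4 (λ N P A ε → N :* (N :- con 1ℚ) :* ((A :+ A :+ (A :+ A)) :* ε) := con (fromℕ 2) :* P :+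
          (con (fromℕ 2) :* (A :* ε :* (N :* N) :- P) :+ con (fromℕ 2) :* (A :* ε) :* N :* (N :- con 1ℚ :- con 1ℚ))) refl
  bound : ∀ n → 1 ℕ.≤ n → (C : CosetSet n) → fromℕ (nonDisjointPairs {n} C) ≤ A * ε * (fromℕ n * fromℕ n) → 𝔼 n
      (λ π → hits C π * hits C π - hits C π) ≤ (A + A + (A + A)) * ε
  -- For n = 1 the factor n(n-1) is zero and the pair identity says nothing, but S is then a single
  -- bit and S² - S = 0.
  bound (suc zero) _ C _ = ≤-trans (≤-reflexive (trans (𝔼-cong 1 (λ π _ → idempotent (C zero (lookup π zero)))) (𝔼-const 1 0ℚ)))
      ((A≥0 ⊕ A≥0 ⊕ (A≥0 ⊕ A≥0)) ⊗ ε≥0)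
    where
    idempotent : ∀ b → (b2q b + 0ℚ) * (b2q b + 0ℚ) - (b2q b + 0ℚ) ≡ 0ℚ
    idempotent true  = refl
    idempotent false = refl
  bound (suc (suc m)) _ C few = conclude (fromℕ (suc (suc m))) (𝔼 (suc (suc m)) (λ π → hits C π * hits C π - hits C π))
      (fromℕ (nonDisjointPairs {suc (suc m)} C)) A ε (1≤N-1 m) (𝔼-pairs C) few (A≥0 ⊗ ε≥0)

theorem1p1 : (Σ[ K ∈ ℚ ] (0ℚ < K × (∀ (n : ℕ) → 1 Data.Nat.≤ n → ∀ (ε : ℚ) → 0ℚ ≤ ε →
    ∀ (f : Perm n → Bool) →
    (∃[ c ] sqDist n (λ π → b2q (f π)) (linear n c) ≤ ε) →
    𝔼 n (λ π → b2q (f π)) ≤ (+ 1) / 2 →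
    ∃[ C ] (fromℕ (size {n} C) ≤ K * fromℕ n
    × fromℕ (nonDisjointPairs {n} C) ≤ K * ε * (fromℕ n * fromℕ n)
    × Pr n (λ π → f π xor maxCosets C π) ≤ K * ε))))
    ×
    (∀ (A : ℚ) → 0ℚ < A → Σ[ B ∈ ℚ ] (0ℚ < B × (∀ (n : ℕ) → 1 Data.Nat.≤ n → ∀ (ε : ℚ) → 0ℚ ≤ ε →
    ∀ (C : CosetSet n) →
    fromℕ (size {n} C) ≤ A * fromℕ n →
    fromℕ (nonDisjointPairs {n} C) ≤ A * ε * (fromℕ n * fromℕ n) →
    ∃[ c ] sqDist n (λ π → b2q (maxCosets C π)) (linear n c) ≤ B * ε)))
theorem1p1 = (FW.K , <-≤-trans (toWitness {a? = 0ℚ <? 1ℚ} _) FW.1≤K , λ n 1≤n ε ε≥0 f close p≤½ → FW.union n 1≤n ε f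
    (FW.approximate n 1≤n ε ε≥0 f close p≤½)) ,
  λ A A>0 → A + A + (A + A) , +-mono-< (+-mono-< A>0 A>0) (+-mono-< A>0 A>0) , λ n 1≤n ε ε≥0 C _ few → 𝟙 C , converse A n 1≤n ε
      ε≥0 (<⇒≤ A>0) C few
  where
  module FW = Forward 1179648 refl
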